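{- Let $\lambda$ be a partition and let $X$ be an alphabet (a set of indeterminates). Then $$Q'_\lambda(X+1)=\sum_{\mu\subseteq\lambda} Q'_\mu(X)\,\aleph(\lambda/\mu),$$ where the sum runs over partitions $\mu$ whose diagram is contained in that of $\lambda$. Equivalently, for every partition $\mu\subseteq\lambda$ the skew function evaluated at $1$ is $$Q'_{\lambda/\mu}(1)=\aleph(\lambda/\mu):=b_\mu^{ -1}\,t^{\mathbf n(\lambda/\mu)}\,(1-t^{\nu_1-0})(1-t^{\nu_2-1})\cdots(1-t^{\nu_r-r+1}),$$ where $r=\ell(\mu)$ and $\nu_i=\lambda^\sim_{\mu_i}$ for $i=1,\dots,r$ (the part of index $\mu_i$ of the partition $\lambda^\sim$ conjugate to $\lambda$).
   Context: Symmetric functions have coefficients in $\mathbb Q[[t]]$, $t$ an indeterminate. Arguments of symmetric functions are understood in the $\lambda$-ring sense: a symmetric function is a polynomial in the power sums $p_i$, and $p_i(X+Y)=p_iX+p_iY$, $p_i(XY)=p_iX\,p_iY$, $p_i(X(1-t))=(1-t^i)p_iX$, $p_i(X\pm1)=p_iX\pm1$. $Q_\lambda$ denotes Macdonald's Hall–Littlewood $Q$-function and $Q'_\lambda(X)=Q_\lambda\big(X/(1-t)\big)$ the modified Hall–Littlewood function, i.e. $Q_\lambda(X)=Q'_\lambda(X(1-t))$; equivalently $Q'_\mu=\sum_T t^{\mathrm{charge}(T)}S_{\mathrm{shape}(T)}$, summed over semistandard tableaux $T$ of weight $\mu$. Skew functions $Q'_{\lambda/\mu}$ are defined by $Q'_\lambda(X+Y)=\sum_\mu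 Q'_{\lambda/\mu}(X)\,Q'_\mu(Y)$. For $\lambda=1^{m_1}2^{m_2}\cdots$, $b_\lambda=\prod_i\prod_{j=1}^{m_i}(1-t^j)$. For partitions $\lambda,\mu$, $\mathbf n(\lambda/\mu)=\sum_i(\lambda^\sim_i-\mu^\sim_i)(\lambda^\sim_i-\mu^\sim_i-1)/2$, where $\sim$ denotes the conjugate partition. -}

module Defs where

open import Data.Bool using (Bool; true; false; _∧_; if_then_else_)
open import Data.Nat as ℕ using (ℕ; zero; suc; _+_; _∸_; _≡ᵇ_; _<ᵇ_; _≤ᵇ_; NonZero)
open import Data.Nat.DivMod using (_/_; _%_)
open import Data.Integer as ℤ using (ℤ; +_)
open import Data.List using (List; []; _∷_; map; length; concat; concatMap; reverse;
                             upTo; foldr; filterᵇ; zipWith)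
open import Data.Nat.ListAction using (sum)
open import Data.Bool.ListAction using (and; all)
open import Data.Maybe using (Maybe; just; nothing)
open import Data.Product using (_×_; _,_; proj₁; proj₂)
open import Data.List.Relation.Unary.All using (All)
open import Data.List.Relation.Unary.Linked using (Linked)
open import Data.List.Properties using (≡-dec)
open import Relation.Nullary.Decidable using (⌊_⌋)
open import Relation.Binary.PropositionalEquality using (_≡_)

IsPartition : List ℕ → Set
IsPartition λ′ = Linked ℕ._≥_ λ′ × All (ℕ._<_ 0) λ′

decreasingᵇ : List ℕ → Bool
decreasingᵇ [] = true
decreasingᵇ (a ∷ []) = true
decreasingᵇ (a ∷ b ∷ xs) = (b ≤ᵇ a) ∧ decreasingᵇ (b ∷ xs)

isPartitionᵇ : List ℕ → Bool
isPartitionᵇ xs = decreasingᵇ xs ∧ all (λ a → 0 <ᵇ a) xs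

range1 : ℕ → List ℕ
range1 n = map suc (upTo n)

words : ℕ → List ℕ → List (List ℕ)
words zero cs = [] ∷ []
words (suc L) cs = concatMap (λ a → map (a ∷_) (words L cs)) cs

partitionsOf : ℕ → List (List ℕ)
partitionsOf n =
  filterᵇ (λ xs → isPartitionᵇ xs ∧ (sum xs ≡ᵇ n))
          (concatMap (λ L → words L (upTo (suc n))) (upTo (suc n)))

stripZeros : List ℕ → List ℕ
stripZeros xs = reverse (drop0 (reverse xs))
  where
  drop0 : List ℕ → List ℕ
  drop0 [] = []
  drop0 (zero ∷ ys) = drop0 ys
  drop0 (suc a ∷ ys) = suc a ∷ ys

boxed : List ℕ → List (List ℕ)
boxed [] = [] ∷ []
boxed (a ∷ as) = concatMap (λ b → map (b ∷_) (boxed as)) (upTo (suc a))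

subPartitions : List ℕ → List (List ℕ)
subPartitions λ′ = map stripZeros (filterᵇ decreasingᵇ (boxed λ′))

-- 1-based indexing, 0 outside the range
at : List ℕ → ℕ → ℕ
at [] i = 0
at (a ∷ as) zero = 0
at (a ∷ as) (suc zero) = a
at (a ∷ as) (suc (suc i)) = at as (suc i)

count : ℕ → List ℕ → ℕ
count i xs = length (filterᵇ (_≡ᵇ i) xs)

conj : List ℕ → List ℕ
conj λ′ = map (λ j → length (filterᵇ (j ≤ᵇ_) λ′)) (range1 (at λ′ 1))

-- Semistandard tableaux, as lists of rows (English notation)

Tableau : Set
Tableau = List (List ℕ)

fillings : List ℕ → ℕ → List Tableau
fillings [] m = [] ∷ []
fillings (r ∷ ν) m =
  concatMap (λ row → map (row ∷_) (fillings ν m)) (words r (range1 m))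

weaklyIncᵇ : List ℕ → Bool
weaklyIncᵇ [] = true
weaklyIncᵇ (a ∷ []) = true
weaklyIncᵇ (a ∷ b ∷ xs) = (a ≤ᵇ b) ∧ weaklyIncᵇ (b ∷ xs)

isSSYTᵇ : Tableau → Bool
isSSYTᵇ [] = true
isSSYTᵇ (R ∷ []) = weaklyIncᵇ R
isSSYTᵇ (R ∷ R′ ∷ T) =
  weaklyIncᵇ R ∧ and (zipWith _<ᵇ_ R R′) ∧ isSSYTᵇ (R′ ∷ T)

hasContentᵇ : List ℕ → Tableau → Bool
hasContentᵇ α T = ⌊ ≡-dec ℕ._≟_ (map (λ i → count i (concat T)) (range1 (length α))) α ⌋

SSYT : List ℕ → List ℕ → List Tableau
SSYT ν α = filterᵇ (λ T → isSSYTᵇ T ∧ hasContentᵇ α T) (fillings ν (length α))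

-- Kostka number: coefficient of x^α in the Schur function s_ν
kostka : List ℕ → List ℕ → ℕ
kostka ν α = length (SSYT ν α)

readingWord : Tableau → List ℕ
readingWord T = concat (reverse T)

private
  Letter = ℕ × ℕ    -- (position , letter)

  -- largest position among entries satisfying P (list sorted by position)
  lastWith : (Letter → Bool) → List Letter → Maybe ℕ
  lastWith P [] = nothing
  lastWith P (x ∷ xs) with lastWith P xs
  ... | just p = just p
  ... | nothing = if P x then just (proj₁ x) else nothing

  -- extract one standard subword: letters r, r+1, … (k of them), searching
  -- leftwards cyclically from position p; `ind` is the current index.
  -- Returns the chosen positions and the sum of the indices.
  extract : ℕ → ℕ → ℕ → ℕ → List Letter → List ℕ × ℕ
  extract zero r p ind ws = [] , 0
  extract (suc k) r p ind ws with lastWith (λ x → (proj₂ x ≡ᵇ r) ∧ (proj₁ x <ᵇ p)) ws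
  ... | just q = let rec = extract k (suc r) q ind ws in (q ∷ proj₁ rec) , ind + proj₂ rec
  ... | nothing with lastWith (λ x → proj₂ x ≡ᵇ r) ws
  ...   | just q = let rec = extract k (suc r) q (suc ind) ws in (q ∷ proj₁ rec) , suc ind + proj₂ rec
  ...   | nothing = [] , 0

  maxLetter : List Letter → ℕ
  maxLetter = foldr (λ x m → proj₂ x ℕ.⊔ m) 0

  memb : ℕ → List ℕ → Bool
  memb q = foldr (λ a b → (a ≡ᵇ q) Data.Bool.∨ b) false

  chargeAux : ℕ → ℕ → List Letter → ℕ
  chargeAux zero N ws = 0
  chargeAux (suc f) N ws =
    let ex = extract (maxLetter ws) 1 N 0 ws in
    proj₂ ex + chargeAux f N (filterᵇ (λ x → Data.Bool.not (memb (proj₁ x) (proj₁ ex))) ws)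

  positions : ℕ → List ℕ → List Letter
  positions i [] = []
  positions i (a ∷ as) = (i , a) ∷ positions (suc i) as

-- charge of a word whose weight is a partition: sum of the charges of its
-- successive standard subwords (first letter 1 found from the right, then
-- r+1 searched leftwards cyclically from r; the index increases by one
-- exactly when the search wraps around, i.e. r+1 lies to the right of r)
charge : List ℕ → ℕ
charge w = chargeAux (length w) (length w) (positions 0 w)

Series : Set
Series = ℕ → ℤ

Σℤ : List ℤ → ℤ
Σℤ = foldr ℤ._+_ (+ 0)

sumS : List Series → Series
sumS fs k = Σℤ (map (λ f → f k) fs)

_⊛_ : Series → Series → Series
(f ⊛ g) k = Σℤ (map (λ i → f i ℤ.* g (k ∸ i)) (upTo (suc k)))

oneS : Series
oneS zero = + 1
oneS (suc k) = + 0

prodS : List Series → Series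
prodS = foldr _⊛_ oneS

tpow : ℕ → Series
tpow e k = if e ≡ᵇ k then + 1 else + 0

oneMinusTpow : ℕ → Series
oneMinusTpow e k = oneS k ℤ.- tpow e k

-- (1 - t^j)^{-1} = Σ_n t^{jn}   (j ≥ 1)
invOneMinusTpow : (j : ℕ) → .{{NonZero j}} → Series
invOneMinusTpow j k = if (k % j) ≡ᵇ 0 then + 1 else + 0

bInv : List ℕ → Series
bInv μ = prodS (concatMap (λ i → map (λ j → invOneMinusTpow (suc j)) (upTo (count i μ)))
                          (range1 (at μ 1)))

-- [x^α] Q'_λ(X) = Σ_{T of weight λ} t^{charge T} [x^α] s_{shape T},
-- as a series in t; here X = x₁ + x₂ + ⋯ and x^α = x₁^{α₁} ⋯ x_ℓ^{α_ℓ}.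
Q′coeff : List ℕ → List ℕ → Series
Q′coeff λ′ α =
  sumS (concatMap (λ ν → map (λ T k → if charge (readingWord T) ≡ᵇ k
                                        then + kostka ν α else + 0)
                             (SSYT ν λ′))
                  (partitionsOf (sum λ′)))

-- [x^α] Q'_λ(X + 1): the λ-ring sum X + 1 adjoins one more variable x₀
-- specialised to 1, so this is Σ_j [x₀^j x^α] Q'_λ(x₀ + X)  (j ≤ |λ| by degree)
Q′coeffPlusOne : List ℕ → List ℕ → Series
Q′coeffPlusOne λ′ α = sumS (map (λ j → Q′coeff λ′ (j ∷ α)) (upTo (suc (sum λ′))))

nSkew : List ℕ → List ℕ → ℕ
nSkew λ′ μ = sum (map (λ i → let d = at (conj λ′) i ∸ at (conj μ) i in (d ℕ.* (d ∸ 1)) / 2)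
                      (range1 (at λ′ 1)))

aleph : List ℕ → List ℕ → Series
aleph λ′ μ =
  bInv μ ⊛ (tpow (nSkew λ′ μ)
    ⊛ prodS (map (λ i → oneMinusTpow (at (conj λ′) (at μ i) ∸ (i ∸ 1))) (range1 (length μ))))

{-# OPTIONS --safe #-}
-- Let φ_λ(w) = t^{charge w} for words w of content λ, and 0 for all other words.  It is constant
-- on plactic classes, hence defines a functional on the plactic ring, where the sums e_j and h_j of
-- the strictly decreasing and of the weakly increasing words of length j generate a commutative
-- ring; by the Robinson–Schensted–Knuth correspondence its value on h_{α₁} h_{α₂} ⋯ is the
-- coefficient of x^α in Q′_λ.  Charge grows by one when a letter other than 1 moves from the front
-- to the end of a word; evaluated on products of e_j this expresses φ_{(m,λ)} as H_m φ_λ for a vertex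
-- operator H_m.  The exchange relations of the H_m turn multiplication by e_j into a sum over
-- vertical strips λ/μ, weighted by Gaussian binomial coefficients.  As Σ_j (−1)^j e_j h_{n−j} = 0 for
-- n > 0, the values Σ_n φ_λ(h_n h_α), which are the coefficients of Q′_λ(X + 1), are found by inverting
-- the alternating sum over vertical strips.  The inverse is the sum over all μ ⊆ λ with the
-- coefficients t^{n(λ/μ)} ∏_i [λ~_i − μ~_{i+1} choose λ~_i − μ~_i], and these are the ℵ(λ/μ).
module Submission where

-- The operators H_m come from collecting the letters 1. In e_α over 1 < 2 < ... the m letters 1
-- that φ requires are scattered among larger letters, whereas charge is under control only when
-- they stand at the end. Let a be the letter 1 and ẽ_j the elementary sums of the larger letters.
-- The iterated commutators d_0 = a, d_(k+1) = [d_k, ẽ_1] satisfy d_k ẽ_j = ẽ_j d_k + ẽ_(j-1)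
-- d_(k+1) and d_(k+1) d_i + d_(i+1) d_k = 0. Hence for m > 0 the part of e_α with m letters a is
-- Σ_I ẽ_(α-1_I) a^(m-1) d_(|I|-m), over sets I of indices. A factor ẽ_i at the right end may be
-- rotated to the front at the cost of t^i, and Σ (-1)^i d_k ẽ_i over i + k = s telescopes to (-1)^s
-- ẽ_s a; so a^(m-1) d_s acts as the coefficient of z^s in E(-z)/E(-tz). The argument applies to
-- products of e_j only, so factors h_n are always eliminated first. An alphabet with as many
-- letters as λ has parts is enough, because φ vanishes on words with any other letter.

open import Algebra.Bundles using (Ring; CommutativeRing)
open import Data.Empty using (⊥; ⊥-elim)
open import Data.List.Membership.Propositional using (_∈_; _∉_)
open import Data.List.Relation.Unary.Any using (here; there)
open import Data.List.Relation.Unary.Unique.Propositional using (Unique)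
open import Data.Product using (_×_; _,_; proj₁; proj₂; ∃; ∃₂)
open import Data.Sum using (_⊎_; inj₁; inj₂)
open import Level using (0ℓ)
import Algebra.Properties.AbelianGroup as GroupProperties
import Algebra.Properties.Ring as RingProperties
import Data.Integer as ℤ
import Data.Integer.Properties as ℤ
import Data.List.Relation.Binary.Pointwise as Pw
import Data.List.Relation.Unary.All.Properties as All
import Data.List.Relation.Unary.AllPairs.Properties as AllPairs
import Data.List.Relation.Unary.Any.Properties as Any
import Data.List.Relation.Unary.Unique.Propositional.Properties as Unique
import Data.Nat.Properties as ℕ
import Relation.Binary.Reasoning.Setoid as SetoidReasoning

-- The auxiliary functions inside the definition of charge.

module ChargeUnfolding where
  open import Defs
  open import Data.Bool using (Bool; false; _∧_; _∨_; not; if_then_else_)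
  open import Data.Nat
  open import Data.List
  open import Data.Product
  open import Data.Maybe using (Maybe; just; nothing)
  open import Relation.Binary.PropositionalEquality
  open import Function using (_∋_)

  Letter : Set
  Letter = ℕ × ℕ

  maxLetter : List Letter → ℕ
  maxLetter = foldr (λ x m → proj₂ x ⊔ m) 0

  memb : ℕ → List ℕ → Bool
  memb q = foldr (λ a b → (a ≡ᵇ q) ∨ b) false

  keep : List ℕ → List Letter → List Letter
  keep D = filterᵇ (λ x → not (memb (proj₁ x) D))

  -- The auxiliary functions behind charge are private to Defs.  Each is recovered here as the
  -- solution of a metavariable: after with-abstraction the private function is applied to
  -- distinct variables only, so unification determines it.
  mutual
    charge₀ : ℕ → ℕ → List ℕ → ℕ
    charge₀ = _

    charge-cons₀ : ∀ w → charge (0 ∷ w) ≡ charge₀ (length w) (suc (length w)) w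
    charge-cons₀ w with suc (length w)
    ... | N with length w
    ... | f = refl

  mutual
    chargeAux : ℕ → ℕ → List Letter → ℕ
    chargeAux = _

    charge₀-[] : ∀ f N → charge₀ f N [] ≡ chargeAux f N ((0 , 0) ∷ [])
    charge₀-[] f N with (List Letter ∋ ((0 , 0) ∷ []))
    ... | ws = refl

  mutual
    positions : ℕ → List ℕ → List Letter
    positions = _

    charge-def₀ : ∀ w → charge w ≡ chargeAux (length w) (length w) (positions 0 w)
    charge-def₀ w with length w
    ... | n with (ℕ ∋ 0)
    ... | i = refl

  mutual
    chargeStep : ℕ → ℕ → ℕ → ℕ → List Letter → ℕ → ℕ
    chargeStep = _

    chargeAux-suc₀ : ∀ f N ws → chargeAux (suc f) N ws ≡ chargeStep (maxLetter ws) 1 N 0 ws f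
    chargeAux-suc₀ f N ws with maxLetter ws
    ... | k with (ℕ ∋ 1)
    ... | r with (ℕ ∋ 0)
    ... | i = refl

  mutual
    extractSum : ℕ → ℕ → ℕ → ℕ → List Letter → ℕ
    extractSum = _

    chargeRest : ℕ → ℕ → ℕ → ℕ → List Letter → ℕ → ℕ
    chargeRest = _

    chargeStep-+ : ∀ k r p i ws f →
      chargeStep k r p i ws f ≡ extractSum k r p i ws + chargeRest k r p i ws f
    chargeStep-+ k r p i ws f with _+_
    ... | g = refl

  mutual
    extractPos : ℕ → ℕ → ℕ → ℕ → List Letter → List ℕ
    extractPos = _

    chargeRest-def : ∀ k r p i ws f →
      chargeRest k r p i ws f ≡ chargeAux f p (keep (extractPos k r p i ws) ws)
    chargeRest-def k r p i ws f with foldr {A = ℕ} {B = Bool}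
    ... | g = refl

  extract : ℕ → ℕ → ℕ → ℕ → List Letter → List ℕ × ℕ
  extract k r p i ws = extractPos k r p i ws , extractSum k r p i ws

  hit : ℕ → ℕ → Letter → Bool
  hit r p x = (proj₂ x ≡ᵇ r) ∧ (proj₁ x <ᵇ p)

  mutual
    leftwards : ℕ → ℕ → List Letter → Maybe ℕ → ℕ → ℕ → List ℕ × ℕ
    leftwards = _

    extract-singleton : ∀ k r p i x → extract (suc k) r p i (x ∷ []) ≡
      leftwards r p (x ∷ []) (if hit r p x then just (proj₁ x) else nothing) k i
    extract-singleton k r p i x
      with (if (proj₂ x ≡ᵇ r) ∧ (proj₁ x <ᵇ p) then just (proj₁ x) else nothing)
    ... | m with (List Letter ∋ (x ∷ []))
    ... | ws = refl

  mutual
    lastBefore : ℕ → ℕ → List Letter → Maybe ℕ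
    lastBefore = _

    extract-suc : ∀ k r p i ws →
      extract (suc k) r p i ws ≡ leftwards r p ws (lastBefore r p ws) k i
    extract-suc k r p i ws with leftwards
    ... | g = refl

  mutual
    cyclic : ℕ → ℕ → List Letter → Maybe ℕ → ℕ → ℕ → List ℕ × ℕ
    cyclic = _

    leftwards-singleton : ∀ k r p i x → leftwards r p (x ∷ []) nothing k i ≡
      cyclic r p (x ∷ []) (if proj₂ x ≡ᵇ r then just (proj₁ x) else nothing) k i
    leftwards-singleton k r p i x
      with (if proj₂ x ≡ᵇ r then just (proj₁ x) else nothing)
    ... | m with (List Letter ∋ (x ∷ []))
    ... | ws = refl

  mutual
    lastAny : ℕ → List Letter → Maybe ℕ
    lastAny = _

    leftwards-nothing : ∀ k r p i ws →
      leftwards r p ws nothing k i ≡ cyclic r p ws (lastAny r ws) k i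
    leftwards-nothing k r p i ws with cyclic
    ... | g = refl

  lastOr : Maybe ℕ → Maybe ℕ → Maybe ℕ
  lastOr (just p) m = just p
  lastOr nothing m = m

  lastBefore-∷ : ∀ r p x ws → lastBefore r p (x ∷ ws) ≡
    lastOr (lastBefore r p ws) (if hit r p x then just (proj₁ x) else nothing)
  lastBefore-∷ r p x ws with lastBefore r p ws
  ... | just q = refl
  ... | nothing = refl

  lastAny-∷ : ∀ r x ws → lastAny r (x ∷ ws) ≡
    lastOr (lastAny r ws) (if proj₂ x ≡ᵇ r then just (proj₁ x) else nothing)
  lastAny-∷ r x ws with lastAny r ws
  ... | just q = refl
  ... | nothing = refl

-- Charge by deletion of subwords, and its invariance under the Knuth relations.

module WordCharge where
  open import Defs using (charge)
  open import Data.Nat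
  open import Data.Nat.Properties
  open import Data.List
  open import Data.List.Properties using (++-assoc; ++-identityʳ)
  open import Data.Product
  open import Data.Maybe using (Maybe; just; nothing)
  open import Relation.Nullary using (yes; no)
  open import Relation.Binary.PropositionalEquality

  Word : Set
  Word = List ℕ

  lastSplit : ℕ → Word → Maybe (Word × Word)
  lastSplit r [] = nothing
  lastSplit r (x ∷ w) with lastSplit r w
  ... | just (u , v) = just (x ∷ u , v)
  ... | nothing with x ≟ r
  ...   | yes _ = just ([] , w)
  ...   | no _ = nothing

  joinSplit : Word → Word → Maybe (Word × Word) → Maybe (Word × Word) → Maybe (Word × Word)
  joinSplit A B m (just (u , v)) = just (A ++ u , v)
  joinSplit A B (just (u , v)) nothing = just (u , v ++ B)
  joinSplit A B nothing nothing = nothing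

  lastSplit-++ : ∀ r A B → lastSplit r (A ++ B) ≡ joinSplit A B (lastSplit r A) (lastSplit r B)
  lastSplit-++ r [] B with lastSplit r B
  ... | just (u , v) = refl
  ... | nothing = refl
  lastSplit-++ r (x ∷ A) B rewrite lastSplit-++ r A B with lastSplit r B
  ... | just (u , v) = refl
  ... | nothing with lastSplit r A
  ...   | just (u , v) = refl
  ...   | nothing with x ≟ r
  ...     | yes _ = refl
  ...     | no _ = refl

  infixr 5 _+₂_
  _+₂_ : ℕ → Word × ℕ → Word × ℕ
  i +₂ (w , s) = w , i + s

  -- The part of the word to the left, resp. right, of the letter chosen last; chosen letters
  -- are removed at once.  The result is the remaining word and the sum of the indices.
  mutual
    subword : ℕ → ℕ → ℕ → Word → Word → Word × ℕ
    subword zero r i L R = L ++ R , 0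
    subword (suc k) r i L R = subwordAt (lastSplit r L) (lastSplit r R) k r i L R

    subwordAt : Maybe (Word × Word) → Maybe (Word × Word) → ℕ → ℕ → ℕ → Word → Word → Word × ℕ
    subwordAt (just (u , v)) _ k r i L R = i +₂ subword k (suc r) i u (v ++ R)
    subwordAt nothing (just (u , v)) k r i L R = suc i +₂ subword k (suc r) (suc i) (L ++ u) v
    subwordAt nothing nothing k r i L R = L ++ R , 0

  maxW : Word → ℕ
  maxW = foldr _⊔_ 0

  maxW-++ : ∀ u v → maxW (u ++ v) ≡ maxW u ⊔ maxW v
  maxW-++ [] v = refl
  maxW-++ (x ∷ u) v = trans (cong (x ⊔_) (maxW-++ u v)) (sym (⊔-assoc x (maxW u) (maxW v)))

  -- The first argument is fuel. The length of the word suffices when the content is a partition,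
  -- since each extraction from a nonempty word then removes a letter.
  chargeW : ℕ → Word → ℕ
  chargeW zero w = 0
  chargeW (suc f) w = let res = subword (maxW w) 1 0 w [] in proj₂ res + chargeW f (proj₁ res)

  -- Only the next search can tell on which side of the cut a block lies; after one choice the
  -- pieces coincide. A block free of the letter sought may therefore cross the cut.
  subword-gap : ∀ k r i A D B → lastSplit r D ≡ nothing →
                subword k r i A (D ++ B) ≡ subword k r i (A ++ D) B
  subword-gap zero r i A D B eq = cong (_, 0) (sym (++-assoc A D B))
  subword-gap (suc k) r i A D B eq
    rewrite lastSplit-++ r D B | lastSplit-++ r A D | eq with lastSplit r A
  ... | just (u , v) = cong (λ z → i +₂ subword k (suc r) i u z) (sym (++-assoc v D B))
  ... | nothing with lastSplit r B
  ...   | just (u , v) = cong (λ z → suc i +₂ subword k (suc r) (suc i) z v) (sym (++-assoc A D u))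
  ...   | nothing = cong (_, 0) (sym (++-assoc A D B))

  -- `N` stands for the largest letter of the surrounding word, so `r + k ≡ N` says that all letters
  -- from `suc r` to `N` are still to be chosen. Without this an extraction might end right after
  -- `r` and leave two different words.
  data Hit (N : ℕ) (M M′ : Word) (r : ℕ) : Set where
    miss : lastSplit r M ≡ nothing → lastSplit r M′ ≡ nothing → Hit N M M′ r
    hit  : ∀ P Q P′ Q′ → lastSplit r M ≡ just (P , Q) → lastSplit r M′ ≡ just (P′ , Q′) →
           (∀ k i A B → r + k ≡ N →
              subword k (suc r) i (A ++ P) (Q ++ B) ≡ subword k (suc r) i (A ++ P′) (Q′ ++ B)) →
           Hit N M M′ r

  -- Replacing M by M′ inside a word: an extraction either leaves both occurrences untouched or
  -- makes the two remaining words equal.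
  Exchange : Word → Word → Set
  Exchange M M′ = maxW M ≡ maxW M′ × (∀ N r → maxW M ≤ N → Hit N M M′ r)

  data Replaced (M M′ : Word) : Word → Word → Set where
    same : ∀ {w} → Replaced M M′ w w
    at   : ∀ A B → Replaced M M′ (A ++ M ++ B) (A ++ M′ ++ B)

  Related : Word → Word → Word × ℕ → Word × ℕ → Set
  Related M M′ (w , s) (w′ , s′) = Replaced M M′ w w′ × s ≡ s′

  related-≡ : ∀ {M M′ p q} → p ≡ q → Related M M′ p q
  related-≡ refl = same , refl

  related-+ : ∀ {M M′} i {p q} → Related M M′ p q → Related M M′ (i +₂ p) (i +₂ q)
  related-+ i (R , e) = R , cong (i +_) e

  related-subst : ∀ {M M′ p p₁ q q₁} → p ≡ p₁ → q ≡ q₁ → Related M M′ p₁ q₁ → Related M M′ p q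
  related-subst refl refl r = r

  module _ {M M′ : Word} (N : ℕ) (max≤N : maxW M ≤ N) (ex : Exchange M M′) where

    mutual
      -- A choice outside the block leaves both blocks intact, a choice inside makes the two
      -- extractions agree from then on. The statement comes in two forms, for a block to the left
      -- and to the right of the cut, because a choice on the far side of the block moves the cut
      -- across it.
      subword-exchangeˡ : ∀ k r i A B R → r + k ≡ suc N →
        Related M M′ (subword k r i (A ++ M ++ B) R) (subword k r i (A ++ M′ ++ B) R)
      subword-exchangeˡ zero r i A B R _
        rewrite ++-assoc A (M ++ B) R | ++-assoc M B R | ++-assoc A (M′ ++ B) R | ++-assoc M′ B R
        = at A (B ++ R) , refl
      subword-exchangeˡ (suc k) r i A B R r+k
        rewrite lastSplit-++ r A (M ++ B) | lastSplit-++ r M B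
              | lastSplit-++ r A (M′ ++ B) | lastSplit-++ r M′ B
        with lastSplit r B
      ... | just (u , v) = related-+ i (subword-exchangeˡ k (suc r) i A u (v ++ R) (shift r k r+k))
      ... | nothing with proj₂ ex N r max≤N
      ...   | hit P Q P′ Q′ e e′ eq rewrite e | e′ = related-≡ (cong (i +₂_)
              (trans (cong (subword k (suc r) i (A ++ P)) (++-assoc Q B R))
                (trans (eq k i A (B ++ R) (suc-injective (shift r k r+k)))
                       (cong (subword k (suc r) i (A ++ P′)) (sym (++-assoc Q′ B R))))))
      ...   | miss e e′ rewrite e | e′ with lastSplit r A
      ...     | just (u , v) = related-+ i (related-subst
                  (cong (subword k (suc r) i u) (reassoc v M B R))
                  (cong (subword k (suc r) i u) (reassoc v M′ B R))
                  (subword-exchangeʳ k (suc r) i u v (B ++ R) (shift r k r+k)))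
      ...     | nothing with lastSplit r R
      ...       | just (u , v) = related-+ (suc i) (related-subst
                  (cong (λ z → subword k (suc r) (suc i) z v) (reassoc A M B u))
                  (cong (λ z → subword k (suc r) (suc i) z v) (reassoc A M′ B u))
                  (subword-exchangeˡ k (suc r) (suc i) A (B ++ u) v (shift r k r+k)))
      ...       | nothing
                  rewrite ++-assoc A (M ++ B) R | ++-assoc M B R
                        | ++-assoc A (M′ ++ B) R | ++-assoc M′ B R = at A (B ++ R) , refl

      subword-exchangeʳ : ∀ k r i L A B → r + k ≡ suc N →
        Related M M′ (subword k r i L (A ++ M ++ B)) (subword k r i L (A ++ M′ ++ B))
      subword-exchangeʳ zero r i L A B _
        rewrite sym (++-assoc L A (M ++ B)) | sym (++-assoc L A (M′ ++ B)) = at (L ++ A) B , refl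
      subword-exchangeʳ (suc k) r i L A B r+k
        with lastSplit r L
      ... | just (u , v) = related-+ i (related-subst
              (cong (subword k (suc r) i u) (sym (++-assoc v A (M ++ B))))
              (cong (subword k (suc r) i u) (sym (++-assoc v A (M′ ++ B))))
              (subword-exchangeʳ k (suc r) i u (v ++ A) B (shift r k r+k)))
      ... | nothing
        rewrite lastSplit-++ r A (M ++ B) | lastSplit-++ r M B
              | lastSplit-++ r A (M′ ++ B) | lastSplit-++ r M′ B
        with lastSplit r B
      ...   | just (u , v) = related-+ (suc i) (related-subst
              (cong (λ z → subword k (suc r) (suc i) z v) (sym (++-assoc L A (M ++ u))))
              (cong (λ z → subword k (suc r) (suc i) z v) (sym (++-assoc L A (M′ ++ u))))
              (subword-exchangeˡ k (suc r) (suc i) (L ++ A) u v (shift r k r+k)))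
      ...   | nothing with proj₂ ex N r max≤N
      ...     | hit P Q P′ Q′ e e′ eq rewrite e | e′ = related-≡ (cong (suc i +₂_)
              (trans (cong (λ z → subword k (suc r) (suc i) z (Q ++ B)) (sym (++-assoc L A P)))
                (trans (eq k (suc i) (L ++ A) B (suc-injective (shift r k r+k)))
                       (cong (λ z → subword k (suc r) (suc i) z (Q′ ++ B)) (++-assoc L A P′)))))
      ...     | miss e e′ rewrite e | e′ with lastSplit r A
      ...       | just (u , v) = related-+ (suc i) (related-subst
                  (cong (subword k (suc r) (suc i) (L ++ u)) refl)
                  (cong (subword k (suc r) (suc i) (L ++ u)) refl)
                  (subword-exchangeʳ k (suc r) (suc i) (L ++ u) v B (shift r k r+k)))
      ...       | nothing
                  rewrite sym (++-assoc L A (M ++ B)) | sym (++-assoc L A (M′ ++ B))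
                  = at (L ++ A) B , refl

      private
        shift : ∀ r k → r + suc k ≡ suc N → suc r + k ≡ suc N
        shift r k e = trans (sym (+-suc r k)) e

        reassoc : ∀ a b c d → (a ++ b ++ c) ++ d ≡ a ++ b ++ (c ++ d)
        reassoc a b c d = trans (++-assoc a (b ++ c) d) (cong (a ++_) (++-assoc b c d))

  -- Equal largest letters give extractions of equal length, and what these leave is again equal or
  -- related by the same replacement.
  chargeW-replaced : ∀ {M M′} → Exchange M M′ → ∀ f {w w′} → Replaced M M′ w w′ →
                     chargeW f w ≡ chargeW f w′
  chargeW-replaced ex zero R = refl
  chargeW-replaced ex (suc f) same = refl
  chargeW-replaced {M} {M′} ex (suc f) (at A B) =
    let N = maxW (A ++ M ++ B)
        N≡ : maxW (A ++ M′ ++ B) ≡ N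
        N≡ = trans (maxW-++ A (M′ ++ B)) (trans (cong (maxW A ⊔_)
               (trans (maxW-++ M′ B) (trans (cong (_⊔ maxW B) (sym (proj₁ ex))) (sym (maxW-++ M B)))))
               (sym (maxW-++ A (M ++ B))))
        M≤ : maxW M ≤ N
        M≤ = subst (maxW M ≤_) (sym (trans (maxW-++ A (M ++ B)) (cong (maxW A ⊔_) (maxW-++ M B))))
               (≤-trans (m≤m⊔n (maxW M) (maxW B)) (m≤n⊔m (maxW A) _))
        rel = subword-exchangeˡ N M≤ ex N 1 0 A B [] refl
        eq : subword (maxW (A ++ M′ ++ B)) 1 0 (A ++ M′ ++ B) []
           ≡ subword N 1 0 (A ++ M′ ++ B) []
        eq = cong (λ n → subword n 1 0 (A ++ M′ ++ B) []) N≡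
    in trans (cong₂ _+_ (proj₂ rel) (chargeW-replaced ex f (proj₁ rel)))
             (cong (λ p → proj₂ p + chargeW f (proj₁ p)) (sym eq))

  subword-left : ∀ k r i {L u v} R → lastSplit r L ≡ just (u , v) →
                 subword (suc k) r i L R ≡ i +₂ subword k (suc r) i u (v ++ R)
  subword-left k r i R eq rewrite eq = refl

  lastSplit-≢ : ∀ {x r} → x ≢ r → lastSplit r (x ∷ []) ≡ nothing
  lastSplit-≢ {x} {r} x≢r with x ≟ r
  ... | yes e = ⊥-elim (x≢r e)
  ... | no _ = refl

  lastSplit-skip : ∀ r A {x} → x ≢ r → lastSplit r (A ++ r ∷ x ∷ []) ≡ just (A , x ∷ [])
  lastSplit-skip r A {x} x≢r rewrite lastSplit-++ r A (r ∷ x ∷ []) with x ≟ r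
  ... | yes e = ⊥-elim (x≢r e)
  ... | no _ with r ≟ r
  ...   | yes _ = cong (λ z → just (z , x ∷ [])) (++-identityʳ A)
  ...   | no r≢r = ⊥-elim (r≢r refl)

  lastSplit-end : ∀ r A → lastSplit r (A ++ r ∷ []) ≡ just (A , [])
  lastSplit-end r A rewrite lastSplit-++ r A (r ∷ []) with r ≟ r
  ... | yes _ = cong (λ z → just (z , [])) (++-identityʳ A)
  ... | no r≢r = ⊥-elim (r≢r refl)

  subword-gap′ : ∀ k r i A x B → x ≢ r → subword k r i (A ++ []) (x ∷ B) ≡ subword k r i (A ++ x ∷ []) B
  subword-gap′ k r i A x B x≢r rewrite ++-identityʳ A = subword-gap k r i A (x ∷ []) B (lastSplit-≢ x≢r)

  -- Once `c` is chosen, `suc c` is sought, which is not `d`; so the side of the cut on which `d`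
  -- remains does not matter. The same holds with `c` and `d` interchanged.
  exchange-far : ∀ {c d} → c ≢ d → suc c ≢ d → suc d ≢ c → Exchange (c ∷ d ∷ []) (d ∷ c ∷ [])
  exchange-far {c} {d} c≢d c+1≢d d+1≢c = max≡ , go
    where
    max≡ : c ⊔ (d ⊔ 0) ≡ d ⊔ (c ⊔ 0)
    max≡ rewrite ⊔-identityʳ d | ⊔-identityʳ c = ⊔-comm c d
    go : ∀ N r → c ⊔ (d ⊔ 0) ≤ N → Hit N (c ∷ d ∷ []) (d ∷ c ∷ []) r
    go N r _ with c ≟ r | d ≟ r
    ... | yes refl | yes refl = ⊥-elim (c≢d refl)
    ... | yes refl | no d≢c = hit [] (d ∷ []) (d ∷ []) [] (lastSplit-skip c [] d≢c)
            (lastSplit-end c (d ∷ []))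
            (λ k i A B _ → subword-gap′ k (suc c) i A d B (λ e → c+1≢d (sym e)))
    ... | no c≢r | yes refl = hit (c ∷ []) [] [] (c ∷ []) (lastSplit-end d (c ∷ []))
            (lastSplit-skip d [] c≢r)
            (λ k i A B _ → sym (subword-gap′ k (suc d) i A c B (λ e → d+1≢c (sym e))))
    ... | no c≢r | no d≢r = miss (lastSplit-miss₂ c d c≢r d≢r) (lastSplit-miss₂ d c d≢r c≢r)
      where
      lastSplit-miss₂ : ∀ x y → x ≢ r → y ≢ r → lastSplit r (x ∷ y ∷ []) ≡ nothing
      lastSplit-miss₂ x y x≢r y≢r
        rewrite lastSplit-++ r (x ∷ []) (y ∷ []) | lastSplit-≢ x≢r | lastSplit-≢ y≢r = refl

  lastSplit-miss₃ : ∀ {r x y z} → x ≢ r → y ≢ r → z ≢ r → lastSplit r (x ∷ y ∷ z ∷ []) ≡ nothing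
  lastSplit-miss₃ {r} {x} {y} {z} x≢r y≢r z≢r
    rewrite lastSplit-++ r (x ∷ []) (y ∷ z ∷ []) | lastSplit-++ r (y ∷ []) (z ∷ [])
          | lastSplit-≢ x≢r | lastSplit-≢ y≢r | lastSplit-≢ z≢r = refl

  private
    room : ∀ {a N} → a + 0 ≡ N → suc a ≤ N → ⊥
    room {a} refl le = <-irrefl (sym (+-identityʳ a)) le

  -- With b = suc a: if a is chosen, both blocks lose their last letter and leave a b and b a to the
  -- left of the cut. The next choice is this b, and afterwards `suc b` is sought, for which the
  -- place of a is irrelevant.
  exchange-aba : ∀ a → Exchange (a ∷ suc a ∷ a ∷ []) (suc a ∷ a ∷ a ∷ [])
  exchange-aba a = max≡ , go
    where
    b = suc a
    max≡ : a ⊔ (b ⊔ (a ⊔ 0)) ≡ b ⊔ (a ⊔ (a ⊔ 0))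
    max≡ = trans (sym (⊔-assoc a b _)) (trans (cong (_⊔ (a ⊔ 0)) (⊔-comm a b)) (⊔-assoc b a _))
    b≢a : b ≢ a
    b≢a e = m≢1+m+n a (trans (sym e) (cong suc (sym (+-identityʳ a))))
    b≤ : ∀ {N} → a ⊔ (b ⊔ (a ⊔ 0)) ≤ N → b ≤ N
    b≤ le = ≤-trans (≤-trans (m≤m⊔n b (a ⊔ 0)) (m≤n⊔m a _)) le
    hit-a : ∀ {N} → b ≤ N → ∀ k i A B → a + k ≡ N →
      subword k b i (A ++ a ∷ b ∷ []) ([] ++ B) ≡ subword k b i (A ++ b ∷ a ∷ []) ([] ++ B)
    -- The extraction cannot end at `a`, because `b` does not exceed the largest letter `N`.
    hit-a le zero i A B e = ⊥-elim (room e le)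
    hit-a le (suc k) i A B e = trans
      (subword-left k b i B (subst (λ z → lastSplit b z ≡ just (A ++ a ∷ [] , []))
         (++-assoc A (a ∷ []) (b ∷ [])) (lastSplit-end b (A ++ a ∷ []))))
      (trans (cong (i +₂_)
         (sym (trans (cong (λ z → subword k (suc b) i z (a ∷ B)) (sym (++-identityʳ A)))
            (subword-gap′ k (suc b) i A a B (λ e → m≢1+m+n a (trans e (cong suc (+-comm 1 a))))))))
         (sym (subword-left k b i B (lastSplit-skip b A (λ e → b≢a (sym e))))))
    go : ∀ N r → a ⊔ (b ⊔ (a ⊔ 0)) ≤ N → Hit N (a ∷ b ∷ a ∷ []) (b ∷ a ∷ a ∷ []) r
    go N r le with a ≟ r
    ... | yes refl = hit (a ∷ b ∷ []) [] (b ∷ a ∷ []) [] (lastSplit-end a (a ∷ b ∷ []))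
                       (lastSplit-end a (b ∷ a ∷ [])) (hit-a (b≤ le))
    ... | no a≢r with b ≟ r
    ...   | no b≢r = miss (lastSplit-miss₃ a≢r b≢r a≢r) (lastSplit-miss₃ b≢r a≢r a≢r)
    ...   | yes refl = hit (a ∷ []) (a ∷ []) [] (a ∷ a ∷ []) (lastSplit-skip b (a ∷ []) a≢r)
              (split₂)
              (λ k i A B _ → sym (subword-gap′ k (suc b) i A a (a ∷ B)
                 (λ e → m≢1+m+n a (trans e (cong suc (+-comm 1 a))))))
      where
      split₂ : lastSplit b (b ∷ a ∷ a ∷ []) ≡ just ([] , a ∷ a ∷ [])
      split₂ = trans (lastSplit-++ b (b ∷ a ∷ []) (a ∷ []))
        (cong₂ (joinSplit (b ∷ a ∷ []) (a ∷ [])) (lastSplit-skip b [] a≢r) (lastSplit-≢ a≢r))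

  -- With b = suc a: after the choice of a, the first block has one b on each side of the cut and
  -- the second has both on the left. The next choice is a b on the left; the other b then lies next
  -- to the cut and may cross it, since `suc b` is sought.
  exchange-bab : ∀ a → Exchange (suc a ∷ a ∷ suc a ∷ []) (suc a ∷ suc a ∷ a ∷ [])
  exchange-bab a = max≡ , go
    where
    b = suc a
    max≡ : b ⊔ (a ⊔ (b ⊔ 0)) ≡ b ⊔ (b ⊔ (a ⊔ 0))
    max≡ = cong (b ⊔_) (trans (sym (⊔-assoc a b 0)) (trans (cong (_⊔ 0) (⊔-comm a b)) (⊔-assoc b a 0)))
    b≢a : b ≢ a
    b≢a e = m≢1+m+n a (trans (sym e) (cong suc (sym (+-identityʳ a))))
    b≢1+b : b ≢ suc b
    b≢1+b e = m≢1+m+n b (trans e (cong suc (sym (+-identityʳ b))))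
    hit-a : ∀ {N} → b ≤ N → ∀ k i A B → a + k ≡ N →
      subword k b i (A ++ b ∷ []) (b ∷ B) ≡ subword k b i (A ++ b ∷ b ∷ []) B
    hit-a le zero i A B e = ⊥-elim (room e le)
    hit-a le (suc k) i A B e = trans (subword-left k b i (b ∷ B) (lastSplit-end b A))
      (trans (cong (i +₂_) (trans (cong (λ z → subword k (suc b) i z (b ∷ B)) (sym (++-identityʳ A)))
          (subword-gap′ k (suc b) i A b B b≢1+b)))
        (sym (subword-left k b i B (subst (λ z → lastSplit b z ≡ just (A ++ b ∷ [] , []))
                (++-assoc A (b ∷ []) (b ∷ [])) (lastSplit-end b (A ++ b ∷ []))))))
    go : ∀ N r → b ⊔ (a ⊔ (b ⊔ 0)) ≤ N → Hit N (b ∷ a ∷ b ∷ []) (b ∷ b ∷ a ∷ []) r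
    go N r le with a ≟ r
    ... | yes refl = hit (b ∷ []) (b ∷ []) (b ∷ b ∷ []) [] (lastSplit-skip a (b ∷ []) b≢a)
                       (lastSplit-end a (b ∷ b ∷ [])) (hit-a (≤-trans (m≤m⊔n b (a ⊔ (b ⊔ 0))) le))
    ... | no a≢r with b ≟ r
    ...   | no b≢r = miss (lastSplit-miss₃ b≢r a≢r b≢r) (lastSplit-miss₃ b≢r b≢r a≢r)
    ...   | yes refl = hit (b ∷ a ∷ []) [] (b ∷ []) (a ∷ []) (lastSplit-end b (b ∷ a ∷ []))
              (lastSplit-skip b (b ∷ []) a≢r)
              (λ k i A B _ → trans
                 (cong (λ z → subword k (suc b) i z B) (sym (++-assoc A (b ∷ []) (a ∷ []))))
                 (sym (trans (cong (λ z → subword k (suc b) i z (a ∷ B)) (sym (++-identityʳ (A ++ b ∷ []))))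
                 (subword-gap′ k (suc b) i (A ++ b ∷ []) a B
                   (λ e → m≢1+m+n a (trans e (cong suc (+-comm 1 a))))))))

  -- Unless z = suc x, the two letters that change places are neither equal nor consecutive. If z =
  -- suc x, the inequalities force y = x, and in the second relation y = z, which leaves the two
  -- short exchanges.
  chargeW-knuth₁ : ∀ f u v {x y z} → x ≤ y → y < z →
                   chargeW f (u ++ x ∷ z ∷ y ∷ v) ≡ chargeW f (u ++ z ∷ x ∷ y ∷ v)
  chargeW-knuth₁ f u v {x} {y} {z} x≤y y<z with z ≟ suc x
  ... | no z≢ = chargeW-replaced (exchange-far (λ { refl → <-irrefl refl (≤-<-trans x≤y y<z) })
                   (λ e → z≢ (sym e)) (λ { refl → <-asym (≤-<-trans x≤y y<z) (n<1+n z) })) f (at u (y ∷ v))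
  ... | yes refl with ≤-antisym x≤y (≤-pred y<z)
  ...   | refl = chargeW-replaced (exchange-aba x) f (at u v)

  chargeW-knuth₂ : ∀ f u v {x y z} → x < y → y ≤ z →
                   chargeW f (u ++ y ∷ x ∷ z ∷ v) ≡ chargeW f (u ++ y ∷ z ∷ x ∷ v)
  chargeW-knuth₂ f u v {x} {y} {z} x<y y≤z with z ≟ suc x
  ... | no z≢ = trans (cong (chargeW f) (sym (++-assoc u (y ∷ []) (x ∷ z ∷ v))))
                  (trans (chargeW-replaced (exchange-far (λ { refl → <-irrefl refl (<-≤-trans x<y y≤z) })
                   (λ e → z≢ (sym e)) (λ { refl → <-asym (<-≤-trans x<y y≤z) (n<1+n z) })) f (at (u ++ y ∷ []) v))
                   (cong (chargeW f) (++-assoc u (y ∷ []) (z ∷ x ∷ v))))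
  ... | yes refl with ≤-antisym y≤z x<y
  ...   | refl = chargeW-replaced (exchange-bab x) f (at u v)

-- Extraction by positions agrees with extraction by deletion.

module ChargeAgreement where
  open import Defs using (charge)
  open ChargeUnfolding
  open WordCharge using (Word; lastSplit; subword; subwordAt; maxW; chargeW; _+₂_; lastSplit-++)
  open import Data.Bool using (true; false; _∧_; _∨_; if_then_else_; T)
  open import Data.Bool.Properties using (∨-identityʳ; ∨-assoc; ∧-zeroʳ)
  open import Data.Nat
  open import Data.Nat.Properties
  open import Data.List
  open import Data.List.Properties using (++-assoc; ++-identityʳ; map-++; filter-++)
  open import Data.List.Relation.Unary.All as All using (All; []; _∷_)
  open import Data.List.Relation.Unary.All.Properties as All using (++⁺; ++⁻ˡ; ++⁻ʳ)
  open import Data.List.Relation.Unary.AllPairs using (AllPairs; []; _∷_)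
  open import Data.Maybe using (just; nothing)
  open import Relation.Nullary using (yes; no)
  open import Relation.Binary.PropositionalEquality

  letters : List Letter → Word
  letters = map proj₂

  ≡ᵇ-refl : ∀ n → (n ≡ᵇ n) ≡ true
  ≡ᵇ-refl zero = refl
  ≡ᵇ-refl (suc n) = ≡ᵇ-refl n

  ≢⇒≡ᵇ : ∀ {m n} → m ≢ n → (m ≡ᵇ n) ≡ false
  ≢⇒≡ᵇ {m} {n} m≢n with m ≡ᵇ n in e
  ... | false = refl
  ... | true = ⊥-elim (m≢n (≡ᵇ⇒≡ m n (subst T (sym e) _)))

  <⇒<ᵇ-true : ∀ {m n} → m < n → (m <ᵇ n) ≡ true
  <⇒<ᵇ-true {m} {n} m<n with m <ᵇ n in e
  ... | true = refl
  ... | false = ⊥-elim (subst T e (<⇒<ᵇ m<n))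

  ≥⇒<ᵇ-false : ∀ {m n} → n ≤ m → (m <ᵇ n) ≡ false
  ≥⇒<ᵇ-false {m} {n} n≤m with m <ᵇ n in e
  ... | false = refl
  ... | true = ⊥-elim (<-irrefl refl (<-≤-trans (<ᵇ⇒< m n (subst T (sym e) _)) n≤m))

  lastOr-assoc : ∀ a b c → lastOr (lastOr a b) c ≡ lastOr a (lastOr b c)
  lastOr-assoc (just _) b c = refl
  lastOr-assoc nothing b c = refl

  lastBefore-++ : ∀ r p A B → lastBefore r p (A ++ B) ≡ lastOr (lastBefore r p B) (lastBefore r p A)
  lastBefore-++ r p [] B with lastBefore r p B
  ... | just _ = refl
  ... | nothing = refl
  lastBefore-++ r p (x ∷ A) B = begin
    lastBefore r p (x ∷ A ++ B)                                 ≡⟨ lastBefore-∷ r p x (A ++ B) ⟩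
    lastOr (lastBefore r p (A ++ B)) m                          ≡⟨ cong (λ z → lastOr z m) (lastBefore-++ r p A B) ⟩
    lastOr (lastOr (lastBefore r p B) (lastBefore r p A)) m     ≡⟨ lastOr-assoc (lastBefore r p B) (lastBefore r p A) m ⟩
    lastOr (lastBefore r p B) (lastOr (lastBefore r p A) m)     ≡⟨ cong (lastOr (lastBefore r p B)) (lastBefore-∷ r p x A) ⟨
    lastOr (lastBefore r p B) (lastBefore r p (x ∷ A))          ∎
    where
    open ≡-Reasoning
    m = if hit r p x then just (proj₁ x) else nothing

  lastAny-++ : ∀ r A B → lastAny r (A ++ B) ≡ lastOr (lastAny r B) (lastAny r A)
  lastAny-++ r [] B with lastAny r B
  ... | just _ = refl
  ... | nothing = refl
  lastAny-++ r (x ∷ A) B = begin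
    lastAny r (x ∷ A ++ B)                              ≡⟨ lastAny-∷ r x (A ++ B) ⟩
    lastOr (lastAny r (A ++ B)) m                       ≡⟨ cong (λ z → lastOr z m) (lastAny-++ r A B) ⟩
    lastOr (lastOr (lastAny r B) (lastAny r A)) m       ≡⟨ lastOr-assoc (lastAny r B) (lastAny r A) m ⟩
    lastOr (lastAny r B) (lastOr (lastAny r A) m)       ≡⟨ cong (lastOr (lastAny r B)) (lastAny-∷ r x A) ⟨
    lastOr (lastAny r B) (lastAny r (x ∷ A))            ∎
    where
    open ≡-Reasoning
    m = if proj₂ x ≡ᵇ r then just (proj₁ x) else nothing

  lastBefore-none : ∀ r p A → All (λ x → hit r p x ≡ false) A → lastBefore r p A ≡ nothing
  lastBefore-none r p [] [] = refl
  lastBefore-none r p (x ∷ A) (h ∷ hs) = trans (lastBefore-∷ r p x A)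
    (trans (cong (λ z → lastOr z _) (lastBefore-none r p A hs))
           (cong (if_then just (proj₁ x) else nothing) h))

  lastAny-none : ∀ r A → All (λ x → proj₂ x ≢ r) A → lastAny r A ≡ nothing
  lastAny-none r [] [] = refl
  lastAny-none r (x ∷ A) (h ∷ hs) = trans (lastAny-∷ r x A)
    (trans (cong (λ z → lastOr z _) (lastAny-none r A hs))
           (cong (if_then just (proj₁ x) else nothing) (≢⇒≡ᵇ h)))

  no-letter : ∀ {r p x} → proj₂ x ≢ r → hit r p x ≡ false
  no-letter {r} {p} {x} ne rewrite ≢⇒≡ᵇ {proj₂ x} {r} ne = refl

  too-far : ∀ {r p} {x : Letter} → p ≤ proj₁ x → hit r p x ≡ false
  too-far {r} {p} {x} le rewrite ≥⇒<ᵇ-false {proj₁ x} {p} le = ∧-zeroʳ _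

  lastBefore-at : ∀ r p A₁ x A₂ B → proj₂ x ≡ r → proj₁ x < p → All (λ x → proj₂ x ≢ r) A₂ →
    All (λ x → p ≤ proj₁ x) B → lastBefore r p ((A₁ ++ x ∷ A₂) ++ B) ≡ just (proj₁ x)
  lastBefore-at r p A₁ x A₂ B refl x<p ne far = begin
    lastBefore r p ((A₁ ++ x ∷ A₂) ++ B)
      ≡⟨ lastBefore-++ r p (A₁ ++ x ∷ A₂) B ⟩
    lastOr (lastBefore r p B) (lastBefore r p (A₁ ++ x ∷ A₂))
      ≡⟨ cong (λ z → lastOr z _) (lastBefore-none r p B (All.map (λ {y} → too-far {r} {p} {y}) far)) ⟩
    lastBefore r p (A₁ ++ x ∷ A₂)
      ≡⟨ lastBefore-++ r p A₁ (x ∷ A₂) ⟩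
    lastOr (lastBefore r p (x ∷ A₂)) (lastBefore r p A₁)
      ≡⟨ cong (λ z → lastOr z (lastBefore r p A₁)) (trans (lastBefore-∷ r p x A₂)
           (cong₂ lastOr (lastBefore-none r p A₂ (All.map (λ {y} → no-letter {r} {p} {y}) ne))
              (cong (if_then just (proj₁ x) else nothing) (cong₂ _∧_ (≡ᵇ-refl r) (<⇒<ᵇ-true x<p))))) ⟩
    just (proj₁ x) ∎
    where open ≡-Reasoning

  lastAny-at : ∀ r A₁ x A₂ → proj₂ x ≡ r → All (λ x → proj₂ x ≢ r) A₂ →
    lastAny r (A₁ ++ x ∷ A₂) ≡ just (proj₁ x)
  lastAny-at r A₁ x A₂ refl ne = begin
    lastAny r (A₁ ++ x ∷ A₂)
      ≡⟨ lastAny-++ r A₁ (x ∷ A₂) ⟩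
    lastOr (lastAny r (x ∷ A₂)) (lastAny r A₁)
      ≡⟨ cong (λ z → lastOr z (lastAny r A₁)) (trans (lastAny-∷ r x A₂)
           (cong₂ lastOr (lastAny-none r A₂ ne)
              (cong (if_then just (proj₁ x) else nothing) (≡ᵇ-refl r)))) ⟩
    just (proj₁ x) ∎
    where open ≡-Reasoning

  lastSplit-none : ∀ {r} w → All (_≢ r) w → lastSplit r w ≡ nothing
  lastSplit-none [] [] = refl
  lastSplit-none {r} (x ∷ w) (h ∷ hs) rewrite lastSplit-none w hs with x ≟ r
  ... | yes e = ⊥-elim (h e)
  ... | no _ = refl

  lastSplit-at : ∀ {r} u v → All (_≢ r) v → lastSplit r (u ++ r ∷ v) ≡ just (u , v)
  lastSplit-at {r} u v ne rewrite lastSplit-++ r u (r ∷ v) | lastSplit-none v ne with r ≟ r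
  ... | yes _ = cong (λ z → just (z , v)) (++-identityʳ u)
  ... | no r≢r = ⊥-elim (r≢r refl)

  memb-++ : ∀ q D E → memb q (D ++ E) ≡ memb q D ∨ memb q E
  memb-++ q [] E = refl
  memb-++ q (d ∷ D) E = trans (cong ((d ≡ᵇ q) ∨_) (memb-++ q D E)) (sym (∨-assoc (d ≡ᵇ q) _ _))

  memb-snoc-≢ : ∀ {q d} D → d ≢ q → memb q (D ++ d ∷ []) ≡ memb q D
  memb-snoc-≢ {q} {d} D ne rewrite memb-++ q D (d ∷ []) | ≢⇒≡ᵇ ne = ∨-identityʳ _

  memb-snoc : ∀ q D → memb q (D ++ q ∷ []) ≡ true
  memb-snoc q [] rewrite ≡ᵇ-refl q = refl
  memb-snoc q (d ∷ D) rewrite memb-snoc q D with d ≡ᵇ q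
  ... | true = refl
  ... | false = refl

  keep-++ : ∀ D A B → keep D (A ++ B) ≡ keep D A ++ keep D B
  keep-++ D A B = filter-++ _ A B

  keep-snoc-≢ : ∀ D {q} A → All (λ x → q ≢ proj₁ x) A → keep (D ++ q ∷ []) A ≡ keep D A
  keep-snoc-≢ D [] [] = refl
  keep-snoc-≢ D {q} (x ∷ A) (h ∷ hs) rewrite memb-snoc-≢ {proj₁ x} {q} D h with memb (proj₁ x) D
  ... | true = keep-snoc-≢ D A hs
  ... | false = cong (x ∷_) (keep-snoc-≢ D A hs)

  keep-snoc-drop : ∀ D x A → keep (D ++ proj₁ x ∷ []) (x ∷ A) ≡ keep (D ++ proj₁ x ∷ []) A
  keep-snoc-drop D x A rewrite memb-snoc (proj₁ x) D = refl

  keep-kept : ∀ D x A → memb (proj₁ x) D ≡ false → keep D (x ∷ A) ≡ x ∷ keep D A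
  keep-kept D x A e rewrite e = refl

  letters-≢ : ∀ {r} D A → All (λ x → proj₂ x ≢ r) A → All (_≢ r) (letters (keep D A))
  letters-≢ D [] [] = []
  letters-≢ D (x ∷ A) (h ∷ hs) with memb (proj₁ x) D
  ... | true = letters-≢ D A hs
  ... | false = h ∷ letters-≢ D A hs

  data LastLetter (r : ℕ) : List Letter → Set where
    at   : ∀ A₁ x A₂ → proj₂ x ≡ r → All (λ x → proj₂ x ≢ r) A₂ → LastLetter r (A₁ ++ x ∷ A₂)
    none : ∀ {A} → All (λ x → proj₂ x ≢ r) A → LastLetter r A

  lastLetter : ∀ r A → LastLetter r A
  lastLetter r [] = none []
  lastLetter r (x ∷ A) with lastLetter r A
  ... | at A₁ y A₂ e ne = at (x ∷ A₁) y A₂ e ne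
  ... | none ne with proj₂ x ≟ r
  ...   | yes e = at [] x A e ne
  ...   | no x≢r = none (x≢r ∷ ne)

  Sorted : List Letter → Set
  Sorted = AllPairs (λ x y → proj₁ x < proj₁ y)

  sorted-split : ∀ A x B → Sorted (A ++ x ∷ B) →
                 All (λ y → proj₁ y < proj₁ x) A × All (λ y → proj₁ x < proj₁ y) B
  sorted-split [] x B (h ∷ _) = [] , h
  sorted-split (a ∷ A) x B (h ∷ hs) with sorted-split A x B hs | ++⁻ʳ A h
  ... | l , r | a<x ∷ _ = (a<x ∷ l) , r

  -- A search by positions does not skip the positions in `D` already used. It need not, because the
  -- letters chosen so far are smaller than the one sought.
  Fresh : ℕ → List ℕ → List Letter → Set
  Fresh r D = All (λ x → r ≤ proj₂ x → memb (proj₁ x) D ≡ false)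

  fresh-next : ∀ {r} D A x B → proj₂ x ≡ r → Sorted (A ++ x ∷ B) → Fresh r D (A ++ x ∷ B) →
               Fresh (suc r) (D ++ proj₁ x ∷ []) (A ++ x ∷ B)
  fresh-next {r} D A x B refl sorted fresh with sorted-split A x B sorted
  ... | l , g with ++⁻ˡ A fresh | ++⁻ʳ A fresh
  ... | fA | fx ∷ fB = ++⁺ (go A fA (All.map (λ lt e → <-irrefl (sym e) lt) l))
                           ((λ le → ⊥-elim (<-irrefl refl le)) ∷ go B fB (All.map (λ lt e → <-irrefl e lt) g))
    where
    go : ∀ C → Fresh r D C → All (λ y → proj₁ x ≢ proj₁ y) C → Fresh (suc r) (D ++ proj₁ x ∷ []) C
    go [] [] [] = []
    go (c ∷ C) (f ∷ fs) (n ∷ ns) = (λ le → trans (memb-snoc-≢ D n) (f (≤-trans (n≤1+n r) le))) ∷ go C fs ns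

  -- The list is cut at the position `p` of the last choice, which itself belongs to `B` and to `D`.
  -- The search below `p` sees exactly `A`; if it fails, the last occurrence in the whole list is
  -- the last one in `B`.
  extract-subword : ∀ k r p i D A B →
    All (λ x → proj₁ x < p) A → All (λ x → p ≤ proj₁ x) B → Sorted (A ++ B) → Fresh r D (A ++ B) →
    subword k r i (letters (keep D A)) (letters (keep D B)) ≡
    (letters (keep (D ++ proj₁ (extract k r p i (A ++ B))) (A ++ B)) , proj₂ (extract k r p i (A ++ B)))
  extract-subword zero r p i D A B near far sorted fresh = cong (_, 0)
    (trans (sym (map-++ proj₂ (keep D A) (keep D B))) (trans (cong letters (sym (keep-++ D A B)))
      (cong (λ z → letters (keep z (A ++ B))) (sym (++-identityʳ D)))))
  extract-subword (suc k) r p i D A B near far sorted fresh with lastLetter r A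
  ... | at A₁ x A₂ refl ne = begin
      subword (suc k) r i (letters (keep D (A₁ ++ x ∷ A₂))) R
        ≡⟨ cong (λ z → subword (suc k) r i z R) L≡ ⟩
      subword (suc k) r i (u ++ r ∷ v) R
        ≡⟨ cong (λ z → subwordAt z (lastSplit r R) k r i (u ++ r ∷ v) R) (lastSplit-at u v (letters-≢ D A₂ ne)) ⟩
      i +₂ subword k (suc r) i u (v ++ R)
        ≡⟨ cong (i +₂_) (cong₂ (subword k (suc r) i) u≡ vR≡) ⟩
      i +₂ subword k (suc r) i (letters (keep D′ A₁)) (letters (keep D′ (x ∷ A₂ ++ B)))
        ≡⟨ cong (i +₂_) (extract-subword k (suc r) q i D′ A₁ (x ∷ A₂ ++ B) A₁<q
             (≤-refl ∷ All.map <⇒≤ B>q) sorted′ (fresh-next D A₁ x (A₂ ++ B) refl sorted′ (subst (Fresh r D) assoc fresh))) ⟩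
      i +₂ (letters (keep (D′ ++ proj₁ (ex (A₁ ++ x ∷ A₂ ++ B))) (A₁ ++ x ∷ A₂ ++ B)) , proj₂ (ex (A₁ ++ x ∷ A₂ ++ B)))
        ≡⟨ cong (λ z → i +₂ (letters (keep (D′ ++ proj₁ (ex z)) z) , proj₂ (ex z))) assoc ⟨
      letters (keep (D′ ++ proj₁ (ex ws)) ws) , i + proj₂ (ex ws)
        ≡⟨ cong (λ z → letters (keep z ws) , i + proj₂ (ex ws)) (++-assoc D (q ∷ []) (proj₁ (ex ws))) ⟩
      letters (keep (D ++ proj₁ (leftwards r p ws (just q) k i)) ws) , proj₂ (leftwards r p ws (just q) k i)
        ≡⟨ cong (λ z → letters (keep (D ++ proj₁ (leftwards r p ws z k i)) ws) , proj₂ (leftwards r p ws z k i))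
             (lastBefore-at r p A₁ x A₂ B refl (All.head (++⁻ʳ A₁ near)) ne far) ⟨
      letters (keep (D ++ proj₁ (extract (suc k) r p i ws)) ws) , proj₂ (extract (suc k) r p i ws) ∎
    where
    open ≡-Reasoning
    ws = (A₁ ++ x ∷ A₂) ++ B
    q = proj₁ x
    D′ = D ++ q ∷ []
    R = letters (keep D B)
    u = letters (keep D A₁)
    v = letters (keep D A₂)
    ex = λ ws → extract k (suc r) q i ws
    assoc : ws ≡ A₁ ++ x ∷ A₂ ++ B
    assoc = ++-assoc A₁ (x ∷ A₂) B
    sorted′ : Sorted (A₁ ++ x ∷ A₂ ++ B)
    sorted′ = subst Sorted assoc sorted
    A₁<q = proj₁ (sorted-split A₁ x (A₂ ++ B) sorted′)
    B>q = proj₂ (sorted-split A₁ x (A₂ ++ B) sorted′)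
    kept : memb q D ≡ false
    kept = All.head (++⁻ʳ A₁ (subst (Fresh r D) assoc fresh)) ≤-refl
    L≡ : letters (keep D (A₁ ++ x ∷ A₂)) ≡ u ++ r ∷ v
    L≡ = trans (cong letters (trans (keep-++ D A₁ (x ∷ A₂)) (cong (keep D A₁ ++_) (keep-kept D x A₂ kept))))
               (map-++ proj₂ (keep D A₁) (x ∷ keep D A₂))
    u≡ : u ≡ letters (keep D′ A₁)
    u≡ = cong letters (sym (keep-snoc-≢ D A₁ (All.map (λ lt e → <-irrefl (sym e) lt) A₁<q)))
    vR≡ : v ++ R ≡ letters (keep D′ (x ∷ A₂ ++ B))
    vR≡ = trans (sym (map-++ proj₂ (keep D A₂) (keep D B))) (cong letters (trans (sym (keep-++ D A₂ B))
            (trans (sym (keep-snoc-≢ D (A₂ ++ B) (All.map (λ lt e → <-irrefl e lt) B>q)))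
                   (sym (keep-snoc-drop D x (A₂ ++ B))))))
  ... | none neA with lastLetter r B
  ...   | none neB = begin
      subword (suc k) r i L (letters (keep D B))
        ≡⟨ cong₂ (λ y z → subwordAt y z k r i L (letters (keep D B)))
             (lastSplit-none L (letters-≢ D A neA)) (lastSplit-none (letters (keep D B)) (letters-≢ D B neB)) ⟩
      L ++ letters (keep D B) , 0
        ≡⟨ cong (_, 0) (trans (sym (map-++ proj₂ (keep D A) (keep D B))) (trans (cong letters (sym (keep-++ D A B)))
             (cong (λ z → letters (keep z (A ++ B))) (sym (++-identityʳ D))))) ⟩
      letters (keep (D ++ []) ws) , 0
        ≡⟨ cong (λ z → letters (keep (D ++ proj₁ (cyclic r p ws z k i)) ws) , proj₂ (cyclic r p ws z k i))
             (lastAny-none r ws (++⁺ neA neB)) ⟨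
      letters (keep (D ++ proj₁ (leftwards r p ws nothing k i)) ws) , proj₂ (leftwards r p ws nothing k i)
        ≡⟨ cong (λ z → letters (keep (D ++ proj₁ (leftwards r p ws z k i)) ws) , proj₂ (leftwards r p ws z k i))
             (lastBefore-none r p ws (All.map (λ {y} → no-letter {r} {p} {y}) (++⁺ neA neB))) ⟨
      letters (keep (D ++ proj₁ (extract (suc k) r p i ws)) ws) , proj₂ (extract (suc k) r p i ws) ∎
    where
    open ≡-Reasoning
    ws = A ++ B
    L = letters (keep D A)
  ...   | at B₁ x B₂ refl ne = begin
      subword (suc k) r i L (letters (keep D (B₁ ++ x ∷ B₂)))
        ≡⟨ cong (subword (suc k) r i L) R≡ ⟩
      subword (suc k) r i L (u ++ r ∷ v)
        ≡⟨ cong₂ (λ y z → subwordAt y z k r i L (u ++ r ∷ v))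
             (lastSplit-none L (letters-≢ D A neA)) (lastSplit-at u v (letters-≢ D B₂ ne)) ⟩
      suc i +₂ subword k (suc r) (suc i) (L ++ u) v
        ≡⟨ cong (suc i +₂_) (cong₂ (subword k (suc r) (suc i)) Lu≡ v≡) ⟩
      suc i +₂ subword k (suc r) (suc i) (letters (keep D′ (A ++ B₁))) (letters (keep D′ (x ∷ B₂)))
        ≡⟨ cong (suc i +₂_) (extract-subword k (suc r) q (suc i) D′ (A ++ B₁) (x ∷ B₂) A<q
             (≤-refl ∷ All.map <⇒≤ B>q) sorted′ (fresh-next D (A ++ B₁) x B₂ refl sorted′ (subst (Fresh r D) assoc fresh))) ⟩
      suc i +₂ (letters (keep (D′ ++ proj₁ (ex ((A ++ B₁) ++ x ∷ B₂))) ((A ++ B₁) ++ x ∷ B₂)) , proj₂ (ex ((A ++ B₁) ++ x ∷ B₂)))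
        ≡⟨ cong (λ z → suc i +₂ (letters (keep (D′ ++ proj₁ (ex z)) z) , proj₂ (ex z))) assoc ⟨
      letters (keep (D′ ++ proj₁ (ex ws)) ws) , suc i + proj₂ (ex ws)
        ≡⟨ cong (λ z → letters (keep z ws) , suc i + proj₂ (ex ws)) (++-assoc D (q ∷ []) (proj₁ (ex ws))) ⟩
      letters (keep (D ++ proj₁ (cyclic r p ws (just q) k i)) ws) , proj₂ (cyclic r p ws (just q) k i)
        ≡⟨ cong (λ z → letters (keep (D ++ proj₁ (cyclic r p ws z k i)) ws) , proj₂ (cyclic r p ws z k i))
             (trans (cong (lastAny r) (sym (++-assoc A B₁ (x ∷ B₂)))) (lastAny-at r (A ++ B₁) x B₂ refl ne)) ⟨
      letters (keep (D ++ proj₁ (leftwards r p ws nothing k i)) ws) , proj₂ (leftwards r p ws nothing k i)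
        ≡⟨ cong (λ z → letters (keep (D ++ proj₁ (leftwards r p ws z k i)) ws) , proj₂ (leftwards r p ws z k i))
             (lastBefore-none r p ws (++⁺ (All.map (λ {y} → no-letter {r} {p} {y}) neA)
                                          (All.map (λ {y} → too-far {r} {p} {y}) far))) ⟨
      letters (keep (D ++ proj₁ (extract (suc k) r p i ws)) ws) , proj₂ (extract (suc k) r p i ws) ∎
    where
    open ≡-Reasoning
    ws = A ++ (B₁ ++ x ∷ B₂)
    q = proj₁ x
    D′ = D ++ q ∷ []
    L = letters (keep D A)
    u = letters (keep D B₁)
    v = letters (keep D B₂)
    ex = λ ws → extract k (suc r) q (suc i) ws
    assoc : ws ≡ (A ++ B₁) ++ x ∷ B₂
    assoc = sym (++-assoc A B₁ (x ∷ B₂))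
    sorted′ : Sorted ((A ++ B₁) ++ x ∷ B₂)
    sorted′ = subst Sorted assoc sorted
    A<q = proj₁ (sorted-split (A ++ B₁) x B₂ sorted′)
    B>q = proj₂ (sorted-split (A ++ B₁) x B₂ sorted′)
    kept : memb q D ≡ false
    kept = All.head (++⁻ʳ (A ++ B₁) (subst (Fresh r D) assoc fresh)) ≤-refl
    R≡ : letters (keep D (B₁ ++ x ∷ B₂)) ≡ u ++ r ∷ v
    R≡ = trans (cong letters (trans (keep-++ D B₁ (x ∷ B₂)) (cong (keep D B₁ ++_) (keep-kept D x B₂ kept))))
               (map-++ proj₂ (keep D B₁) (x ∷ keep D B₂))
    Lu≡ : L ++ u ≡ letters (keep D′ (A ++ B₁))
    Lu≡ = trans (sym (map-++ proj₂ (keep D A) (keep D B₁))) (cong letters (trans (sym (keep-++ D A B₁))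
            (sym (keep-snoc-≢ D (A ++ B₁) (All.map (λ lt e → <-irrefl (sym e) lt) A<q)))))
    v≡ : v ≡ letters (keep D′ (x ∷ B₂))
    v≡ = cong letters (trans (sym (keep-snoc-≢ D B₂ (All.map (λ lt e → <-irrefl e lt) B>q)))
           (sym (keep-snoc-drop D x B₂)))

  maxLetter-letters : ∀ ws → maxLetter ws ≡ maxW (letters ws)
  maxLetter-letters [] = refl
  maxLetter-letters (x ∷ ws) = cong (proj₂ x ⊔_) (maxLetter-letters ws)

  keep-[] : ∀ ws → keep [] ws ≡ ws
  keep-[] [] = refl
  keep-[] (x ∷ ws) = cong (x ∷_) (keep-[] ws)

  All-keep′ : ∀ {P : Letter → Set} D A → All P A → All P (keep D A)
  All-keep′ D [] [] = []
  All-keep′ D (x ∷ A) (h ∷ hs) with memb (proj₁ x) D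
  ... | true = All-keep′ D A hs
  ... | false = h ∷ All-keep′ D A hs

  sorted-keep : ∀ D A → Sorted A → Sorted (keep D A)
  sorted-keep D [] [] = []
  sorted-keep D (x ∷ A) (h ∷ hs) with memb (proj₁ x) D
  ... | true = sorted-keep D A hs
  ... | false = All-keep′ D A h ∷ sorted-keep D A hs

  chargeAux-chargeW : ∀ f N ws → All (λ x → proj₁ x < N) ws → Sorted ws →
                      chargeAux f N ws ≡ chargeW f (letters ws)
  chargeAux-chargeW zero N ws near sorted = refl
  chargeAux-chargeW (suc f) N ws near sorted = begin
    proj₂ ex + chargeAux f N (keep (proj₁ ex) ws)
      ≡⟨ cong (proj₂ ex +_) (chargeAux-chargeW f N (keep (proj₁ ex) ws)
           (All-keep′ (proj₁ ex) ws near) (sorted-keep (proj₁ ex) ws sorted)) ⟩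
    proj₂ ex + chargeW f (letters (keep (proj₁ ex) ws))
      ≡⟨ cong (λ p → proj₂ p + chargeW f (proj₁ p)) eq ⟨
    chargeW (suc f) (letters ws) ∎
    where
    open ≡-Reasoning
    ex = extract (maxLetter ws) 1 N 0 ws
    eq : subword (maxW (letters ws)) 1 0 (letters ws) [] ≡ (letters (keep (proj₁ ex) ws) , proj₂ ex)
    eq = trans (cong₂ (λ k w → subword k 1 0 w []) (sym (maxLetter-letters ws)) (cong letters (sym (keep-[] ws))))
      (trans (extract-subword (maxLetter ws) 1 N 0 [] ws [] near []
        (subst Sorted (sym (++-identityʳ ws)) sorted) (All.universal (λ _ _ → refl) _))
        (cong (λ z → letters (keep (proj₁ (extract (maxLetter ws) 1 N 0 z)) z) , proj₂ (extract (maxLetter ws) 1 N 0 z))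
          (++-identityʳ ws)))

  positions-bounds : ∀ i w → All (λ x → i ≤ proj₁ x × proj₁ x < i + length w) (positions i w)
  positions-bounds i [] = []
  positions-bounds i (a ∷ w) = (≤-refl , m<m+n i (s≤s z≤n)) ∷
    All.map (λ {x} (l , u) → ≤-trans (n≤1+n i) l , subst (proj₁ x <_) (sym (+-suc i (length w))) u) (positions-bounds (suc i) w)

  positions-sorted : ∀ i w → Sorted (positions i w)
  positions-sorted i [] = []
  positions-sorted i (a ∷ w) = All.map proj₁ (positions-bounds (suc i) w) ∷ positions-sorted (suc i) w

  letters-positions : ∀ i w → letters (positions i w) ≡ w
  letters-positions i [] = refl
  letters-positions i (a ∷ w) = cong (a ∷_) (letters-positions (suc i) w)

  charge≡chargeW : ∀ w → charge w ≡ chargeW (length w) w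
  charge≡chargeW w = trans (chargeAux-chargeW (length w) (length w) (positions 0 w)
      (All.map proj₂ (positions-bounds 0 w)) (positions-sorted 0 w))
    (cong (chargeW (length w)) (letters-positions 0 w))

-- Charge under rotation of a word and under raising its letters.

module ChargeRotation where
  open import Defs using (charge; count)
  open WordCharge
  open ChargeAgreement using (≡ᵇ-refl; ≢⇒≡ᵇ; charge≡chargeW; lastSplit-none)
  open import Data.Bool using (true; false; if_then_else_)
  open import Data.Nat
  open import Data.Nat.Properties
  open import Data.List
  open import Data.List.Properties using (++-assoc; ++-identityʳ; length-++; map-++; length-map)
  open import Data.List.Relation.Unary.All as All using (All; []; _∷_)
  open import Data.Maybe as Maybe using (Maybe; just; nothing)
  open import Relation.Nullary using (yes; no)
  open import Relation.Binary.PropositionalEquality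

  δ : ℕ → ℕ → ℕ
  δ r c = if r ≡ᵇ c then 1 else 0

  δ-refl : ∀ c → δ c c ≡ 1
  δ-refl c rewrite ≡ᵇ-refl c = refl

  δ-≢ : ∀ {r c} → r ≢ c → δ r c ≡ 0
  δ-≢ ne rewrite ≢⇒≡ᵇ ne = refl

  count-∷ : ∀ c x w → count c (x ∷ w) ≡ δ x c + count c w
  count-∷ c x w with x ≡ᵇ c
  ... | true = refl
  ... | false = refl

  count-++ : ∀ c u v → count c (u ++ v) ≡ count c u + count c v
  count-++ c [] v = refl
  count-++ c (x ∷ u) v = trans (count-∷ c x (u ++ v)) (trans (cong (δ x c +_) (count-++ c u v))
    (trans (sym (+-assoc (δ x c) (count c u) (count c v))) (cong (_+ count c v) (sym (count-∷ c x u)))))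

  count-insert : ∀ c u r v → count c (u ++ r ∷ v) ≡ δ r c + count c (u ++ v)
  count-insert c [] r v = count-∷ c r v
  count-insert c (x ∷ u) r v = begin
    count c (x ∷ u ++ r ∷ v)            ≡⟨ count-∷ c x (u ++ r ∷ v) ⟩
    δ x c + count c (u ++ r ∷ v)        ≡⟨ cong (δ x c +_) (count-insert c u r v) ⟩
    δ x c + (δ r c + count c (u ++ v))  ≡⟨ +-assoc (δ x c) (δ r c) _ ⟨
    δ x c + δ r c + count c (u ++ v)    ≡⟨ cong (_+ count c (u ++ v)) (+-comm (δ x c) (δ r c)) ⟩
    δ r c + δ x c + count c (u ++ v)    ≡⟨ +-assoc (δ r c) (δ x c) _ ⟩
    δ r c + (δ x c + count c (u ++ v))  ≡⟨ cong (δ r c +_) (count-∷ c x (u ++ v)) ⟨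
    δ r c + count c (x ∷ u ++ v)        ∎
    where open ≡-Reasoning

  data SplitView (r : ℕ) (w : Word) : Maybe (Word × Word) → Set where
    found : ∀ u v → w ≡ u ++ r ∷ v → SplitView r w (just (u , v))
    none  : count r w ≡ 0 → SplitView r w nothing

  splitView : ∀ r w → SplitView r w (lastSplit r w)
  splitView r [] = none refl
  splitView r (x ∷ w) with lastSplit r w | splitView r w
  ... | just (u , v) | found _ _ e = found (x ∷ u) v (cong (x ∷_) e)
  ... | nothing | none e with x ≟ r
  ...   | yes refl = found [] w refl
  ...   | no x≢r = none (trans (count-∷ r x w) (trans (cong (_+ count r w) (δ-≢ x≢r)) e))

  inRange : ℕ → ℕ → ℕ → ℕ
  inRange r zero c = 0
  inRange r (suc k) c = δ r c + inRange (suc r) k c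

  AllPresent : ℕ → ℕ → Word → Set
  AllPresent r k w = ∀ j → r ≤ j → j < r + k → 1 ≤ count j w

  private
    present-next : ∀ r k u v {w} → w ≡ u ++ r ∷ v → AllPresent r (suc k) w → AllPresent (suc r) k (u ++ v)
    present-next r k u v refl h j r<j j< = subst (1 ≤_)
      (trans (count-insert j u r v) (cong (_+ count j (u ++ v)) (δ-≢ (<⇒≢ r<j))))
      (h j (<⇒≤ r<j) (subst (j <_) (sym (+-suc r k)) j<))

  record Removed (r k : ℕ) (w w′ : Word) : Set where
    constructor _,_
    field
      counts : ∀ c → count c w ≡ inRange r k c + count c w′
      lengths : length w ≡ k + length w′
  open Removed public

  private
    removed-step : ∀ r k u v {w w′} → w ≡ u ++ r ∷ v → Removed (suc r) k (u ++ v) w′ → Removed r (suc k) w w′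
    removed-step r k u v {w′ = w′} refl (hc , hl) =
      (λ c → trans (count-insert c u r v) (trans (cong (δ r c +_) (hc c))
               (sym (+-assoc (δ r c) (inRange (suc r) k c) (count c w′))))) ,
      trans (length-++ u) (trans (+-suc (length u) (length v)) (cong suc (trans (sym (length-++ u)) hl)))

  subword-removed : ∀ k r i L R → AllPresent r k (L ++ R) →
                    Removed r k (L ++ R) (proj₁ (subword k r i L R))
  subword-removed zero r i L R h = (λ c → refl) , refl
  subword-removed (suc k) r i L R h with lastSplit r L | splitView r L
  ... | just (u , v) | found _ _ e =
    let e′ = trans (cong (_++ R) e) (++-assoc u (r ∷ v) R)
    in removed-step r k u (v ++ R) e′ (subword-removed k (suc r) i u (v ++ R) (present-next r k u (v ++ R) e′ h))
  ... | nothing | none eL with lastSplit r R | splitView r R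
  ...   | just (u , v) | found _ _ e =
    let e′ = trans (cong (L ++_) e) (sym (++-assoc L u (r ∷ v)))
    in removed-step r k (L ++ u) v e′ (subword-removed k (suc r) (suc i) (L ++ u) v (present-next r k (L ++ u) v e′ h))
  ...   | nothing | none eR = ⊥-elim (<-irrefl (sym (trans (count-++ r L R) (cong₂ _+_ eL eR)))
            (h r ≤-refl (m<m+n r (s≤s z≤n))))

  inRange-< : ∀ r k c → c < r → inRange r k c ≡ 0
  inRange-< r zero c lt = refl
  inRange-< r (suc k) c lt = cong₂ _+_ (δ-≢ (λ e → <-irrefl (sym e) lt)) (inRange-< (suc r) k c (m<n⇒m<1+n lt))

  inRange-in : ∀ r k c → r ≤ c → c < r + k → inRange r k c ≡ 1
  inRange-in r zero c le lt = ⊥-elim (<-irrefl refl (<-≤-trans lt (subst (_≤ c) (sym (+-identityʳ r)) le)))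
  inRange-in r (suc k) c le lt with r ≟ c
  ... | yes refl = cong₂ _+_ (δ-refl c) (inRange-< (suc c) k c ≤-refl)
  ... | no r≢c = cong₂ _+_ (δ-≢ r≢c) (inRange-in (suc r) k c (≤∧≢⇒< le r≢c) (subst (c <_) (+-suc r k) lt))

  -- Decreasing multiplicities guarantee that an extraction finds every letter from 1 to the largest
  -- one, and the property passes to the remaining word.
  record PartitionContent (w : Word) : Set where
    constructor _,_
    field
      no-zero : count 0 w ≡ 0
      decreasing : ∀ j → 1 ≤ j → count (suc j) w ≤ count j w
  open PartitionContent public

  maxW-present : ∀ w → maxW w ≡ 0 ⊎ 1 ≤ count (maxW w) w
  maxW-present [] = inj₁ refl
  maxW-present (x ∷ w) with ⊔-sel x (maxW w)
  ... | inj₁ e = inj₂ (subst (λ m → 1 ≤ count m (x ∷ w)) (sym e)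
                   (subst (1 ≤_) (sym (trans (count-∷ x x w) (cong (_+ count x w) (δ-refl x)))) (s≤s z≤n)))
  ... | inj₂ e with maxW-present w
  ...   | inj₁ z = inj₁ (trans e z)
  ...   | inj₂ p = inj₂ (subst (λ m → 1 ≤ count m (x ∷ w)) (sym e)
                     (≤-trans p (subst (count (maxW w) w ≤_) (sym (count-∷ (maxW w) x w)) (m≤n+m _ _))))

  count-> : ∀ c w → maxW w < c → count c w ≡ 0
  count-> c [] lt = refl
  count-> c (x ∷ w) lt = trans (count-∷ c x w) (cong₂ _+_
    (δ-≢ (<⇒≢ (≤-<-trans (m≤m⊔n x (maxW w)) lt))) (count-> c w (≤-<-trans (m≤n⊔m x (maxW w)) lt)))

  module _ {w : Word} (pc : PartitionContent w) where
    private
      descend : ∀ d j → 1 ≤ j → count (d + j) w ≤ count j w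
      descend zero j le = ≤-refl
      descend (suc d) j le = ≤-trans (decreasing pc (d + j) (≤-trans le (m≤n+m j d))) (descend d j le)

    content-present : AllPresent 1 (maxW w) w
    content-present j 1≤j j< with maxW-present w
    ... | inj₁ z = ⊥-elim (<-irrefl refl (<-≤-trans j< (≤-trans (s≤s (≤-reflexive z)) 1≤j)))
    ... | inj₂ p = ≤-trans p (subst (λ m → count m w ≤ count j w) (m∸n+n≡m (≤-pred j<)) (descend (maxW w ∸ j) j 1≤j))

    rest : Word
    rest = proj₁ (subword (maxW w) 1 0 w [])

    rest-removed : Removed 1 (maxW w) w rest
    rest-removed = subst (λ z → Removed 1 (maxW w) z rest) (++-identityʳ w)
      (subword-removed (maxW w) 1 0 w [] (subst (AllPresent 1 (maxW w)) (sym (++-identityʳ w)) content-present))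

    rest-content : PartitionContent rest
    rest-content = n≤0⇒n≡0 (subst (count 0 rest ≤_) (no-zero pc) (≤-trans (m≤n+m _ _) (≤-reflexive (sym (counts rest-removed 0))))) , mono
      where
      mono : ∀ j → 1 ≤ j → count (suc j) rest ≤ count j rest
      mono j 1≤j with maxW w <? suc j
      ... | yes lt = subst (_≤ count j rest) (sym (n≤0⇒n≡0 (subst (count (suc j) rest ≤_) (count-> (suc j) w lt)
                       (≤-trans (m≤n+m _ _) (≤-reflexive (sym (counts rest-removed (suc j)))))))) z≤n
      ... | no ≮ = +-cancelˡ-≤ 1 _ _ (subst₂ _≤_
          (trans (counts rest-removed (suc j)) (cong (_+ count (suc j) rest) (inRange-in 1 (maxW w) (suc j) (s≤s z≤n) (s≤s (≮⇒≥ ≮)))))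
          (trans (counts rest-removed j) (cong (_+ count j rest) (inRange-in 1 (maxW w) j 1≤j (s≤s (<⇒≤ (≮⇒≥ ≮))))))
          (decreasing pc j 1≤j))

  maxW-∷-pos : ∀ {x w} → PartitionContent (x ∷ w) → 1 ≤ maxW (x ∷ w)
  maxW-∷-pos {zero} {w} (z , _) with trans (sym (count-∷ 0 0 w)) z
  ... | ()
  maxW-∷-pos {suc x} {w} _ = ≤-trans (s≤s z≤n) (m≤m⊔n (suc x) (maxW w))

  rest-shorter : ∀ {x w f} (pc : PartitionContent (x ∷ w)) → length (x ∷ w) ≤ suc f → length (rest pc) ≤ f
  rest-shorter {x} {w} pc le = ≤-pred (≤-trans
    (subst (suc (length (rest pc)) ≤_) (sym (lengths (rest-removed pc))) (+-monoˡ-≤ (length (rest pc)) (maxW-∷-pos pc))) le)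

  chargeW-[] : ∀ f → chargeW f [] ≡ 0
  chargeW-[] zero = refl
  chargeW-[] (suc f) = chargeW-[] f

  chargeW-fuel : ∀ f g w → PartitionContent w → length w ≤ f → length w ≤ g → chargeW f w ≡ chargeW g w
  chargeW-fuel f g [] pc _ _ = trans (chargeW-[] f) (sym (chargeW-[] g))
  chargeW-fuel (suc f) (suc g) (x ∷ w) pc lf lg =
    cong (proj₂ (subword (maxW (x ∷ w)) 1 0 (x ∷ w) []) +_)
      (chargeW-fuel f g (rest pc) (rest-content pc) (rest-shorter pc lf) (rest-shorter pc lg))

  data Rotated (x : ℕ) : Word × ℕ → Word × ℕ → Set where
    stay  : ∀ {p q} w s → p ≡ (x ∷ w , s) → q ≡ (w ++ x ∷ [] , s) → Rotated x p q
    moved : ∀ {p q} w s → p ≡ (w , s) → q ≡ (w , suc s) → Rotated x p q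

  rotated-+ : ∀ {x} i {p q} → Rotated x p q → Rotated x (i +₂ p) (i +₂ q)
  rotated-+ i (stay w s refl refl) = stay w (i + s) refl refl
  rotated-+ i (moved w s refl refl) = moved w (i + s) refl (cong (w ,_) (+-suc i s))

  -- With nothing to the left, the next search wraps around at once and raises the index. The same
  -- choices are made when everything lies to the left and the index has been raised beforehand.
  subword-turn : ∀ k r i W → subword k r i [] W ≡ subword k r (suc i) W []
  subword-turn zero r i W = cong (_, 0) (sym (++-identityʳ W))
  subword-turn (suc k) r i W with lastSplit r W
  ... | just (u , v) = cong (λ z → suc i +₂ subword k (suc r) (suc i) u z) (sym (++-identityʳ v))
  ... | nothing = cong (_, 0) (sym (++-identityʳ W))

  -- If `x` is chosen at the front, nothing remains to the left of the cut; if it is chosen at the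
  -- end, the search has wrapped around and nothing remains to the right. By `subword-turn` the
  -- continuations agree, so the sums differ only by the index of `x` itself.
  subword-rotate : ∀ k r i x L R → Rotated x (subword k r i (x ∷ L) R) (subword k r i L (R ++ x ∷ []))
  subword-rotate zero r i x L R = stay (L ++ R) 0 refl (cong (_, 0) (sym (++-assoc L R (x ∷ []))))
  subword-rotate (suc k) r i x L R with lastSplit r L
  ... | just (u , v) = rotated-+ i (subst (λ z → Rotated x (subword k (suc r) i (x ∷ u) (v ++ R)) (subword k (suc r) i u z))
          (++-assoc v R (x ∷ [])) (subword-rotate k (suc r) i x u (v ++ R)))
  ... | nothing with x ≟ r
  ...   | yes refl rewrite lastSplit-end r R = moved (proj₁ res) (i + proj₂ res) refl
            (cong (suc i +₂_) (sym (subword-turn k (suc r) i (L ++ R))))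
    where res = subword k (suc r) i [] (L ++ R)
  ...   | no x≢r rewrite lastSplit-++ r R (x ∷ []) | lastSplit-≢ x≢r with lastSplit r R
  ...     | just (u , v) = rotated-+ (suc i) (subword-rotate k (suc r) (suc i) x (L ++ u) v)
  ...     | nothing = stay (L ++ R) 0 refl (cong (_, 0) (sym (++-assoc L R (x ∷ []))))

  -- As `x` is not 1, both extractions start with the same letter 1, and `subword-rotate` describes
  -- the rest. When `x` is chosen, the sum grows by one and equal words remain; until then the
  -- remaining words are again rotations of each other.
  chargeW-rotate : ∀ f x w → 2 ≤ x → PartitionContent (x ∷ w) → length (x ∷ w) ≤ f →
                   chargeW f (w ++ x ∷ []) ≡ suc (chargeW f (x ∷ w))
  chargeW-rotate (suc f) x w 2≤x pc le with maxW (x ∷ w) in maxeq | content-present pc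
  ... | zero | _ = ⊥-elim (<-irrefl (sym maxeq) (maxW-∷-pos pc))
  ... | suc k | present with lastSplit 1 w in spliteq | splitView 1 w
  ...   | nothing | none e = ⊥-elim (<-irrefl (sym (trans (count-∷ 1 x w) (cong₂ _+_ (δ-≢ (λ e → <-irrefl (sym e) 2≤x)) e)))
            (present 1 ≤-refl (s≤s (s≤s z≤n))))
  ...   | just (u , v) | _ = go (subword-rotate k 2 0 x u v)
    where
    x≢1 : x ≢ 1
    x≢1 e = <-irrefl (sym e) 2≤x
    max₂ : maxW (w ++ x ∷ []) ≡ suc k
    max₂ = trans (maxW-++ w (x ∷ [])) (trans (⊔-comm (maxW w) (x ⊔ 0)) (trans (cong (_⊔ maxW w) (⊔-identityʳ x)) maxeq))
    split₂ : lastSplit 1 (w ++ x ∷ []) ≡ just (u , v ++ x ∷ [])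
    split₂ = trans (lastSplit-++ 1 w (x ∷ [])) (cong₂ (joinSplit w (x ∷ [])) spliteq (lastSplit-≢ x≢1))
    res₂ : subword (maxW (w ++ x ∷ [])) 1 0 (w ++ x ∷ []) [] ≡ subword k 2 0 u (v ++ x ∷ [])
    res₂ = trans (cong (λ n → subword n 1 0 (w ++ x ∷ []) []) max₂)
      (trans (subword-left k 1 0 [] split₂) (cong (subword k 2 0 u) (++-identityʳ (v ++ x ∷ []))))
    split₁ : lastSplit 1 (x ∷ w) ≡ just (x ∷ u , v)
    split₁ = trans (lastSplit-++ 1 (x ∷ []) w) (cong (joinSplit (x ∷ []) w _) spliteq)
    res₁ : subword (suc k) 1 0 (x ∷ w) [] ≡ subword k 2 0 (x ∷ u) v
    res₁ = trans (subword-left k 1 0 [] split₁) (cong (subword k 2 0 (x ∷ u)) (++-identityʳ v))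
    rest≡ : rest pc ≡ proj₁ (subword k 2 0 (x ∷ u) v)
    rest≡ = trans (cong (λ n → proj₁ (subword n 1 0 (x ∷ w) [])) maxeq) (cong proj₁ res₁)
    total : ∀ p → subword k 2 0 u (v ++ x ∷ []) ≡ p → chargeW (suc f) (w ++ x ∷ []) ≡ proj₂ p + chargeW f (proj₁ p)
    total p e = cong (λ p → proj₂ p + chargeW f (proj₁ p)) (trans res₂ e)
    total₁ : ∀ p → subword k 2 0 (x ∷ u) v ≡ p →
      let q = subword k 2 0 (x ∷ u) (v ++ []) in proj₂ q + chargeW f (proj₁ q) ≡ proj₂ p + chargeW f (proj₁ p)
    total₁ p e = cong (λ p → proj₂ p + chargeW f (proj₁ p)) (trans (cong (subword k 2 0 (x ∷ u)) (++-identityʳ v)) e)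
    go : Rotated x (subword k 2 0 (x ∷ u) v) (subword k 2 0 u (v ++ x ∷ [])) →
      let q = subword k 2 0 (x ∷ u) (v ++ []) in
      chargeW (suc f) (w ++ x ∷ []) ≡ suc (proj₂ q + chargeW f (proj₁ q))
    go (moved w′ s e₁ e₂) = trans (total _ e₂) (cong suc (sym (total₁ _ e₁)))
    go (stay w′ s e₁ e₂) = trans (total _ e₂) (trans (cong (s +_)
        (chargeW-rotate f x w′ 2≤x (subst PartitionContent r≡ (rest-content pc))
           (subst (λ z → length z ≤ f) r≡ (rest-shorter pc le))))
        (trans (+-suc s _) (cong suc (sym (total₁ _ e₁)))))
      where
      r≡ : rest pc ≡ x ∷ w′
      r≡ = trans rest≡ (cong proj₁ e₁)

  mapSplit : Maybe (Word × Word) → Maybe (Word × Word)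
  mapSplit (just (u , v)) = just (map suc u , map suc v)
  mapSplit nothing = nothing

  lastSplit-shift : ∀ r w → lastSplit (suc r) (map suc w) ≡ mapSplit (lastSplit r w)
  lastSplit-shift r [] = refl
  lastSplit-shift r (x ∷ w) rewrite lastSplit-shift r w with lastSplit r w
  ... | just (u , v) = refl
  ... | nothing with x ≟ r | suc x ≟ suc r
  ...   | yes _ | yes _ = refl
  ...   | no _ | no _ = refl
  ...   | yes e | no ne = ⊥-elim (ne (cong suc e))
  ...   | no ne | yes e = ⊥-elim (ne (suc-injective e))

  lastSplit-ones : ∀ r n → 2 ≤ r → lastSplit r (replicate n 1) ≡ nothing
  lastSplit-ones r n 2≤r = lastSplit-none (replicate n 1) (ones n)
    where
    ones : ∀ n → All (_≢ r) (replicate n 1)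
    ones zero = []
    ones (suc n) = (λ e → <-irrefl e 2≤r) ∷ ones n

  shiftRes : ℕ → Word × ℕ → Word × ℕ
  shiftRes n (w , s) = map suc w ++ replicate n 1 , s

  subword-shift : ∀ k r i L R n → 1 ≤ r →
    subword k (suc r) i (map suc L) (map suc R ++ replicate n 1) ≡ shiftRes n (subword k r i L R)
  subword-shift zero r i L R n _ = cong (_, 0)
    (trans (sym (++-assoc (map suc L) (map suc R) _)) (cong (_++ replicate n 1) (sym (map-++ suc L R))))
  subword-shift (suc k) r i L R n 1≤r
    rewrite lastSplit-shift r L | lastSplit-++ (suc r) (map suc R) (replicate n 1)
          | lastSplit-shift r R | lastSplit-ones (suc r) n (s≤s 1≤r)
    with lastSplit r L
  ... | just (u , v) = cong (i +₂_) (trans (cong (subword k (suc (suc r)) i (map suc u))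
          (trans (sym (++-assoc (map suc v) (map suc R) _)) (cong (_++ replicate n 1) (sym (map-++ suc v R)))))
          (subword-shift k (suc r) i u (v ++ R) n (s≤s z≤n)))
  ... | nothing with lastSplit r R
  ...   | just (u , v) = cong (suc i +₂_) (trans (cong (λ z → subword k (suc (suc r)) (suc i) z (map suc v ++ replicate n 1)) (sym (map-++ suc L u)))
          (subword-shift k (suc r) (suc i) (L ++ u) v n (s≤s z≤n)))
  ...   | nothing = cong (_, 0)
    (trans (sym (++-assoc (map suc L) (map suc R) _)) (cong (_++ replicate n 1) (sym (map-++ suc L R))))

  subword-shift₀ : ∀ k r i L n → 1 ≤ r →
    subword k (suc r) i (map suc L ++ replicate n 1) [] ≡ shiftRes n (subword k r i L [])
  subword-shift₀ zero r i L n _ = cong (_, 0) (trans (++-identityʳ _)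
    (cong (λ z → map suc z ++ replicate n 1) (sym (++-identityʳ L))))
  subword-shift₀ (suc k) r i L n 1≤r
    rewrite lastSplit-++ (suc r) (map suc L) (replicate n 1)
          | lastSplit-shift r L | lastSplit-ones (suc r) n (s≤s 1≤r)
    with lastSplit r L
  ... | just (u , v) = cong (i +₂_) (trans (cong (subword k (suc (suc r)) i (map suc u))
          (trans (++-identityʳ _) (cong (λ z → map suc z ++ replicate n 1) (sym (++-identityʳ v)))))
          (subword-shift k (suc r) i u (v ++ []) n (s≤s z≤n)))
  ... | nothing = cong (_, 0) (trans (++-identityʳ _)
    (cong (λ z → map suc z ++ replicate n 1) (sym (++-identityʳ L))))

  maxW-shift : ∀ w n → maxW (map suc w ++ replicate (suc n) 1) ≡ suc (maxW w)
  maxW-shift [] zero = refl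
  maxW-shift [] (suc n) = cong (1 ⊔_) (maxW-shift [] n)
  maxW-shift (x ∷ w) n = cong (suc x ⊔_) (maxW-shift w n)

  replicate-snoc : ∀ n (x : ℕ) → replicate (suc n) x ≡ replicate n x ++ x ∷ []
  replicate-snoc zero x = refl
  replicate-snoc (suc n) x = cong (x ∷_) (replicate-snoc n x)

  rest-[]-count : ∀ {w} (pc : PartitionContent w) n → count 1 w ≤ suc n → count 1 (rest pc) ≤ n
  rest-[]-count {[]} pc n le = z≤n
  rest-[]-count {x ∷ w} pc n le = ≤-pred (subst (_≤ suc n)
    (trans (counts (rest-removed pc) 1) (cong (_+ count 1 (rest pc)) (inRange-in 1 (maxW (x ∷ w)) 1 ≤-refl (s≤s (maxW-∷-pos pc))))) le)

  -- Each extraction starts with the last of the final letters 1, so the raised letters are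
  -- afterwards chosen from the right end as in `w`. The bound on `count 1 w` provides one final 1
  -- for every extraction from `w`; surplus ones contribute 0.
  chargeW-shift : ∀ f w n → PartitionContent w → count 1 w ≤ n →
                  chargeW f (map suc w ++ replicate n 1) ≡ chargeW f w
  chargeW-shift zero w n pc le = refl
  chargeW-shift (suc f) [] zero pc le = refl
  chargeW-shift (suc f) (x ∷ w) zero pc le = ⊥-elim (<-irrefl refl
    (≤-trans (content-present pc 1 ≤-refl (s≤s (maxW-∷-pos pc))) le))
  chargeW-shift (suc f) w (suc n) pc le = trans (cong (λ p → proj₂ p + chargeW f (proj₁ p)) eq)
    (cong (proj₂ (subword (maxW w) 1 0 w []) +_) (chargeW-shift f (rest pc) n (rest-content pc) (rest-[]-count pc n le)))
    where
    W = map suc w ++ replicate (suc n) 1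
    split : lastSplit 1 W ≡ just (map suc w ++ replicate n 1 , [])
    split = trans (cong (lastSplit 1) (trans (cong (map suc w ++_) (replicate-snoc n 1))
      (sym (++-assoc (map suc w) (replicate n 1) (1 ∷ []))))) (lastSplit-end 1 (map suc w ++ replicate n 1))
    eq : subword (maxW W) 1 0 W [] ≡ shiftRes n (subword (maxW w) 1 0 w [])
    eq = trans (cong (λ k → subword k 1 0 W []) (maxW-shift w n))
      (trans (subword-left (maxW w) 1 0 [] split) (subword-shift₀ (maxW w) 1 0 w n ≤-refl))

  charge-knuth₁ : ∀ u v {x y z} → x ≤ y → y < z → charge (u ++ x ∷ z ∷ y ∷ v) ≡ charge (u ++ z ∷ x ∷ y ∷ v)
  charge-knuth₁ u v {x} {y} {z} p q = trans (charge≡chargeW (u ++ x ∷ z ∷ y ∷ v))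
    (trans (chargeW-knuth₁ (length (u ++ x ∷ z ∷ y ∷ v)) u v p q)
    (trans (cong (λ n → chargeW n (u ++ z ∷ x ∷ y ∷ v)) (trans (length-++ u) (sym (length-++ u))))
           (sym (charge≡chargeW (u ++ z ∷ x ∷ y ∷ v)))))

  charge-knuth₂ : ∀ u v {x y z} → x < y → y ≤ z → charge (u ++ y ∷ x ∷ z ∷ v) ≡ charge (u ++ y ∷ z ∷ x ∷ v)
  charge-knuth₂ u v {x} {y} {z} p q = trans (charge≡chargeW (u ++ y ∷ x ∷ z ∷ v))
    (trans (chargeW-knuth₂ (length (u ++ y ∷ x ∷ z ∷ v)) u v p q)
    (trans (cong (λ n → chargeW n (u ++ y ∷ z ∷ x ∷ v)) (trans (length-++ u) (sym (length-++ u))))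
           (sym (charge≡chargeW (u ++ y ∷ z ∷ x ∷ v)))))

  charge-rotate : ∀ x w → 2 ≤ x → PartitionContent (x ∷ w) → charge (w ++ x ∷ []) ≡ suc (charge (x ∷ w))
  charge-rotate x w 2≤x pc = trans (charge≡chargeW (w ++ x ∷ []))
    (trans (cong (λ n → chargeW n (w ++ x ∷ [])) (trans (length-++ w) (+-comm (length w) 1)))
    (trans (chargeW-rotate (length (x ∷ w)) x w 2≤x pc ≤-refl) (cong suc (sym (charge≡chargeW (x ∷ w))))))

  charge-shift : ∀ w n → PartitionContent w → count 1 w ≤ n → charge (map suc w ++ replicate n 1) ≡ charge w
  charge-shift w n pc le = trans (charge≡chargeW W) (trans (chargeW-shift (length W) w n pc le)
    (trans (chargeW-fuel (length W) (length w) w pc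
        (subst (length w ≤_) (sym (trans (length-++ (map suc w)) (cong (_+ length (replicate n 1)) (length-map suc w)))) (m≤m+n _ _)) ≤-refl)
      (sym (charge≡chargeW w))))
    where W = map suc w ++ replicate n 1

-- Normalisation of ring identities.

module RingNormalisation where
  open import Data.Bool using (Bool; true; false; not)
  open import Data.Bool.Properties as Bool using ()
  open import Data.Nat as ℕ using (ℕ)
  open import Data.Fin as Fin using (Fin)
  open import Data.List using (List; []; _∷_; _++_; map; concatMap)
  open import Data.List.Properties using (≡-dec)
  open import Data.Maybe using (Maybe; just; nothing)
  open import Data.Vec using (Vec; lookup)
  open import Relation.Nullary using (yes; no)
  open import Relation.Binary.PropositionalEquality as ≡ using (_≡_)

  -- A solver for identities valid in all rings, commutative or not: both sides are expanded into
  -- signed words in the atoms and opposite terms are cancelled.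
  infixl 6 _:+_ _:-_
  infixl 7 _:*_
  data Exp (n : ℕ) : Set where
    :0 :1 : Exp n
    var : Fin n → Exp n
    _:+_ _:*_ _:-_ : Exp n → Exp n → Exp n

  v0 : ∀ {n} → Exp (1 ℕ.+ n)
  v0 = var (Fin.# 0)
  v1 : ∀ {n} → Exp (2 ℕ.+ n)
  v1 = var (Fin.# 1)
  v2 : ∀ {n} → Exp (3 ℕ.+ n)
  v2 = var (Fin.# 2)
  v3 : ∀ {n} → Exp (4 ℕ.+ n)
  v3 = var (Fin.# 3)
  v4 : ∀ {n} → Exp (5 ℕ.+ n)
  v4 = var (Fin.# 4)
  v5 : ∀ {n} → Exp (6 ℕ.+ n)
  v5 = var (Fin.# 5)
  v6 : ∀ {n} → Exp (7 ℕ.+ n)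
  v6 = var (Fin.# 6)
  v7 : ∀ {n} → Exp (8 ℕ.+ n)
  v7 = var (Fin.# 7)
  v8 : ∀ {n} → Exp (9 ℕ.+ n)
  v8 = var (Fin.# 8)
  v9 : ∀ {n} → Exp (10 ℕ.+ n)
  v9 = var (Fin.# 9)
  v10 : ∀ {n} → Exp (11 ℕ.+ n)
  v10 = var (Fin.# 10)

  Term : ℕ → Set
  Term n = Bool × List (Fin n)

  negate : ∀ {n} → Term n → Term n
  negate (s , m) = not s , m

  mulTerm : ∀ {n} → Term n → Term n → Term n
  mulTerm (true , m) (s , m′) = s , m ++ m′
  mulTerm (false , m) (s , m′) = not s , m ++ m′

  expand : ∀ {n} → Exp n → List (Term n)
  expand :0 = []
  expand :1 = (true , []) ∷ []
  expand (var i) = (true , i ∷ []) ∷ []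
  expand (a :+ b) = expand a ++ expand b
  expand (a :- b) = expand a ++ map negate (expand b)
  expand (a :* b) = concatMap (λ x → map (mulTerm x) (expand b)) (expand a)

  removeTerm : ∀ {n} → Term n → List (Term n) → Maybe (List (Term n))
  removeTerm x [] = nothing
  removeTerm (s , m) ((s′ , m′) ∷ ts) with s Bool.≟ s′ | ≡-dec Fin._≟_ m m′
  ... | yes _ | yes _ = just ts
  ... | _ | _ with removeTerm (s , m) ts
  ...   | just ts′ = just ((s′ , m′) ∷ ts′)
  ...   | nothing = nothing

  cancel : ∀ {n} → List (Term n) → List (Term n)
  cancel [] = []
  cancel (x ∷ ts) with removeTerm (negate x) (cancel ts)
  ... | just ts′ = ts′
  ... | nothing = x ∷ cancel ts

  module RingSolver (𝓡 : Ring 0ℓ 0ℓ) where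
    open Ring 𝓡 renaming (Carrier to A)
    open RingProperties 𝓡
    open GroupProperties +-abelianGroup using (⁻¹-∙-comm; ⁻¹-involutive)
    open SetoidReasoning setoid

    module _ {n : ℕ} (ρ : Fin n → A) where
      ⟦_⟧ : Exp n → A
      ⟦ :0 ⟧ = 0#
      ⟦ :1 ⟧ = 1#
      ⟦ var i ⟧ = ρ i
      ⟦ a :+ b ⟧ = ⟦ a ⟧ + ⟦ b ⟧
      ⟦ a :- b ⟧ = ⟦ a ⟧ - ⟦ b ⟧
      ⟦ a :* b ⟧ = ⟦ a ⟧ * ⟦ b ⟧

      word : List (Fin n) → A
      word [] = 1#
      word (i ∷ m) = ρ i * word m

      term : Term n → A
      term (true , m) = word m
      term (false , m) = - word m

      terms : List (Term n) → A
      terms [] = 0#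
      terms (x ∷ ts) = term x + terms ts

      terms-++ : ∀ xs ys → terms (xs ++ ys) ≈ terms xs + terms ys
      terms-++ [] ys = sym (+-identityˡ _)
      terms-++ (x ∷ xs) ys = trans (+-congˡ (terms-++ xs ys)) (sym (+-assoc _ _ _))

      term-negate : ∀ x → term (negate x) ≈ - term x
      term-negate (true , m) = refl
      term-negate (false , m) = sym (⁻¹-involutive (word m))

      terms-negate : ∀ xs → terms (map negate xs) ≈ - terms xs
      terms-negate [] = sym -0#≈0#
      terms-negate (x ∷ xs) = trans (+-cong (term-negate x) (terms-negate xs)) (⁻¹-∙-comm _ _)

      word-++ : ∀ xs ys → word (xs ++ ys) ≈ word xs * word ys
      word-++ [] ys = sym (*-identityˡ _)
      word-++ (i ∷ xs) ys = trans (*-congˡ (word-++ xs ys)) (sym (*-assoc _ _ _))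

      term-mul : ∀ x y → term (mulTerm x y) ≈ term x * term y
      term-mul (true , m) (true , m′) = word-++ m m′
      term-mul (true , m) (false , m′) = trans (-‿cong (word-++ m m′)) (-‿distribʳ-* _ _)
      term-mul (false , m) (true , m′) = trans (-‿cong (word-++ m m′)) (-‿distribˡ-* _ _)
      term-mul (false , m) (false , m′) = begin
        word (m ++ m′)            ≈⟨ word-++ m m′ ⟩
        word m * word m′          ≈⟨ ⁻¹-involutive _ ⟨
        - - (word m * word m′)    ≈⟨ -‿cong (-‿distribʳ-* _ _) ⟩
        - (word m * - word m′)    ≈⟨ -‿distribˡ-* _ _ ⟩
        - word m * - word m′      ∎

      terms-mul₁ : ∀ x ys → terms (map (mulTerm x) ys) ≈ term x * terms ys
      terms-mul₁ x [] = sym (zeroʳ _)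
      terms-mul₁ x (y ∷ ys) = trans (+-cong (term-mul x y) (terms-mul₁ x ys)) (sym (distribˡ _ _ _))

      terms-mul : ∀ xs ys → terms (concatMap (λ x → map (mulTerm x) ys) xs) ≈ terms xs * terms ys
      terms-mul [] ys = sym (zeroˡ _)
      terms-mul (x ∷ xs) ys = trans (terms-++ (map (mulTerm x) ys) _)
        (trans (+-cong (terms-mul₁ x ys) (terms-mul xs ys)) (sym (distribʳ _ _ _)))

      expand-sound : ∀ e → terms (expand e) ≈ ⟦ e ⟧
      expand-sound :0 = refl
      expand-sound :1 = +-identityʳ _
      expand-sound (var i) = trans (+-identityʳ _) (*-identityʳ _)
      expand-sound (a :+ b) = trans (terms-++ (expand a) (expand b)) (+-cong (expand-sound a) (expand-sound b))
      expand-sound (a :- b) = trans (terms-++ (expand a) (map negate (expand b)))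
        (+-cong (expand-sound a) (trans (terms-negate (expand b)) (-‿cong (expand-sound b))))
      expand-sound (a :* b) = trans (terms-mul (expand a) (expand b)) (*-cong (expand-sound a) (expand-sound b))

      private
        swap+ : ∀ x y z → x + (y + z) ≈ y + (x + z)
        swap+ x y z = trans (sym (+-assoc x y z)) (trans (+-congʳ (+-comm x y)) (+-assoc y x z))

      removeTerm-sound : ∀ x ts {ts′} → removeTerm x ts ≡ just ts′ → terms ts ≈ term x + terms ts′
      removeTerm-sound (s , m) ((s′ , m′) ∷ ts) eq with s Bool.≟ s′ | ≡-dec Fin._≟_ m m′
      removeTerm-sound (s , m) ((s′ , m′) ∷ ts) ≡.refl | yes ≡.refl | yes ≡.refl = refl
      removeTerm-sound (s , m) ((s′ , m′) ∷ ts) eq | yes _ | no _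
        with removeTerm (s , m) ts in e | eq
      ... | just ts′ | ≡.refl = trans (+-congˡ (removeTerm-sound (s , m) ts e)) (swap+ _ _ _)
      removeTerm-sound (s , m) ((s′ , m′) ∷ ts) eq | no _ | _
        with removeTerm (s , m) ts in e | eq
      ... | just ts′ | ≡.refl = trans (+-congˡ (removeTerm-sound (s , m) ts e)) (swap+ _ _ _)

      cancel-sound : ∀ ts → terms ts ≈ terms (cancel ts)
      cancel-sound [] = refl
      cancel-sound (x ∷ ts) with removeTerm (negate x) (cancel ts) in e
      ... | nothing = +-congˡ (cancel-sound ts)
      ... | just ts′ = begin
        term x + terms ts                   ≈⟨ +-congˡ (cancel-sound ts) ⟩
        term x + terms (cancel ts)          ≈⟨ +-congˡ (removeTerm-sound (negate x) (cancel ts) e) ⟩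
        term x + (term (negate x) + terms ts′) ≈⟨ +-assoc _ _ _ ⟨
        term x + term (negate x) + terms ts′ ≈⟨ +-congʳ (+-congˡ (term-negate x)) ⟩
        term x + - term x + terms ts′       ≈⟨ +-congʳ (-‿inverseʳ _) ⟩
        0# + terms ts′                      ≈⟨ +-identityˡ _ ⟩
        terms ts′                           ∎

    -≈0⇒≈ : ∀ {x y} → x - y ≈ 0# → x ≈ y
    -≈0⇒≈ {x} {y} eq = begin
      x               ≈⟨ +-identityʳ x ⟨
      x + 0#          ≈⟨ +-congˡ (-‿inverseˡ y) ⟨
      x + (- y + y)   ≈⟨ +-assoc _ _ _ ⟨
      x - y + y       ≈⟨ +-congʳ eq ⟩
      0# + y          ≈⟨ +-identityˡ y ⟩
      y               ∎

    ≈⇒-≈0 : ∀ {x y} → x ≈ y → x - y ≈ 0#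
    ≈⇒-≈0 {x} {y} eq = trans (+-congʳ eq) (-‿inverseʳ y)

    -- The cancellation is computed from the syntax alone, so the hypothesis holds by reflexivity
    -- once all terms cancel.
    solve : ∀ {n} (ρ : Vec A n) (a b : Exp n) → cancel (expand (a :- b)) ≡ [] →
            ⟦ lookup ρ ⟧ a ≈ ⟦ lookup ρ ⟧ b
    solve ρ a b eq = -≈0⇒≈ (trans (sym (expand-sound (lookup ρ) (a :- b)))
      (trans (cancel-sound (lookup ρ) (expand (a :- b))) (reflexive (≡.cong (terms (lookup ρ)) eq))))

    -- Serves identities that hold modulo known relations: the solver proves the identity after a
    -- combination of differences of the two sides of these relations has been added, and the
    -- differences, being zero, are then dropped.
    drop0 : ∀ {x z} → z ≈ 0# → x + z ≈ x
    drop0 {x} eq = trans (+-congˡ eq) (+-identityʳ x)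

  insert : ∀ {n} → Fin n → List (Fin n) → List (Fin n)
  insert i [] = i ∷ []
  insert i (j ∷ m) with i Fin.≤? j
  ... | yes _ = i ∷ j ∷ m
  ... | no _ = j ∷ insert i m

  sort : ∀ {n} → List (Fin n) → List (Fin n)
  sort [] = []
  sort (i ∷ m) = insert i (sort m)

  sortTerm : ∀ {n} → Term n → Term n
  sortTerm (s , m) = s , sort m

  module CommutativeRingSolver (𝓡 : CommutativeRing 0ℓ 0ℓ) where
    open CommutativeRing 𝓡 renaming (Carrier to A)
    open RingSolver ring public hiding (solve)

    module _ {n : ℕ} (ρ : Fin n → A) where
      word-insert : ∀ i m → word ρ (insert i m) ≈ ρ i * word ρ m
      word-insert i [] = refl
      word-insert i (j ∷ m) with i Fin.≤? j
      ... | yes _ = refl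
      ... | no _ = trans (*-congˡ (word-insert i m)) (trans (sym (*-assoc _ _ _))
                     (trans (*-congʳ (*-comm (ρ j) (ρ i))) (*-assoc _ _ _)))

      word-sort : ∀ m → word ρ (sort m) ≈ word ρ m
      word-sort [] = refl
      word-sort (i ∷ m) = trans (word-insert i (sort m)) (*-congˡ (word-sort m))

      terms-sort : ∀ ts → terms ρ (map sortTerm ts) ≈ terms ρ ts
      terms-sort [] = refl
      terms-sort ((true , m) ∷ ts) = +-cong (word-sort m) (terms-sort ts)
      terms-sort ((false , m) ∷ ts) = +-cong (-‿cong (word-sort m)) (terms-sort ts)

    solve : ∀ {n} (ρ : Vec A n) (a b : Exp n) → cancel (map sortTerm (expand (a :- b))) ≡ [] →
            ⟦ lookup ρ ⟧ a ≈ ⟦ lookup ρ ⟧ b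
    solve ρ a b eq = -≈0⇒≈ (trans (sym (expand-sound (lookup ρ) (a :- b)))
      (trans (sym (terms-sort (lookup ρ) (expand (a :- b))))
      (trans (cancel-sound (lookup ρ) (map sortTerm (expand (a :- b)))) (reflexive (≡.cong (terms (lookup ρ)) eq)))))

-- Signs and convolution sums.

module Convolutions where
  open import Data.Nat as ℕ using (ℕ; zero; suc)
  open import Data.Vec using ([]; _∷_)
  open import Relation.Binary.PropositionalEquality as ≡ using (_≡_)
  open RingNormalisation

  module FiniteSums (𝓡 : Ring 0ℓ 0ℓ) where
    open Ring 𝓡 renaming (Carrier to A) hiding (zero)
    open RingSolver 𝓡
    open GroupProperties +-abelianGroup using (⁻¹-∙-comm; ⁻¹-involutive)
    open RingProperties 𝓡 using (-‿distribˡ-*; -‿distribʳ-*; -0#≈0#)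
    open SetoidReasoning setoid

    sgn : ℕ → A → A
    sgn zero x = x
    sgn (suc i) x = - sgn i x

    sgn-cong : ∀ i {x y} → x ≈ y → sgn i x ≈ sgn i y
    sgn-cong zero p = p
    sgn-cong (suc i) p = -‿cong (sgn-cong i p)

    sgn-0 : ∀ i → sgn i 0# ≈ 0#
    sgn-0 zero = refl
    sgn-0 (suc i) = trans (-‿cong (sgn-0 i)) -0#≈0#

    sgn-+ : ∀ i x y → sgn i (x + y) ≈ sgn i x + sgn i y
    sgn-+ zero x y = refl
    sgn-+ (suc i) x y = trans (-‿cong (sgn-+ i x y)) (sym (⁻¹-∙-comm _ _))

    sgn-*ˡ : ∀ i x y → sgn i (x * y) ≈ sgn i x * y
    sgn-*ˡ zero x y = refl
    sgn-*ˡ (suc i) x y = trans (-‿cong (sgn-*ˡ i x y)) (-‿distribˡ-* _ _)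

    sgn-*ʳ : ∀ i x y → sgn i (x * y) ≈ x * sgn i y
    sgn-*ʳ zero x y = refl
    sgn-*ʳ (suc i) x y = trans (-‿cong (sgn-*ʳ i x y)) (-‿distribʳ-* _ _)

    sgn-sgn : ∀ i j x → sgn i (sgn j x) ≈ sgn (i ℕ.+ j) x
    sgn-sgn zero j x = refl
    sgn-sgn (suc i) j x = -‿cong (sgn-sgn i j x)

    -- conv F s = Σ F i k over i + k = s
    conv : (ℕ → ℕ → A) → ℕ → A
    conv F zero = F 0 0
    conv F (suc s) = F 0 (suc s) + conv (λ i → F (suc i)) s

    conv-cong : ∀ {F G} s → (∀ i k → i ℕ.+ k ≡ s → F i k ≈ G i k) → conv F s ≈ conv G s
    conv-cong zero p = p 0 0 ≡.refl
    conv-cong (suc s) p = +-cong (p 0 (suc s) ≡.refl) (conv-cong s (λ i k e → p (suc i) k (≡.cong suc e)))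

    conv-0 : ∀ {F} s → (∀ i k → i ℕ.+ k ≡ s → F i k ≈ 0#) → conv F s ≈ 0#
    conv-0 zero p = p 0 0 ≡.refl
    conv-0 (suc s) p = trans (+-cong (p 0 (suc s) ≡.refl) (conv-0 s (λ i k e → p (suc i) k (≡.cong suc e)))) (+-identityʳ _)

    conv-+ : ∀ F G s → conv (λ i k → F i k + G i k) s ≈ conv F s + conv G s
    conv-+ F G zero = refl
    conv-+ F G (suc s) = trans (+-congˡ (conv-+ (λ i → F (suc i)) (λ i → G (suc i)) s))
      (solve (F 0 (suc s) ∷ G 0 (suc s) ∷ conv (λ i → F (suc i)) s ∷ conv (λ i → G (suc i)) s ∷ [])
        (v0 :+ v1 :+ (v2 :+ v3)) ((v0 :+ v2) :+ (v1 :+ v3)) ≡.refl)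

    conv-neg : ∀ F s → conv (λ i k → - F i k) s ≈ - conv F s
    conv-neg F zero = refl
    conv-neg F (suc s) = trans (+-congˡ (conv-neg (λ i → F (suc i)) s)) (⁻¹-∙-comm _ _)

    conv-*ˡ : ∀ x F s → conv (λ i k → x * F i k) s ≈ x * conv F s
    conv-*ˡ x F zero = refl
    conv-*ˡ x F (suc s) = trans (+-congˡ (conv-*ˡ x (λ i → F (suc i)) s)) (sym (distribˡ _ _ _))

    conv-*ʳ : ∀ F s x → conv F s * x ≈ conv (λ i k → F i k * x) s
    conv-*ʳ F zero x = refl
    conv-*ʳ F (suc s) x = trans (distribʳ _ _ _) (+-congˡ (conv-*ʳ (λ i → F (suc i)) s x))

    conv-sgn : ∀ j F s → conv (λ i k → sgn j (F i k)) s ≈ sgn j (conv F s)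
    conv-sgn zero F s = refl
    conv-sgn (suc j) F s = trans (conv-neg _ s) (-‿cong (conv-sgn j F s))

    conv-last : ∀ F s → conv F (suc s) ≈ conv (λ i k → F i (suc k)) s + F (suc s) 0
    conv-last F zero = refl
    conv-last F (suc s) = trans (+-congˡ (conv-last (λ i → F (suc i)) s)) (sym (+-assoc _ _ _))

    conv-flip : ∀ F s → conv F s ≈ conv (λ i k → F k i) s
    conv-flip F zero = refl
    conv-flip F (suc s) = begin
      F 0 (suc s) + conv (λ i → F (suc i)) s             ≈⟨ +-congˡ (conv-flip (λ i → F (suc i)) s) ⟩
      F 0 (suc s) + conv (λ i k → F (suc k) i) s         ≈⟨ +-comm _ _ ⟩
      conv (λ i k → F (suc k) i) s + F 0 (suc s)         ≈⟨ conv-last (λ i k → F k i) s ⟨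
      conv (λ i k → F k i) (suc s)                       ∎

    conv-assoc : ∀ (F : ℕ → ℕ → ℕ → A) s →
      conv (λ i k → conv (λ a b → F i a b) k) s ≈ conv (λ k b → conv (λ i a → F i a b) k) s
    conv-assoc F zero = refl
    conv-assoc F (suc s) = begin
      conv (F 0) (suc s) + conv (λ i k → conv (F (suc i)) k) s
        ≈⟨ +-congˡ (conv-assoc (λ i → F (suc i)) s) ⟩
      (F 0 0 (suc s) + conv (λ a b → F 0 (suc a) b) s) + conv (λ k b → conv (λ i a → F (suc i) a b) k) s
        ≈⟨ +-assoc _ _ _ ⟩
      F 0 0 (suc s) + (conv (λ a b → F 0 (suc a) b) s + conv (λ k b → conv (λ i a → F (suc i) a b) k) s)
        ≈⟨ +-congˡ (conv-+ (λ a b → F 0 (suc a) b) (λ k b → conv (λ i a → F (suc i) a b) k) s) ⟨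
      F 0 0 (suc s) + conv (λ k b → F 0 (suc k) b + conv (λ i a → F (suc i) a b) k) s ∎

-- The plactic ring.

module PlacticWords where
  open import Data.Nat as ℕ using (ℕ; _≤_; _<_)
  open import Data.List using ([]; _∷_; _++_)
  open import Data.List.Properties using (++-assoc; ++-identityʳ)
  open import Data.List.Relation.Unary.All as All using ([]; _∷_)
  open import Data.List.Relation.Unary.AllPairs using ([]; _∷_)
  open import Data.Vec using ([]; _∷_)
  open import Relation.Binary.PropositionalEquality as ≡ using (_≡_)
  open WordCharge using (Word)

  module PlacticRing (𝓚 : CommutativeRing 0ℓ 0ℓ) where
    private
      module K = CommutativeRing 𝓚
    open RingProperties K.ring using () renaming (-‿distribˡ-* to K-neg; -1*x≈-x to K-1*)

    record Invariant (f : Word → K.Carrier) : Set where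
      field
        knuth₁ : ∀ u v {x y z} → x ≤ y → y < z → f (u ++ x ∷ z ∷ y ∷ v) K.≈ f (u ++ z ∷ x ∷ y ∷ v)
        knuth₂ : ∀ u v {x y z} → x < y → y ≤ z → f (u ++ y ∷ x ∷ z ∷ v) K.≈ f (u ++ y ∷ z ∷ x ∷ v)
    open Invariant public

    -- A formal linear combination of words, given by the linear functional on functions of
    -- words that it defines; two of them are identified when they agree on all functions
    -- constant on plactic classes.
    record Elem : Set where
      no-eta-equality
      field
        ap : (Word → K.Carrier) → K.Carrier
        ap-cong : ∀ {f g} → (∀ w → f w K.≈ g w) → ap f K.≈ ap g
        ap-+ : ∀ f g → ap (λ w → f w K.+ g w) K.≈ ap f K.+ ap g
        ap-* : ∀ c f → ap (λ w → c K.* f w) K.≈ c K.* ap f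
    open Elem public

    infix 4 _≋_
    record _≋_ (X Y : Elem) : Set where
      constructor mk
      field
        at : ∀ f → Invariant f → ap X f K.≈ ap Y f
    open _≋_ public

    ap-0 : ∀ X → ap X (λ _ → K.0#) K.≈ K.0#
    ap-0 X = K.trans (ap-cong X (λ _ → K.sym (K.zeroˡ K.0#))) (K.trans (ap-* X K.0# (λ _ → K.0#)) (K.zeroˡ _))

    ap-neg : ∀ X f → ap X (λ w → K.- f w) K.≈ K.- ap X f
    ap-neg X f = K.trans (ap-cong X (λ w → K.sym (K-1* (f w)))) (K.trans (ap-* X (K.- K.1#) f) (K-1* _))

    private
      exchange : ∀ a b c d → (a K.+ b) K.+ (c K.+ d) K.≈ (a K.+ c) K.+ (b K.+ d)
      exchange a b c d = K.trans (K.+-assoc a b _) (K.trans (K.+-congˡ (K.trans (K.sym (K.+-assoc b c d))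
        (K.trans (K.+-congʳ (K.+-comm b c)) (K.+-assoc c b d)))) (K.sym (K.+-assoc a c _)))

    infixl 6 _⊞_
    infixl 7 _⊡_
    _⊞_ _⊡_ : Elem → Elem → Elem
    X ⊞ Y = record
      { ap = λ f → ap X f K.+ ap Y f
      ; ap-cong = λ e → K.+-cong (ap-cong X e) (ap-cong Y e)
      ; ap-+ = λ f g → K.trans (K.+-cong (ap-+ X f g) (ap-+ Y f g)) (exchange _ _ _ _)
      ; ap-* = λ c f → K.trans (K.+-cong (ap-* X c f) (ap-* Y c f)) (K.sym (K.distribˡ _ _ _)) }
    X ⊡ Y = record
      { ap = λ f → ap X (λ u → ap Y (λ v → f (u ++ v)))
      ; ap-cong = λ e → ap-cong X (λ u → ap-cong Y (λ v → e (u ++ v)))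
      ; ap-+ = λ f g → K.trans (ap-cong X (λ u → ap-+ Y (λ v → f (u ++ v)) (λ v → g (u ++ v)))) (ap-+ X _ _)
      ; ap-* = λ c f → K.trans (ap-cong X (λ u → ap-* Y c (λ v → f (u ++ v)))) (ap-* X c _) }

    neg : Elem → Elem
    neg X = record
      { ap = λ f → K.- ap X f
      ; ap-cong = λ e → K.-‿cong (ap-cong X e)
      ; ap-+ = λ f g → K.trans (K.-‿cong (ap-+ X f g)) (K.sym (⁻¹-∙-comm _ _))
      ; ap-* = λ c f → K.trans (K.-‿cong (ap-* X c f)) (-‿distribʳ-* _ _) }
      where
      open import Algebra.Properties.AbelianGroup K.+-abelianGroup using (⁻¹-∙-comm)
      open RingProperties K.ring using (-‿distribʳ-*)

    nil : Elem
    nil = record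
      { ap = λ f → K.0# ; ap-cong = λ _ → K.refl
      ; ap-+ = λ f g → K.sym (K.+-identityˡ _) ; ap-* = λ c f → K.sym (K.zeroʳ _) }

    wordElem : Word → Elem
    wordElem w = record
      { ap = λ f → f w ; ap-cong = λ e → e w ; ap-+ = λ f g → K.refl ; ap-* = λ c f → K.refl }

    letter : ℕ → Elem
    letter x = wordElem (x ∷ [])

    -- A fixed prefix keeps a function invariant, and so does the application of an element to the
    -- suffix; these two facts make multiplication respect `_≋_`.
    invariant-prefix : ∀ {f} → Invariant f → ∀ u → Invariant (λ v → f (u ++ v))
    invariant-prefix {f} inv u = record
      { knuth₁ = λ u′ v p q → ≡.subst₂ (λ a b → f a K.≈ f b) (++-assoc u u′ _) (++-assoc u u′ _) (knuth₁ inv (u ++ u′) v p q)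
      ; knuth₂ = λ u′ v p q → ≡.subst₂ (λ a b → f a K.≈ f b) (++-assoc u u′ _) (++-assoc u u′ _) (knuth₂ inv (u ++ u′) v p q) }

    invariant-suffix : ∀ {f} → Invariant f → ∀ Y → Invariant (λ u → ap Y (λ v → f (u ++ v)))
    invariant-suffix {f} inv Y = record
      { knuth₁ = λ u v {x} {y} {z} p q → ap-cong Y (λ w →
          ≡.subst₂ (λ a b → f a K.≈ f b) (≡.sym (++-assoc u (x ∷ z ∷ y ∷ v) w)) (≡.sym (++-assoc u (z ∷ x ∷ y ∷ v) w)) (knuth₁ inv u (v ++ w) p q))
      ; knuth₂ = λ u v {x} {y} {z} p q → ap-cong Y (λ w →
          ≡.subst₂ (λ a b → f a K.≈ f b) (≡.sym (++-assoc u (y ∷ x ∷ z ∷ v) w)) (≡.sym (++-assoc u (y ∷ z ∷ x ∷ v) w)) (knuth₂ inv u (v ++ w) p q)) }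

    𝒫 : Ring 0ℓ 0ℓ
    𝒫 = record
      { Carrier = Elem ; _≈_ = _≋_ ; _+_ = _⊞_ ; _*_ = _⊡_ ; -_ = neg ; 0# = nil ; 1# = wordElem []
      ; isRing = record
        { +-isAbelianGroup = record
          { isGroup = record
            { isMonoid = record
              { isSemigroup = record
                { isMagma = record
                  { isEquivalence = record
                    { refl = mk (λ f i → K.refl) ; sym = λ p → mk (λ f i → K.sym (at p f i))
                    ; trans = λ p q → mk (λ f i → K.trans (at p f i) (at q f i)) }
                  ; ∙-cong = λ p q → mk (λ f i → K.+-cong (at p f i) (at q f i)) }
                ; assoc = λ X Y Z → mk (λ f i → K.+-assoc _ _ _) }
              ; identity = (λ X → mk (λ f i → K.+-identityˡ _)) , (λ X → mk (λ f i → K.+-identityʳ _)) }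
            ; inverse = (λ X → mk (λ f i → K.-‿inverseˡ _)) , (λ X → mk (λ f i → K.-‿inverseʳ _))
            ; ⁻¹-cong = λ p → mk (λ f i → K.-‿cong (at p f i)) }
          ; comm = λ X Y → mk (λ f i → K.+-comm _ _) }
        ; *-cong = λ {X} {X′} {Y} {Y′} p q → mk (λ f i → K.trans
            (ap-cong X (λ u → at q (λ v → f (u ++ v)) (invariant-prefix i u)))
            (at p _ (invariant-suffix i Y′)))
        ; *-assoc = λ X Y Z → mk (λ f i → ap-cong X (λ u → ap-cong Y (λ v → ap-cong Z (λ w →
            K.reflexive (≡.cong f (++-assoc u v w))))))
        ; *-identity = (λ X → mk (λ f i → K.refl)) , (λ X → mk (λ f i → ap-cong X (λ u → K.reflexive (≡.cong f (++-identityʳ u)))))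
        ; distrib = (λ X Y Z → mk (λ f i → ap-+ X _ _)) , (λ X Y Z → mk (λ f i → K.refl)) } }

-- Noncommutative elementary and complete symmetric functions.

module ElementaryAndComplete where
  open import Data.Nat as ℕ using (ℕ; zero; suc; _≤_; _<_)
  open import Data.Fin using (zero; suc)
  open import Data.List using (List; []; _∷_; _++_)
  open import Data.List.Relation.Unary.All as All using (All; []; _∷_)
  open import Data.List.Relation.Unary.AllPairs using (AllPairs; []; _∷_)
  open import Data.Vec using (Vec; []; _∷_)
  open import Relation.Binary.PropositionalEquality as ≡ using (_≡_)
  open RingNormalisation
  open Convolutions

  module ColumnAlgebra (𝓡 : Ring 0ℓ 0ℓ) (letter : ℕ → Ring.Carrier 𝓡)
    (letters-knuth₁ : ∀ {x y z} → x ≤ y → y < z → Ring._≈_ 𝓡 (Ring._*_ 𝓡 (Ring._*_ 𝓡 (letter x) (letter z)) (letter y)) (Ring._*_ 𝓡 (Ring._*_ 𝓡 (letter z) (letter x)) (letter y)))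
    (letters-knuth₂ : ∀ {x y z} → x < y → y ≤ z → Ring._≈_ 𝓡 (Ring._*_ 𝓡 (Ring._*_ 𝓡 (letter y) (letter x)) (letter z)) (Ring._*_ 𝓡 (Ring._*_ 𝓡 (letter y) (letter z)) (letter x)))
    where
    open Ring 𝓡 renaming (Carrier to A₀) hiding (zero)
    open RingSolver 𝓡
    open FiniteSums 𝓡
    open SetoidReasoning setoid

    infix 9 _⁻
    _⁻ : (ℕ → A₀) → ℕ → A₀
    (f ⁻) zero = 0#
    (f ⁻) (suc j) = f j

    -- Alphabets are listed in increasing order. The head is therefore the last letter of a strictly
    -- decreasing word, and in `h` the first letter of a weakly increasing one.
    e : List ℕ → ℕ → A₀
    e [] zero = 1#
    e [] (suc j) = 0#
    e (b ∷ B) j = e B j + (e B ⁻) j * letter b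

    h : List ℕ → ℕ → A₀
    h [] zero = 1#
    h [] (suc j) = 0#
    h (b ∷ B) zero = 1#
    h (b ∷ B) (suc j) = h B (suc j) + letter b * h (b ∷ B) j

    e-zero : ∀ B → e B 0 ≈ 1#
    e-zero [] = refl
    e-zero (b ∷ B) = trans (+-cong (e-zero B) (zeroˡ _)) (+-identityʳ _)

    e-one : ∀ b B → e (b ∷ B) 1 ≈ e B 1 + letter b
    e-one b B = +-congˡ (trans (*-congʳ (e-zero B)) (*-identityˡ _))

    *0 : ∀ x {z} → z ≈ 0# → x * z ≈ 0#
    *0 x p = trans (*-congˡ p) (zeroʳ x)

    0* : ∀ x {z} → z ≈ 0# → z * x ≈ 0#
    0* x p = trans (*-congʳ p) (zeroˡ x)

    0+0 : ∀ {x y} → x ≈ 0# → y ≈ 0# → x + y ≈ 0#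
    0+0 p q = trans (+-cong p q) (+-identityʳ 0#)

    0-0 : ∀ {x y} → x ≈ 0# → y ≈ 0# → x - y ≈ 0#
    0-0 p q = trans (+-cong p (-‿cong q)) (trans (+-identityˡ _) (trans (sym (+-identityʳ _)) (-‿inverseˡ 0#)))

    module _ {a b : ℕ} (a<b : a < b) where
      private A = letter a ; β = letter b

      -- Letter by letter this is a c b = c a b for a < b < c; in `bae₁` it is b a c = b c a.
      ae₁b : ∀ B → All (b <_) B → A * e B 1 * β ≈ e B 1 * A * β
      ae₁b [] [] = solve (A ∷ β ∷ []) (v0 :* :0 :* v1) (:0 :* v0 :* v1) ≡.refl
      ae₁b (c ∷ C) (b<c ∷ b<C) = begin
        A * e (c ∷ C) 1 * β              ≈⟨ *-congʳ (*-congˡ (e-one c C)) ⟩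
        A * (e C 1 + letter c) * β       ≈⟨ solve (A ∷ β ∷ e C 1 ∷ letter c ∷ []) (v0 :* (v2 :+ v3) :* v1) (v0 :* v2 :* v1 :+ v0 :* v3 :* v1) ≡.refl ⟩
        A * e C 1 * β + A * letter c * β ≈⟨ +-cong (ae₁b C b<C) (letters-knuth₁ (ℕ.<⇒≤ a<b) b<c) ⟩
        e C 1 * A * β + letter c * A * β ≈⟨ solve (A ∷ β ∷ e C 1 ∷ letter c ∷ []) (v2 :* v0 :* v1 :+ v3 :* v0 :* v1) ((v2 :+ v3) :* v0 :* v1) ≡.refl ⟩
        (e C 1 + letter c) * A * β       ≈⟨ *-congʳ (*-congʳ (e-one c C)) ⟨
        e (c ∷ C) 1 * A * β              ∎

      bae₁ : ∀ B → All (b <_) B → β * A * e B 1 ≈ β * e B 1 * A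
      bae₁ [] [] = solve (A ∷ β ∷ []) (v1 :* v0 :* :0) (v1 :* :0 :* v0) ≡.refl
      bae₁ (c ∷ C) (b<c ∷ b<C) = begin
        β * A * e (c ∷ C) 1              ≈⟨ *-congˡ (e-one c C) ⟩
        β * A * (e C 1 + letter c)       ≈⟨ distribˡ _ _ _ ⟩
        β * A * e C 1 + β * A * letter c ≈⟨ +-cong (bae₁ C b<C) (letters-knuth₂ a<b (ℕ.<⇒≤ b<c)) ⟩
        β * e C 1 * A + β * letter c * A ≈⟨ solve (A ∷ β ∷ e C 1 ∷ letter c ∷ []) (v1 :* v2 :* v0 :+ v1 :* v3 :* v0) (v1 :* (v2 :+ v3) :* v0) ≡.refl ⟩
        β * (e C 1 + letter c) * A       ≈⟨ *-congʳ (*-congˡ (e-one c C)) ⟨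
        β * e (c ∷ C) 1 * A              ∎

    ae₁a : ∀ {a} B → All (a <_) B → letter a * e B 1 * letter a ≈ e B 1 * letter a * letter a
    ae₁a {a} [] [] = solve (letter a ∷ []) (v0 :* :0 :* v0) (:0 :* v0 :* v0) ≡.refl
    ae₁a {a} (c ∷ C) (a<c ∷ a<C) = begin
      A * e (c ∷ C) 1 * A              ≈⟨ *-congʳ (*-congˡ (e-one c C)) ⟩
      A * (e C 1 + letter c) * A       ≈⟨ solve (A ∷ e C 1 ∷ letter c ∷ []) (v0 :* (v1 :+ v2) :* v0) (v0 :* v1 :* v0 :+ v0 :* v2 :* v0) ≡.refl ⟩
      A * e C 1 * A + A * letter c * A ≈⟨ +-cong (ae₁a C a<C) (letters-knuth₁ ℕ.≤-refl a<c) ⟩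
      e C 1 * A * A + letter c * A * A ≈⟨ solve (A ∷ e C 1 ∷ letter c ∷ []) (v1 :* v0 :* v0 :+ v2 :* v0 :* v0) ((v1 :+ v2) :* v0 :* v0) ≡.refl ⟩
      (e C 1 + letter c) * A * A       ≈⟨ *-congʳ (*-congʳ (e-one c C)) ⟨
      e (c ∷ C) 1 * A * A              ∎
      where A = letter a

    Increasing : List ℕ → Set
    Increasing = AllPairs _<_

    e⁻-∷ : ∀ b B j → (e (b ∷ B) ⁻) j ≈ (e B ⁻) j + ((e B ⁻) ⁻) j * letter b
    e⁻-∷ b B zero = sym (trans (+-identityˡ _) (zeroˡ _))
    e⁻-∷ b B (suc j) = refl

    d₁ : ℕ → List ℕ → A₀
    d₁ a B = letter a * e B 1 - e B 1 * letter a

    -- The commutator with e_1 is the only correction. When the least letter b is split off, the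
    -- defect is a combination of the two inductive instances and of a e_1 b = e_1 a b, b a e_1 = b
    -- e_1 a and b a b = b b a.
    a-past-e : ∀ {a} B j → All (a <_) B → Increasing B →
               letter a * e B j ≈ e B j * letter a + (e B ⁻) j * d₁ a B
    a-past-e⁻ : ∀ {a} B j → All (a <_) B → Increasing B →
               letter a * (e B ⁻) j ≈ (e B ⁻) j * letter a + ((e B ⁻) ⁻) j * d₁ a B
    a-past-e⁻ {a} B zero _ _ = solve (letter a ∷ d₁ a B ∷ []) (v0 :* :0) (:0 :* v0 :+ :0 :* v1) ≡.refl
    a-past-e⁻ B (suc j) a<B inc = a-past-e B j a<B inc
    a-past-e {a} [] zero _ _ = solve (letter a ∷ d₁ a [] ∷ []) (v0 :* :1) (:1 :* v0 :+ :0 :* v1) ≡.refl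
    a-past-e {a} [] (suc j) _ _ = solve (letter a ∷ e [] j ∷ []) (v0 :* :0) (:0 :* v0 :+ v1 :* (v0 :* :0 :- :0 :* v0)) ≡.refl
    a-past-e {a} (b ∷ B) j (a<b ∷ a<B) (b<B ∷ inc) = begin
      A * (E + F * β)
        ≈⟨ solve ρ (v0 :* (v1 :+ v2 :* v3)) (rhs :+ ((v0 :* v1 :- (v1 :* v0 :+ v2 :* δ)) :+ (v0 :* v2 :- (v2 :* v0 :+ v4 :* δ)) :* v3
              :+ v4 :* ((v0 :* v5 :* v3 :- v5 :* v0 :* v3) :- (v3 :* v0 :* v5 :- v3 :* v5 :* v0) :- (v3 :* v0 :* v3 :- v3 :* v3 :* v0)))) ≡.refl ⟩
      _ ≈⟨ drop0 (0+0 (0+0 (≈⇒-≈0 (a-past-e B j a<B inc)) (0* _ (≈⇒-≈0 (a-past-e⁻ B j a<B inc))))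
             (*0 _ (0-0 (0-0 (≈⇒-≈0 (ae₁b a<b B b<B)) (≈⇒-≈0 (bae₁ a<b B b<B))) (≈⇒-≈0 (letters-knuth₂ a<b ℕ.≤-refl))))) ⟩
      (E + F * β) * A + (F + G * β) * (A * (E₁ + β) - (E₁ + β) * A)
        ≈⟨ +-congˡ (*-cong (e⁻-∷ b B j) (+-cong (*-congˡ (e-one b B)) (-‿cong (*-congʳ (e-one b B))))) ⟨
      (E + F * β) * A + (e (b ∷ B) ⁻) j * d₁ a (b ∷ B) ∎
      where
      A = letter a ; β = letter b ; E = e B j ; F = (e B ⁻) j ; G = ((e B ⁻) ⁻) j ; E₁ = e B 1
      ρ : Vec A₀ 6
      ρ = A ∷ E ∷ F ∷ β ∷ G ∷ E₁ ∷ []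
      δ : Exp 6
      δ = v0 :* v5 :- v5 :* v0
      rhs : Exp 6
      rhs = (v1 :+ v2 :* v3) :* v0 :+ (v2 :+ v4 :* v3) :* (v0 :* (v5 :+ v3) :- (v5 :+ v3) :* v0)

    d₁a : ∀ {a} B → All (a <_) B → d₁ a B * letter a ≈ 0#
    d₁a {a} B a<B = trans (solve (letter a ∷ e B 1 ∷ []) ((v0 :* v1 :- v1 :* v0) :* v0) (v0 :* v1 :* v0 :- v1 :* v0 :* v0) ≡.refl)
      (≈⇒-≈0 (ae₁a B a<B))

    aea : ∀ {a} B j → All (a <_) B → Increasing B → letter a * e B j * letter a ≈ e B j * letter a * letter a
    aea {a} B j a<B inc = begin
      A * e B j * A ≈⟨ *-congʳ (a-past-e B j a<B inc) ⟩
      (e B j * A + (e B ⁻) j * d₁ a B) * A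
        ≈⟨ solve (A ∷ e B j ∷ (e B ⁻) j ∷ d₁ a B ∷ []) ((v1 :* v0 :+ v2 :* v3) :* v0) (v1 :* v0 :* v0 :+ v2 :* (v3 :* v0)) ≡.refl ⟩
      e B j * A * A + (e B ⁻) j * (d₁ a B * A) ≈⟨ drop0 (*0 _ (d₁a B a<B)) ⟩
      e B j * A * A ∎
      where A = letter a

    aea⁻ : ∀ {a} B j → All (a <_) B → Increasing B → letter a * (e B ⁻) j * letter a ≈ (e B ⁻) j * letter a * letter a
    aea⁻ {a} B zero _ _ = solve (letter a ∷ []) (v0 :* :0 :* v0) (:0 :* v0 :* v0) ≡.refl
    aea⁻ B (suc j) = aea B j

    pred-comm : ∀ {f g : ℕ → A₀} → (∀ i j → f i * g j ≈ g j * f i) → ∀ i j → (f ⁻) i * g j ≈ g j * (f ⁻) i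
    pred-comm {g = g} c zero j = trans (zeroˡ _) (sym (zeroʳ _))
    pred-comm c (suc i) j = c i j

    -- Moving the least letter to the right by `a-past-e` brings both products to a normal form,
    -- which is symmetric in i and j as soon as the sums over the larger letters commute.
    e-comm : ∀ B → Increasing B → ∀ i j → e B i * e B j ≈ e B j * e B i
    e-comm [] _ zero j = trans (*-identityˡ _) (sym (*-identityʳ _))
    e-comm [] _ (suc i) j = trans (zeroˡ _) (sym (zeroʳ _))
    e-comm (b ∷ B) (b<B ∷ inc) i j = trans (norm i j) (trans mid (sym (norm j i)))
      where
      β = letter b
      D = d₁ b B
      E = e B
      F = e B ⁻
      comm = e-comm B inc
      commFE = pred-comm {E} {E} comm
      commFF : ∀ i j → F i * F j ≈ F j * F i
      commFF = pred-comm {E} {F} (λ i j → sym (pred-comm {E} {E} comm j i))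
      norm : ∀ i j → (E i + F i * β) * (E j + F j * β) ≈
        E i * E j + (E i * F j + F i * E j) * β + F i * F j * (D + β * β)
      norm i j = begin
        (E i + F i * β) * (E j + F j * β)
          ≈⟨ solve (β ∷ D ∷ E i ∷ F i ∷ E j ∷ F j ∷ []) ((v2 :+ v3 :* v0) :* (v4 :+ v5 :* v0))
               ((v2 :* v4 :+ (v2 :* v5 :+ v3 :* v4) :* v0 :+ v3 :* v5 :* (v1 :+ v0 :* v0)) :+
                (v3 :* (v0 :* v4 :- (v4 :* v0 :+ v5 :* v1)) :+ v3 :* (v0 :* v5 :* v0 :- v5 :* v0 :* v0))) ≡.refl ⟩
        _ ≈⟨ drop0 (0+0 (*0 _ (≈⇒-≈0 (a-past-e B j b<B inc))) (*0 _ (≈⇒-≈0 (aea⁻ B j b<B inc)))) ⟩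
        E i * E j + (E i * F j + F i * E j) * β + F i * F j * (D + β * β) ∎
      mid : E i * E j + (E i * F j + F i * E j) * β + F i * F j * (D + β * β) ≈
            E j * E i + (E j * F i + F j * E i) * β + F j * F i * (D + β * β)
      mid = +-cong (+-cong (comm i j) (*-congʳ (trans (+-cong (sym (commFE j i)) (commFE i j)) (+-comm _ _)))) (*-congʳ (commFF i j))

    h-∷ : ∀ b B k → h (b ∷ B) k ≈ h B k + ((λ k → letter b * h (b ∷ B) k) ⁻) k
    h-∷ b [] zero = sym (+-identityʳ _)
    h-∷ b (c ∷ B) zero = sym (+-identityʳ _)
    h-∷ b B (suc k) = refl

    -- The new letter b adds e_i b h_(k-1) and e_(i-1) b h_k, with e over the old and h over the new
    -- alphabet. Under alternating signs these two families cancel.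
    e-h-∷ : ∀ b B s → conv (λ i k → sgn i (e (b ∷ B) i * h (b ∷ B) k)) s ≈ conv (λ i k → sgn i (e B i * h B k)) s
    e-h-∷ b B s = begin
      conv (λ i k → sgn i (e (b ∷ B) i * h (b ∷ B) k)) s
        ≈⟨ conv-cong s (λ i k _ → trans (sgn-cong i (trans (*-congʳ refl) (step i k)))
             (trans (sgn-+ i _ _) (+-congʳ (sgn-+ i _ _)))) ⟩
      conv (λ i k → sgn i (e B i * h B k) + sgn i (e B i * (G ⁻) k) + sgn i ((e B ⁻) i * G k)) s
        ≈⟨ trans (conv-+ _ (λ i k → sgn i ((e B ⁻) i * G k)) s) (+-congʳ (conv-+ _ (λ i k → sgn i (e B i * (G ⁻) k)) s)) ⟩
      conv (λ i k → sgn i (e B i * h B k)) s + conv (λ i k → sgn i (e B i * (G ⁻) k)) s + conv (λ i k → sgn i ((e B ⁻) i * G k)) s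
        ≈⟨ trans (+-assoc _ _ _) (drop0 (opposite s)) ⟩
      conv (λ i k → sgn i (e B i * h B k)) s ∎
      where
      G : ℕ → A₀
      G k = letter b * h (b ∷ B) k
      step : ∀ i k → e (b ∷ B) i * h (b ∷ B) k ≈ e B i * h B k + e B i * (G ⁻) k + (e B ⁻) i * G k
      step i k = begin
        (e B i + (e B ⁻) i * letter b) * h (b ∷ B) k ≈⟨ distribʳ _ _ _ ⟩
        e B i * h (b ∷ B) k + (e B ⁻) i * letter b * h (b ∷ B) k
          ≈⟨ +-cong (trans (*-congˡ (h-∷ b B k)) (distribˡ _ _ _)) (*-assoc _ _ _) ⟩
        e B i * h B k + e B i * (G ⁻) k + (e B ⁻) i * G k ∎
      opposite : ∀ s → conv (λ i k → sgn i (e B i * (G ⁻) k)) s + conv (λ i k → sgn i ((e B ⁻) i * G k)) s ≈ 0#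
      opposite zero = 0+0 (zeroʳ _) (zeroˡ _)
      opposite (suc s) = begin
        conv (λ i k → sgn i (e B i * (G ⁻) k)) (suc s) + (0# * G (suc s) + conv (λ i k → - sgn i (e B i * G k)) s)
          ≈⟨ +-cong (trans (conv-last (λ i k → sgn i (e B i * (G ⁻) k)) s) (drop0 (trans (sgn-cong (suc s) (zeroʳ _)) (sgn-0 (suc s)))))
               (trans (+-cong (zeroˡ _) (conv-neg _ s)) (+-identityˡ _)) ⟩
        conv (λ i k → sgn i (e B i * G k)) s - conv (λ i k → sgn i (e B i * G k)) s ≈⟨ -‿inverseʳ _ ⟩
        0# ∎

    e-h : ∀ B s → conv (λ i k → sgn i (e B i * h B k)) (suc s) ≈ 0#
    e-h [] s = conv-0 {λ i k → sgn i (e [] i * h [] k)} (suc s) λ { zero zero () ; zero (suc k) _ → zeroʳ _ ; (suc i) k _ → trans (sgn-cong (suc i) (zeroˡ _)) (sgn-0 (suc i)) }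
    e-h (b ∷ B) s = trans (e-h-∷ b B (suc s)) (e-h B s)

    e* h* : List ℕ → List ℕ → A₀
    e* B [] = 1#
    e* B (j ∷ α) = e B j * e* B α
    h* B [] = 1#
    h* B (j ∷ α) = h B j * h* B α

    e*-comm : ∀ B → Increasing B → ∀ α j → e* B α * e B j ≈ e B j * e* B α
    e*-comm B inc [] j = trans (*-identityˡ _) (sym (*-identityʳ _))
    e*-comm B inc (i ∷ α) j = begin
      e B i * e* B α * e B j   ≈⟨ *-assoc _ _ _ ⟩
      e B i * (e* B α * e B j) ≈⟨ *-congˡ (e*-comm B inc α j) ⟩
      e B i * (e B j * e* B α) ≈⟨ *-assoc _ _ _ ⟨
      e B i * e B j * e* B α   ≈⟨ *-congʳ (e-comm B inc i j) ⟩
      e B j * e B i * e* B α   ≈⟨ *-assoc _ _ _ ⟩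
      e B j * (e B i * e* B α) ∎

    e*-snoc : ∀ B α j → e* B (α ++ j ∷ []) ≈ e* B α * e B j
    e*-snoc B [] j = trans (*-identityʳ _) (sym (*-identityˡ _))
    e*-snoc B (i ∷ α) j = trans (*-congˡ (e*-snoc B α j)) (sym (*-assoc _ _ _))

    -- Σ (−1)^i e_i h_{n−i} = 0, solved for h_n
    h-expand : ∀ B n → h B (suc n) ≈ conv (λ i k → sgn i (e B (suc i) * h B k)) n
    h-expand B n = -≈0⇒≈ (begin
      h B (suc n) - conv (λ i k → sgn i (e B (suc i) * h B k)) n
        ≈⟨ +-cong (trans (sym (*-identityˡ _)) (*-congʳ (sym (e-zero B)))) (sym (conv-neg _ n)) ⟩
      conv (λ i k → sgn i (e B i * h B k)) (suc n) ≈⟨ e-h B n ⟩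
      0# ∎)

    h-zero : ∀ B → h B 0 ≈ 1#
    h-zero [] = refl
    h-zero (b ∷ B) = refl

    -- The index of the first h drops, so that repeated use leaves products of e alone.
    h*-expand : ∀ B β n α → e* B β * h* B (suc n ∷ α) ≈ conv (λ i k → sgn i (e* B (β ++ suc i ∷ []) * h* B (k ∷ α))) n
    h*-expand B β n α = begin
      e* B β * (h B (suc n) * h* B α) ≈⟨ trans (sym (*-assoc _ _ _)) (*-congʳ (*-congˡ (h-expand B n))) ⟩
      e* B β * conv (λ i k → sgn i (e B (suc i) * h B k)) n * h* B α
        ≈⟨ *-congʳ (trans (sym (conv-*ˡ (e* B β) _ n)) (conv-cong n (λ i k _ → sym (sgn-*ʳ i _ _)))) ⟩
      conv (λ i k → sgn i (e* B β * (e B (suc i) * h B k))) n * h* B α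
        ≈⟨ conv-*ʳ _ n (h* B α) ⟩
      conv (λ i k → sgn i (e* B β * (e B (suc i) * h B k)) * h* B α) n
        ≈⟨ conv-cong n (λ i k _ → trans (sym (sgn-*ˡ i _ _)) (sgn-cong i (trans (*-congʳ (trans (sym (*-assoc _ _ _)) (*-congʳ (sym (e*-snoc B β (suc i)))))) (*-assoc _ _ _)))) ⟩
      conv (λ i k → sgn i (e* B (β ++ suc i ∷ []) * h* B (k ∷ α))) n ∎

    e-h* : ∀ B α s → conv (λ i k → sgn i (e* B (i ∷ []) * h* B (k ∷ α))) (suc s) ≈ 0#
    e-h* B α s = begin
      conv (λ i k → sgn i (e* B (i ∷ []) * h* B (k ∷ α))) (suc s)
        ≈⟨ conv-cong {λ i k → sgn i (e* B (i ∷ []) * h* B (k ∷ α))} {λ i k → sgn i (e B i * h B k) * h* B α} (suc s)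
             (λ i k _ → trans (sgn-cong i (trans (*-congʳ (*-identityʳ (e B i))) (sym (*-assoc (e B i) (h B k) (h* B α))))) (sgn-*ˡ i (e B i * h B k) (h* B α))) ⟩
      conv (λ i k → sgn i (e B i * h B k) * h* B α) (suc s) ≈⟨ conv-*ʳ (λ i k → sgn i (e B i * h B k)) (suc s) (h* B α) ⟨
      conv (λ i k → sgn i (e B i * h B k)) (suc s) * h* B α ≈⟨ 0* _ (e-h B s) ⟩
      0# ∎

    module SmallestLetter (a : ℕ) (B : List ℕ) (a<B : All (a <_) B) (inc : Increasing B) where
      private A = letter a

      ẽ : ℕ → A₀
      ẽ = e B

      d : ℕ → A₀
      d zero = A
      d (suc k) = d k * ẽ 1 - ẽ 1 * d k

      -- The commutator with `ẽ 1` is a derivation that kills every `ẽ j` and sends `d k` to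
      -- `d (suc k)`; applied to one instance of the relation it gives the next.
      d-past-ẽ : ∀ k j → d k * ẽ j ≈ ẽ j * d k + (ẽ ⁻) j * d (suc k)
      d-past-ẽ zero j = a-past-e B j a<B inc
      d-past-ẽ (suc k) j = begin
        (d k * ẽ 1 - ẽ 1 * d k) * ẽ j
          ≈⟨ solve (d k ∷ d (suc k) ∷ ẽ 1 ∷ ẽ j ∷ (ẽ ⁻) j ∷ []) ((v0 :* v2 :- v2 :* v0) :* v3)
               ((v3 :* (v0 :* v2 :- v2 :* v0) :+ v4 :* (v1 :* v2 :- v2 :* v1)) :+
                ((v0 :* v3 :- (v3 :* v0 :+ v4 :* v1)) :* v2 :- v2 :* (v0 :* v3 :- (v3 :* v0 :+ v4 :* v1))
                 :+ v0 :* (v2 :* v3 :- v3 :* v2) :- (v2 :* v3 :- v3 :* v2) :* v0 :- (v2 :* v4 :- v4 :* v2) :* v1)) ≡.refl ⟩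
        _ ≈⟨ drop0 (0-0 (0-0 (0+0 (0-0 (0* _ IH) (*0 _ IH)) (*0 _ c₁)) (0* _ c₁)) (0* _ c₂)) ⟩
        ẽ j * d (suc k) + (ẽ ⁻) j * d (suc (suc k)) ∎
        where
        IH = ≈⇒-≈0 (d-past-ẽ k j)
        c₁ = ≈⇒-≈0 (e-comm B inc 1 j)
        c₂ = ≈⇒-≈0 (sym (pred-comm {ẽ} {ẽ} (e-comm B inc) j 1))

      d-past-ẽ⁻ : ∀ k j → d k * (ẽ ⁻) j ≈ (ẽ ⁻) j * d k + ((ẽ ⁻) ⁻) j * d (suc k)
      d-past-ẽ⁻ k zero = solve (d k ∷ d (suc k) ∷ []) (v0 :* :0) (:0 :* v0 :+ :0 :* v1) ≡.refl
      d-past-ẽ⁻ k (suc j) = d-past-ẽ k j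

      private
        d-past-ẽ₁ : ∀ k → d k * ẽ 1 ≈ ẽ 1 * d k + d (suc k)
        d-past-ẽ₁ k = solve (d k ∷ ẽ 1 ∷ []) (v0 :* v1) (v1 :* v0 :+ (v0 :* v1 :- v1 :* v0)) ≡.refl

        dd : ∀ k i → d (suc k) * d i * ẽ 1 ≈
             ẽ 1 * (d (suc k) * d i) + (d (suc (suc k)) * d i + d (suc k) * d (suc i))
        dd k i = begin
          d (suc k) * d i * ẽ 1
            ≈⟨ solve (d (suc k) ∷ d i ∷ ẽ 1 ∷ d (suc (suc k)) ∷ d (suc i) ∷ []) (v0 :* v1 :* v2)
                 ((v2 :* (v0 :* v1) :+ (v3 :* v1 :+ v0 :* v4)) :+
                  (v0 :* (v1 :* v2 :- (v2 :* v1 :+ v4)) :+ (v0 :* v2 :- (v2 :* v0 :+ v3)) :* v1)) ≡.refl ⟩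
          _ ≈⟨ drop0 (0+0 (*0 _ (≈⇒-≈0 (d-past-ẽ₁ i))) (0* _ (≈⇒-≈0 (d-past-ẽ₁ (suc k))))) ⟩
          _ ∎

      -- The same derivation, applied to the hypothesis.
      d-next : ∀ k → d (suc k) * d k ≈ 0# → d (suc k) * d (suc k) + d (suc (suc k)) * d k ≈ 0#
      d-next k eq = begin
        d (suc k) * d (suc k) + d (suc (suc k)) * d k
          ≈⟨ solve (d (suc k) ∷ d k ∷ ẽ 1 ∷ d (suc (suc k)) ∷ []) (v0 :* v0 :+ v3 :* v1)
               (:0 :+ (v0 :* v1 :* v2 :- v2 :* (v0 :* v1) :- (v0 :* v1 :* v2 :- (v2 :* (v0 :* v1) :+ (v3 :* v1 :+ v0 :* v0))))) ≡.refl ⟩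
        _ ≈⟨ drop0 (0-0 (0-0 (0* _ eq) (*0 _ eq)) (≈⇒-≈0 (dd k k))) ⟩
        0# ∎

      -- The derivation alone does not lead from one vanishing product to the next. Moving `ẽ 2`
      -- through d_(k+1) d_k = 0 does: it produces ẽ_1 times the relation `d-next`, and d_(k+2)
      -- d_(k+1).
      d-diag : ∀ k → d (suc k) * d k ≈ 0#
      d-diag zero = d₁a B a<B
      d-diag (suc k) = begin
        d₂ * d₁′
          ≈⟨ solve (d₂ ∷ d₁′ ∷ d₀ ∷ ẽ 2 ∷ ẽ 1 ∷ []) (v0 :* v1)
               (:0 :+ (v1 :* v2 :* v3 :- v3 :* (v1 :* v2) :- v4 :* (v1 :* v1 :+ v0 :* v2)
                 :- v1 :* (v2 :* v3 :- (v3 :* v2 :+ v4 :* v1)) :- (v1 :* v3 :- (v3 :* v1 :+ v4 :* v0)) :* v2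
                 :- (v1 :* v4 :- (v4 :* v1 :+ v0)) :* v1)) ≡.refl ⟩
        _ ≈⟨ drop0 (0-0 (0-0 (0-0 (0-0 (0-0 (0* _ IH) (*0 _ IH)) (*0 _ (d-next k IH))) (*0 _ (≈⇒-≈0 (d-past-ẽ k 2))))
               (0* _ (≈⇒-≈0 (d-past-ẽ (suc k) 2)))) (0* _ (≈⇒-≈0 (d-past-ẽ₁ (suc k))))) ⟩
        0# ∎
        where
        IH = d-diag k
        d₀ = d k ; d₁′ = d (suc k) ; d₂ = d (suc (suc k))

      private
        AA : ℕ → ℕ → Set
        AA k i = d (suc k) * d i + d (suc i) * d k ≈ 0#

        AA-step : ∀ k i → AA k i → AA (suc k) i → AA k (suc i)
        AA-step k i p q = begin
          d (suc k) * d (suc i) + d (suc (suc i)) * d k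
            ≈⟨ solve (d (suc k) ∷ d i ∷ d (suc i) ∷ d k ∷ ẽ 1 ∷ d (suc (suc k)) ∷ d (suc (suc i)) ∷ []) (v0 :* v2 :+ v6 :* v3)
                 (:0 :+ ((v0 :* v1 :+ v2 :* v3) :* v4 :- v4 :* (v0 :* v1 :+ v2 :* v3) :- (v5 :* v1 :+ v2 :* v0)
                  :- (v0 :* v1 :* v4 :- (v4 :* (v0 :* v1) :+ (v5 :* v1 :+ v0 :* v2)))
                  :- (v2 :* v3 :* v4 :- (v4 :* (v2 :* v3) :+ (v6 :* v3 :+ v2 :* v0))))) ≡.refl ⟩
          _ ≈⟨ drop0 (0-0 (0-0 (0-0 (0-0 (0* _ p) (*0 _ p)) q) (≈⇒-≈0 (dd k i))) (≈⇒-≈0 (dd i k))) ⟩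
          0# ∎

        -- Induction on the distance of the two indices. The derivation turns a relation at distance
        -- n + 1 into the sum of one at distance n and one at distance n + 2, hence two consecutive
        -- distances are carried along.
        AA-dist : ∀ n k → AA k (n ℕ.+ k) × AA k (suc n ℕ.+ k)
        AA-dist zero k = 0+0 (d-diag k) (d-diag k) , d-next k (d-diag k)
        AA-dist (suc n) k with AA-dist n k
        ... | p , q = q , AA-step k (suc n ℕ.+ k) q
                (≡.subst (AA (suc k)) (ℕ.+-suc n k) (proj₁ (AA-dist n (suc k))))

        AA-sym : ∀ k i → AA k i → AA i k
        AA-sym k i p = trans (+-comm _ _) p

      d-anti : ∀ k i → d (suc k) * d i + d (suc i) * d k ≈ 0#
      d-anti k i with ℕ.≤-total k i
      ... | inj₁ k≤i = ≡.subst (AA k) (ℕ.m∸n+n≡m k≤i) (proj₁ (AA-dist (i ℕ.∸ k) k))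
      ... | inj₂ i≤k = AA-sym i k (≡.subst (AA i) (ℕ.m∸n+n≡m i≤k) (proj₁ (AA-dist (k ℕ.∸ i) i)))

      -- For m > 0 this is a^(m-1) d_(k-m), read as 0 when k < m.
      Y : ℕ → ℕ → A₀
      Y zero zero = 1#
      Y zero (suc k) = 0#
      Y (suc zero) = d ⁻
      Y (suc (suc m)) = (λ k → A * Y (suc m) k) ⁻

      Y-zero : ∀ m → Y (suc m) 0 ≈ 0#
      Y-zero zero = refl
      Y-zero (suc m) = refl

      private
        daY : ∀ m k i → d (suc k) * (A * Y (suc m) i) ≈ - (d 1 * (d k * Y (suc m) i))
        daY m k i = begin
          d (suc k) * (A * y)
            ≈⟨ solve (d (suc k) ∷ A ∷ y ∷ d 1 ∷ d k ∷ []) (v0 :* (v1 :* v2)) ((:0 :- v3 :* (v4 :* v2)) :+ (v0 :* v1 :+ v3 :* v4) :* v2) ≡.refl ⟩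
          _ ≈⟨ drop0 (0* _ (d-anti k 0)) ⟩
          0# - d 1 * (d k * y) ≈⟨ +-identityˡ _ ⟩
          - (d 1 * (d k * y)) ∎
          where y = Y (suc m) i

        d₁aY : ∀ x → d 1 * (A * x) ≈ 0#
        d₁aY x = trans (sym (*-assoc _ _ _)) (0* _ (d-diag 0))

        AY₀ : ∀ m x → x * (A * Y (suc m) 0) ≈ 0#
        AY₀ m x = *0 _ (*0 _ (Y-zero m))

      Y-diag : ∀ m k → d (suc k) * Y m (suc k) ≈ 0#
      Y-diag zero k = zeroʳ _
      Y-diag (suc zero) k = d-diag k
      Y-diag (suc (suc m)) zero = d₁aY _
      Y-diag (suc (suc m)) (suc k) = trans (daY m (suc k) (suc k))
        (trans (-‿cong (*0 _ (Y-diag (suc m) k))) (trans (sym (+-identityˡ _)) (-‿inverseʳ 0#)))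

      Y-anti : ∀ m k i → d (suc k) * Y m (suc i) + d (suc i) * Y m (suc k) ≈ 0#
      Y-anti zero k i = 0+0 (zeroʳ _) (zeroʳ _)
      Y-anti (suc zero) k i = d-anti k i
      Y-anti (suc (suc m)) zero zero = 0+0 (d₁aY _) (d₁aY _)
      Y-anti (suc (suc m)) zero (suc i) = 0+0 (d₁aY _) (AY₀ m _)
      Y-anti (suc (suc m)) (suc k) zero = 0+0 (AY₀ m _) (d₁aY _)
      Y-anti (suc (suc m)) (suc k) (suc i) = begin
        d (suc (suc k)) * (A * Y (suc m) (suc i)) + d (suc (suc i)) * (A * Y (suc m) (suc k))
          ≈⟨ +-cong (daY m (suc k) (suc i)) (daY m (suc i) (suc k)) ⟩
        - (d 1 * (d (suc k) * Y (suc m) (suc i))) + - (d 1 * (d (suc i) * Y (suc m) (suc k)))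
          ≈⟨ +-cong (sym (+-identityˡ _)) refl ⟩
        (0# - d 1 * p) - d 1 * q
          ≈⟨ solve (d 1 ∷ p ∷ q ∷ []) (:0 :- v0 :* v1 :- v0 :* v2) (:0 :- v0 :* (v1 :+ v2)) ≡.refl ⟩
        0# - d 1 * (p + q) ≈⟨ 0-0 refl (*0 _ (Y-anti (suc m) k i)) ⟩
        0# ∎
        where
        p = d (suc k) * Y (suc m) (suc i)
        q = d (suc i) * Y (suc m) (suc k)

      -- N Z α = Σ_I ẽ_{α−1_I} Z_{|I|}, summed over the sets I of indices of α.
      N : (ℕ → A₀) → List ℕ → A₀
      N Z [] = Z 0
      N Z (j ∷ α) = ẽ j * N Z α + (ẽ ⁻) j * N (λ k → Z (suc k)) α

      N-zero : ∀ {Z} α → (∀ k → Z k ≈ 0#) → N Z α ≈ 0#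
      N-zero [] z = z 0
      N-zero (j ∷ α) z = 0+0 (*0 _ (N-zero α z)) (*0 _ (N-zero α (λ k → z (suc k))))

      private
        shiftBy : ℕ → (ℕ → A₀) → ℕ → A₀
        shiftBy i Z k = Z (k ℕ.+ i)

        M : ℕ → ℕ → List ℕ → A₀
        M m i α = N (shiftBy i (Y m)) α

        N-cong : ∀ {Z Z′} α → (∀ k → Z k ≈ Z′ k) → N Z α ≈ N Z′ α
        N-cong [] z = z 0
        N-cong (j ∷ α) z = +-cong (*-congˡ (N-cong α z)) (*-congˡ (N-cong α (λ k → z (suc k))))

        M-step : ∀ m i j α → M m i (j ∷ α) ≈ ẽ j * M m i α + (ẽ ⁻) j * M m (suc i) α
        M-step m i j α = +-congˡ (*-congˡ (N-cong α (λ k → reflexive (≡.cong (Y m) (≡.sym (ℕ.+-suc k i))))))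

        dM-∷ : ∀ m k i j α → d k * M m i (j ∷ α) ≈
          ẽ j * (d k * M m i α) + (ẽ ⁻) j * (d (suc k) * M m i α + d k * M m (suc i) α)
            + ((ẽ ⁻) ⁻) j * (d (suc k) * M m (suc i) α)
        dM-∷ m k i j α = begin
          d k * M m i (j ∷ α) ≈⟨ *-congˡ (M-step m i j α) ⟩
          d k * (ẽ j * x + (ẽ ⁻) j * y)
            ≈⟨ solve (d k ∷ ẽ j ∷ (ẽ ⁻) j ∷ ((ẽ ⁻) ⁻) j ∷ x ∷ y ∷ d (suc k) ∷ []) (v0 :* (v1 :* v4 :+ v2 :* v5))
                 ((v1 :* (v0 :* v4) :+ v2 :* (v6 :* v4 :+ v0 :* v5) :+ v3 :* (v6 :* v5)) :+
                  ((v0 :* v1 :- (v1 :* v0 :+ v2 :* v6)) :* v4 :+ (v0 :* v2 :- (v2 :* v0 :+ v3 :* v6)) :* v5)) ≡.refl ⟩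
          _ ≈⟨ drop0 (0+0 (0* _ (≈⇒-≈0 (d-past-ẽ k j))) (0* _ (≈⇒-≈0 (d-past-ẽ⁻ k j)))) ⟩
          _ ∎
          where x = M m i α ; y = M m (suc i) α

        -- Moving d to the right past ẽ_j reproduces the relation for the shorter list with its
        -- indices kept or raised; at the end of the list it is `Y-anti`.
        M-anti : ∀ m α k i → d (suc k) * M m (suc i) α + d (suc i) * M m (suc k) α ≈ 0#
        M-anti m [] k i = Y-anti m k i
        M-anti m (j ∷ α) k i = begin
          d (suc k) * M m (suc i) (j ∷ α) + d (suc i) * M m (suc k) (j ∷ α)
            ≈⟨ +-cong (dM-∷ m (suc k) (suc i) j α) (dM-∷ m (suc i) (suc k) j α) ⟩
          (ẽ j * p + F * (q + r) + G * s) + (ẽ j * p′ + F * (q′ + r′) + G * s′)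
            ≈⟨ solve (ẽ j ∷ F ∷ G ∷ p ∷ q ∷ r ∷ s ∷ p′ ∷ q′ ∷ r′ ∷ s′ ∷ [])
                 ((v0 :* v3 :+ v1 :* (v4 :+ v5) :+ v2 :* v6) :+ (v0 :* v7 :+ v1 :* (v8 :+ v9) :+ v2 :* v10))
                 (v0 :* (v3 :+ v7) :+ v1 :* ((v4 :+ v9) :+ (v5 :+ v8)) :+ v2 :* (v6 :+ v10)) ≡.refl ⟩
          ẽ j * (p + p′) + F * ((q + r′) + (r + q′)) + G * (s + s′)
            ≈⟨ 0+0 (0+0 (*0 _ (M-anti m α k i)) (*0 _ (0+0 (M-anti m α (suc k) i) (M-anti m α k (suc i)))))
                   (*0 _ (M-anti m α (suc k) (suc i))) ⟩
          0# ∎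
          where
          F = (ẽ ⁻) j ; G = ((ẽ ⁻) ⁻) j
          p = d (suc k) * M m (suc i) α ; q = d (suc (suc k)) * M m (suc i) α ; r = d (suc k) * M m (suc (suc i)) α ; s = d (suc (suc k)) * M m (suc (suc i)) α
          p′ = d (suc i) * M m (suc k) α ; q′ = d (suc (suc i)) * M m (suc k) α ; r′ = d (suc i) * M m (suc (suc k)) α ; s′ = d (suc (suc i)) * M m (suc (suc k)) α

        M-diag : ∀ m α k → d (suc k) * M m (suc k) α ≈ 0#
        M-diag m [] k = Y-diag m k
        M-diag m (j ∷ α) k = trans (dM-∷ m (suc k) (suc k) j α)
          (0+0 (0+0 (*0 _ (M-diag m α k)) (*0 _ (trans (+-comm _ _) (M-anti m α k (suc k))))) (*0 _ (M-diag m α (suc k))))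

        Y-next : ∀ m i → A * Y m (suc i) + d (suc i) * Y m 0 ≈ Y (suc m) (suc (suc i))
        Y-next zero i = trans (+-cong (zeroʳ _) (*-identityʳ _)) (+-identityˡ _)
        Y-next (suc m) i = trans (+-congˡ (*0 _ (Y-zero m))) (+-identityʳ _)

        Y-next₀ : ∀ m → A * Y m 0 ≈ Y (suc m) 1
        Y-next₀ zero = *-identityʳ _
        Y-next₀ (suc m) = refl

        -- Needed for `M-next₀`: there the passage of a across ẽ_j leaves a term with d_1, which
        -- this identity absorbs.
        M-next : ∀ m α i → A * M m (suc i) α + d (suc i) * M m 0 α ≈ M (suc m) (suc (suc i)) α
        M-next m [] i = Y-next m i
        M-next m (j ∷ α) i = begin
          A * M m (suc i) (j ∷ α) + d (suc i) * M m 0 (j ∷ α)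
            ≈⟨ +-cong (dM-∷ m 0 (suc i) j α) (dM-∷ m (suc i) 0 j α) ⟩
          (ẽ j * p + F * (q + r) + G * s) + (ẽ j * p′ + F * (q′ + r′) + G * s′)
            ≈⟨ solve (ẽ j ∷ F ∷ G ∷ p ∷ q ∷ r ∷ s ∷ p′ ∷ q′ ∷ r′ ∷ s′ ∷ [])
                 ((v0 :* v3 :+ v1 :* (v4 :+ v5) :+ v2 :* v6) :+ (v0 :* v7 :+ v1 :* (v8 :+ v9) :+ v2 :* v10))
                 ((v0 :* (v3 :+ v7) :+ v1 :* (v5 :+ v8)) :+ (v1 :* (v4 :+ v9) :+ v2 :* (v6 :+ v10))) ≡.refl ⟩
          _ ≈⟨ drop0 (0+0 (*0 _ (M-anti m α 0 i)) (*0 _ (M-anti m α 0 (suc i)))) ⟩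
          ẽ j * (p + p′) + F * (r + q′)
            ≈⟨ +-cong (*-congˡ (M-next m α i)) (*-congˡ (M-next m α (suc i))) ⟩
          ẽ j * M (suc m) (suc (suc i)) α + F * M (suc m) (suc (suc (suc i))) α
            ≈⟨ M-step (suc m) (suc (suc i)) j α ⟨
          M (suc m) (suc (suc i)) (j ∷ α) ∎
          where
          F = (ẽ ⁻) j ; G = ((ẽ ⁻) ⁻) j
          p = A * M m (suc i) α ; q = d 1 * M m (suc i) α ; r = A * M m (suc (suc i)) α ; s = d 1 * M m (suc (suc i)) α
          p′ = d (suc i) * M m 0 α ; q′ = d (suc (suc i)) * M m 0 α ; r′ = d (suc i) * M m 1 α ; s′ = d (suc (suc i)) * M m 1 α

        M-next₀ : ∀ m α → A * M m 0 α ≈ M (suc m) 1 α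
        M-next₀ m [] = Y-next₀ m
        M-next₀ m (j ∷ α) = begin
          A * M m 0 (j ∷ α) ≈⟨ dM-∷ m 0 0 j α ⟩
          ẽ j * (A * M m 0 α) + (ẽ ⁻) j * (d 1 * M m 0 α + A * M m 1 α) + ((ẽ ⁻) ⁻) j * (d 1 * M m 1 α)
            ≈⟨ drop0 (*0 _ (M-diag m α 0)) ⟩
          ẽ j * (A * M m 0 α) + (ẽ ⁻) j * (d 1 * M m 0 α + A * M m 1 α)
            ≈⟨ +-cong (*-congˡ (M-next₀ m α)) (*-congˡ (trans (+-comm _ _) (M-next m α 0))) ⟩
          ẽ j * M (suc m) 1 α + (ẽ ⁻) j * M (suc m) 2 α ≈⟨ M-step (suc m) 1 j α ⟨
          M (suc m) 1 (j ∷ α) ∎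

      -- The part of e_α (over the alphabet a ∷ B) that contains the letter a exactly m times.
      X : ℕ → List ℕ → A₀
      X zero [] = 1#
      X (suc m) [] = 0#
      X zero (j ∷ α) = ẽ j * X zero α
      X (suc m) (j ∷ α) = ẽ j * X (suc m) α + (ẽ ⁻) j * (A * X m α)

      -- The letters a are collected on the right. A factor whose index drops by one has given up
      -- either a letter a or a letter used in a commutator, so |I| exceeds m by the order of the
      -- commutator.
      X-normal : ∀ m α → X m α ≈ N (Y m) α
      X-normal zero [] = refl
      X-normal (suc m) [] = sym (Y-zero m)
      X-normal zero (j ∷ α) = trans (*-congˡ (X-normal zero α))
        (sym (drop0 (*0 _ (N-zero α (λ k → refl)))))
      X-normal (suc m) (j ∷ α) = +-cong (*-congˡ (X-normal (suc m) α)) (*-congˡ (begin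
        A * X m α ≈⟨ *-congˡ (trans (X-normal m α) (N-cong α (λ k → reflexive (≡.cong (Y m) (≡.sym (ℕ.+-identityʳ k)))))) ⟩
        A * M m 0 α ≈⟨ M-next₀ m α ⟩
        M (suc m) 1 α ≈⟨ N-cong α (λ k → reflexive (≡.cong (Y (suc m)) (ℕ.+-comm k 1))) ⟩
        N (λ k → Y (suc m) (suc k)) α ∎))

      -- By `d-past-ẽ` every summand splits into two, neighbouring halves cancel, and only the one
      -- with d_0 remains.
      telescope : ∀ s → conv (λ i k → sgn i (d k * ẽ i)) s ≈ sgn s (ẽ s * A)
      telescope s = begin
        conv (λ i k → sgn i (d k * ẽ i)) s
          ≈⟨ conv-cong s (λ i k _ → trans (sgn-cong i (d-past-ẽ k i)) (sgn-+ i _ _)) ⟩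
        conv (λ i k → P i k + Q i (suc k)) s ≈⟨ conv-+ P (λ i k → Q i (suc k)) s ⟩
        conv P s + conv (λ i k → Q i (suc k)) s
          ≈⟨ solve (conv P s ∷ conv (λ i k → Q i (suc k)) s ∷ P s 0 ∷ []) (v0 :+ v1) (v2 :+ (v1 :- v2 :+ v0)) ≡.refl ⟩
        P s 0 + (conv (λ i k → Q i (suc k)) s - P s 0 + conv P s) ≈⟨ drop0 vanish ⟩
        P s 0 ∎
        where
        P Q : ℕ → ℕ → A₀
        P i k = sgn i (ẽ i * d k)
        Q i k = sgn i ((ẽ ⁻) i * d k)
        vanish : conv (λ i k → Q i (suc k)) s - P s 0 + conv P s ≈ 0#
        vanish = begin
          conv (λ i k → Q i (suc k)) s + Q (suc s) 0 + conv P s ≈⟨ +-congʳ (conv-last Q s) ⟨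
          (0# * d (suc s) + conv (λ i k → - P i k) s) + conv P s
            ≈⟨ +-congʳ (trans (+-cong (zeroˡ _) (conv-neg P s)) (+-identityˡ _)) ⟩
          - conv P s + conv P s ≈⟨ -‿inverseˡ _ ⟩
          0# ∎

      pw : ℕ → A₀
      pw zero = 1#
      pw (suc p) = pw p * A

      pw-ẽ : ∀ p s → pw p * (ẽ s * A) ≈ ẽ s * pw (suc p)
      pw-ẽ zero s = solve (A ∷ ẽ s ∷ []) (:1 :* (v1 :* v0)) (v1 :* (:1 :* v0)) ≡.refl
      pw-ẽ (suc p) s = begin
        pw p * A * (ẽ s * A) ≈⟨ solve (A ∷ ẽ s ∷ pw p ∷ []) (v2 :* v0 :* (v1 :* v0)) (v2 :* (v0 :* v1 :* v0)) ≡.refl ⟩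
        pw p * (A * ẽ s * A) ≈⟨ *-congˡ (aea B s a<B inc) ⟩
        pw p * (ẽ s * A * A) ≈⟨ *-assoc _ _ _ ⟨
        pw p * (ẽ s * A) * A ≈⟨ *-congʳ (pw-ẽ p s) ⟩
        ẽ s * pw (suc p) * A ≈⟨ *-assoc _ _ _ ⟩
        ẽ s * pw (suc (suc p)) ∎

      ẽ* : List ℕ → A₀
      ẽ* = e* B

      e*-split : ∀ U j Z → U * (e (a ∷ B) j * Z) ≈ U * ẽ j * Z + U * ((ẽ ⁻) j * A) * Z
      e*-split U j Z = solve (U ∷ ẽ j ∷ (ẽ ⁻) j ∷ A ∷ Z ∷ []) (v0 :* ((v1 :+ v2 :* v3) :* v4)) (v0 :* v1 :* v4 :+ v0 :* (v2 :* v3) :* v4) ≡.refl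

      X-join : ∀ U j x y → U * ẽ j * x + U * ((ẽ ⁻) j * A) * y ≈ U * (ẽ j * x + (ẽ ⁻) j * (A * y))
      X-join U j x y = solve (U ∷ ẽ j ∷ (ẽ ⁻) j ∷ A ∷ x ∷ y ∷ []) (v0 :* v1 :* v4 :+ v0 :* (v2 :* v3) :* v5) (v0 :* (v1 :* v4 :+ v2 :* (v3 :* v5))) ≡.refl

      N-split : ∀ β Z j α → ẽ* β * N Z (j ∷ α) ≈ ẽ* (j ∷ β) * N Z α + (ẽ ⁻) j * ẽ* β * N (λ k → Z (suc k)) α
      N-split β Z j α = begin
        ẽ* β * (ẽ j * x + (ẽ ⁻) j * y)
          ≈⟨ solve (ẽ* β ∷ ẽ j ∷ (ẽ ⁻) j ∷ x ∷ y ∷ []) (v0 :* (v1 :* v3 :+ v2 :* v4)) (v0 :* v1 :* v3 :+ v0 :* v2 :* v4) ≡.refl ⟩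
        ẽ* β * ẽ j * x + ẽ* β * (ẽ ⁻) j * y ≈⟨ +-cong (*-congʳ (e*-comm B inc β j)) (*-congʳ (comm⁻ j)) ⟩
        ẽ j * ẽ* β * x + (ẽ ⁻) j * ẽ* β * y ∎
        where
        x = N Z α ; y = N (λ k → Z (suc k)) α
        comm⁻ : ∀ j → ẽ* β * (ẽ ⁻) j ≈ (ẽ ⁻) j * ẽ* β
        comm⁻ zero = trans (zeroʳ _) (sym (zeroˡ _))
        comm⁻ (suc j) = e*-comm B inc β j

      -- Under a functional that obeys the rotation rule this becomes the recursion that determines
      -- `q`.
      telescope* : ∀ β p s → conv (λ i k → sgn i (ẽ* β * (pw p * d k) * ẽ i)) s ≈ sgn s (ẽ* (s ∷ β) * (pw p * A))
      telescope* β p s = begin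
        conv (λ i k → sgn i (ẽ* β * (pw p * d k) * ẽ i)) s
          ≈⟨ conv-cong s (λ i k _ → trans (sgn-cong i (solve (ẽ* β ∷ pw p ∷ d k ∷ ẽ i ∷ []) (v0 :* (v1 :* v2) :* v3) (v0 :* v1 :* (v2 :* v3)) ≡.refl)) (sgn-*ʳ i _ _)) ⟩
        conv (λ i k → ẽ* β * pw p * sgn i (d k * ẽ i)) s ≈⟨ conv-*ˡ _ _ s ⟩
        ẽ* β * pw p * conv (λ i k → sgn i (d k * ẽ i)) s ≈⟨ *-congˡ (telescope s) ⟩
        ẽ* β * pw p * sgn s (ẽ s * A) ≈⟨ sgn-*ʳ s _ _ ⟨
        sgn s (ẽ* β * pw p * (ẽ s * A)) ≈⟨ sgn-cong s (begin
          ẽ* β * pw p * (ẽ s * A)   ≈⟨ *-assoc _ _ _ ⟩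
          ẽ* β * (pw p * (ẽ s * A)) ≈⟨ *-congˡ (pw-ẽ p s) ⟩
          ẽ* β * (ẽ s * pw (suc p)) ≈⟨ *-assoc _ _ _ ⟨
          ẽ* β * ẽ s * pw (suc p)   ≈⟨ *-congʳ (e*-comm B inc β s) ⟩
          ẽ* (s ∷ β) * (pw p * A)   ∎) ⟩
        sgn s (ẽ* (s ∷ β) * (pw p * A)) ∎

      pw-Y : ∀ β p m k → ẽ* β * (pw p * Y (suc (suc m)) (suc k)) ≈ ẽ* β * (pw (suc p) * Y (suc m) k)
      pw-Y β p m k = *-congˡ (sym (*-assoc _ _ _))

-- Vertex operators on functionals and their exchange relations.

module VertexOperators where
  open import Data.Nat as ℕ using (ℕ; zero; suc; _≤_; s≤s)
  open import Data.List using (List; []; _∷_)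
  open import Data.List.Relation.Binary.Permutation.Propositional as ↭ using (_↭_; prep; swap)
  open import Data.Vec using ([]; _∷_)
  open import Relation.Binary.PropositionalEquality as ≡ using (_≡_)
  open RingNormalisation
  open Convolutions

  module Operators (𝓚 : CommutativeRing 0ℓ 0ℓ) (t : CommutativeRing.Carrier 𝓚) where
    open CommutativeRing 𝓚 renaming (Carrier to A; sym to ≈-sym) hiding (zero)
    open FiniteSums ring
    open CommutativeRingSolver 𝓚
    open RingProperties ring using (-1*x≈-x; -0#≈0#; -‿distribˡ-*)
    open GroupProperties +-abelianGroup using (⁻¹-involutive)
    open SetoidReasoning setoid

    -- A functional on symmetric functions, given by its values on the products e_α.
    Fun : Set
    Fun = List ℕ → A

    infix 4 _≐_
    _≐_ : Fun → Fun → Set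
    Ψ ≐ Φ = ∀ α → Ψ α ≈ Φ α

    infixr 8 _▹_ _◂_ _◂◂_
    _▹_ _◂_ _◂◂_ : ℕ → Fun → Fun
    (j ▹ Ψ) α = Ψ (j ∷ α)
    zero ◂ Ψ = λ _ → 0#
    suc j ◂ Ψ = j ▹ Ψ
    zero ◂◂ Ψ = λ _ → 0#
    suc j ◂◂ Ψ = j ◂ Ψ

    -- The conditions under which the values come from a linear functional on the polynomial ring in
    -- e_1, e_2, ....
    record Good (Ψ : Fun) : Set where
      field
        perm : ∀ {α β} → α ↭ β → Ψ α ≈ Ψ β
        drop : ∀ α → Ψ (0 ∷ α) ≈ Ψ α
    open Good public

    good-0 : Good (λ _ → 0#)
    good-0 = record { perm = λ _ → refl ; drop = λ _ → refl }

    good-▹ : ∀ j {Ψ} → Good Ψ → Good (j ▹ Ψ)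
    good-▹ j g = record { perm = λ p → perm g (prep j p) ; drop = λ α → trans (perm g (swap j 0 ↭.refl)) (drop g (j ∷ α)) }

    good-◂ : ∀ j {Ψ} → Good Ψ → Good (j ◂ Ψ)
    good-◂ zero g = good-0
    good-◂ (suc j) g = good-▹ j g

    good-◂◂ : ∀ j {Ψ} → Good Ψ → Good (j ◂◂ Ψ)
    good-◂◂ zero g = good-0
    good-◂◂ (suc j) g = good-◂ j g

    record Linear (L : Fun → Fun) : Set where
      field
        lcong : ∀ {Ψ Φ} → Ψ ≐ Φ → L Ψ ≐ L Φ
        ladd : ∀ Ψ Φ → L (λ α → Ψ α + Φ α) ≐ λ α → L Ψ α + L Φ α
        lscale : ∀ c Ψ → L (λ α → c * Ψ α) ≐ λ α → c * L Ψ α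
    open Linear public

    module _ {L : Fun → Fun} (lin : Linear L) where
      l0 : L (λ _ → 0#) ≐ λ _ → 0#
      l0 α = trans (lcong lin (λ _ → ≈-sym (zeroˡ 0#)) α) (trans (lscale lin 0# (λ _ → 0#) α) (zeroˡ _))

      lneg : ∀ Ψ → L (λ α → - Ψ α) ≐ λ α → - L Ψ α
      lneg Ψ α = trans (lcong lin (λ β → ≈-sym (-1*x≈-x (Ψ β))) α) (trans (lscale lin (- 1#) Ψ α) (-1*x≈-x _))

      lsgn : ∀ i Ψ → L (λ α → sgn i (Ψ α)) ≐ λ α → sgn i (L Ψ α)
      lsgn zero Ψ α = refl
      lsgn (suc i) Ψ α = trans (lneg (λ α → sgn i (Ψ α)) α) (-‿cong (lsgn i Ψ α))

      lconv : ∀ (G : ℕ → ℕ → Fun) s → L (λ α → conv (λ i k → G i k α) s) ≐ λ α → conv (λ i k → L (G i k) α) s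
      lconv G zero α = refl
      lconv G (suc s) α = trans (ladd lin (G 0 (suc s)) (λ α → conv (λ i k → G (suc i) k α) s) α) (+-congˡ (lconv (λ i → G (suc i)) s α))

    linear-∘ : ∀ {L M} → Linear L → Linear M → Linear (λ Ψ → L (M Ψ))
    linear-∘ l m = record
      { lcong = λ p → lcong l (lcong m p)
      ; ladd = λ Ψ Φ α → trans (lcong l (ladd m Ψ Φ) α) (ladd l _ _ α)
      ; lscale = λ c Ψ α → trans (lcong l (lscale m c Ψ) α) (lscale l c _ α) }

    pow : ℕ → A
    pow zero = 1#
    pow (suc i) = t * pow i

    -- The coefficient (-t)^i of e_i z^i in E(-tz).
    c : ℕ → A
    c i = sgn i (pow i)

    c-suc : ∀ i → c (suc i) ≈ - (t * c i)
    c-suc i = -‿cong (sgn-*ʳ i t (pow i))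

    -- The product of E(-tz) with the series of the q_s, solved for its last coefficient. The first
    -- argument is fuel; every value not below s gives the same result.
    qf : ℕ → ℕ → Fun → Fun
    qf f zero Ψ α = Ψ α
    qf zero (suc s) Ψ α = 0#
    qf (suc f) (suc s) Ψ α = sgn (suc s) (Ψ (suc s ∷ α)) - conv (λ i k → c (suc i) * qf f k Ψ (suc i ∷ α)) s

    -- q_s with Σ_s q_s z^s = E(−z)/E(−tz)
    q : ℕ → Fun → Fun
    q s = qf s s

    qf-stable : ∀ f g s Ψ α → s ≤ f → s ≤ g → qf f s Ψ α ≈ qf g s Ψ α
    qf-stable f g zero Ψ α _ _ = refl
    qf-stable (suc f) (suc g) (suc s) Ψ α (s≤s p) (s≤s r) = +-congˡ (-‿cong (conv-cong s (λ i k e →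
      *-congˡ (qf-stable f g k Ψ (suc i ∷ α) (k≤ i k e p) (k≤ i k e r)))))
      where
      k≤ : ∀ i k {s f} → i ℕ.+ k ≡ s → s ≤ f → k ≤ f
      k≤ i k e le = ℕ.≤-trans (ℕ.≤-trans (ℕ.m≤n+m k i) (ℕ.≤-reflexive e)) le

    q-suc : ∀ s Ψ α → q (suc s) Ψ α ≈ sgn (suc s) (Ψ (suc s ∷ α)) - conv (λ i k → c (suc i) * q k Ψ (suc i ∷ α)) s
    q-suc s Ψ α = +-congˡ (-‿cong (conv-cong s (λ i k e →
      *-congˡ (qf-stable s k k Ψ (suc i ∷ α) (ℕ.≤-trans (ℕ.m≤n+m k i) (ℕ.≤-reflexive e)) ℕ.≤-refl))))

    strong : (P : ℕ → Set) → (∀ s → (∀ k → k ℕ.< s → P k) → P s) → ∀ s → P s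
    strong P step s = go (suc s) s ℕ.≤-refl
      where
      go : ∀ n s → s ℕ.< n → P s
      go (suc n) s (s≤s le) = step s (λ k k<s → go n k (ℕ.≤-trans k<s le))

    private
      k<suc : ∀ i k {s} → i ℕ.+ k ≡ s → k ℕ.< suc s
      k<suc i k e = s≤s (ℕ.≤-trans (ℕ.m≤n+m k i) (ℕ.≤-reflexive e))

    -- The recursion has one solution only. Linearity of `q` and its commutation rules are obtained
    -- by exhibiting a second one.
    q-unique : ∀ Ψ (Θ : ℕ → Fun) → Θ 0 ≐ Ψ →
      (∀ s α → Θ (suc s) α ≈ sgn (suc s) (Ψ (suc s ∷ α)) - conv (λ i k → c (suc i) * Θ k (suc i ∷ α)) s) →
      ∀ s → Θ s ≐ q s Ψ
    q-unique Ψ Θ h0 hs = strong (λ s → Θ s ≐ q s Ψ) λ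
      { zero _ α → h0 α
      ; (suc s) IH α → trans (hs s α) (trans (+-congˡ (-‿cong (conv-cong s (λ i k e →
          *-congˡ (IH k (k<suc i k e) (suc i ∷ α)))))) (≈-sym (q-suc s Ψ α))) }

    q-good : ∀ s {Ψ} → Good Ψ → Good (q s Ψ)
    q-good s {Ψ} g = record
      { perm = strong (λ s → ∀ {α β} → α ↭ β → q s Ψ α ≈ q s Ψ β) stepP s
      ; drop = strong (λ s → ∀ α → q s Ψ (0 ∷ α) ≈ q s Ψ α) stepD s }
      where
      stepP : ∀ s → (∀ k → k ℕ.< s → ∀ {α β} → α ↭ β → q k Ψ α ≈ q k Ψ β) → ∀ {α β} → α ↭ β → q s Ψ α ≈ q s Ψ β
      stepP zero _ p = perm g p
      stepP (suc s) IH {α} {β} p = trans (q-suc s Ψ α) (trans (+-cong (sgn-cong (suc s) (perm g (prep (suc s) p)))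
        (-‿cong (conv-cong s (λ i k e → *-congˡ (IH k (k<suc i k e) (prep (suc i) p)))))) (≈-sym (q-suc s Ψ β)))
      stepD : ∀ s → (∀ k → k ℕ.< s → ∀ α → q k Ψ (0 ∷ α) ≈ q k Ψ α) → ∀ α → q s Ψ (0 ∷ α) ≈ q s Ψ α
      stepD zero _ α = drop g α
      stepD (suc s) IH α = trans (q-suc s Ψ (0 ∷ α)) (trans (+-cong (sgn-cong (suc s) (drop (good-▹ (suc s) g) α))
        (-‿cong (conv-cong s (λ i k e → *-congˡ (trans
          (strong (λ s → ∀ {α β} → α ↭ β → q s Ψ α ≈ q s Ψ β) stepP k (swap (suc i) 0 ↭.refl)) (IH k (k<suc i k e) (suc i ∷ α))))))) (≈-sym (q-suc s Ψ α)))

    q-linear : ∀ s → Linear (q s)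
    q-linear s = record { lcong = cg s ; ladd = ad s ; lscale = sc s }
      where
      cg : ∀ s {Ψ Φ} → Ψ ≐ Φ → q s Ψ ≐ q s Φ
      cg s {Ψ} {Φ} p = q-unique Φ (λ s → q s Ψ) p (λ s α → trans (q-suc s Ψ α) (+-congʳ (sgn-cong (suc s) (p (suc s ∷ α))))) s
      ad : ∀ s Ψ Φ → q s (λ α → Ψ α + Φ α) ≐ λ α → q s Ψ α + q s Φ α
      ad s Ψ Φ α = ≈-sym (q-unique (λ α → Ψ α + Φ α) (λ s α → q s Ψ α + q s Φ α) (λ _ → refl) (λ s α → begin
        q (suc s) Ψ α + q (suc s) Φ α ≈⟨ +-cong (q-suc s Ψ α) (q-suc s Φ α) ⟩
        (x s α Ψ - y s α Ψ) + (x s α Φ - y s α Φ)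
          ≈⟨ solve (x s α Ψ ∷ y s α Ψ ∷ x s α Φ ∷ y s α Φ ∷ []) ((v0 :- v1) :+ (v2 :- v3)) ((v0 :+ v2) :- (v1 :+ v3)) ≡.refl ⟩
        (x s α Ψ + x s α Φ) - (y s α Ψ + y s α Φ)
          ≈⟨ +-cong (≈-sym (sgn-+ (suc s) _ _)) (-‿cong (≈-sym (trans (conv-cong s (λ i k _ → distribˡ _ _ _)) (conv-+ _ _ s)))) ⟩
        _ ∎) s α)
        where
        x y : ℕ → List ℕ → Fun → A
        x s α Ψ = sgn (suc s) (Ψ (suc s ∷ α))
        y s α Ψ = conv (λ i k → c (suc i) * q k Ψ (suc i ∷ α)) s
      sc : ∀ s a Ψ → q s (λ α → a * Ψ α) ≐ λ α → a * q s Ψ α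
      sc s a Ψ α = ≈-sym (q-unique (λ α → a * Ψ α) (λ s α → a * q s Ψ α) (λ _ → refl) (λ s α → begin
        a * q (suc s) Ψ α ≈⟨ *-congˡ (q-suc s Ψ α) ⟩
        a * (x s α - y s α) ≈⟨ solve (a ∷ x s α ∷ y s α ∷ []) (v0 :* (v1 :- v2)) (v0 :* v1 :- v0 :* v2) ≡.refl ⟩
        a * x s α - a * y s α ≈⟨ +-cong (≈-sym (sgn-*ʳ (suc s) _ _)) (-‿cong (≈-sym (trans (conv-cong s (λ i k _ →
             solve (c (suc i) ∷ a ∷ q k Ψ (suc i ∷ α) ∷ []) (v0 :* (v1 :* v2)) (v1 :* (v0 :* v2)) ≡.refl)) (conv-*ˡ a _ s)))) ⟩
        _ ∎) s α)
        where
        x y : ℕ → List ℕ → A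
        x s α = sgn (suc s) (Ψ (suc s ∷ α))
        y s α = conv (λ i k → c (suc i) * q k Ψ (suc i ∷ α)) s

    q-▹ : ∀ s j {Ψ} → Good Ψ → ∀ α → q s (j ▹ Ψ) α ≈ q s Ψ (j ∷ α)
    q-▹ s j {Ψ} g α = ≈-sym (q-unique (j ▹ Ψ) (λ s α → q s Ψ (j ∷ α)) (λ _ → refl) (λ s α →
      trans (q-suc s Ψ (j ∷ α)) (+-cong (sgn-cong (suc s) (perm g (swap (suc s) j ↭.refl)))
        (-‿cong (conv-cong s (λ i k _ → *-congˡ (perm (q-good k g) (swap (suc i) j ↭.refl))))))) s α)

    q-comm : ∀ r s {Ψ} → Good Ψ → q r (q s Ψ) ≐ q s (q r Ψ)
    q-comm r s {Ψ} g = q-unique (q r Ψ) (λ s → q r (q s Ψ)) (λ _ → refl) (λ s α → begin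
      q r (q (suc s) Ψ) α
        ≈⟨ lcong (q-linear r) (q-suc s Ψ) α ⟩
      q r (λ α → sgn (suc s) (Ψ (suc s ∷ α)) - conv (λ i k → c (suc i) * q k Ψ (suc i ∷ α)) s) α
        ≈⟨ trans (ladd (q-linear r) _ _ α) (+-cong (lsgn (q-linear r) (suc s) (suc s ▹ Ψ) α)
             (trans (lneg (q-linear r) _ α) (-‿cong (lconv (q-linear r) (λ i k α → c (suc i) * q k Ψ (suc i ∷ α)) s α)))) ⟩
      sgn (suc s) (q r (suc s ▹ Ψ) α) - conv (λ i k → q r (λ α → c (suc i) * q k Ψ (suc i ∷ α)) α) s
        ≈⟨ +-cong (sgn-cong (suc s) (q-▹ r (suc s) g α)) (-‿cong (conv-cong s (λ i k _ →
             trans (lscale (q-linear r) (c (suc i)) (suc i ▹ q k Ψ) α) (*-congˡ (q-▹ r (suc i) (q-good k g) α))))) ⟩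
      _ ∎) s

    q-sum : ∀ s {Ψ} → Good Ψ → ∀ α → conv (λ i k → c i * q k Ψ (i ∷ α)) s ≈ sgn s (Ψ (s ∷ α))
    q-sum zero g α = *-identityˡ _
    q-sum (suc s) {Ψ} g α = begin
      1# * q (suc s) Ψ (0 ∷ α) + R ≈⟨ +-congʳ (trans (*-identityˡ _) (trans (drop (q-good (suc s) g) α) (q-suc s Ψ α))) ⟩
      x - R + R ≈⟨ solve (x ∷ R ∷ []) (v0 :- v1 :+ v1) v0 ≡.refl ⟩
      x ∎
      where
      x = sgn (suc s) (Ψ (suc s ∷ α))
      R = conv (λ i k → c (suc i) * q k Ψ (suc i ∷ α)) s

    -- This is q_(l-m), and 0 for l < m; two arguments are used to avoid negative indices.
    q̂ : ℕ → ℕ → Fun → Fun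
    q̂ zero l = q l
    q̂ (suc m) zero = λ _ _ → 0#
    q̂ (suc m) (suc l) = q̂ m l

    q̂-linear : ∀ m l → Linear (q̂ m l)
    q̂-linear zero l = q-linear l
    q̂-linear (suc m) zero = record { lcong = λ _ _ → refl ; ladd = λ _ _ _ → ≈-sym (+-identityˡ _) ; lscale = λ _ _ _ → ≈-sym (zeroʳ _) }
    q̂-linear (suc m) (suc l) = q̂-linear m l

    q̂-good : ∀ m l {Ψ} → Good Ψ → Good (q̂ m l Ψ)
    q̂-good zero l = q-good l
    q̂-good (suc m) zero _ = good-0
    q̂-good (suc m) (suc l) = q̂-good m l

    q̂-comm-q : ∀ m l s {Ψ} → Good Ψ → q̂ m l (q s Ψ) ≐ q s (q̂ m l Ψ)
    q̂-comm-q zero l s g = q-comm l s g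
    q̂-comm-q (suc m) zero s g α = ≈-sym (l0 (q-linear s) α)
    q̂-comm-q (suc m) (suc l) s g = q̂-comm-q m l s g

    q̂-comm : ∀ m l n r {Ψ} → Good Ψ → q̂ m l (q̂ n r Ψ) ≐ q̂ n r (q̂ m l Ψ)
    q̂-comm m l zero r g = q̂-comm-q m l r g
    q̂-comm m l (suc n) zero g α = l0 (q̂-linear m l) α
    q̂-comm m l (suc n) (suc r) g = q̂-comm m l n r g

    -- K m l is the operator H_{m−l}, where H_m Ψ = Σ_I Ψ(q_{|I|−m} e_{α−1_I}) is dual to the
    -- operator with Q′_{(m,λ)} = H_m Q′_λ.
    K : ℕ → ℕ → Fun → Fun
    K m l Ψ [] = q̂ m l Ψ []
    K m l Ψ (j ∷ α) = K m l (j ▹ Ψ) α + K m (suc l) (j ◂ Ψ) α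

    ▹-+ : ∀ j Ψ Φ → (j ◂ (λ α → Ψ α + Φ α)) ≐ λ α → (j ◂ Ψ) α + (j ◂ Φ) α
    ▹-+ zero Ψ Φ α = ≈-sym (+-identityˡ _)
    ▹-+ (suc j) Ψ Φ α = refl

    ◂-scale : ∀ j a Ψ → (j ◂ (λ α → a * Ψ α)) ≐ λ α → a * (j ◂ Ψ) α
    ◂-scale zero a Ψ α = ≈-sym (zeroʳ _)
    ◂-scale (suc j) a Ψ α = refl

    ◂-cong : ∀ j {Ψ Φ} → Ψ ≐ Φ → (j ◂ Ψ) ≐ (j ◂ Φ)
    ◂-cong zero p α = refl
    ◂-cong (suc j) p α = p (j ∷ α)

    K-linear : ∀ m l → Linear (K m l)
    K-linear m l = record { lcong = λ p α → cg m l α p ; ladd = λ Ψ Φ α → ad m l α Ψ Φ ; lscale = λ a Ψ α → sc m l α a Ψ }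
      where
      cg : ∀ m l α {Ψ Φ} → Ψ ≐ Φ → K m l Ψ α ≈ K m l Φ α
      cg m l [] p = lcong (q̂-linear m l) p []
      cg m l (j ∷ α) p = +-cong (cg m l α (λ β → p (j ∷ β))) (cg m (suc l) α (◂-cong j p))
      ad : ∀ m l α Ψ Φ → K m l (λ α → Ψ α + Φ α) α ≈ K m l Ψ α + K m l Φ α
      ad m l [] Ψ Φ = ladd (q̂-linear m l) Ψ Φ []
      ad m l (j ∷ α) Ψ Φ = begin
        K m l (λ α → (j ▹ Ψ) α + (j ▹ Φ) α) α + K m (suc l) (j ◂ (λ α → Ψ α + Φ α)) α
          ≈⟨ +-cong (ad m l α (j ▹ Ψ) (j ▹ Φ)) (trans (cg m (suc l) α (▹-+ j Ψ Φ)) (ad m (suc l) α (j ◂ Ψ) (j ◂ Φ))) ⟩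
        (x + y) + (z + w) ≈⟨ solve (x ∷ y ∷ z ∷ w ∷ []) ((v0 :+ v1) :+ (v2 :+ v3)) ((v0 :+ v2) :+ (v1 :+ v3)) ≡.refl ⟩
        (x + z) + (y + w) ∎
        where x = K m l (j ▹ Ψ) α ; y = K m l (j ▹ Φ) α ; z = K m (suc l) (j ◂ Ψ) α ; w = K m (suc l) (j ◂ Φ) α
      sc : ∀ m l α a Ψ → K m l (λ α → a * Ψ α) α ≈ a * K m l Ψ α
      sc m l [] a Ψ = lscale (q̂-linear m l) a Ψ []
      sc m l (j ∷ α) a Ψ = trans (+-cong (sc m l α a (j ▹ Ψ)) (trans (cg m (suc l) α (◂-scale j a Ψ)) (sc m (suc l) α a (j ◂ Ψ)))) (≈-sym (distribˡ _ _ _))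

    ◂▹ : ∀ i j {Ψ} → Good Ψ → (j ▹ (i ◂ Ψ)) ≐ (i ◂ (j ▹ Ψ))
    ◂▹ zero j g α = refl
    ◂▹ (suc i) j g α = perm g (swap i j ↭.refl)

    ▹-swap : ∀ i j {Ψ} → Good Ψ → (j ▹ (i ▹ Ψ)) ≐ (i ▹ (j ▹ Ψ))
    ▹-swap i j g α = perm g (swap i j ↭.refl)

    ◂◂-comm : ∀ i j {Ψ} → Good Ψ → (j ◂ (i ◂ Ψ)) ≐ (i ◂ (j ◂ Ψ))
    ◂◂-comm zero zero g α = refl
    ◂◂-comm zero (suc j) g α = refl
    ◂◂-comm (suc i) zero g α = refl
    ◂◂-comm (suc i) (suc j) g α = perm g (swap i j ↭.refl)

    K-good : ∀ m l {Ψ} → Good Ψ → Good (K m l Ψ)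
    K-good m l g = record { perm = pm m l g ; drop = λ α → trans (+-cong (lcong (K-linear m l) (drop g) α) (l0 (K-linear m (suc l)) α)) (+-identityʳ _) }
      where
      pm : ∀ m l {Ψ} → Good Ψ → ∀ {α β} → α ↭ β → K m l Ψ α ≈ K m l Ψ β
      pm m l g ↭.refl = refl
      pm m l g (prep j p) = +-cong (pm m l (good-▹ j g) p) (pm m (suc l) (good-◂ j g) p)
      pm m l g (↭.trans p r) = trans (pm m l g p) (pm m l g r)
      pm m l {Ψ} g {i ∷ j ∷ α} {_ ∷ _ ∷ β} (swap i j p) = begin
        (K m l (j ▹ (i ▹ Ψ)) α + K m (suc l) (j ◂ (i ▹ Ψ)) α) + (K m (suc l) (j ▹ (i ◂ Ψ)) α + K m (suc (suc l)) (j ◂ (i ◂ Ψ)) α)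
          ≈⟨ +-cong (+-cong (tr l (good-▹ j (good-▹ i g)) (▹-swap i j g)) (tr (suc l) (good-◂ j (good-▹ i g)) (λ α → ≈-sym (◂▹ j i g α))))
                    (+-cong (tr (suc l) (good-▹ j (good-◂ i g)) (◂▹ i j g)) (tr (suc (suc l)) (good-◂ j (good-◂ i g)) (◂◂-comm i j g))) ⟩
        (x + y) + (z + w) ≈⟨ solve (x ∷ y ∷ z ∷ w ∷ []) ((v0 :+ v1) :+ (v2 :+ v3)) ((v0 :+ v2) :+ (v1 :+ v3)) ≡.refl ⟩
        (x + z) + (y + w) ∎
        where
        x = K m l (i ▹ (j ▹ Ψ)) β ; y = K m (suc l) (i ▹ (j ◂ Ψ)) β ; z = K m (suc l) (i ◂ (j ▹ Ψ)) β ; w = K m (suc (suc l)) (i ◂ (j ◂ Ψ)) β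
        tr : ∀ l {Φ Φ′} → Good Φ → Φ ≐ Φ′ → K m l Φ α ≈ K m l Φ′ β
        tr l g e = trans (pm m l g p) (lcong (K-linear m l) e β)

    K-suc : ∀ m l Ψ α → K (suc m) (suc l) Ψ α ≈ K m l Ψ α
    K-suc m l Ψ [] = refl
    K-suc m l Ψ (j ∷ α) = +-cong (K-suc m l (j ▹ Ψ) α) (K-suc m (suc l) (j ◂ Ψ) α)

    module _ (m : ℕ) {Ψ : Fun} (g : Good Ψ) where
      private
        sumK : ℕ → ℕ → List ℕ → A
        sumK l s α = conv (λ i k → c (suc i) * K m l (q k Ψ) (suc i ∷ α)) s

      -- Taking a factor e_(i+1) out of `K m l` costs a term with e_i and `K m (suc l)`. These terms
      -- add up by `q-sum`, and the factor t is the quotient of consecutive coefficients of E(-tz),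
      -- up to sign.
      q-K-sum : ∀ l s α → K m l (q (suc s) Ψ) α + sumK l s α ≈ sgn (suc s) (K m l (suc s ▹ Ψ) α) - t * sgn s (K m (suc l) (s ▹ Ψ) α)
      q-K-sum l s α = begin
        K m l (q (suc s) Ψ) α + sumK l s α
          ≈⟨ +-cong (trans (lcong (K-linear m l) (q-suc s Ψ) α) (trans (ladd (K-linear m l) _ _ α)
                (+-cong (lsgn (K-linear m l) (suc s) (suc s ▹ Ψ) α) (trans (lneg (K-linear m l) _ α)
                  (-‿cong (trans (lconv (K-linear m l) (λ i k β → c (suc i) * q k Ψ (suc i ∷ β)) s α)
                     (conv-cong s (λ i k _ → lscale (K-linear m l) (c (suc i)) (suc i ▹ q k Ψ) α))))))))
               (trans (conv-cong s (λ i k _ → distribˡ _ _ _)) (conv-+ _ _ s)) ⟩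
        (x - y) + (y + z) ≈⟨ solve (x ∷ y ∷ z ∷ []) ((v0 :- v1) :+ (v1 :+ v2)) (v0 :+ v2) ≡.refl ⟩
        x + z ≈⟨ +-congˡ z≈ ⟩
        x - t * sgn s (K m (suc l) (s ▹ Ψ) α) ∎
        where
        x = sgn (suc s) (K m l (suc s ▹ Ψ) α)
        y = conv (λ i k → c (suc i) * K m l (suc i ▹ q k Ψ) α) s
        z = conv (λ i k → c (suc i) * K m (suc l) (i ▹ q k Ψ) α) s
        z≈ : z ≈ - (t * sgn s (K m (suc l) (s ▹ Ψ) α))
        z≈ = begin
          z ≈⟨ conv-cong s (λ i k _ → trans (*-congʳ (c-suc i)) (trans (≈-sym (-‿distribˡ-* _ _)) (-‿cong (*-assoc _ _ _)))) ⟩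
          conv (λ i k → - (t * (c i * K m (suc l) (i ▹ q k Ψ) α))) s
            ≈⟨ trans (conv-neg _ s) (-‿cong (conv-*ˡ t _ s)) ⟩
          - (t * conv (λ i k → c i * K m (suc l) (i ▹ q k Ψ) α) s)
            ≈⟨ -‿cong (*-congˡ (begin
                conv (λ i k → c i * K m (suc l) (i ▹ q k Ψ) α) s
                  ≈⟨ conv-cong s (λ i k _ → lscale (K-linear m (suc l)) (c i) (i ▹ q k Ψ) α) ⟨
                conv (λ i k → K m (suc l) (λ β → c i * q k Ψ (i ∷ β)) α) s
                  ≈⟨ lconv (K-linear m (suc l)) (λ i k β → c i * q k Ψ (i ∷ β)) s α ⟨
                K m (suc l) (λ β → conv (λ i k → c i * q k Ψ (i ∷ β)) s) α
                  ≈⟨ lcong (K-linear m (suc l)) (q-sum s g) α ⟩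
                K m (suc l) (λ β → sgn s (Ψ (s ∷ β))) α ≈⟨ lsgn (K-linear m (suc l)) s (s ▹ Ψ) α ⟩
                sgn s (K m (suc l) (s ▹ Ψ) α) ∎)) ⟩
          - (t * sgn s (K m (suc l) (s ▹ Ψ) α)) ∎

      private
        -- The value of `q s (K m l Ψ)` that `q-past-K` predicts; it is identified by checking the
        -- recursion of `q`.
        Θ : ℕ → ℕ → Fun
        Θ l zero = K m l Ψ
        Θ l (suc s) α = t * Θ (suc l) s α + K m l (q (suc s) Ψ) α - K m (suc l) (q s Ψ) α

        sumΘ : ℕ → ℕ → List ℕ → A
        sumΘ l s α = conv (λ i k → c (suc i) * Θ l k (suc i ∷ α)) s

        sumΘ-suc : ∀ l s α → sumΘ l (suc s) α ≈ t * sumΘ (suc l) s α + sumK l (suc s) α - sumK (suc l) s α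
        sumΘ-suc l s α = begin
          sumΘ l (suc s) α ≈⟨ conv-last (λ i k → c (suc i) * Θ l k (suc i ∷ α)) s ⟩
          conv (λ i k → c (suc i) * (t * Θ (suc l) k (suc i ∷ α) + K m l (q (suc k) Ψ) (suc i ∷ α) - K m (suc l) (q k Ψ) (suc i ∷ α))) s
            + z ≈⟨ +-congʳ (trans (conv-cong s (λ i k _ → solve (c (suc i) ∷ t ∷ Θ (suc l) k (suc i ∷ α) ∷ K m l (q (suc k) Ψ) (suc i ∷ α) ∷ K m (suc l) (q k Ψ) (suc i ∷ α) ∷ [])
                       (v0 :* (v1 :* v2 :+ v3 :- v4)) (v1 :* (v0 :* v2) :+ v0 :* v3 :- v0 :* v4) ≡.refl))
                     (trans (conv-+ _ _ s) (+-cong (trans (conv-+ _ _ s) (+-congʳ (conv-*ˡ t _ s))) (conv-neg _ s)))) ⟩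
          (t * sumΘ (suc l) s α + y - sumK (suc l) s α) + z
            ≈⟨ solve (t * sumΘ (suc l) s α ∷ y ∷ sumK (suc l) s α ∷ z ∷ []) ((v0 :+ v1 :- v2) :+ v3) (v0 :+ (v1 :+ v3) :- v2) ≡.refl ⟩
          t * sumΘ (suc l) s α + (y + z) - sumK (suc l) s α
            ≈⟨ +-congʳ (+-congˡ (conv-last (λ i k → c (suc i) * K m l (q k Ψ) (suc i ∷ α)) s)) ⟨
          t * sumΘ (suc l) s α + sumK l (suc s) α - sumK (suc l) s α ∎
          where
          y = conv (λ i k → c (suc i) * K m l (q (suc k) Ψ) (suc i ∷ α)) s
          z = c (suc (suc s)) * K m l Ψ (suc (suc s) ∷ α)

        Θ-spec : ∀ s l α → Θ l (suc s) α ≈ sgn (suc s) (K m l Ψ (suc s ∷ α)) - sumΘ l s α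
        Θ-spec zero l α = begin
          t * w + Kq - w
            ≈⟨ solve (t ∷ w ∷ Kq ∷ p ∷ w′ ∷ cK ∷ []) (v0 :* v1 :+ v2 :- v1)
                 (((:0 :- (v3 :+ v4)) :- v5) :+ ((v2 :+ v5 :- ((:0 :- v3) :- v0 :* v4)) :+ (v1 :- v4) :* (v0 :- :1))) ≡.refl ⟩
          ((0# - (p + w′)) - cK) + ((Kq + cK - ((0# - p) - t * w′)) + (w - w′) * (t - 1#))
            ≈⟨ drop0 (trans (+-cong (≈⇒-≈0 (trans (q-K-sum l 0 α) (+-congʳ (≈-sym (+-identityˡ _)))))
                 (trans (*-congʳ (≈⇒-≈0 (≈-sym (lcong (K-linear m (suc l)) (drop g) α)))) (zeroˡ _))) (+-identityʳ _)) ⟩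
          (0# - (p + w′)) - cK ≈⟨ +-congʳ (+-identityˡ _) ⟩
          - (p + w′) - cK ∎
          where
          w = K m (suc l) Ψ α
          w′ = K m (suc l) (0 ▹ Ψ) α
          p = K m l (1 ▹ Ψ) α
          Kq = K m l (q 1 Ψ) α
          cK = c 1 * K m l Ψ (1 ∷ α)
        Θ-spec (suc s) l α = begin
          t * Θ (suc l) (suc s) α + Kq₂ - Kq₁
            ≈⟨ +-congʳ (+-congʳ (*-congˡ (Θ-spec s (suc l) α))) ⟩
          t * (- (sgn s (p + r)) - S) + Kq₂ - Kq₁
            ≈⟨ +-congʳ (+-congʳ (*-congˡ (+-congʳ (trans (-‿cong (sgn-+ s p r)) (≈-sym (+-identityˡ _)))))) ⟩
          t * ((0# - (p′ + r′)) - S) + Kq₂ - Kq₁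
            ≈⟨ solve (t ∷ p′ ∷ r′ ∷ S ∷ Kq₂ ∷ Kq₁ ∷ S₂ ∷ S₁ ∷ x′ ∷ []) (v0 :* ((:0 :- (v1 :+ v2)) :- v3) :+ v4 :- v5)
                 ((v8 :+ v1 :- (v0 :* v3 :+ v6 :- v7)) :+ ((v4 :+ v6 :- (v8 :- v0 :* (:0 :- v1))) :- (v5 :+ v7 :- ((:0 :- v1) :- v0 :* v2)))) ≡.refl ⟩
          (x′ + p′ - (t * S + S₂ - S₁)) + ((Kq₂ + S₂ - (x′ - t * (0# - p′))) - (Kq₁ + S₁ - ((0# - p′) - t * r′)))
            ≈⟨ drop0 (trans (+-cong (≈⇒-≈0 (trans (q-K-sum l (suc s) α) (+-congˡ (-‿cong (*-congˡ (≈-sym (+-identityˡ _)))))))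
                  (-‿cong (≈⇒-≈0 (trans (q-K-sum (suc l) s α) (+-congʳ (≈-sym (+-identityˡ _))))))) (-‿inverseʳ 0#)) ⟩
          x′ + p′ - (t * S + S₂ - S₁) ≈⟨ +-cong (x′+p′) (-‿cong (sumΘ-suc l s α)) ⟨
          sgn (suc (suc s)) (K m l Ψ (suc (suc s) ∷ α)) - sumΘ l (suc s) α ∎
          where
          p = K m (suc l) (suc s ▹ Ψ) α
          r = K m (suc (suc l)) (s ▹ Ψ) α
          p′ = sgn s p
          r′ = sgn s r
          S = sumΘ (suc l) s α
          Kq₂ = K m l (q (suc (suc s)) Ψ) α
          Kq₁ = K m (suc l) (q (suc s) Ψ) α
          S₂ = sumK l (suc s) α
          S₁ = sumK (suc l) s α
          x′ = sgn (suc (suc s)) (K m l (suc (suc s) ▹ Ψ) α)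
          x′+p′ : sgn (suc (suc s)) (K m l (suc (suc s) ▹ Ψ) α + p) ≈ x′ + p′
          x′+p′ = trans (sgn-+ (suc (suc s)) _ p) (+-congˡ (⁻¹-involutive p′))

      q-past-K : ∀ s l α → q (suc s) (K m l Ψ) α - t * q s (K m (suc l) Ψ) α ≈ K m l (q (suc s) Ψ) α - K m (suc l) (q s Ψ) α
      q-past-K s l α = begin
        q (suc s) (K m l Ψ) α - t * q s (K m (suc l) Ψ) α
          ≈⟨ +-cong (q-unique (K m l Ψ) (Θ l) (λ _ → refl) (λ s α → Θ-spec s l α) (suc s) α)
                    (-‿cong (*-congˡ (q-unique (K m (suc l) Ψ) (Θ (suc l)) (λ _ → refl) (λ s α → Θ-spec s (suc l) α) s α))) ⟨
        (t * Θ (suc l) s α + x - y) - t * Θ (suc l) s α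
          ≈⟨ solve (t * Θ (suc l) s α ∷ x ∷ y ∷ []) ((v0 :+ v1 :- v2) :- v0) (v1 :- v2) ≡.refl ⟩
        x - y ∎
        where x = K m l (q (suc s) Ψ) α ; y = K m (suc l) (q s Ψ) α

      q̂-past-K : ∀ n s l α → q̂ n (suc s) (K m l Ψ) α - t * q̂ n s (K m (suc l) Ψ) α ≈ K m l (q̂ n (suc s) Ψ) α - K m (suc l) (q̂ n s Ψ) α
      q̂-past-K zero s l α = q-past-K s l α
      q̂-past-K (suc zero) zero l α = +-cong refl (-‿cong (trans (zeroʳ t) (≈-sym (l0 (K-linear m (suc l)) α))))
      q̂-past-K (suc (suc n)) zero l α = +-cong (≈-sym (l0 (K-linear m l) α)) (-‿cong (trans (zeroʳ t) (≈-sym (l0 (K-linear m (suc l)) α))))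
      q̂-past-K (suc n) (suc s) l α = q̂-past-K n s l α

    module _ (m : ℕ) where
      private
        KK : ℕ → ℕ → Fun → Fun
        KK l r Ψ = K m l (K m r Ψ)

        ◂-K : ∀ j r Ψ → (j ◂ K m r Ψ) ≐ λ α → K m r (j ◂ Ψ) α + K m (suc r) (j ◂◂ Ψ) α
        ◂-K zero r Ψ α = ≈-sym (trans (+-cong (l0 (K-linear m r) α) (l0 (K-linear m (suc r)) α)) (+-identityˡ _))
        ◂-K (suc j) r Ψ α = refl

        KK-∷ : ∀ l r Ψ j α → KK l r Ψ (j ∷ α) ≈
          (KK l r (j ▹ Ψ) α + KK l (suc r) (j ◂ Ψ) α) + (KK (suc l) r (j ◂ Ψ) α + KK (suc l) (suc r) (j ◂◂ Ψ) α)
        KK-∷ l r Ψ j α = +-cong (ladd (K-linear m l) (K m r (j ▹ Ψ)) (K m (suc r) (j ◂ Ψ)) α)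
          (trans (lcong (K-linear m (suc l)) (◂-K j r Ψ) α) (ladd (K-linear m (suc l)) _ _ α))

        -- The exchange relation symmetrised in s and r. For r = s it is twice `Δ`, and as 2 may be
        -- a zero divisor, the vanishing of `Δ` is proved separately.
        R : ℕ → ℕ → Fun → Fun
        R s r Ψ α = (KK (suc s) r Ψ α - t * KK s (suc r) Ψ α) + (KK (suc r) s Ψ α - t * KK r (suc s) Ψ α)

        Δ : ℕ → Fun → Fun
        Δ s Ψ α = KK (suc s) s Ψ α - t * KK s (suc s) Ψ α

        base : ∀ s r {Ψ} → Good Ψ → KK (suc s) r Ψ [] - t * KK s (suc r) Ψ [] ≈
               q̂ m r (q̂ m (suc s) Ψ) [] - q̂ m (suc r) (q̂ m s Ψ) []
        base s r g = q̂-past-K m g m s r []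

        -- On the empty product the relation reduces to the commutation of the operators `q̂`. A
        -- further factor e_j splits it into four relations of the same kind with s and r kept or
        -- raised.
        R≈0 : ∀ α s r {Ψ} → Good Ψ → R s r Ψ α ≈ 0#
        R≈0 [] s r {Ψ} g = trans (+-cong (base s r g) (trans (base r s g) (+-cong (q̂-comm m s m (suc r) g []) (-‿cong (q̂-comm m (suc s) m r g [])))))
          (solve (q̂ m r (q̂ m (suc s) Ψ) [] ∷ q̂ m (suc r) (q̂ m s Ψ) [] ∷ []) ((v0 :- v1) :+ (v1 :- v0)) :0 ≡.refl)
        R≈0 (j ∷ α) s r {Ψ} g = begin
          R s r Ψ (j ∷ α)
            ≈⟨ +-cong (+-cong (KK-∷ (suc s) r Ψ j α) (-‿cong (*-congˡ (KK-∷ s (suc r) Ψ j α))))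
                      (+-cong (KK-∷ (suc r) s Ψ j α) (-‿cong (*-congˡ (KK-∷ r (suc s) Ψ j α)))) ⟩
          _ ≈⟨ regroup t (KK (suc s) r (j ▹ Ψ) α) (KK (suc s) (suc r) (j ◂ Ψ) α) (KK (suc (suc s)) r (j ◂ Ψ) α) (KK (suc (suc s)) (suc r) (j ◂◂ Ψ) α)
                 (KK s (suc r) (j ▹ Ψ) α) (KK s (suc (suc r)) (j ◂ Ψ) α) (KK (suc s) (suc r) (j ◂ Ψ) α) (KK (suc s) (suc (suc r)) (j ◂◂ Ψ) α)
                 (KK (suc r) s (j ▹ Ψ) α) (KK (suc r) (suc s) (j ◂ Ψ) α) (KK (suc (suc r)) s (j ◂ Ψ) α) (KK (suc (suc r)) (suc s) (j ◂◂ Ψ) α)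
                 (KK r (suc s) (j ▹ Ψ) α) (KK r (suc (suc s)) (j ◂ Ψ) α) (KK (suc r) (suc s) (j ◂ Ψ) α) (KK (suc r) (suc (suc s)) (j ◂◂ Ψ) α) ⟩
          (R s r (j ▹ Ψ) α + (R (suc s) r (j ◂ Ψ) α + R s (suc r) (j ◂ Ψ) α)) + R (suc s) (suc r) (j ◂◂ Ψ) α
            ≈⟨ +-cong (+-cong (R≈0 α s r (good-▹ j g)) (+-cong (R≈0 α (suc s) r (good-◂ j g)) (R≈0 α s (suc r) (good-◂ j g)))) (R≈0 α (suc s) (suc r) (good-◂◂ j g)) ⟩
          (0# + (0# + 0#)) + 0# ≈⟨ trans (+-identityʳ _) (trans (+-identityˡ _) (+-identityˡ _)) ⟩
          0# ∎
          where
          pairUp : ∀ t a b x y p r z w → (a + b + (x + y)) - t * (p + r + (z + w)) ≈ (a - t * p) + ((x - t * z) + (b - t * r)) + (y - t * w)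
          pairUp t a b x y p r z w = solve (t ∷ a ∷ b ∷ x ∷ y ∷ p ∷ r ∷ z ∷ w ∷ [])
            ((v1 :+ v2 :+ (v3 :+ v4)) :- v0 :* (v5 :+ v6 :+ (v7 :+ v8)))
            ((v1 :- v0 :* v5) :+ ((v3 :- v0 :* v7) :+ (v2 :- v0 :* v6)) :+ (v4 :- v0 :* v8)) ≡.refl
          regroup : ∀ t a₁ a₂ a₃ a₄ b₁ b₂ b₃ b₄ c₁ c₂ c₃ c₄ d₁ d₂ d₃ d₄ →
            ((a₁ + a₂ + (a₃ + a₄)) - t * (b₁ + b₂ + (b₃ + b₄))) + ((c₁ + c₂ + (c₃ + c₄)) - t * (d₁ + d₂ + (d₃ + d₄))) ≈
            (((a₁ - t * b₁) + (c₁ - t * d₁)) + (((a₃ - t * b₃) + (c₂ - t * d₂)) + ((a₂ - t * b₂) + (c₃ - t * d₃)))) + ((a₄ - t * b₄) + (c₄ - t * d₄))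
          regroup t a₁ a₂ a₃ a₄ b₁ b₂ b₃ b₄ c₁ c₂ c₃ c₄ d₁ d₂ d₃ d₄ =
            trans (+-cong (pairUp t a₁ a₂ a₃ a₄ b₁ b₂ b₃ b₄) (pairUp t c₁ c₂ c₃ c₄ d₁ d₂ d₃ d₄))
              (solve ((a₁ - t * b₁) ∷ (a₃ - t * b₃) ∷ (a₂ - t * b₂) ∷ (a₄ - t * b₄) ∷ (c₁ - t * d₁) ∷ (c₃ - t * d₃) ∷ (c₂ - t * d₂) ∷ (c₄ - t * d₄) ∷ [])
                (v0 :+ (v1 :+ v2) :+ v3 :+ (v4 :+ (v5 :+ v6) :+ v7)) ((v0 :+ v4) :+ ((v1 :+ v6) :+ (v2 :+ v5)) :+ (v3 :+ v7)) ≡.refl)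

        Δ≈0 : ∀ α s {Ψ} → Good Ψ → Δ s Ψ α ≈ 0#
        Δ≈0 [] s g = trans (base s s g) (≈⇒-≈0 (q̂-comm m s m (suc s) g []))
        Δ≈0 (j ∷ α) s {Ψ} g = begin
          Δ s Ψ (j ∷ α) ≈⟨ +-cong (KK-∷ (suc s) s Ψ j α) (-‿cong (*-congˡ (KK-∷ s (suc s) Ψ j α))) ⟩
          _ ≈⟨ solve (t ∷ KK (suc s) s (j ▹ Ψ) α ∷ KK (suc s) (suc s) (j ◂ Ψ) α ∷ KK (suc (suc s)) s (j ◂ Ψ) α ∷ KK (suc (suc s)) (suc s) (j ◂◂ Ψ) α
                   ∷ KK s (suc s) (j ▹ Ψ) α ∷ KK s (suc (suc s)) (j ◂ Ψ) α ∷ KK (suc s) (suc (suc s)) (j ◂◂ Ψ) α ∷ [])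
                 (((v1 :+ v2) :+ (v3 :+ v4)) :- v0 :* ((v5 :+ v6) :+ (v2 :+ v7)))
                 ((v1 :- v0 :* v5) :+ ((v3 :- v0 :* v2) :+ (v2 :- v0 :* v6)) :+ (v4 :- v0 :* v7)) ≡.refl ⟩
          Δ s (j ▹ Ψ) α + R (suc s) s (j ◂ Ψ) α + Δ (suc s) (j ◂◂ Ψ) α
            ≈⟨ +-cong (+-cong (Δ≈0 α s (good-▹ j g)) (R≈0 α (suc s) s (good-◂ j g))) (Δ≈0 α (suc s) (good-◂◂ j g)) ⟩
          (0# + 0#) + 0# ≈⟨ trans (+-identityʳ _) (+-identityˡ _) ⟩
          0# ∎

      K-comm : ∀ {Ψ} → Good Ψ → ∀ α → K m 1 (K m 0 Ψ) α ≈ t * K m 0 (K m 1 Ψ) α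
      K-comm g α = -≈0⇒≈ (Δ≈0 α 0 g)

    H : ℕ → Fun → Fun
    H m = K m 0

    H-comm : ∀ m {Ψ} → Good Ψ → ∀ α → H m (H (suc m) Ψ) α ≈ t * H (suc m) (H m Ψ) α
    H-comm m {Ψ} g α = begin
      H m (H (suc m) Ψ) α ≈⟨ K-suc m 0 (H (suc m) Ψ) α ⟨
      K (suc m) 1 (K (suc m) 0 Ψ) α ≈⟨ K-comm (suc m) g α ⟩
      t * K (suc m) 0 (K (suc m) 1 Ψ) α ≈⟨ *-congˡ (lcong (K-linear (suc m) 0) (K-suc m 0 Ψ) α) ⟩
      t * H (suc m) (H m Ψ) α ∎

    H-∷ : ∀ m Ψ j α → H (suc m) Ψ (j ∷ α) ≈ H (suc m) (j ▹ Ψ) α + H m (j ◂ Ψ) α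
    H-∷ m Ψ j α = +-congˡ (K-suc m 0 (j ◂ Ψ) α)

-- Gaussian binomial coefficients, sums over vertical strips and their inversion.

module GaussianStrips where
  open import Data.Nat as ℕ using (ℕ; zero; suc)
  open import Data.Nat.Tactic.RingSolver using (solve-∀)
  open import Data.List using (List; []; _∷_; length)
  open import Data.List.Relation.Binary.Permutation.Propositional as ↭ using (_↭_; prep; swap)
  open import Data.Vec using ([]; _∷_)
  open import Relation.Binary.PropositionalEquality as ≡ using (_≡_)
  open RingNormalisation
  open Convolutions
  open VertexOperators

  private
    regroup₁ : ∀ L c a W k i → suc L ℕ.* (c ℕ.+ a) ℕ.+ W ℕ.+ (k ℕ.+ i) ≡ suc L ℕ.* (c ℕ.+ a) ℕ.+ k ℕ.+ (W ℕ.+ i)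
    regroup₁ = solve-∀

    regroup₂ : ∀ L c a W k → suc L ℕ.* (c ℕ.+ a) ℕ.+ k ℕ.+ (W ℕ.+ L ℕ.* k) ≡ suc L ℕ.* (k ℕ.+ a) ℕ.+ W ℕ.+ suc L ℕ.* c
    regroup₂ = solve-∀

  module VerticalStrips (𝓚 : CommutativeRing 0ℓ 0ℓ) (t : CommutativeRing.Carrier 𝓚) where
    open CommutativeRing 𝓚 renaming (Carrier to A; sym to ≈-sym) hiding (zero)
    open FiniteSums ring
    open CommutativeRingSolver 𝓚
    open Operators 𝓚 t
    open SetoidReasoning setoid

    -- gb a b is the Gaussian binomial coefficient [a+b choose b]
    gb : ℕ → ℕ → A
    gb zero b = 1#
    gb (suc a) zero = 1#
    gb (suc a) (suc b) = gb a (suc b) + pow (suc a) * gb (suc a) b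

    gb-0 : ∀ a → gb a 0 ≈ 1#
    gb-0 zero = refl
    gb-0 (suc a) = refl

    -- The inductive step of the Gaussian binomial theorem: one more factor either raises a, or
    -- passes a others at the cost of t^a and raises k.
    pascal : ∀ (V : ℕ → ℕ → A) m → conv (λ k a → gb a k * V k a) (suc m) ≈
             conv (λ k a → gb a k * V k (suc a)) m + conv (λ k a → gb a k * (pow a * V (suc k) a)) m
    pascal V m = begin
      conv (λ k a → gb a k * V k a) (suc m)
        ≈⟨ conv-cong {λ k a → gb a k * V k a} {λ k a → g₁ k a * V k a + g₂ k a * V k a} (suc m)
             (λ k a e → trans (*-congʳ (split k a e)) (distribʳ (V k a) (g₁ k a) (g₂ k a))) ⟩
      conv (λ k a → g₁ k a * V k a + g₂ k a * V k a) (suc m) ≈⟨ conv-+ (λ k a → g₁ k a * V k a) (λ k a → g₂ k a * V k a) (suc m) ⟩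
      conv (λ k a → g₁ k a * V k a) (suc m) + conv (λ k a → g₂ k a * V k a) (suc m)
        ≈⟨ +-cong (trans (conv-last (λ k a → g₁ k a * V k a) m) (drop0 (zeroˡ _)))
             (trans (+-congʳ (zeroˡ _)) (trans (+-identityˡ _) (conv-cong m (λ k a _ →
               solve (pow a ∷ gb a k ∷ V (suc k) a ∷ []) (v0 :* v1 :* v2) (v1 :* (v0 :* v2)) ≡.refl)))) ⟩
      conv (λ k a → gb a k * V k (suc a)) m + conv (λ k a → gb a k * (pow a * V (suc k) a)) m ∎
      where
      g₁ g₂ : ℕ → ℕ → A
      g₁ k zero = 0#
      g₁ k (suc a) = gb a k
      g₂ zero a = 0#
      g₂ (suc k) a = pow a * gb a k
      split : ∀ k a → k ℕ.+ a ≡ suc m → gb a k ≈ g₁ k a + g₂ k a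
      split zero (suc a) _ = trans (≈-sym (gb-0 a)) (≈-sym (+-identityʳ _))
      split (suc k) zero _ = ≈-sym (trans (+-identityˡ _) (*-identityˡ _))
      split (suc k) (suc a) _ = refl

    -- Both sides are the Gaussian trinomial coefficient of n, x and k.
    trinomial : ∀ n x k → gb (n ℕ.+ x) k * gb n x ≈ gb n (x ℕ.+ k) * gb x k
    trinomial zero x k = trans (*-identityʳ _) (≈-sym (*-identityˡ _))
    trinomial (suc n) zero k rewrite ℕ.+-identityʳ n = refl
    trinomial (suc n) (suc x) zero rewrite ℕ.+-identityʳ x = trans (*-identityˡ _) (≈-sym (*-identityʳ _))
    trinomial (suc n) (suc x) (suc k) = begin
      (gb (n ℕ.+ suc x) (suc k) + pow (suc n ℕ.+ suc x) * gb (suc n ℕ.+ suc x) k) * gb (suc n) (suc x)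
        ≈⟨ *-congʳ (+-congˡ (*-congʳ (pow-+ (suc n) (suc x)))) ⟩
      (G + pn * px * G′) * (gb n (suc x) + pn * gb (suc n) x)
        ≈⟨ solve (G ∷ pn ∷ px ∷ G′ ∷ gb n (suc x) ∷ gb (suc n) x ∷ []) ((v0 :+ v1 :* v2 :* v3) :* (v4 :+ v1 :* v5))
             (v0 :* v4 :+ v1 :* (v0 :* v5) :+ v1 :* v2 :* (v3 :* (v4 :+ v1 :* v5))) ≡.refl ⟩
      G * gb n (suc x) + pn * (G * gb (suc n) x) + pn * px * (G′ * gb (suc n) (suc x))
        ≈⟨ +-cong (+-cong (trinomial n (suc x) (suc k)) (*-congˡ (trans (*-congʳ (reflexive (≡.cong (λ z → gb z (suc k)) (ℕ.+-suc n x)))) (trinomial (suc n) x (suc k)))))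
                  (*-congˡ (trinomial (suc n) (suc x) k)) ⟩
      gb n (suc x ℕ.+ suc k) * gb (suc x) (suc k) + pn * (gb (suc n) (x ℕ.+ suc k) * gb x (suc k)) + pn * px * (gb (suc n) (suc x ℕ.+ k) * gb (suc x) k)
        ≈⟨ +-congˡ (*-congˡ (*-congʳ (reflexive (≡.cong (gb (suc n)) (≡.sym (ℕ.+-suc x k)))))) ⟩
      U * (B₁ + px * B₂) + pn * (W * B₁) + pn * px * (W * B₂)
        ≈⟨ solve (U ∷ B₁ ∷ px ∷ B₂ ∷ pn ∷ W ∷ []) (v0 :* (v1 :+ v2 :* v3) :+ v4 :* (v5 :* v1) :+ v4 :* v2 :* (v5 :* v3)) ((v0 :+ v4 :* v5) :* (v1 :+ v2 :* v3)) ≡.refl ⟩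
      (U + pn * W) * (B₁ + px * B₂) ∎
      where
      pow-+ : ∀ i j → pow (i ℕ.+ j) ≈ pow i * pow j
      pow-+ zero j = ≈-sym (*-identityˡ _)
      pow-+ (suc i) j = trans (*-congˡ (pow-+ i j)) (≈-sym (*-assoc _ _ _))
      G = gb (n ℕ.+ suc x) (suc k) ; G′ = gb (suc n ℕ.+ suc x) k ; pn = pow (suc n) ; px = pow (suc x)
      U = gb n (suc x ℕ.+ suc k) ; W = gb (suc n) (x ℕ.+ suc k) ; B₁ = gb x (suc k) ; B₂ = gb (suc x) k

    -- t^{x(x−1)/2}
    tri : ℕ → A
    tri zero = 1#
    tri (suc x) = pow x * tri x

    -- Up to sign this is ∏ (1 - t^i z), 0 ≤ i ≤ y, at z = 1. Here the two halves of Pascal's rule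
    -- are opposite to each other.
    alternating : ∀ y → conv (λ k x → gb x k * sgn k (tri x)) (suc y) ≈ 0#
    alternating y = begin
      conv (λ k x → gb x k * sgn k (tri x)) (suc y) ≈⟨ pascal (λ k x → sgn k (tri x)) y ⟩
      conv (λ k x → gb x k * sgn k (pow x * tri x)) y + conv (λ k x → gb x k * (pow x * - sgn k (tri x))) y
        ≈⟨ +-congˡ (trans (conv-cong y (λ k x _ → trans (*-congˡ (trans (≈-sym (-‿distribʳ-* _ _)) (-‿cong (≈-sym (sgn-*ʳ k _ _))))) (≈-sym (-‿distribʳ-* _ _)))) (conv-neg _ y)) ⟩
      S - S ≈⟨ -‿inverseʳ _ ⟩
      0# ∎
      where
      open RingProperties ring using (-‿distribʳ-*)
      S = conv (λ k x → gb x k * sgn k (pow x * tri x)) y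

    iter : ℕ → (Fun → Fun) → Fun → Fun
    iter zero L Ψ = Ψ
    iter (suc n) L Ψ = L (iter n L Ψ)

    iter-linear : ∀ n {L} → Linear L → Linear (iter n L)
    iter-linear zero l = record { lcong = λ p → p ; ladd = λ _ _ _ → refl ; lscale = λ _ _ _ → refl }
    iter-linear (suc n) l = linear-∘ l (iter-linear n l)

    iter-good : ∀ n m {Ψ} → Good Ψ → Good (iter n (H m) Ψ)
    iter-good zero m g = g
    iter-good (suc n) m g = K-good m 0 (iter-good n m g)

    iter-+ : ∀ m n L Ψ → iter m L (iter n L Ψ) ≡ iter (m ℕ.+ n) L Ψ
    iter-+ zero n L Ψ = ≡.refl
    iter-+ (suc m) n L Ψ = ≡.cong L (iter-+ m n L Ψ)

    H-past-iter : ∀ m a {Ψ} → Good Ψ → ∀ α → H m (iter a (H (suc m)) Ψ) α ≈ pow a * iter a (H (suc m)) (H m Ψ) α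
    H-past-iter m zero g α = ≈-sym (*-identityˡ _)
    H-past-iter m (suc a) {Ψ} g α = begin
      H m (H (suc m) (iter a (H (suc m)) Ψ)) α ≈⟨ H-comm m (iter-good a (suc m) g) α ⟩
      t * H (suc m) (H m (iter a (H (suc m)) Ψ)) α
        ≈⟨ *-congˡ (trans (lcong (K-linear (suc m) 0) (H-past-iter m a g) α) (lscale (K-linear (suc m) 0) (pow a) _ α)) ⟩
      t * (pow a * iter (suc a) (H (suc m)) (H m Ψ) α) ≈⟨ *-assoc _ _ _ ⟨
      pow (suc a) * iter (suc a) (H (suc m)) (H m Ψ) α ∎

    sh : ℕ → ℕ → Fun → Fun
    sh zero j Ψ = j ▹ Ψ
    sh (suc k) zero Ψ = λ _ → 0#
    sh (suc k) (suc j) Ψ = sh k j Ψ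

    good-sh : ∀ k j {Ψ} → Good Ψ → Good (sh k j Ψ)
    good-sh zero j g = good-▹ j g
    good-sh (suc k) zero g = good-0
    good-sh (suc k) (suc j) g = good-sh k j g

    module _ (r : ℕ) where
      private
        P O : Fun → Fun
        P = H (suc r)
        O = H r
        PO : ℕ → ℕ → Fun → Fun
        PO a k Ψ = iter a P (iter k O Ψ)
        lin : ∀ a k → Linear (PO a k)
        lin a k = linear-∘ (iter-linear a (K-linear (suc r) 0)) (iter-linear k (K-linear r 0))

      -- The Gaussian binomial theorem for operators with O P = t P O: each factor P either stays,
      -- or takes one from j and becomes O.
      ▹-iter : ∀ m j {Ψ} → Good Ψ → (j ▹ iter m P Ψ) ≐ λ α → conv (λ k a → gb a k * PO a k (sh k j Ψ) α) m
      ▹-iter zero j g α = ≈-sym (*-identityˡ _)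
      ▹-iter (suc m) j {Ψ} g α = begin
        P (iter m P Ψ) (j ∷ α) ≈⟨ H-∷ r (iter m P Ψ) j α ⟩
        P (j ▹ iter m P Ψ) α + O (j ◂ iter m P Ψ) α
          ≈⟨ +-cong (trans (lcong (K-linear (suc r) 0) (▹-iter m j g) α) (through (K-linear (suc r) 0) (λ k → sh k j Ψ)))
                    (trans (lcong (K-linear r 0) (pred j) α) (trans (through (K-linear r 0) (λ k → sh (suc k) j Ψ))
                      (conv-cong m (λ k a _ → *-congˡ (commute k a))))) ⟩
        conv (λ k a → gb a k * PO (suc a) k (sh k j Ψ) α) m + conv (λ k a → gb a k * (pow a * PO a (suc k) (sh (suc k) j Ψ) α)) m
          ≈⟨ pascal (λ k a → PO a k (sh k j Ψ) α) m ⟨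
        conv (λ k a → gb a k * PO a k (sh k j Ψ) α) (suc m) ∎
        where
        through : ∀ {L} (l : Linear L) (G : ℕ → Fun) →
          L (λ α → conv (λ k a → gb a k * PO a k (G k) α) m) α ≈ conv (λ k a → gb a k * L (PO a k (G k)) α) m
        through l G = trans (lconv l (λ k a α → gb a k * PO a k (G k) α) m α) (conv-cong m (λ k a _ → lscale l (gb a k) (PO a k (G k)) α))
        pred : ∀ j → (j ◂ iter m P Ψ) ≐ λ α → conv (λ k a → gb a k * PO a k (sh (suc k) j Ψ) α) m
        pred zero α = ≈-sym (conv-0 m (λ k a _ → trans (*-congˡ (l0 (lin a k) α)) (zeroʳ _)))
        pred (suc j) α = ▹-iter m j g α
        commute : ∀ k a → O (PO a k (sh (suc k) j Ψ)) α ≈ pow a * PO a (suc k) (sh (suc k) j Ψ) α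
        commute k a = H-past-iter r a (iter-good k r (good-sh (suc k) j g)) α

    ε : Fun
    ε [] = 1#
    ε (zero ∷ α) = ε α
    ε (suc j ∷ α) = 0#

    ε-good : Good ε
    ε-good = record { perm = pm ; drop = λ _ → refl }
      where
      pm : ∀ {α β} → α ↭ β → ε α ≈ ε β
      pm ↭.refl = refl
      pm (prep zero p) = pm p
      pm (prep (suc j) p) = refl
      pm (swap zero zero p) = pm p
      pm (swap zero (suc j) p) = refl
      pm (swap (suc i) zero p) = refl
      pm (swap (suc i) (suc j) p) = refl
      pm (↭.trans p q) = trans (pm p) (pm q)

    private
      q-ε : ∀ l → q (suc l) ε [] ≈ 0#
      q-ε l = trans (q-suc l ε []) (trans (+-cong (sgn-0 (suc l)) (-‿cong (conv-0 l (λ i k _ → trans (*-congˡ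
        (trans (≈-sym (q-▹ k (suc i) ε-good [])) (l0 (q-linear k) []))) (zeroʳ _))))) (-‿inverseʳ 0#))

      K-ε : ∀ l α → K 0 (suc l) ε α ≈ 0#
      K-ε l [] = q-ε l
      K-ε l (zero ∷ α) = trans (+-cong (K-ε l α) (l0 (K-linear 0 (suc (suc l))) α)) (+-identityʳ _)
      K-ε l (suc zero ∷ α) = trans (+-cong (l0 (K-linear 0 (suc l)) α) (K-ε (suc l) α)) (+-identityʳ _)
      K-ε l (suc (suc j) ∷ α) = trans (+-cong (l0 (K-linear 0 (suc l)) α) (l0 (K-linear 0 (suc (suc l))) α)) (+-identityʳ _)

    -- Allows parts that have been lowered to 0 to be discarded.
    H-ε : H 0 ε ≐ ε
    H-ε [] = refl
    H-ε (zero ∷ α) = trans (+-cong (H-ε α) (l0 (K-linear 0 1) α)) (+-identityʳ _)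
    H-ε (suc zero ∷ α) = trans (+-cong (l0 (K-linear 0 0) α) (K-ε 0 α)) (+-identityʳ _)
    H-ε (suc (suc j) ∷ α) = trans (+-cong (l0 (K-linear 0 0) α) (l0 (K-linear 0 1) α)) (+-identityʳ _)

    iter-H-ε : ∀ k → iter k (H 0) ε ≐ ε
    iter-H-ε zero α = refl
    iter-H-ε (suc k) α = trans (lcong (K-linear 0 0) (iter-H-ε k) α) (H-ε α)

    -- A partition is represented by the list m_r, …, m_1 of its multiplicities.
    Φ : List ℕ → Fun
    Φ [] = ε
    Φ (m ∷ ms) = iter m (H (suc (length ms))) (Φ ms)

    Φ-good : ∀ ms → Good (Φ ms)
    Φ-good [] = ε-good
    Φ-good (m ∷ ms) = iter-good m (suc (length ms)) (Φ-good ms)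

    -- Sum over the vertical strips λ/μ: of the m_r parts equal to r, k are decreased to r − 1 and
    -- a are kept; c is the number of parts received from r + 1.
    vsum : List ℕ → ℕ → (ℕ → List ℕ → A) → A
    vsum [] c g = g 0 []
    vsum (m ∷ ms) c g = conv (λ k a → gb a k * vsum ms k (λ i ns → g (k ℕ.+ i) ((c ℕ.+ a) ∷ ns))) m

    wt : List ℕ → ℕ
    wt [] = 0
    wt (m ∷ ms) = suc (length ms) ℕ.* m ℕ.+ wt ms

    -- Agreement is required only where the boxes add up: the c parts received from above have size
    -- `length ms` each, and i boxes are removed.
    vsum-cong : ∀ ms c {g g′ : ℕ → List ℕ → A} →
      (∀ i ns → length ns ≡ length ms → wt ns ℕ.+ i ≡ wt ms ℕ.+ length ms ℕ.* c → g i ns ≈ g′ i ns) → vsum ms c g ≈ vsum ms c g′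
    vsum-cong [] c p = p 0 [] ≡.refl ≡.refl
    vsum-cong (m ∷ ms) c p = conv-cong m (λ k a e → *-congˡ (vsum-cong ms k (λ i ns l w →
      p (k ℕ.+ i) ((c ℕ.+ a) ∷ ns) (≡.cong suc l) (weights k a e i ns l w))))
      where
      weights : ∀ k a → k ℕ.+ a ≡ m → ∀ i ns → length ns ≡ length ms → wt ns ℕ.+ i ≡ wt ms ℕ.+ length ms ℕ.* k →
        suc (length ns) ℕ.* (c ℕ.+ a) ℕ.+ wt ns ℕ.+ (k ℕ.+ i) ≡ suc (length ms) ℕ.* m ℕ.+ wt ms ℕ.+ suc (length ms) ℕ.* c
      weights k a ≡.refl i ns l w rewrite l = ≡.trans
        (regroup₁ (length ms) c a (wt ns) k i)
        (≡.trans (≡.cong (suc (length ms) ℕ.* (c ℕ.+ a) ℕ.+ k ℕ.+_) w)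
        (regroup₂ (length ms) c a (wt ms) k))

    vsum-0 : ∀ ms c {g} → (∀ i ns → g i ns ≈ 0#) → vsum ms c g ≈ 0#
    vsum-0 [] c p = p 0 []
    vsum-0 (m ∷ ms) c p = conv-0 m (λ k a _ → trans (*-congˡ (vsum-0 ms k (λ i ns → p _ _))) (zeroʳ _))

    vsum-+ : ∀ ms c g g′ → vsum ms c (λ i ns → g i ns + g′ i ns) ≈ vsum ms c g + vsum ms c g′
    vsum-+ [] c g g′ = refl
    vsum-+ (m ∷ ms) c g g′ = trans (conv-cong m (λ k a _ → trans (*-congˡ (vsum-+ ms k _ _)) (distribˡ _ _ _))) (conv-+ _ _ m)

    vsum-* : ∀ ms c x g → vsum ms c (λ i ns → x * g i ns) ≈ x * vsum ms c g
    vsum-* [] c x g = refl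
    vsum-* (m ∷ ms) c x g = trans (conv-cong m (λ k a _ → trans (*-congˡ (vsum-* ms k x _))
      (solve (gb a k ∷ x ∷ vsum ms k (λ i ns → g (k ℕ.+ i) ((c ℕ.+ a) ∷ ns)) ∷ []) (v0 :* (v1 :* v2)) (v1 :* (v0 :* v2)) ≡.refl))) (conv-*ˡ x _ m)

    vsum-sgn : ∀ ms c j g → vsum ms c (λ i ns → sgn j (g i ns)) ≈ sgn j (vsum ms c g)
    vsum-sgn [] c j g = refl
    vsum-sgn (m ∷ ms) c j g = trans (conv-cong m (λ k a _ → trans (*-congˡ (vsum-sgn ms k j _)) (≈-sym (sgn-*ʳ j _ _)))) (conv-sgn j _ m)

    vsum-conv : ∀ ms c (G : ℕ → ℕ → ℕ → List ℕ → A) s →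
      vsum ms c (λ i ns → conv (λ x y → G x y i ns) s) ≈ conv (λ x y → vsum ms c (G x y)) s
    vsum-conv ms c G zero = refl
    vsum-conv ms c G (suc s) = trans (vsum-+ ms c (G 0 (suc s)) _) (+-congˡ (vsum-conv ms c (λ x → G (suc x)) s))

    sel : ℕ → ℕ → A → A
    sel zero zero x = x
    sel zero (suc j) x = 0#
    sel (suc i) zero x = 0#
    sel (suc i) (suc j) x = sel i j x

    sel-cong : ∀ i j {x y} → x ≈ y → sel i j x ≈ sel i j y
    sel-cong zero zero p = p
    sel-cong zero (suc j) p = refl
    sel-cong (suc i) zero p = refl
    sel-cong (suc i) (suc j) p = sel-cong i j p

    lsel : ∀ {L} → Linear L → ∀ i j Ψ → L (λ α → sel i j (Ψ α)) ≐ λ α → sel i j (L Ψ α)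
    lsel l zero zero Ψ α = refl
    lsel l zero (suc j) Ψ α = l0 l α
    lsel l (suc i) zero Ψ α = l0 l α
    lsel l (suc i) (suc j) Ψ α = lsel l i j Ψ α

    lvsum : ∀ {L} → Linear L → ∀ ms c (G : ℕ → List ℕ → Fun) →
            L (λ α → vsum ms c (λ i ns → G i ns α)) ≐ λ α → vsum ms c (λ i ns → L (G i ns) α)
    lvsum l [] c G α = refl
    lvsum l (m ∷ ms) c G α = trans (lconv l (λ k a α → gb a k * vsum ms k (λ i ns → G (k ℕ.+ i) ((c ℕ.+ a) ∷ ns) α)) m α)
      (conv-cong m (λ k a _ → trans (lscale l (gb a k) _ α) (*-congˡ (lvsum l ms k (λ i ns → G (k ℕ.+ i) ((c ℕ.+ a) ∷ ns)) α))))

    private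
      -- The k parts just lowered to `length ms` join the kept parts of that size, as powers of one
      -- operator; if no size is left they have become 0 and disappear by `iter-H-ε`.
      vsum-carry : ∀ ms k (g : ℕ → Fun → A) → (∀ i {Ψ Ψ′} → Ψ ≐ Ψ′ → g i Ψ ≈ g i Ψ′) →
        vsum ms 0 (λ i ns → g i (iter k (H (length ms)) (Φ ns))) ≈ vsum ms k (λ i ns → g i (Φ ns))
      vsum-carry [] k g gc = gc 0 (iter-H-ε k)
      vsum-carry (m ∷ ms) k g gc = conv-cong m (λ k′ a _ → *-congˡ (vsum-cong ms k′ (λ i ns l _ →
        gc (k′ ℕ.+ i) (λ α → reflexive (≡.cong (λ Ψ → Ψ α)
          (≡.trans (≡.cong (λ n → iter k (H (suc (length ms))) (iter a (H (suc n)) (Φ ns))) l)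
            (≡.trans (iter-+ k a (H (suc (length ms))) (Φ ns))
               (≡.cong (λ n → iter (k ℕ.+ a) (H (suc n)) (Φ ns)) (≡.sym l)))))))))

    -- One size at a time: `▹-iter` decides how many of the largest parts are lowered, and the
    -- remaining j - k boxes come from the smaller parts by induction.
    e-strips : ∀ ms j α → Φ ms (j ∷ α) ≈ vsum ms 0 (λ i ns → sel i j (Φ ns α))
    e-strips [] zero α = refl
    e-strips [] (suc j) α = refl
    e-strips (m ∷ ms) j α = begin
      iter m P (Φ ms) (j ∷ α) ≈⟨ ▹-iter (length ms) m j (Φ-good ms) α ⟩
      conv (λ k a → gb a k * iter a P (iter k O (sh k j (Φ ms))) α) m
        ≈⟨ conv-cong m (λ k a _ → *-congˡ (begin
             iter a P (iter k O (sh k j (Φ ms))) α ≈⟨ lcong (lin a k) (shifted k j) α ⟩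
             iter a P (iter k O (λ α → vsum ms 0 (λ i ns → sel (k ℕ.+ i) j (Φ ns α)))) α
               ≈⟨ lvsum (lin a k) ms 0 (λ i ns α → sel (k ℕ.+ i) j (Φ ns α)) α ⟩
             vsum ms 0 (λ i ns → iter a P (iter k O (λ α → sel (k ℕ.+ i) j (Φ ns α))) α)
               ≈⟨ vsum-cong ms 0 (λ i ns _ _ → lsel (lin a k) (k ℕ.+ i) j (Φ ns) α) ⟩
             vsum ms 0 (λ i ns → sel (k ℕ.+ i) j (iter a P (iter k O (Φ ns)) α))
               ≈⟨ vsum-carry ms k (λ i Ψ → sel (k ℕ.+ i) j (iter a P Ψ α))
                    (λ i p → sel-cong (k ℕ.+ i) j (lcong (iter-linear a (K-linear (suc (length ms)) 0)) p α)) ⟩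
             vsum ms k (λ i ns → sel (k ℕ.+ i) j (iter a P (Φ ns) α))
               ≈⟨ vsum-cong ms k (λ i ns l _ → sel-cong (k ℕ.+ i) j (reflexive (≡.cong (λ n → iter a (H (suc n)) (Φ ns) α) (≡.sym l)))) ⟩
             vsum ms k (λ i ns → sel (k ℕ.+ i) j (Φ (a ∷ ns) α)) ∎)) ⟩
      vsum (m ∷ ms) 0 (λ i ns → sel i j (Φ ns α)) ∎
      where
      P O : Fun → Fun
      P = H (suc (length ms))
      O = H (length ms)
      lin : ∀ a k → Linear (λ Ψ → iter a P (iter k O Ψ))
      lin a k = linear-∘ (iter-linear a (K-linear (suc (length ms)) 0)) (iter-linear k (K-linear (length ms) 0))
      shifted : ∀ k j → sh k j (Φ ms) ≐ λ α → vsum ms 0 (λ i ns → sel (k ℕ.+ i) j (Φ ns α))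
      shifted zero j α = e-strips ms j α
      shifted (suc k) zero α = ≈-sym (vsum-0 ms 0 (λ _ _ → refl))
      shifted (suc k) (suc j) α = shifted k j α

    -- Sum over μ ⊆ λ of the coefficients ℵ(λ/μ): x is the difference of the lengths of the
    -- previous columns of λ and μ, n the multiplicity of the current part in μ.
    asum : List ℕ → ℕ → (List ℕ → A) → A
    asum [] x g = g []
    asum (m ∷ ms) x g = conv (λ n y → tri y * gb n y * asum ms y (λ ns → g (n ∷ ns))) (x ℕ.+ m)

    private
      conv-first : ∀ {F} m → (∀ y n → F (suc y) n ≈ 0#) → conv F m ≈ F 0 m
      conv-first zero p = refl
      conv-first (suc m) p = trans (+-congˡ (conv-0 m (λ i k _ → p i k))) (+-identityʳ _)

      J : List ℕ → ℕ → ℕ → (List ℕ → A) → A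
      J ms k x g = vsum ms k (λ i ns → sgn i (asum ns x g))

      -- The first multiplicity enters `asum` only through its sum with x, so the parts received
      -- from above may be credited to x.
      J-carry : ∀ ms k x g → J ms k x g ≈ J ms 0 (x ℕ.+ k) g
      J-carry [] k x g = refl
      J-carry (m ∷ ms) k x g = conv-cong m (λ k′ a _ → *-congˡ (vsum-cong ms k′ (λ i ns _ _ →
        sgn-cong (k′ ℕ.+ i) (reflexive (≡.cong (λ s → conv (λ n y → tri y * gb n y * asum ns y (λ ns → g (n ∷ ns))) s)
          (≡.sym (ℕ.+-assoc x k a)))))))

    -- By `trinomial` the sum over the number k of lowered parts factors off once the total y = k +
    -- x is fixed, and by `alternating` it vanishes unless y = 0. Then all m parts of this size are
    -- retained, and the smaller sizes follow by induction.
    strips-inverse : ∀ ms g → vsum ms 0 (λ i ns → sgn i (asum ns 0 g)) ≈ g ms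
    strips-inverse [] g = refl
    strips-inverse (m ∷ ms) g = begin
      conv (λ k a → gb a k * vsum ms k (λ i ns → sgn (k ℕ.+ i) (conv (λ n y → tri y * gb n y * asum ns y (λ ns → g (n ∷ ns))) a))) m
        ≈⟨ conv-cong m (λ k a _ → spread k a) ⟩
      conv (λ k a → conv (λ y n → F k y n) a) m ≈⟨ conv-assoc F m ⟩
      conv (λ y n → conv (λ k x → F k x n) y) m ≈⟨ conv-first m (λ y n → trans (collect (suc y) n) (trans (*-congˡ (alternating y)) (zeroʳ _))) ⟩
      F 0 0 m ≈⟨ trans (collect 0 m) (trans (*-cong (trans (*-congʳ (gb-0 m)) (*-identityˡ _)) (*-identityˡ _)) (*-identityʳ _)) ⟩
      J ms 0 0 (λ ns → g (m ∷ ns)) ≈⟨ strips-inverse ms (λ ns → g (m ∷ ns)) ⟩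
      g (m ∷ ms) ∎
      where
      J′ : ℕ → ℕ → A
      J′ y n = J ms 0 y (λ ns → g (n ∷ ns))
      F : ℕ → ℕ → ℕ → A
      F k x n = gb n (x ℕ.+ k) * J′ (x ℕ.+ k) n * (gb x k * sgn k (tri x))
      spread : ∀ k a → gb a k * vsum ms k (λ i ns → sgn (k ℕ.+ i) (conv (λ n y → tri y * gb n y * asum ns y (λ ns → g (n ∷ ns))) a))
               ≈ conv (λ y n → F k y n) a
      spread k a = begin
        gb a k * vsum ms k (λ i ns → sgn (k ℕ.+ i) (conv (λ n y → tri y * gb n y * asum ns y (λ ns → g (n ∷ ns))) a))
          ≈⟨ *-congˡ (trans (vsum-cong ms k (λ i ns _ _ → ≈-sym (sgn-sgn k i _))) (trans (vsum-sgn ms k k _)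
               (sgn-cong k (trans (vsum-cong ms k (λ i ns _ _ → ≈-sym (conv-sgn i _ a))) (vsum-conv ms k _ a))))) ⟩
        gb a k * sgn k (conv (λ n y → vsum ms k (λ i ns → sgn i (tri y * gb n y * asum ns y (λ ns → g (n ∷ ns))))) a)
          ≈⟨ trans (*-congˡ (sgn-cong k (conv-cong a (λ n y _ → trans (vsum-cong ms k (λ i ns _ _ → sgn-*ʳ i _ _)) (vsum-* ms k (tri y * gb n y) _)))))
               (trans (≈-sym (sgn-*ʳ k _ _)) (trans (sgn-cong k (≈-sym (conv-*ˡ (gb a k) _ a))) (≈-sym (conv-sgn k _ a)))) ⟩
        conv (λ n y → sgn k (gb a k * (tri y * gb n y * J ms k y (λ ns → g (n ∷ ns))))) a
          ≈⟨ conv-cong a (λ n y e → begin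
               sgn k (gb a k * (tri y * gb n y * J ms k y (λ ns → g (n ∷ ns))))
                 ≈⟨ sgn-cong k (*-congˡ (*-congˡ (J-carry ms k y (λ ns → g (n ∷ ns))))) ⟩
               sgn k (gb a k * (tri y * gb n y * J′ (y ℕ.+ k) n))
                 ≈⟨ sgn-cong k (trans (*-congʳ (reflexive (≡.cong (λ z → gb z k) (≡.sym e))))
                      (solve (gb (n ℕ.+ y) k ∷ tri y ∷ gb n y ∷ J′ (y ℕ.+ k) n ∷ []) (v0 :* (v1 :* v2 :* v3)) (v0 :* v2 :* (v3 :* v1)) ≡.refl)) ⟩
               sgn k (gb (n ℕ.+ y) k * gb n y * (J′ (y ℕ.+ k) n * tri y))
                 ≈⟨ sgn-cong k (*-congʳ (trinomial n y k)) ⟩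
               sgn k (gb n (y ℕ.+ k) * gb y k * (J′ (y ℕ.+ k) n * tri y))
                 ≈⟨ sgn-cong k (solve (gb n (y ℕ.+ k) ∷ gb y k ∷ J′ (y ℕ.+ k) n ∷ tri y ∷ []) (v0 :* v1 :* (v2 :* v3)) (v0 :* v2 :* (v1 :* v3)) ≡.refl) ⟩
               sgn k (gb n (y ℕ.+ k) * J′ (y ℕ.+ k) n * (gb y k * tri y))
                 ≈⟨ trans (sgn-*ʳ k _ _) (*-congˡ (sgn-*ʳ k _ _)) ⟩
               F k y n ∎) ⟩
        conv (λ n y → F k y n) a ≈⟨ conv-flip (λ n y → F k y n) a ⟩
        conv (λ y n → F k y n) a ∎
      collect : ∀ y n → conv (λ k x → F k x n) y ≈ gb n y * J′ y n * conv (λ k x → gb x k * sgn k (tri x)) y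
      collect y n = trans (conv-cong y (λ k x e → *-congʳ (reflexive (≡.cong (λ z → gb n z * J′ z n) (≡.trans (ℕ.+-comm x k) e))))) (conv-*ˡ _ _ y)

    private
      add : ℕ → List ℕ → List ℕ
      add c [] = []
      add c (m ∷ ms) = (c ℕ.+ m) ∷ ms

      add-0 : ∀ ms → add 0 ms ≡ ms
      add-0 [] = ≡.refl
      add-0 (m ∷ ms) = ≡.refl

    vsum-top : ∀ ms c g → (∀ i ns → g (suc i) ns ≈ 0#) → vsum ms c g ≈ g 0 (add c ms)
    vsum-top [] c g p = refl
    vsum-top (m ∷ ms) c g p = begin
      vsum (m ∷ ms) c g ≈⟨ conv-first m (λ k a → trans (*-congˡ (vsum-0 ms (suc k) (λ i ns → p _ _))) (zeroʳ _)) ⟩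
      gb m 0 * vsum ms 0 (λ i ns → g i ((c ℕ.+ m) ∷ ns)) ≈⟨ trans (*-congʳ (gb-0 m)) (*-identityˡ _) ⟩
      vsum ms 0 (λ i ns → g i ((c ℕ.+ m) ∷ ns)) ≈⟨ vsum-top ms 0 (λ i ns → g i ((c ℕ.+ m) ∷ ns)) (λ i ns → p i _) ⟩
      g 0 ((c ℕ.+ m) ∷ add 0 ms) ≈⟨ reflexive (≡.cong (λ z → g 0 ((c ℕ.+ m) ∷ z)) (add-0 ms)) ⟩
      g 0 ((c ℕ.+ m) ∷ ms) ∎

    -- The transform is unitriangular: the empty strip contributes the value at `ms` with
    -- coefficient 1, every other strip a value at smaller weight.
    signed-unique : (V W : List ℕ → A) → (∀ ms → vsum ms 0 (λ i ns → sgn i (V ns)) ≈ vsum ms 0 (λ i ns → sgn i (W ns))) →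
                    ∀ ms → V ms ≈ W ms
    signed-unique V W eq ms = strong (λ s → ∀ ms → wt ms ≡ s → V ms ≈ W ms) step (wt ms) ms ≡.refl
      where
      X : List ℕ → A
      X ns = V ns - W ns
      step : ∀ s → (∀ k → k ℕ.< s → ∀ ms → wt ms ≡ k → V ms ≈ W ms) → ∀ ms → wt ms ≡ s → V ms ≈ W ms
      step s IH ms ≡.refl = -≈0⇒≈ (begin
        X ms ≈⟨ reflexive (≡.cong X (add-0 ms)) ⟨
        g 0 (add 0 ms) ≈⟨ vsum-top ms 0 g (λ _ _ → refl) ⟨
        vsum ms 0 g ≈⟨ vsum-cong ms 0 top ⟩
        vsum ms 0 (λ i ns → sgn i (V ns) + - 1# * sgn i (W ns)) ≈⟨ trans (vsum-+ ms 0 _ _) (+-congˡ (vsum-* ms 0 (- 1#) _)) ⟩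
        vsum ms 0 (λ i ns → sgn i (V ns)) + - 1# * vsum ms 0 (λ i ns → sgn i (W ns)) ≈⟨ +-congˡ (-1*x≈-x _) ⟩
        vsum ms 0 (λ i ns → sgn i (V ns)) - vsum ms 0 (λ i ns → sgn i (W ns)) ≈⟨ ≈⇒-≈0 (eq ms) ⟩
        0# ∎)
        where
        open RingProperties ring using (-1*x≈-x)
        g : ℕ → List ℕ → A
        g zero ns = X ns
        g (suc i) ns = 0#
        top : ∀ i ns → length ns ≡ length ms → wt ns ℕ.+ i ≡ wt ms ℕ.+ length ms ℕ.* 0 → g i ns ≈ sgn i (V ns) + - 1# * sgn i (W ns)
        top zero ns _ _ = +-congˡ (≈-sym (-1*x≈-x _))
        top (suc i) ns _ w = ≈-sym (trans (+-congˡ (-1*x≈-x _)) (≈⇒-≈0 (sgn-cong (suc i) (IH (wt ns) wt< ns ≡.refl))))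
          where
          wt< : wt ns ℕ.< wt ms
          wt< = ℕ.≤-trans (ℕ.≤-trans (ℕ.m≤m+n (suc (wt ns)) i) (ℕ.≤-reflexive (≡.sym (ℕ.+-suc (wt ns) i))))
            (ℕ.≤-reflexive (≡.trans w (≡.trans (≡.cong (wt ms ℕ.+_) (ℕ.*-zeroʳ (length ms))) (ℕ.+-identityʳ _))))

-- From the rules for charge to iterated vertex operators and the expansion at X + 1.

module HallLittlewoodFunctionals where
  open import Data.Nat as ℕ using (ℕ; zero; suc; _≤_; _<_; z≤n; s≤s)
  open import Data.List using (List; []; _∷_; _++_; length; map; replicate)
  open import Data.List.Properties using (++-assoc; ++-identityʳ; map-++; length-++)
  open import Data.List.Relation.Unary.All as All using (All; []; _∷_)
  open import Data.List.Relation.Unary.AllPairs using (AllPairs; []; _∷_)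
  open import Data.List.Relation.Unary.Linked as Linked using ([]; [-]; _∷_)
  open import Data.List.Relation.Binary.Permutation.Propositional as ↭ using (_↭_; prep; swap)
  open import Data.List.Relation.Binary.Permutation.Propositional.Properties using (shift)
  open import Data.Unit using (⊤; tt)
  open import Data.Vec using ([]; _∷_)
  open import Relation.Binary.PropositionalEquality as ≡ using (_≡_; _≢_)
  open import Defs using (IsPartition; count)
  open WordCharge using (Word)
  open ChargeRotation using (count-++; count-∷; δ-≢; replicate-snoc)
  open RingNormalisation
  open Convolutions
  open PlacticWords
  open ElementaryAndComplete
  open VertexOperators
  open GaussianStrips

  alphabet : ℕ → List ℕ
  alphabet zero = []
  alphabet (suc n) = 1 ∷ map suc (alphabet n)

  rowsOf : List ℕ → List ℕ
  rowsOf [] = []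
  rowsOf (m ∷ ms) = replicate m (suc (length ms)) ++ rowsOf ms

  part-∷ : ∀ {x xs} → 0 < x → All (_≤ x) xs → IsPartition xs → IsPartition (x ∷ xs)
  part-∷ {xs = []} pos [] (l , ps) = [-] , pos ∷ ps
  part-∷ {xs = y ∷ ys} pos (y≤ ∷ _) (l , ps) = (y≤ ∷ l) , pos ∷ ps

  rowsOf-≤ : ∀ ms → All (_≤ length ms) (rowsOf ms)
  rowsOf-≤ [] = []
  rowsOf-≤ (m ∷ ms) = All.++⁺ (All.replicate⁺ m ℕ.≤-refl) (All.map ℕ.m≤n⇒m≤1+n (rowsOf-≤ ms))

  rowsOf-part′ : ∀ k ms → IsPartition (rowsOf ms) → IsPartition (replicate k (suc (length ms)) ++ rowsOf ms)
  rowsOf-part′ zero ms p = p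
  rowsOf-part′ (suc k) ms p = part-∷ (s≤s z≤n) (All.++⁺ (All.replicate⁺ k ℕ.≤-refl) (All.map ℕ.m≤n⇒m≤1+n (rowsOf-≤ ms))) (rowsOf-part′ k ms p)

  rowsOf-part : ∀ ms → IsPartition (rowsOf ms)
  rowsOf-part [] = [] , []
  rowsOf-part (m ∷ ms) = rowsOf-part′ m ms (rowsOf-part ms)

  module HallLittlewood (𝓚 : CommutativeRing 0ℓ 0ℓ) (t : CommutativeRing.Carrier 𝓚) where
    open CommutativeRing 𝓚 renaming (Carrier to A; sym to ≈-sym) hiding (zero)
    open FiniteSums ring
    open CommutativeRingSolver 𝓚
    open PlacticRing 𝓚
    open Operators 𝓚 t
    open VerticalStrips 𝓚 t
    open SetoidReasoning setoid
    private
      module P = Ring 𝒫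
      module S = FiniteSums 𝒫
    module C = ColumnAlgebra 𝒫 letter (λ p q → mk (λ f i → knuth₁ i [] [] p q)) (λ p q → mk (λ f i → knuth₂ i [] [] p q))
    open C using (e; h; e*; h*; _⁻)

    ap-conv : ∀ F s f → ap (S.conv F s) f ≈ conv (λ i k → ap (F i k) f) s
    ap-conv F zero f = refl
    ap-conv F (suc s) f = +-congˡ (ap-conv (λ i → F (suc i)) s f)

    ap-sgn : ∀ i X f → ap (S.sgn i X) f ≈ sgn i (ap X f)
    ap-sgn zero X f = refl
    ap-sgn (suc i) X f = -‿cong (ap-sgn i X f)

    -- An element is a functional and carries no list of words. That only words with property `Q`
    -- occur in it is therefore expressed by its vanishing on functions that vanish on `Q`.
    Supp : (Word → Set) → Elem → Set
    Supp Q X = ∀ f → (∀ w → Q w → f w ≈ 0#) → ap X f ≈ 0#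

    supp-agree : ∀ {Q} X → Supp Q X → ∀ {f g} → (∀ w → Q w → f w ≈ g w) → ap X f ≈ ap X g
    supp-agree X sX {f} {g} p = -≈0⇒≈ (trans (+-congˡ (≈-sym (ap-neg X g))) (trans (≈-sym (ap-+ X f (λ w → - g w)))
      (sX _ (λ w qw → ≈⇒-≈0 (p w qw)))))

    supp-* : ∀ {P Q R : Word → Set} X Y → (∀ u v → P u → Q v → R (u ++ v)) → Supp P X → Supp Q Y → Supp R (X P.* Y)
    supp-* X Y join sX sY f p = sX _ (λ u pu → sY _ (λ v qv → p (u ++ v) (join u v pu qv)))

    supp-top : ∀ X → Supp (λ _ → ⊤) X
    supp-top X f p = trans (ap-cong X (λ w → p w tt)) (ap-0 X)

    supp-e : ∀ {Q : ℕ → Set} B j → All Q B → Supp (λ w → All Q w × length w ≡ j) (e B j)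
    supp-e⁻ : ∀ {Q : ℕ → Set} B j → All Q B → Supp (λ w → All Q w × suc (length w) ≡ j) ((e B ⁻) j)
    supp-e⁻ B zero qs f p = refl
    supp-e⁻ B (suc j) qs f p = supp-e B j qs f (λ w (qw , l) → p w (qw , ≡.cong suc l))
    supp-e [] zero qs f p = p [] ([] , ≡.refl)
    supp-e [] (suc j) qs f p = refl
    supp-e {Q} (b ∷ B) j (qb ∷ qs) f p = trans (+-cong (supp-e B j qs f p)
      (supp-e⁻ B j qs _ (λ w (qw , l) → p (w ++ b ∷ []) (All.++⁺ qw (qb ∷ []) , ≡.trans (≡.trans (length-++ w) (ℕ.+-comm (length w) 1)) l)))) (+-identityʳ _)

    supp-e* : ∀ {Q : ℕ → Set} B α → All Q B → Supp (All Q) (e* B α)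
    supp-e* B [] qs f p = p [] []
    supp-e* B (j ∷ α) qs = supp-* (e B j) (e* B α) (λ u v (pu , _) pv → All.++⁺ pu pv) (supp-e B j qs) (supp-e* B α qs)

    -- Two arbitrary elements cannot be interchanged in an iterated application. The e_j can be
    -- interchanged with any element, being finite sums of words.
    Fubini : Elem → Set
    Fubini X = ∀ Z (g : Word → Word → A) → ap Z (λ z → ap X (λ v → g v z)) ≈ ap X (λ v → ap Z (λ z → g v z))

    fubini-e : ∀ B j → Fubini (e B j)
    fubini-e⁻ : ∀ B j → Fubini ((e B ⁻) j)
    fubini-e⁻ B zero Z g = ap-0 Z
    fubini-e⁻ B (suc j) = fubini-e B j
    fubini-e [] zero Z g = refl
    fubini-e [] (suc j) Z g = ap-0 Z
    fubini-e (b ∷ B) j Z g = trans (ap-+ Z _ _) (+-cong (fubini-e B j Z g) (fubini-e⁻ B j Z (λ v z → g (v ++ b ∷ []) z)))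

    e-shift : ∀ B j f → ap (e (map suc B) j) f ≈ ap (e B j) (λ w → f (map suc w))
    e⁻-shift : ∀ B j f → ap ((e (map suc B) ⁻) j) f ≈ ap ((e B ⁻) j) (λ w → f (map suc w))
    e⁻-shift B zero f = refl
    e⁻-shift B (suc j) f = e-shift B j f
    e-shift [] zero f = refl
    e-shift [] (suc j) f = refl
    e-shift (b ∷ B) j f = +-cong (e-shift B j f) (trans (e⁻-shift B j (λ u → f (u ++ suc b ∷ [])))
      (ap-cong ((e B ⁻) j) (λ w → reflexive (≡.cong f (≡.sym (map-++ suc w (b ∷ [])))))))

    e*-shift : ∀ B α f → ap (e* (map suc B) α) f ≈ ap (e* B α) (λ w → f (map suc w))
    e*-shift B [] f = refl
    e*-shift B (j ∷ α) f = trans (e-shift B j _) (ap-cong (e B j) (λ u → trans (e*-shift B α (λ v → f (map suc u ++ v)))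
      (ap-cong (e* B α) (λ v → reflexive (≡.cong f (≡.sym (map-++ suc u v)))))))

    alphabet-pos : ∀ n → All (1 ≤_) (alphabet n)
    alphabet-pos zero = []
    alphabet-pos (suc n) = ℕ.≤-refl ∷ All.map⁺ (All.map (λ _ → s≤s z≤n) (alphabet-pos n))

    alphabet-≥2 : ∀ n → All (2 ≤_) (map suc (alphabet n))
    alphabet-≥2 n = All.map⁺ (All.map s≤s (alphabet-pos n))

    alphabet-inc : ∀ n → AllPairs _<_ (alphabet n)
    alphabet-inc zero = []
    alphabet-inc (suc n) = alphabet-≥2 n ∷ AllPairs.map⁺ (AllPairs-map (alphabet-inc n))
      where
      AllPairs-map : ∀ {xs} → AllPairs _<_ xs → AllPairs (λ x y → suc x < suc y) xs
      AllPairs-map [] = []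
      AllPairs-map (p ∷ ps) = All.map s≤s p ∷ AllPairs-map ps

    inc-tail : ∀ {x xs} → AllPairs _<_ (x ∷ xs) → AllPairs _<_ xs
    inc-tail (_ ∷ ps) = ps

    -- The rules by which charge enters; any family of functions on words that satisfies them would
    -- do.
    module Evaluate
      (φ : List ℕ → Word → A)
      (φ-inv : ∀ lam → Invariant (φ lam))
      (φ-[] : φ [] [] ≈ 1#)
      (φ-count : ∀ m lam w → count 1 w ≢ m → φ (m ∷ lam) w ≈ 0#)
      (φ-rotate : ∀ {m lam} → IsPartition (m ∷ lam) → ∀ w x → 2 ≤ x → φ (m ∷ lam) (w ++ x ∷ []) ≈ t * φ (m ∷ lam) (x ∷ w))
      (φ-shift : ∀ {m lam} → IsPartition (m ∷ lam) → ∀ w → All (1 ≤_) w → φ (m ∷ lam) (map suc w ++ replicate m 1) ≈ φ lam w)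
      where

      F : List ℕ → Fun
      F lam α = ap (e* (alphabet (length lam)) α) (φ lam)

      F-good : ∀ lam → Good (F lam)
      F-good lam = record { perm = λ p → at (pm p) (φ lam) (φ-inv lam) ; drop = λ α → at (P.trans (P.*-congʳ {e* B α} (C.e-zero B)) (P.*-identityˡ (e* B α))) (φ lam) (φ-inv lam) }
        where
        B = alphabet (length lam)
        pm : ∀ {α β} → α ↭ β → e* B α ≋ e* B β
        pm ↭.refl = P.refl
        pm (prep j p) = P.*-congˡ {e B j} (pm p)
        pm {_ ∷ _ ∷ α} {_ ∷ _ ∷ β} (swap i j p) = P.trans (P.sym (P.*-assoc (e B i) (e B j) (e* B α)))
          (P.trans (P.*-cong (C.e-comm B (alphabet-inc (length lam)) i j) (pm p)) (P.*-assoc (e B j) (e B i) (e* B β)))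
        pm (↭.trans p q) = P.trans (pm p) (pm q)

      module Row (m′ : ℕ) (lam : List ℕ) (part : IsPartition (suc m′ ∷ lam)) where
        private
          m = suc m′
          n = length lam
          B = map suc (alphabet n)
          f = φ (m ∷ lam)
          inv = φ-inv (m ∷ lam)
          module L = C.SmallestLetter 1 B (alphabet-≥2 n) (inc-tail (alphabet-inc (suc n)))
        open L

        private
          count-≥2 : ∀ {w} → All (2 ≤_) w → count 1 w ≡ 0
          count-≥2 [] = ≡.refl
          count-≥2 {x ∷ w} (p ∷ ps) = ≡.trans (count-∷ 1 x w) (≡.cong₂ ℕ._+_ (δ-≢ (λ e → ℕ.<-irrefl (≡.sym e) p)) (count-≥2 ps))

          supp₁ : ∀ j c U → Supp (λ w → count 1 w ≡ c) U → Supp (λ w → count 1 w ≡ c) (U P.* ẽ j)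
          supp₁ j c U sU = supp-* {P = λ w → count 1 w ≡ c} {Q = λ w → All (2 ≤_) w × length w ≡ j} {R = λ w → count 1 w ≡ c} U (ẽ j) (λ u v e (ge , _) → ≡.trans (count-++ 1 u v) (≡.trans (≡.cong₂ ℕ._+_ e (count-≥2 ge)) (ℕ.+-identityʳ c)))
            sU (supp-e B j (alphabet-≥2 n))

          supp₂ : ∀ j c U → Supp (λ w → count 1 w ≡ c) U → Supp (λ w → count 1 w ≡ suc c) (U P.* ((ẽ ⁻) j P.* letter 1))
          supp₂ j c U sU = supp-* {P = λ w → count 1 w ≡ c} {Q = λ w → count 1 w ≡ 1} {R = λ w → count 1 w ≡ suc c} U ((ẽ ⁻) j P.* letter 1)
            (λ u v e e′ → ≡.trans (count-++ 1 u v) (≡.trans (≡.cong₂ ℕ._+_ e e′) (ℕ.+-comm c 1)))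
            sU (supp-* {P = λ w → All (2 ≤_) w × suc (length w) ≡ j} {Q = _≡ 1 ∷ []} {R = λ w → count 1 w ≡ 1} ((ẽ ⁻) j) (letter 1) (λ { u _ (ge , _) ≡.refl → ≡.trans (count-++ 1 u (1 ∷ [])) (≡.cong (ℕ._+ 1) (count-≥2 ge)) })
                  (supp-e⁻ B j (alphabet-≥2 n)) (λ g p → p _ ≡.refl))

        -- `U` is the part of the product already treated and contains c letters 1. As `f` kills
        -- words whose number of 1s is not c + k, the summands with k further ones are all that
        -- counts.
        F-expand : ∀ α k c U → Supp (λ w → count 1 w ≡ c) U → (∀ w → count 1 w ≢ c ℕ.+ k → f w ≈ 0#) →
                   ap (U P.* e* (1 ∷ B) α) f ≈ ap (U P.* X k α) f
        F-expand [] zero c U sU v = refl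
        F-expand [] (suc k) c U sU v = trans (sU _ (λ u e → v (u ++ []) (λ e′ → ℕ.m≢1+m+n c
          (≡.trans (≡.sym e) (≡.trans (≡.trans (≡.cong (count 1) (≡.sym (++-identityʳ u))) e′) (ℕ.+-suc c k)))))) (≈-sym (ap-0 U))
        F-expand (j ∷ α) zero c U sU v = begin
          ap (U P.* (e (1 ∷ B) j P.* e* (1 ∷ B) α)) f ≈⟨ at (e*-split U j (e* (1 ∷ B) α)) f inv ⟩
          ap (U P.* ẽ j P.* e* (1 ∷ B) α) f + ap (U P.* ((ẽ ⁻) j P.* letter 1) P.* e* (1 ∷ B) α) f
            ≈⟨ +-cong (F-expand α 0 c (U P.* ẽ j) (supp₁ j c U sU) v)
                 (supp-* {P = λ w → count 1 w ≡ suc c} {Q = λ _ → ⊤} {R = λ w → c < count 1 w} (U P.* ((ẽ ⁻) j P.* letter 1)) (e* (1 ∷ B) α)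
                   (λ u w e _ → ≡.subst (c <_) (≡.sym (count-++ 1 u w)) (ℕ.≤-trans (ℕ.≤-reflexive (≡.sym e)) (ℕ.m≤m+n _ _)))
                   (supp₂ j c U sU) (supp-top (e* (1 ∷ B) α)) f
                   (λ w lt → v w (λ e → ℕ.<-irrefl (≡.sym (≡.trans e (ℕ.+-identityʳ c))) lt))) ⟩
          ap (U P.* ẽ j P.* X 0 α) f + 0# ≈⟨ +-identityʳ _ ⟩
          ap (U P.* ẽ j P.* X 0 α) f ≈⟨ at (P.*-assoc U (ẽ j) (X 0 α)) f inv ⟩
          ap (U P.* (ẽ j P.* X 0 α)) f ∎
        F-expand (j ∷ α) (suc k) c U sU v = begin
          ap (U P.* (e (1 ∷ B) j P.* e* (1 ∷ B) α)) f ≈⟨ at (e*-split U j (e* (1 ∷ B) α)) f inv ⟩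
          ap (U P.* ẽ j P.* e* (1 ∷ B) α) f + ap (U P.* ((ẽ ⁻) j P.* letter 1) P.* e* (1 ∷ B) α) f
            ≈⟨ +-cong (F-expand α (suc k) c (U P.* ẽ j) (supp₁ j c U sU) v)
                 (F-expand α k (suc c) (U P.* ((ẽ ⁻) j P.* letter 1)) (supp₂ j c U sU) (λ w ne → v w (λ e → ne (≡.trans e (ℕ.+-suc c k))))) ⟩
          ap (U P.* ẽ j P.* X (suc k) α) f + ap (U P.* ((ẽ ⁻) j P.* letter 1) P.* X k α) f
            ≈⟨ at (X-join U j (X (suc k) α) (X k α)) f inv ⟩
          ap (U P.* X (suc k) (j ∷ α)) f ∎

        private
          rotate : ∀ v z → All (2 ≤_) v → f (z ++ v) ≈ pow (length v) * f (v ++ z)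
          rotate [] z [] = trans (reflexive (≡.cong f (++-identityʳ z))) (≈-sym (*-identityˡ _))
          rotate (x ∷ v) z (p ∷ ps) = begin
            f (z ++ x ∷ v) ≈⟨ reflexive (≡.cong f (++-assoc z (x ∷ []) v)) ⟨
            f ((z ++ x ∷ []) ++ v) ≈⟨ rotate v (z ++ x ∷ []) ps ⟩
            pow (length v) * f (v ++ z ++ x ∷ []) ≈⟨ *-congˡ (reflexive (≡.cong f (++-assoc v z (x ∷ [])))) ⟨
            pow (length v) * f ((v ++ z) ++ x ∷ []) ≈⟨ *-congˡ (φ-rotate part (v ++ z) x p) ⟩
            pow (length v) * (t * f (x ∷ v ++ z)) ≈⟨ solve (pow (length v) ∷ t ∷ f (x ∷ v ++ z) ∷ []) (v0 :* (v1 :* v2)) (v1 :* v0 :* v2) ≡.refl ⟩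
            pow (suc (length v)) * f (x ∷ v ++ z) ∎

          rotate-e : ∀ Z i → ap (Z P.* ẽ i) f ≈ pow i * ap (ẽ i P.* Z) f
          rotate-e Z i = begin
            ap Z (λ z → ap (ẽ i) (λ v → f (z ++ v)))
              ≈⟨ ap-cong Z (λ z → trans (supp-agree (ẽ i) (supp-e B i (alphabet-≥2 n)) (λ { v (ge , ≡.refl) → rotate v z ge })) (ap-* (ẽ i) (pow i) (λ v → f (v ++ z)))) ⟩
            ap Z (λ z → pow i * ap (ẽ i) (λ v → f (v ++ z))) ≈⟨ ap-* Z (pow i) _ ⟩
            pow i * ap Z (λ z → ap (ẽ i) (λ v → f (v ++ z))) ≈⟨ *-congˡ (fubini-e B i Z (λ v z → f (v ++ z))) ⟩
            pow i * ap (ẽ i P.* Z) f ∎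

          pw-word : ∀ p g → ap (pw p) g ≈ g (replicate p 1)
          pw-word zero g = refl
          pw-word (suc p) g = trans (pw-word p (λ u → g (u ++ 1 ∷ []))) (reflexive (≡.cong g (≡.sym (replicate-snoc p 1))))

          Θ : ℕ → Fun
          Θ s β = ap (ẽ* β P.* (pw m′ P.* d s)) f

          -- All m letters 1 stand at the end here, so the shift rule removes them and lowers the
          -- other letters.
          Θ-zero : Θ 0 ≐ F lam
          Θ-zero β = begin
            ap (ẽ* β) (λ u → ap (pw (suc m′)) (λ v → f (u ++ v))) ≈⟨ ap-cong (ẽ* β) (λ u → pw-word (suc m′) (λ v → f (u ++ v))) ⟩
            ap (ẽ* β) (λ u → f (u ++ replicate m 1)) ≈⟨ e*-shift (alphabet n) β _ ⟩
            ap (e* (alphabet n) β) (λ w → f (map suc w ++ replicate m 1))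
              ≈⟨ supp-agree (e* (alphabet n) β) (supp-e* (alphabet n) β (alphabet-pos n)) (λ w pos → φ-shift part w pos) ⟩
            F lam β ∎

          Θ-drop : ∀ s β → Θ s (0 ∷ β) ≈ Θ s β
          Θ-drop s β = at (P.*-congʳ {pw m′ P.* d s} (P.trans (P.*-congʳ {ẽ* β} (C.e-zero B)) (P.*-identityˡ (ẽ* β)))) f inv

          -- Rotating ẽ_i from the front to the end turns (-t)^i into (-1)^i, after which the sum
          -- telescopes.
          Θ-sum : ∀ s β → conv (λ i k → c i * Θ k (i ∷ β)) s ≈ sgn s (F lam (s ∷ β))
          Θ-sum s β = begin
            conv (λ i k → c i * Θ k (i ∷ β)) s
              ≈⟨ conv-cong s (λ i k _ → trans (≈-sym (sgn-*ˡ i _ _)) (sgn-cong i (trans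
                   (*-congˡ (at (P.*-assoc (ẽ i) (ẽ* β) (pw m′ P.* d k)) f inv)) (≈-sym (rotate-e (ẽ* β P.* (pw m′ P.* d k)) i))))) ⟩
            conv (λ i k → sgn i (ap (ẽ* β P.* (pw m′ P.* d k) P.* ẽ i) f)) s
              ≈⟨ trans (ap-conv (λ i k → S.sgn i (ẽ* β P.* (pw m′ P.* d k) P.* ẽ i)) s f) (conv-cong s (λ i k _ → ap-sgn i _ f)) ⟨
            ap (S.conv (λ i k → S.sgn i (ẽ* β P.* (pw m′ P.* d k) P.* ẽ i)) s) f ≈⟨ at (telescope* β m′ s) f inv ⟩
            ap (S.sgn s (ẽ* (s ∷ β) P.* (pw m′ P.* letter 1))) f ≈⟨ ap-sgn s _ f ⟩
            sgn s (Θ 0 (s ∷ β)) ≈⟨ sgn-cong s (Θ-zero (s ∷ β)) ⟩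
            sgn s (F lam (s ∷ β)) ∎

          Θ≐q : ∀ s → Θ s ≐ q s (F lam)
          Θ≐q = q-unique (F lam) Θ Θ-zero (λ s β → begin
            Θ (suc s) β ≈⟨ Θ-drop (suc s) β ⟨
            Θ (suc s) (0 ∷ β) ≈⟨ solve (Θ (suc s) (0 ∷ β) ∷ conv (λ i k → c (suc i) * Θ k (suc i ∷ β)) s ∷ []) v0 ((:1 :* v0 :+ v1) :- v1) ≡.refl ⟩
            conv (λ i k → c i * Θ k (i ∷ β)) (suc s) - conv (λ i k → c (suc i) * Θ k (suc i ∷ β)) s ≈⟨ +-congʳ (Θ-sum (suc s) β) ⟩
            sgn (suc s) (F lam (suc s ∷ β)) - conv (λ i k → c (suc i) * Θ k (suc i ∷ β)) s ∎)

          vanish : ∀ β p → ap (ẽ* β P.* (pw p P.* P.0#)) f ≈ 0#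
          vanish β p = trans (ap-cong (ẽ* β) (λ u → ap-0 (pw p))) (ap-0 (ẽ* β))

          -- `Y (suc k) l` begins with k letters 1; with the p letters in front of it they make up
          -- the m′ letters that belong to `Θ`.
          Y≈q̂ : ∀ k p l β → p ℕ.+ k ≡ m′ → ap (ẽ* β P.* (pw p P.* Y (suc k) l)) f ≈ q̂ (suc k) l (F lam) β
          Y≈q̂ zero p zero β _ = vanish β p
          Y≈q̂ zero p (suc s) β e rewrite ≡.trans (≡.sym (ℕ.+-identityʳ p)) e = Θ≐q s β
          Y≈q̂ (suc k) p zero β _ = vanish β p
          Y≈q̂ (suc k) p (suc l) β e = trans (at (pw-Y β p k l) f inv) (Y≈q̂ k (suc p) l β (≡.trans (≡.sym (ℕ.+-suc p k)) e))

          infixr 8 _▹▹_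
          _▹▹_ : List ℕ → Fun → Fun
          [] ▹▹ Ψ = Ψ
          (j ∷ β) ▹▹ Ψ = j ▹ (β ▹▹ Ψ)

          good-▹▹ : ∀ β {Ψ} → Good Ψ → Good (β ▹▹ Ψ)
          good-▹▹ [] g = g
          good-▹▹ (j ∷ β) g = good-▹ j (good-▹▹ β g)

          q̂-▹ : ∀ k l j {Ψ} → Good Ψ → ∀ γ → q̂ k l (j ▹ Ψ) γ ≈ q̂ k l Ψ (j ∷ γ)
          q̂-▹ zero l j g γ = q-▹ l j g γ
          q̂-▹ (suc k) zero j g γ = refl
          q̂-▹ (suc k) (suc l) j g γ = q̂-▹ k l j g γ

          q̂-▹▹ : ∀ k l β {Ψ} → Good Ψ → ∀ γ → q̂ k l (β ▹▹ Ψ) γ ≈ q̂ k l Ψ (β ++ γ)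
          q̂-▹▹ k l [] g γ = refl
          q̂-▹▹ k l (j ∷ β) g γ = trans (q̂-▹ k l j (good-▹▹ β g) γ) (trans (q̂-▹▹ k l β g (j ∷ γ)) (perm (q̂-good k l g) (shift j β γ)))

          -- `N` and `K` obey the same recursion along α. The list `β` collects the factors already
          -- split off, which may be put in front because they commute.
          N≈K : ∀ α Z l β → (∀ k → Z k ≡ Y m (k ℕ.+ l)) → ap (ẽ* β P.* N Z α) f ≈ K m l (β ▹▹ F lam) α
          N≈K [] Z l β eq = begin
            ap (ẽ* β P.* Z 0) f ≈⟨ reflexive (≡.cong (λ z → ap (ẽ* β P.* z) f) (eq 0)) ⟩
            ap (ẽ* β P.* Y m l) f ≈⟨ at (P.*-congˡ {ẽ* β} (P.sym (P.*-identityˡ (Y m l)))) f inv ⟩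
            ap (ẽ* β P.* (pw 0 P.* Y m l)) f ≈⟨ Y≈q̂ m′ 0 l β ≡.refl ⟩
            q̂ m l (F lam) β ≈⟨ reflexive (≡.cong (q̂ m l (F lam)) (++-identityʳ β)) ⟨
            q̂ m l (F lam) (β ++ []) ≈⟨ q̂-▹▹ m l β (F-good lam) [] ⟨
            q̂ m l (β ▹▹ F lam) [] ∎
          N≈K (j ∷ α) Z l β eq = trans (at (N-split β Z j α) f inv) (+-cong (N≈K α Z l (j ∷ β) eq) (pred j))
            where
            eq′ : ∀ k → Z (suc k) ≡ Y m (k ℕ.+ suc l)
            eq′ k = ≡.trans (eq (suc k)) (≡.cong (Y m) (≡.sym (ℕ.+-suc k l)))
            pred : ∀ j → ap ((ẽ ⁻) j P.* ẽ* β P.* N (λ k → Z (suc k)) α) f ≈ K m (suc l) (j ◂ (β ▹▹ F lam)) α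
            pred zero = ≈-sym (l0 (K-linear m (suc l)) α)
            pred (suc j) = N≈K α (λ k → Z (suc k)) (suc l) (j ∷ β) eq′

        F-row : F (m ∷ lam) ≐ H m (F lam)
        F-row α = begin
          ap (e* (1 ∷ B) α) f ≈⟨ at (P.*-identityˡ (e* (1 ∷ B) α)) f inv ⟨
          ap (P.1# P.* e* (1 ∷ B) α) f ≈⟨ F-expand α m 0 P.1# (λ g p → p [] ≡.refl) (φ-count m lam) ⟩
          ap (P.1# P.* X m α) f ≈⟨ at (P.*-congˡ {P.1#} (X-normal m α)) f inv ⟩
          ap (P.1# P.* N (Y m) α) f ≈⟨ N≈K α (Y m) 0 [] (λ k → ≡.cong (Y m) (≡.sym (ℕ.+-identityʳ k))) ⟩
          H m (F lam) α ∎

      F-empty : F [] ≐ ε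
      F-empty [] = φ-[]
      F-empty (zero ∷ α) = F-empty α
      F-empty (suc j ∷ α) = refl

      F-rows : ∀ ms → F (rowsOf ms) ≐ Φ ms
      F-rows [] = F-empty
      F-rows (m ∷ ms) = go m
        where
        go : ∀ k → F (replicate k (suc (length ms)) ++ rowsOf ms) ≐ iter k (H (suc (length ms))) (Φ ms)
        go zero = F-rows ms
        go (suc k) α = trans (Row.F-row (length ms) (replicate k (suc (length ms)) ++ rowsOf ms) (rowsOf-part′ (suc k) ms (rowsOf-part ms)) α)
          (lcong (K-linear (suc (length ms)) 0) (go k) α)

      -- The value of Q′_λ on e_β h_α, for λ with multiplicities ms.
      FX : List ℕ → List ℕ → List ℕ → A
      FX ms β α = ap (e* B β P.* h* B α) (φ (rowsOf ms))
        where B = alphabet (length (rowsOf ms))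

      FX-[] : ∀ ms β → FX ms β [] ≈ Φ ms β
      FX-[] ms β = trans (at (P.*-identityʳ (e* (alphabet (length (rowsOf ms))) β)) (φ (rowsOf ms)) (φ-inv (rowsOf ms))) (F-rows ms β)

      FX-zero : ∀ ms β α → FX ms β (0 ∷ α) ≈ FX ms β α
      FX-zero ms β α = at (P.*-congˡ {e* B β} (P.trans (P.*-congʳ {h* B α} (C.h-zero B)) (P.*-identityˡ (h* B α)))) (φ (rowsOf ms)) (φ-inv (rowsOf ms))
        where B = alphabet (length (rowsOf ms))

      FX-suc : ∀ ms β n α → FX ms β (suc n ∷ α) ≈ conv (λ i k → sgn i (FX ms (β ++ suc i ∷ []) (k ∷ α))) n
      FX-suc ms β n α = begin
        FX ms β (suc n ∷ α) ≈⟨ at (C.h*-expand B β n α) g (φ-inv (rowsOf ms)) ⟩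
        ap (S.conv (λ i k → S.sgn i (e* B (β ++ suc i ∷ []) P.* h* B (k ∷ α))) n) g
          ≈⟨ trans (ap-conv (λ i k → S.sgn i (e* B (β ++ suc i ∷ []) P.* h* B (k ∷ α))) n g)
               (conv-cong n (λ i k _ → ap-sgn i (e* B (β ++ suc i ∷ []) P.* h* B (k ∷ α)) g)) ⟩
        conv (λ i k → sgn i (FX ms (β ++ suc i ∷ []) (k ∷ α))) n ∎
        where
        B = alphabet (length (rowsOf ms))
        g = φ (rowsOf ms)

      private
        sel-sgn : ∀ i j s x → sel i j (sgn s x) ≈ sgn s (sel i j x)
        sel-sgn zero zero s x = refl
        sel-sgn zero (suc j) s x = ≈-sym (sgn-0 s)
        sel-sgn (suc i) zero s x = ≈-sym (sgn-0 s)
        sel-sgn (suc i) (suc j) s x = sel-sgn i j s x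

        sel-conv : ∀ i j G s → sel i j (conv G s) ≈ conv (λ x y → sel i j (G x y)) s
        sel-conv zero zero G s = refl
        sel-conv zero (suc j) G s = ≈-sym (conv-0 s (λ _ _ _ → refl))
        sel-conv (suc i) zero G s = ≈-sym (conv-0 s (λ _ _ _ → refl))
        sel-conv (suc i) (suc j) G s = sel-conv i j G s

      -- For products of e alone this is `e-strips`. A factor h is traded by `FX-suc` for factors e,
      -- which are appended to `β` and do not interfere with e_j, and for an h of smaller index.
      FX-strips : ∀ α β ms j → FX ms (j ∷ β) α ≈ vsum ms 0 (λ i ns → sel i j (FX ns β α))
      FX-strips [] β ms j = trans (FX-[] ms (j ∷ β)) (trans (e-strips ms j β)
        (vsum-cong ms 0 (λ i ns _ _ → sel-cong i j (≈-sym (FX-[] ns β)))))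
      FX-strips (n ∷ α) β ms j = strong (λ n → ∀ β ms j → FX ms (j ∷ β) (n ∷ α) ≈ vsum ms 0 (λ i ns → sel i j (FX ns β (n ∷ α)))) step n β ms j
        where
        step : ∀ n → (∀ k → k ℕ.< n → ∀ β ms j → FX ms (j ∷ β) (k ∷ α) ≈ vsum ms 0 (λ i ns → sel i j (FX ns β (k ∷ α)))) →
               ∀ β ms j → FX ms (j ∷ β) (n ∷ α) ≈ vsum ms 0 (λ i ns → sel i j (FX ns β (n ∷ α)))
        step zero _ β ms j = trans (FX-zero ms (j ∷ β) α) (trans (FX-strips α β ms j)
          (vsum-cong ms 0 (λ i ns _ _ → sel-cong i j (≈-sym (FX-zero ns β α)))))
        step (suc n) IH β ms j = begin
          FX ms (j ∷ β) (suc n ∷ α) ≈⟨ FX-suc ms (j ∷ β) n α ⟩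
          conv (λ x k → sgn x (FX ms (j ∷ β ++ suc x ∷ []) (k ∷ α))) n
            ≈⟨ conv-cong n (λ x k e → trans (sgn-cong x (IH k (s≤s (ℕ.≤-trans (ℕ.m≤n+m k x) (ℕ.≤-reflexive e))) (β ++ suc x ∷ []) ms j)) (≈-sym (vsum-sgn ms 0 x _))) ⟩
          conv (λ x k → vsum ms 0 (λ i ns → sgn x (sel i j (FX ns (β ++ suc x ∷ []) (k ∷ α))))) n
            ≈⟨ vsum-conv ms 0 (λ x k i ns → sgn x (sel i j (FX ns (β ++ suc x ∷ []) (k ∷ α)))) n ⟨
          vsum ms 0 (λ i ns → conv (λ x k → sgn x (sel i j (FX ns (β ++ suc x ∷ []) (k ∷ α)))) n)
            ≈⟨ vsum-cong ms 0 (λ i ns _ _ → trans (conv-cong n (λ x k _ → ≈-sym (sel-sgn i j x _)))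
                 (trans (≈-sym (sel-conv i j _ n)) (sel-cong i j (≈-sym (FX-suc ns β n α))))) ⟩
          vsum ms 0 (λ i ns → sel i j (FX ns β (suc n ∷ α))) ∎

      module _ (α : List ℕ) where
        private
          U : List ℕ → ℕ → A
          U ms k = FX ms [] (k ∷ α)

          G : List ℕ → ℕ → ℕ → A
          G ms i k = sgn i (FX ms (i ∷ []) (k ∷ α))

        -- The coefficient of x^α in Q′_λ(X + 1): the exponent k of the variable set to 1 is bounded
        -- by the weight of λ.
        V : List ℕ → A
        V ms = conv (λ k _ → U ms k) (wt ms)

        private
          G-suc : ∀ ms s → conv (G ms) (suc s) ≈ 0#
          G-suc ms s = begin
            conv (G ms) (suc s)
              ≈⟨ trans (ap-conv (λ i k → S.sgn i (e* B (i ∷ []) P.* h* B (k ∷ α))) (suc s) g)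
                   (conv-cong {λ i k → ap (S.sgn i (e* B (i ∷ []) P.* h* B (k ∷ α))) g} {G ms} (suc s) (λ i k _ → ap-sgn i (e* B (i ∷ []) P.* h* B (k ∷ α)) g)) ⟨
            ap (S.conv (λ i k → S.sgn i (e* B (i ∷ []) P.* h* B (k ∷ α))) (suc s)) g ≈⟨ at (C.e-h* B α s) g (φ-inv (rowsOf ms)) ⟩
            0# ∎
            where
            B = alphabet (length (rowsOf ms))
            g = φ (rowsOf ms)

          G-zero : ∀ ms → G ms 0 0 ≈ FX ms [] α
          G-zero ms = trans (at (P.*-congʳ {h* B (0 ∷ α)} (P.trans (P.*-congʳ {P.1#} (C.e-zero B)) (P.*-identityˡ P.1#))) g (φ-inv (rowsOf ms))) (FX-zero ms [] α)
            where
            B = alphabet (length (rowsOf ms))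
            g = φ (rowsOf ms)

          conv-sel : ∀ i w N (T : ℕ → A) → i ℕ.+ w ≡ N → conv (λ x y → sgn x (sel i x (T y))) N ≈ sgn i (T w)
          conv-sel zero w zero T ≡.refl = refl
          conv-sel zero w (suc N) T ≡.refl = trans (+-congˡ (conv-0 N (λ x y _ → sgn-0 (suc x)))) (+-identityʳ _)
          conv-sel (suc i) w (suc N) T e = trans (+-identityˡ _) (trans (conv-neg _ N) (-‿cong (conv-sel i w N T (ℕ.suc-injective e))))

          conv-collapse : ∀ ms N → conv (λ s _ → conv (G ms) s) N ≈ FX ms [] α
          conv-collapse ms zero = G-zero ms
          conv-collapse ms (suc N) = trans (conv-last (λ s _ → conv (G ms) s) N)
            (trans (+-cong (conv-collapse ms N) (G-suc ms N)) (+-identityʳ _))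

        -- The left side collects (-1)^x e_x h_k over all x + k ≤ N, with N the weight. Grouped by x
        -- + k, each group but that of sum 0 vanishes, because e and h are inverse to each other up
        -- to sign.
        V-strips : ∀ ms → vsum ms 0 (λ i ns → sgn i (V ns)) ≈ FX ms [] α
        V-strips ms = begin
          vsum ms 0 (λ i ns → sgn i (V ns))
            -- A strip of i boxes leaves weight N - i, so the bound on k inside `V ns` becomes i + k
            -- ≤ N.
            ≈⟨ vsum-cong ms 0 (λ i ns _ w → conv-sel i (wt ns) N (λ y → conv (λ k _ → U ns k) y)
                 (≡.trans (ℕ.+-comm i (wt ns)) (≡.trans w (≡.trans (≡.cong (wt ms ℕ.+_) (ℕ.*-zeroʳ (length ms))) (ℕ.+-identityʳ _))))) ⟨
          vsum ms 0 (λ i ns → conv (λ x y → sgn x (sel i x (conv (λ k _ → U ns k) y))) N)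
            ≈⟨ vsum-conv ms 0 (λ x y i ns → sgn x (sel i x (conv (λ k _ → U ns k) y))) N ⟩
          conv (λ x y → vsum ms 0 (λ i ns → sgn x (sel i x (conv (λ k _ → U ns k) y)))) N
            ≈⟨ conv-cong N (λ x y _ → begin
                 vsum ms 0 (λ i ns → sgn x (sel i x (conv (λ k _ → U ns k) y))) ≈⟨ vsum-sgn ms 0 x _ ⟩
                 sgn x (vsum ms 0 (λ i ns → sel i x (conv (λ k _ → U ns k) y)))
                   ≈⟨ sgn-cong x (trans (vsum-cong ms 0 (λ i ns _ _ → sel-conv i x (λ k _ → U ns k) y)) (vsum-conv ms 0 (λ k _ i ns → sel i x (U ns k)) y)) ⟩
                 sgn x (conv (λ k _ → vsum ms 0 (λ i ns → sel i x (U ns k))) y)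
                   ≈⟨ sgn-cong x (conv-cong y (λ k _ _ → ≈-sym (FX-strips (k ∷ α) [] ms x))) ⟩
                 sgn x (conv (λ k _ → FX ms (x ∷ []) (k ∷ α)) y) ≈⟨ conv-sgn x _ y ⟨
                 conv (λ k _ → G ms x k) y ∎) ⟩
          conv (λ x y → conv (λ k _ → G ms x k) y) N ≈⟨ conv-assoc (λ x k _ → G ms x k) N ⟩
          conv (λ s _ → conv (G ms) s) N ≈⟨ conv-collapse ms N ⟩
          FX ms [] α ∎
          where N = wt ms

        V-asum : ∀ ms → V ms ≈ asum ms 0 (λ ns → FX ns [] α)
        V-asum = signed-unique V (λ ms → asum ms 0 (λ ns → FX ns [] α))
          (λ ms → trans (V-strips ms) (≈-sym (strips-inverse ms (λ ns → FX ns [] α))))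

-- Row insertion and its inverse.

module RowInsertion where
  open import Data.Nat
  open import Data.Nat.Properties
  open import Data.List hiding (lookup)
  open import Data.List.Relation.Unary.All as All using (All; []; _∷_)
  open import Data.List.Relation.Unary.AllPairs using (AllPairs; []; _∷_)
  open import Data.Maybe using (Maybe; just; nothing)
  open import Data.Unit using (⊤; tt)
  open import Relation.Nullary using (yes; no)
  open import Relation.Binary.PropositionalEquality
  open import Defs using (Tableau)

  Row : Set
  Row = List ℕ

  Weakly : Row → Set
  Weakly = AllPairs _≤_

  infix 4 _▷_ _▷ₕ_
  data _▷_ : Row → Row → Set where
    []  : ∀ {R} → R ▷ []
    _∷_ : ∀ {r s R S} → r < s → R ▷ S → (r ∷ R) ▷ (s ∷ S)

  _▷ₕ_ : Row → Tableau → Set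
  R ▷ₕ [] = ⊤
  R ▷ₕ (S ∷ T) = R ▷ S

  data NonEmpty : Row → Set where
    cons : ∀ {x R} → NonEmpty (x ∷ R)

  data Tab : Tableau → Set where
    []  : Tab []
    row : ∀ {R T} → Weakly R → NonEmpty R → R ▷ₕ T → Tab T → Tab (R ∷ T)

  data Ins (x : ℕ) : Row → Row → Maybe ℕ → Set where
    end  : Ins x [] (x ∷ []) nothing
    bump : ∀ {r R} → x < r → Ins x (r ∷ R) (x ∷ R) (just r)
    pass : ∀ {r R R′ m} → r ≤ x → Ins x R R′ m → Ins x (r ∷ R) (r ∷ R′) m

  -- The last number is the row of the new box, which the recording tableau needs.
  data TIns : ℕ → Tableau → Tableau → ℕ → Set where
    new : ∀ {x} → TIns x [] ((x ∷ []) ∷ []) 0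
    app : ∀ {x R R′ T} → Ins x R R′ nothing → TIns x (R ∷ T) (R′ ∷ T) 0
    bmp : ∀ {x y R R′ T T′ i} → Ins x R R′ (just y) → TIns y T T′ i → TIns x (R ∷ T) (R′ ∷ T′) (suc i)

  ins : ∀ x R → ∃₂ λ R′ m → Ins x R R′ m
  ins x [] = x ∷ [] , nothing , end
  ins x (r ∷ R) with x <? r
  ... | yes x<r = x ∷ R , just r , bump x<r
  ... | no x≮r with ins x R
  ...   | R′ , m , i = r ∷ R′ , m , pass (≮⇒≥ x≮r) i

  tins : ∀ x T → ∃₂ λ T′ i → TIns x T T′ i
  tins x [] = _ , _ , new
  tins x (R ∷ T) with ins x R
  ... | R′ , nothing , p = _ , _ , app p
  ... | R′ , just y , p with tins y T
  ...   | T′ , i , q = _ , _ , bmp p q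

  ins-det : ∀ {x R R₁ R₂ m₁ m₂} → Ins x R R₁ m₁ → Ins x R R₂ m₂ → R₁ ≡ R₂ × m₁ ≡ m₂
  ins-det end end = refl , refl
  ins-det (bump _) (bump _) = refl , refl
  ins-det (bump p) (pass q _) = ⊥-elim (<⇒≱ p q)
  ins-det (pass q _) (bump p) = ⊥-elim (<⇒≱ p q)
  ins-det (pass _ p) (pass _ q) with ins-det p q
  ... | refl , refl = refl , refl

  tins-det : ∀ {x T T₁ T₂ i₁ i₂} → TIns x T T₁ i₁ → TIns x T T₂ i₂ → T₁ ≡ T₂ × i₁ ≡ i₂
  tins-det new new = refl , refl
  tins-det (app p) (app q) with ins-det p q
  ... | refl , refl = refl , refl
  tins-det (app p) (bmp q _) with ins-det p q
  ... | _ , ()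
  tins-det (bmp p _) (app q) with ins-det p q
  ... | _ , ()
  tins-det (bmp p p′) (bmp q q′) with ins-det p q
  ... | refl , refl with tins-det p′ q′
  ...   | refl , refl = refl , refl

  ins-bumped : ∀ {x R R′ y} → Ins x R R′ (just y) → x < y
  ins-bumped (bump p) = p
  ins-bumped (pass _ p) = ins-bumped p

  All-ins : ∀ {P : ℕ → Set} {x R R′ m} → Ins x R R′ m → P x → All P R → All P R′
  All-ins end px [] = px ∷ []
  All-ins (bump _) px (_ ∷ ps) = px ∷ ps
  All-ins (pass _ i) px (p ∷ ps) = p ∷ All-ins i px ps

  weakly-ins : ∀ {x R R′ m} → Ins x R R′ m → Weakly R → Weakly R′
  weakly-ins end [] = [] ∷ []
  weakly-ins (bump x<r) (p ∷ ps) = All.map (≤-trans (<⇒≤ x<r)) p ∷ ps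
  weakly-ins (pass r≤x i) (p ∷ ps) = All-ins i r≤x p ∷ weakly-ins i ps

  nonEmpty-ins : ∀ {x R R′ m} → Ins x R R′ m → NonEmpty R′
  nonEmpty-ins end = cons
  nonEmpty-ins (bump _) = cons
  nonEmpty-ins (pass _ _) = cons

  ins-▷ : ∀ {x R R′ m S} → Ins x R R′ m → R ▷ S → R′ ▷ S
  ins-▷ i [] = []
  ins-▷ (bump x<r) (p ∷ ps) = <-trans x<r p ∷ ps
  ins-▷ (pass _ i) (p ∷ ps) = p ∷ ins-▷ i ps

  -- The entry below the old place of y, if any, exceeds y; so y enters the next row weakly to the
  -- left of that place, below entries smaller than y.
  ins-ins-▷ : ∀ {x R R′ y S S′ m} → Ins x R R′ (just y) → R ▷ S → Ins y S S′ m → R′ ▷ S′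
  ins-ins-▷ (bump x<r) [] end = x<r ∷ []
  ins-ins-▷ (bump x<r) (p ∷ ps) (bump _) = x<r ∷ ps
  ins-ins-▷ (bump x<r) (p ∷ ps) (pass s≤r _) = ⊥-elim (<⇒≱ p s≤r)
  ins-ins-▷ (pass r≤x i) [] end = ≤-<-trans r≤x (ins-bumped i) ∷ []
  ins-ins-▷ (pass r≤x i) (p ∷ ps) (bump _) = ≤-<-trans r≤x (ins-bumped i) ∷ ins-▷ i ps
  ins-ins-▷ (pass r≤x i) (p ∷ ps) (pass _ j) = p ∷ ins-ins-▷ i ps j

  ins-ins-▷ₕ : ∀ {x R R′ y T T′ i} → Ins x R R′ (just y) → R ▷ₕ T → TIns y T T′ i → R′ ▷ₕ T′
  ins-ins-▷ₕ i _ new = ins-ins-▷ i [] end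
  ins-ins-▷ₕ i p (app j) = ins-ins-▷ i p j
  ins-ins-▷ₕ i p (bmp j _) = ins-ins-▷ i p j

  ins-▷ₕ : ∀ {x R R′ m} T → Ins x R R′ m → R ▷ₕ T → R′ ▷ₕ T
  ins-▷ₕ [] _ _ = tt
  ins-▷ₕ (S ∷ T) i p = ins-▷ i p

  tab-tins : ∀ {x T T′ i} → TIns x T T′ i → Tab T → Tab T′
  tab-tins new [] = row ([] ∷ []) cons tt []
  tab-tins (app {T = T} p) (row w _ a t) = row (weakly-ins p w) (nonEmpty-ins p) (ins-▷ₕ T p a) t
  tab-tins (bmp p q) (row w _ a t) = row (weakly-ins p w) (nonEmpty-ins p) (ins-ins-▷ₕ p a q) (tab-tins q t)

  -- The second letter acts strictly to the right of the first, where the original entries are at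
  -- least as large as the letter bumped first.
  ins-ins-≤ : ∀ {x₁ x₂ R₀ R₁ R₂ m₁ m₂} → x₁ ≤ x₂ → Ins x₁ R₀ R₁ m₁ → Ins x₂ R₁ R₂ m₂ → Weakly R₀ →
              (m₁ ≡ nothing → m₂ ≡ nothing) × (∀ {y₁ y₂} → m₁ ≡ just y₁ → m₂ ≡ just y₂ → y₁ ≤ y₂)
  ins-ins-≤ le end (bump lt) _ = ⊥-elim (<⇒≱ lt le)
  ins-ins-≤ le end (pass _ end) _ = (λ _ → refl) , λ ()
  ins-ins-≤ le (bump _) (bump lt) _ = ⊥-elim (<⇒≱ lt le)
  ins-ins-≤ le (bump {r} _) (pass _ j) (r≤ ∷ _) = (λ ()) , λ { refl e → bumped-≥ j e r≤ }
    where
    bumped-≥ : ∀ {x R R′ m y} → Ins x R R′ m → m ≡ just y → All (r ≤_) R → r ≤ y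
    bumped-≥ (bump _) refl (p ∷ _) = p
    bumped-≥ (pass _ i) e (_ ∷ ps) = bumped-≥ i e ps
  ins-ins-≤ le (pass r≤x _) (bump lt) _ = ⊥-elim (<⇒≱ lt (≤-trans r≤x le))
  ins-ins-≤ le (pass _ i) (pass _ j) (_ ∷ ws) = ins-ins-≤ le i j ws

  -- The smaller letter acts no further right than the place where `x₁` now stands, so it must bump
  -- something, and nothing larger than `x₁`.
  ins-ins-> : ∀ {x₁ x₂ R₀ R₁ R₂ m₁ m₂} → x₂ < x₁ → Ins x₁ R₀ R₁ m₁ → Ins x₂ R₁ R₂ m₂ →
              ∃ λ y₂ → m₂ ≡ just y₂ × y₂ ≤ x₁
  ins-ins-> lt end (bump _) = _ , refl , ≤-refl
  ins-ins-> lt end (pass le _) = ⊥-elim (<⇒≱ lt le)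
  ins-ins-> lt (bump _) (bump _) = _ , refl , ≤-refl
  ins-ins-> lt (bump _) (pass le _) = ⊥-elim (<⇒≱ lt le)
  ins-ins-> lt (pass r≤ _) (bump _) = _ , refl , r≤
  ins-ins-> lt (pass _ i) (pass _ j) = ins-ins-> lt i j

  -- The bumped letters inherit the inequality, so the comparison passes down the rows and the
  -- second path stops no later. In `tins->` it continues strictly longer.
  tins-≤ : ∀ {x₁ x₂ T₀ T₁ T₂ i₁ i₂} → x₁ ≤ x₂ → TIns x₁ T₀ T₁ i₁ → TIns x₂ T₁ T₂ i₂ → Tab T₀ → i₂ ≤ i₁
  tins-≤ le p (app _) _ = z≤n
  tins-≤ le new (bmp (bump lt) _) _ = ⊥-elim (<⇒≱ lt le)
  tins-≤ le new (bmp (pass _ ()) _) _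
  tins-≤ le (app p) (bmp q _) (row w _ _ _) with proj₁ (ins-ins-≤ le p q w) refl
  ... | ()
  tins-≤ le (bmp p p′) (bmp q q′) (row w _ _ t) = s≤s (tins-≤ (proj₂ (ins-ins-≤ le p q w) refl refl) p′ q′ t)

  tins-> : ∀ {x₁ x₂ T₀ T₁ T₂ i₁ i₂} → x₂ < x₁ → TIns x₁ T₀ T₁ i₁ → TIns x₂ T₁ T₂ i₂ → i₁ < i₂
  tins-> lt new (bmp _ _) = s≤s z≤n
  tins-> lt new (app (pass le _)) = ⊥-elim (<⇒≱ lt le)
  tins-> lt (app p) (app q) with ins-ins-> lt p q
  ... | _ , () , _
  tins-> lt (app p) (bmp q _) = s≤s z≤n
  tins-> lt (bmp p _) (app q) with ins-ins-> lt p q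
  ... | _ , () , _
  tins-> lt (bmp p p′) (bmp q q′) with ins-ins-> lt p q
  ... | _ , refl , y≤ = s≤s (tins-> (≤-<-trans y≤ (ins-bumped p)) p′ q′)

  data Box : ℕ → List ℕ → List ℕ → Set where
    new  : Box 0 [] (1 ∷ [])
    here : ∀ {n s} → Box 0 (suc n ∷ s) (suc (suc n) ∷ s)
    there : ∀ {i n s s′} → Box i s s′ → Box (suc i) (n ∷ s) (n ∷ s′)

  shape : Tableau → List ℕ
  shape = map length

  box-det : ∀ {i s s₁ s₂} → Box i s s₁ → Box i s s₂ → s₁ ≡ s₂
  box-det new new = refl
  box-det here here = refl
  box-det (there p) (there q) = cong (_ ∷_) (box-det p q)

  box-inj : ∀ {i s s₁ s₂} → Box i s₁ s → Box i s₂ s → s₁ ≡ s₂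
  box-inj new new = refl
  box-inj here here = refl
  box-inj (there p) (there q) = cong (_ ∷_) (box-inj p q)

  ins-length : ∀ {x R R′ y} → Ins x R R′ (just y) → length R′ ≡ length R
  ins-length (bump _) = refl
  ins-length (pass _ i) = cong suc (ins-length i)

  ins-length′ : ∀ {x R R′} → Ins x R R′ nothing → length R′ ≡ suc (length R)
  ins-length′ end = refl
  ins-length′ (pass _ i) = cong suc (ins-length′ i)

  box-tins : ∀ {x T T′ i} → TIns x T T′ i → Tab T → Box i (shape T) (shape T′)
  box-tins new _ = new
  box-tins (app {R = r ∷ R} {T = T} p) (row _ cons _ _) = subst (λ n → Box 0 (length (r ∷ R) ∷ shape T) (n ∷ shape T)) (sym (ins-length′ p)) here
  box-tins {T′ = R′ ∷ T′} (bmp {R = R} {T = T} p q) (row _ _ _ t) = subst (λ n → Box _ (length R ∷ shape T) (n ∷ shape T′)) (sym (ins-length p)) (there (box-tins q t))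

  inserted : ∀ {x R R′ m} → Ins x R R′ m → x ∈ R′
  inserted end = here refl
  inserted (bump _) = here refl
  inserted (pass _ i) = there (inserted i)

  -- The expelled letter is the last entry smaller than y, since that is where y must have stood.
  unbump : ∀ y r R → Weakly (r ∷ R) → r < y → ∃₂ λ x R₀ → Ins x R₀ (r ∷ R) (just y) × Weakly R₀ × All (r ≤_) R₀
  unbump y r [] w r<y = r , y ∷ [] , bump r<y , [] ∷ [] , <⇒≤ r<y ∷ []
  unbump y r (s ∷ R) (r≤ ∷ w) r<y with s <? y
  ... | yes s<y with unbump y s R w s<y
  ...   | x , R₀ , i , w₀ , s≤ = x , r ∷ R₀ , pass (x≥ i) i , r≤R₀ ∷ w₀ , ≤-refl ∷ r≤R₀
    where
    r≤R₀ = All.map (≤-trans (All.head r≤)) s≤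
    x≥ : ∀ {x R₀ m} → Ins x R₀ (s ∷ R) m → r ≤ x
    x≥ i = All.lookup r≤ (inserted i)
  unbump y r (s ∷ R) (r≤ ∷ w@(s≤ ∷ _)) r<y | no s≮y = r , y ∷ s ∷ R , bump r<y ,
    (y≤s ∷ All.map (≤-trans y≤s) s≤) ∷ w , <⇒≤ r<y ∷ r≤
    where y≤s = ≮⇒≥ s≮y

  ins-inj : ∀ {x₁ x₂ R₁ R₂ R′ y} → Ins x₁ R₁ R′ (just y) → Ins x₂ R₂ R′ (just y) → Weakly R₁ → Weakly R₂ → x₁ ≡ x₂ × R₁ ≡ R₂
  ins-inj (bump _) (bump _) _ _ = refl , refl
  ins-inj (bump _) (pass _ j) (y≤ ∷ _) _ = ⊥-elim (<⇒≱ (ins-bumped j) (All.lookup y≤ (inserted j)))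
  ins-inj (pass _ i) (bump _) _ (y≤ ∷ _) = ⊥-elim (<⇒≱ (ins-bumped i) (All.lookup y≤ (inserted i)))
  ins-inj (pass _ i) (pass _ j) (_ ∷ w₁) (_ ∷ w₂) with ins-inj i j w₁ w₂
  ... | refl , refl = refl , refl

  ins-inj′ : ∀ {x₁ x₂ R₁ R₂ R′} → Ins x₁ R₁ R′ nothing → Ins x₂ R₂ R′ nothing → x₁ ≡ x₂ × R₁ ≡ R₂
  ins-inj′ end end = refl , refl
  ins-inj′ end (pass _ ())
  ins-inj′ (pass _ ()) end
  ins-inj′ (pass _ i) (pass _ j) with ins-inj′ i j
  ... | refl , refl = refl , refl

  tins-inj : ∀ {x₁ x₂ T₁ T₂ T′ i} → TIns x₁ T₁ T′ i → TIns x₂ T₂ T′ i → Tab T₁ → Tab T₂ → x₁ ≡ x₂ × T₁ ≡ T₂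
  tins-inj new new _ _ = refl , refl
  tins-inj new (app (pass _ ())) _ _
  tins-inj new (app end) _ (row _ () _ _)
  tins-inj (app (pass _ ())) new _ _
  tins-inj (app end) new (row _ () _ _) _
  tins-inj (app p) (app q) _ _ with ins-inj′ p q
  ... | refl , refl = refl , refl
  tins-inj (bmp p p′) (bmp q q′) (row w₁ _ _ t₁) (row w₂ _ _ t₂) with tins-inj p′ q′ t₁ t₂
  ... | refl , refl with ins-inj p q w₁ w₂
  ...   | refl , refl = refl , refl

  ▷-length : ∀ {R S} → R ▷ S → length S ≤ length R
  ▷-length [] = z≤n
  ▷-length (_ ∷ p) = s≤s (▷-length p)

  ▷-init : ∀ R x S → (R ∷ʳ x) ▷ S → length S ≤ length R → R ▷ S
  ▷-init R x [] _ _ = []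
  ▷-init (r ∷ R) x (s ∷ S) (p ∷ ps) (s≤s le) = p ∷ ▷-init R x S ps le

  ▷-∈ : ∀ {r R S y} → Weakly (r ∷ R) → (r ∷ R) ▷ S → y ∈ S → r < y
  ▷-∈ w (p ∷ ps) (here refl) = p
  ▷-∈ {R = []} w (p ∷ []) (there ())
  ▷-∈ {R = s ∷ R} ((r≤s ∷ _) ∷ w) (p ∷ ps) (there y∈) = ≤-<-trans r≤s (▷-∈ w ps y∈)

  ▷-> : ∀ {R R′ x y S} → Ins x R R′ (just y) → R′ ▷ S → All (y <_) S → R ▷ S
  ▷-> i [] [] = []
  ▷-> (bump _) (_ ∷ ps) (q ∷ _) = q ∷ ps
  ▷-> (pass _ i) (p ∷ ps) (_ ∷ qs) = p ∷ ▷-> i ps qs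

  unins-▷ : ∀ {x R R′ y S S′ m} → Ins x R R′ (just y) → Weakly R → R′ ▷ S′ → Ins y S S′ m → Weakly S → R ▷ S
  unins-▷ i w p end _ = []
  unins-▷ (bump _) w (_ ∷ ps) (bump y<s) _ = y<s ∷ ps
  unins-▷ (pass r≤x i) w (_ ∷ ps) (bump y<s) (s≤ ∷ _) = <-trans (≤-<-trans r≤x (ins-bumped i)) y<s ∷ ▷-> i ps (All.map (<-≤-trans y<s) s≤)
  unins-▷ (bump _) (y≤ ∷ w) (p ∷ ps) (pass s≤y j) _ = ⊥-elim (no-room y≤ ps (inserted j))
    where
    no-room : ∀ {y R S} → All (y ≤_) R → R ▷ S → y ∈ S → ⊥
    no-room (q ∷ _) (p ∷ _) (here refl) = <⇒≱ p q
    no-room (_ ∷ qs) (_ ∷ ps) (there y∈) = no-room qs ps y∈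
  unins-▷ (pass r≤x i) (_ ∷ w) (p ∷ ps) (pass _ j) (_ ∷ ws) = p ∷ unins-▷ i w ps j ws

  unins-▷ₕ : ∀ {x R R′ y T T′ i} → Ins x R R′ (just y) → Weakly R → R′ ▷ₕ T′ → TIns y T T′ i → Tab T → R ▷ₕ T
  unins-▷ₕ i w p new _ = tt
  unins-▷ₕ i w p (app j) (row ws _ _ _) = unins-▷ i w p j ws
  unins-▷ₕ i w p (bmp j _) (row ws _ _ _) = unins-▷ i w p j ws

  data Decreasing : List ℕ → Set where
    []  : Decreasing []
    [-] : ∀ {n} → Decreasing (n ∷ [])
    _∷_ : ∀ {m n s} → n ≤ m → Decreasing (n ∷ s) → Decreasing (m ∷ n ∷ s)

  tab-decreasing : ∀ {T} → Tab T → Decreasing (shape T)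
  tab-decreasing [] = []
  tab-decreasing {_ ∷ []} (row _ _ _ _) = [-]
  tab-decreasing {_ ∷ _ ∷ _} (row _ _ p t) = ▷-length p ∷ tab-decreasing t

  decreasing-tail : ∀ {n s} → Decreasing (n ∷ s) → Decreasing s
  decreasing-tail [-] = []
  decreasing-tail (_ ∷ d) = d

  snocView : ∀ (R : Row) n → length R ≡ suc n → ∃₂ λ R₀ x → R ≡ R₀ ∷ʳ x × length R₀ ≡ n
  snocView (x ∷ []) zero refl = [] , x , refl , refl
  snocView (r ∷ R@(_ ∷ _)) (suc n) e with snocView R n (suc-injective e)
  ... | R₀ , x , e₁ , e′ = r ∷ R₀ , x , cong (r ∷_) e₁ , cong suc e′
  snocView (r ∷ []) (suc n) ()

  weakly-snoc : ∀ R x → Weakly (R ∷ʳ x) → Weakly R × All (_≤ x) R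
  weakly-snoc [] x w = [] , []
  weakly-snoc (r ∷ R) x (p ∷ w) with weakly-snoc R x w
  ... | wR , ≤x = All.++⁻ˡ R p ∷ wR , All.head (All.++⁻ʳ R p) ∷ ≤x

  ins-end : ∀ {R x} → All (_≤ x) R → Ins x R (R ∷ʳ x) nothing
  ins-end [] = end
  ins-end (p ∷ ps) = pass p (ins-end ps)

  tins-first : ∀ {y T T′ i} → TIns y T T′ i → ∃₂ λ S T″ → T′ ≡ S ∷ T″ × y ∈ S
  tins-first new = _ , _ , refl , here refl
  tins-first (app p) = _ , _ , refl , inserted p
  tins-first (bmp p _) = _ , _ , refl , inserted p

  nonEmpty-length : ∀ {R} n → length R ≡ suc n → NonEmpty R
  nonEmpty-length {_ ∷ _} n _ = cons

  -- The last letter of row i is expelled and travels upwards. In each row above it finds an entry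
  -- to replace, because the first entry there is smaller than every entry of the row beneath.
  uninsert : ∀ {T′} i s → Tab T′ → Box i s (shape T′) → Decreasing s → ∃₂ λ x T → TIns x T T′ i × Tab T
  uninsert {R ∷ T} i s t b d = go i s R T t b refl d
    where
    go : ∀ i s R T {s′} → Tab (R ∷ T) → Box i s s′ → s′ ≡ shape (R ∷ T) → Decreasing s → ∃₂ λ x T₀ → TIns x T₀ (R ∷ T) i × Tab T₀
    go 0 [] (x ∷ []) [] t new refl d = x , [] , new , []
    go 0 (suc n ∷ _) R T (row w ne a t) here e d with snocView R (suc n) (sym (proj₁ (∷-injective e)))
      where open import Data.List.Properties using (∷-injective)
    ... | R₀ , x , refl , e′ with weakly-snoc R₀ x w
    ...   | w₀ , ≤x = x , R₀ ∷ T , app (ins-end ≤x) , row w₀ (nonEmpty-length n e′) (above T a (proj₂ (∷-injective e)) d) t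
      where
      open import Data.List.Properties using (∷-injective)
      above : ∀ T {s} → (R₀ ∷ʳ x) ▷ₕ T → s ≡ shape T → Decreasing (suc n ∷ s) → R₀ ▷ₕ T
      above [] _ _ _ = tt
      above (S ∷ T) p refl (le ∷ _) = ▷-init R₀ x S p (subst (length S ≤_) (sym e′) le)
    go (suc i) (n ∷ s) (r ∷ R) [] _ (there ()) refl d
    go (suc i) (n ∷ s) (r ∷ R) (S ∷ T) (row w ne a t) (there b) refl d with go i s S T t b refl (decreasing-tail d)
    ... | y , T₀ , q , t₀ with tins-first q
    ...   | _ , _ , refl , y∈ with unbump y r R w (▷-∈ w a y∈)
    ...     | x , R₀ , p , w₀ , _ = x , R₀ ∷ T₀ , bmp p q , row w₀ (nonEmpty-length (length R) (sym (ins-length p))) (unins-▷ₕ p w₀ a q t₀) t₀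
  uninsert {[]} i s t () d

-- The Robinson-Schensted-Knuth correspondence and its compatibility with plactic classes.

module RobinsonSchenstedKnuth where
  open import Data.Nat
  open import Data.Nat.Properties
  open import Data.Nat.ListAction using (sum)
  open import Data.List hiding (lookup; sum)
  open import Data.List.Properties using (++-assoc; length-++; ∷-injective; ∷ʳ-injective; unfold-reverse; length-map)
  open import Data.List.Relation.Unary.All as All using (All; []; _∷_)
  open import Data.List.Relation.Unary.AllPairs using ([]; _∷_)
  open import Data.Maybe using (just; nothing)
  open import Data.Unit using (⊤; tt)
  open import Relation.Nullary using (¬_; yes; no)
  open import Relation.Binary.PropositionalEquality
  open import Defs using (Tableau; count)
  open WordCharge using (Word)
  open ChargeRotation using (count-++; count-∷; δ)
  open PlacticWords
  open RowInsertion

  -- A box labelled b is added to row i; the rows above contain only labels < b, so that i is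
  -- the topmost row containing the largest label.
  data Add (b : ℕ) : ℕ → Tableau → Tableau → Set where
    new   : Add b 0 [] ((b ∷ []) ∷ [])
    here  : ∀ {R Q} → All (_≤ b) R → All (All (_≤ b)) Q → Add b 0 (R ∷ Q) ((R ∷ʳ b) ∷ Q)
    there : ∀ {i R Q Q′} → All (_< b) R → Add b i Q Q′ → Add b (suc i) (R ∷ Q) (R ∷ Q′)

  add-det : ∀ {b i Q Q₁ Q₂} → Add b i Q Q₁ → Add b i Q Q₂ → Q₁ ≡ Q₂
  add-det new new = refl
  add-det (here _ _) (here _ _) = refl
  add-det (there _ p) (there _ q) = cong (_ ∷_) (add-det p q)

  add-bound : ∀ {b c i Q Q′} → Add b i Q Q′ → All (All (_≤ c)) Q′ → b ≤ c
  add-bound new ((p ∷ []) ∷ []) = p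
  add-bound (here {R} _ _) (p ∷ _) = All.head (All.++⁻ʳ R p)
  add-bound (there _ a) (_ ∷ ps) = add-bound a ps

  snoc-≢[] : ∀ (R : Row) {x} → ¬ (R ∷ʳ x ≡ [])
  snoc-≢[] [] ()
  snoc-≢[] (_ ∷ _) ()

  add-inj : ∀ {b₁ b₂ i₁ i₂ Q₁ Q₂ Q′} → Add b₁ i₁ Q₁ Q′ → Add b₂ i₂ Q₂ Q′ → Tab Q₁ → Tab Q₂ →
            b₁ ≡ b₂ × i₁ ≡ i₂ × Q₁ ≡ Q₂
  add-inj p q t₁ t₂ = go p q refl t₁ t₂
    where
    go : ∀ {b₁ b₂ i₁ i₂ Q₁ Q₂ Q′ Q″} → Add b₁ i₁ Q₁ Q′ → Add b₂ i₂ Q₂ Q″ → Q′ ≡ Q″ → Tab Q₁ → Tab Q₂ →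
         b₁ ≡ b₂ × i₁ ≡ i₂ × Q₁ ≡ Q₂
    go new new refl _ _ = refl , refl , refl
    go new (here {_ ∷ R} _ _) e _ _ = ⊥-elim (snoc-≢[] R (sym (proj₂ (∷-injective (proj₁ (∷-injective e))))))
    go new (here {[]} _ _) e _ (row _ () _ _)
    go new (there _ ()) refl _ _
    go (here {_ ∷ R} _ _) new e _ _ = ⊥-elim (snoc-≢[] R (proj₂ (∷-injective (proj₁ (∷-injective e)))))
    go (here {[]} _ _) new e (row _ () _ _) _
    go (there _ ()) new refl _ _
    go (here {R₁} _ _) (here {R₂} _ _) e _ _ with ∷-injective e
    ... | e₁ , refl with ∷ʳ-injective R₁ R₂ e₁
    ...   | refl , refl = refl , refl , refl
    go (here {R₁} _ ≤b) (there <b q) refl _ _ = ⊥-elim (<⇒≱ (All.head (All.++⁻ʳ R₁ <b)) (add-bound q ≤b))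
    go (there <b p) (here {R₂} _ ≤b) refl _ _ = ⊥-elim (<⇒≱ (All.head (All.++⁻ʳ R₂ <b)) (add-bound p ≤b))
    go (there _ p) (there _ q) refl (row _ _ _ t₁) (row _ _ _ t₂) with go p q refl t₁ t₂
    ... | refl , refl , refl = refl , refl , refl

  -- Describes a recording tableau to which b has last been added in row j. It permits b again in
  -- every row not below j, and a larger label in every row.
  Top : ℕ → ℕ → Tableau → Set
  Top b j [] = ⊤
  Top b zero (R ∷ Q) = All (_≤ b) R × Top b zero Q
  Top b (suc j) (R ∷ Q) = All (_< b) R × Top b j Q

  top-≤ : ∀ {b} j Q → Top b j Q → All (All (_≤ b)) Q
  top-≤ j [] _ = []
  top-≤ zero (R ∷ Q) (p , t) = p ∷ top-≤ zero Q t
  top-≤ (suc j) (R ∷ Q) (p , t) = All.map <⇒≤ p ∷ top-≤ j Q t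

  ≤-top : ∀ {b} Q → All (All (_≤ b)) Q → Top b 0 Q
  ≤-top [] [] = tt
  ≤-top (R ∷ Q) (p ∷ ps) = p , ≤-top Q ps

  add-top : ∀ {b i Q Q′} → Add b i Q Q′ → Top b i Q′
  add-top new = (≤-refl ∷ []) , tt
  add-top (here {R} {Q} p ps) = All.++⁺ p (≤-refl ∷ []) , ≤-top Q ps
  add-top (there p a) = p , add-top a

  top-raise : ∀ {b c} Q → b < c → All (All (_≤ b)) Q → Top c (length Q) Q
  top-raise [] b<c [] = tt
  top-raise (R ∷ Q) b<c (p ∷ ps) = All.map (λ le → ≤-<-trans le b<c) p , top-raise Q b<c ps

  add-exists : ∀ {b j} i Q → Top b j Q → i ≤ j → i ≤ length Q → ∃ λ Q′ → Add b i Q Q′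
  add-exists zero [] _ _ _ = _ , new
  add-exists {j = j} zero (R ∷ Q) t _ _ with top-≤ j (R ∷ Q) t
  ... | p ∷ ps = _ , here p ps
  add-exists {j = suc j} (suc i) (R ∷ Q) (p , t) (s≤s le) (s≤s le′) with add-exists i Q t le le′
  ... | Q′ , a = _ , there p a
  add-exists (suc i) [] _ _ ()

  box-add : ∀ {b i Q Q′} → Add b i Q Q′ → Tab Q → Box i (shape Q) (shape Q′)
  box-add new _ = new
  box-add {b} (here {r ∷ R} {Q} _ _) (row _ cons _ _) = subst (λ n → Box 0 (suc (length R) ∷ shape Q) (suc n ∷ shape Q))
    (sym (trans (length-++ R) (+-comm (length R) 1))) Box.here
  box-add (there _ a) (row _ _ _ t) = Box.there (box-add a t)

  box-≤ : ∀ {i s s′} → Box i s s′ → i ≤ length s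
  box-≤ new = z≤n
  box-≤ here = z≤n
  box-≤ (there b) = s≤s (box-≤ b)

  weakly-∷ʳ : ∀ {R b} → Weakly R → All (_≤ b) R → Weakly (R ∷ʳ b)
  weakly-∷ʳ [] [] = [] ∷ []
  weakly-∷ʳ (p ∷ w) (q ∷ qs) = All.++⁺ p (q ∷ []) ∷ weakly-∷ʳ w qs

  ▷-∷ʳ : ∀ {R S b} → R ▷ S → length S < length R → All (_< b) R → R ▷ (S ∷ʳ b)
  ▷-∷ʳ {r ∷ R} [] _ (p ∷ _) = p ∷ []
  ▷-∷ʳ (q ∷ qs) (s≤s lt) (_ ∷ ps) = q ∷ ▷-∷ʳ qs lt ps

  ext-▷ : ∀ {R S b} → R ▷ S → (R ∷ʳ b) ▷ S
  ext-▷ [] = []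
  ext-▷ (p ∷ ps) = p ∷ ext-▷ ps

  tab-add : ∀ {b i Q Q′} → Add b i Q Q′ → Tab Q → Decreasing (shape Q′) → Tab Q′
  tab-add new [] _ = row ([] ∷ []) cons tt []
  tab-add (here {R} {Q} p _) (row w ne a t) _ = row (weakly-∷ʳ w p) (ne′ ne) (above Q a) t
    where
    ne′ : ∀ {R b} → NonEmpty R → NonEmpty (R ∷ʳ b)
    ne′ cons = cons
    above : ∀ Q → R ▷ₕ Q → (R ∷ʳ _) ▷ₕ Q
    above [] _ = tt
    above (S ∷ Q) q = ext-▷ q
  tab-add {b} (there {R = R} p a) (row w ne ab t) d = row w ne (above a ab d) (tab-add a t (decreasing-tail d))
    where
    len : ∀ {R} → NonEmpty R → 0 < length R
    len cons = s≤s z≤n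
    above : ∀ {i Q Q′} → Add b i Q Q′ → R ▷ₕ Q → Decreasing (length R ∷ shape Q′) → R ▷ₕ Q′
    above new _ d = ▷-∷ʳ [] (len ne) p
    above (here {S} _ _) q (le ∷ _) = ▷-∷ʳ q (subst (_≤ length R) (trans (length-++ S) (+-comm (length S) 1)) le) p
    above (there _ _) q _ = q

  add-≤ : ∀ {b i Q Q′} → Add b i Q Q′ → All (All (_≤ b)) Q′
  add-≤ {i = i} {Q′ = Q′} a = top-≤ i Q′ (add-top a)

  add-shrink : ∀ {b i Q Q′ R} → Add b i Q Q′ → R ▷ₕ Q′ → R ▷ₕ Q
  add-shrink new _ = tt
  add-shrink (here {S} _ _) p = shrink S p
    where
    shrink : ∀ S {x R} → R ▷ (S ∷ʳ x) → R ▷ S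
    shrink [] _ = []
    shrink (s ∷ S) (p ∷ ps) = p ∷ shrink S ps
  add-shrink (there _ _) p = p

  -- The label to remove is the largest one, at the end of the highest row that contains it. That
  -- row is longer than the next, because an entry under its last one would have to be larger still.
  unadd : ∀ R Q → Tab (R ∷ Q) → ∃ λ b → ∃₂ λ i Q₀ → Add b i Q₀ (R ∷ Q) × Tab Q₀
  unadd R [] (row w ne a t) with snocView R (length R ∸ 1) (pos ne)
    where
    pos : ∀ {R} → NonEmpty R → length R ≡ suc (length R ∸ 1)
    pos cons = refl
  ... | [] , b , refl , _ = b , 0 , [] , new , []
  ... | r ∷ R₀ , b , refl , _ with weakly-snoc (r ∷ R₀) b w
  ...   | w₀ , ≤b = b , 0 , (r ∷ R₀) ∷ [] , here ≤b [] , row w₀ cons tt []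
  unadd R (S ∷ Q) (row w ne a t) with unadd S Q t
  ... | b , i , Q₀ , ad , t₀ with snocView R (length R ∸ 1) (pos ne)
    where
    pos : ∀ {R} → NonEmpty R → length R ≡ suc (length R ∸ 1)
    pos cons = refl
  ...   | R₀ , l , refl , _ with weakly-snoc R₀ l w
  ...     | w₀ , ≤l with l <? b
  ...       | yes l<b = b , suc i , (R₀ ∷ʳ l) ∷ Q₀ , there (All.++⁺ (All.map (λ le → ≤-<-trans le l<b) ≤l) (l<b ∷ [])) ad , row w ne (add-shrink ad a) t₀
  ...       | no l≮b = l , 0 , R₀ ∷ S ∷ Q , here ≤l entries , row w₀ (ne₀ t R₀ short) (▷-init R₀ l S a short) t
    where
    entries : All (All (_≤ l)) (S ∷ Q)
    entries = All.map (All.map (λ le → ≤-trans le (≮⇒≥ l≮b))) (add-≤ ad)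
    full : ∀ R S → (R ∷ʳ l) ▷ S → length R < length S → All (_≤ l) S → ⊥
    full [] (s ∷ S) (p ∷ _) _ (q ∷ _) = <⇒≱ p q
    full (r ∷ R) (s ∷ S) (_ ∷ ps) (s≤s lt) (_ ∷ qs) = full R S ps lt qs
    short : length S ≤ length R₀
    short = ≮⇒≥ (λ lt → full R₀ S a lt (All.head entries))
    ne₀ : ∀ {S} → Tab (S ∷ Q) → ∀ R₀ → length S ≤ length R₀ → NonEmpty R₀
    ne₀ _ (_ ∷ _) _ = cons
    ne₀ (row _ cons _ _) [] ()

  -- A relation instead of a pair of inverse functions: bijectivity is then assembled from
  -- determinism, injectivity and totality of the single steps. The most recent pair stands first.
  data RSK : List (ℕ × ℕ) → Tableau → Tableau → Set where
    []   : RSK [] [] []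
    step : ∀ {b x w P P′ Q Q′ i} → RSK w P Q → TIns x P P′ i → Add b i Q Q′ → RSK ((b , x) ∷ w) P′ Q′

  rsk-tab : ∀ {w P Q} → RSK w P Q → Tab P × Tab Q × shape P ≡ shape Q
  rsk-tab [] = [] , [] , refl
  rsk-tab (step {i = i} r p a) with rsk-tab r
  ... | tP , tQ , e = tP′ , tab-add a tQ (subst Decreasing shape≡ (tab-decreasing tP′)) , shape≡
    where
    tP′ = tab-tins p tP
    shape≡ = box-det (box-tins p tP) (subst (λ s → Box i s _) (sym e) (box-add a tQ))

  rsk-functional : ∀ {w P₁ P₂ Q₁ Q₂} → RSK w P₁ Q₁ → RSK w P₂ Q₂ → P₁ ≡ P₂ × Q₁ ≡ Q₂
  rsk-functional [] [] = refl , refl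
  rsk-functional (step r p a) (step r′ p′ a′) with rsk-functional r r′
  ... | refl , refl with tins-det p p′
  ...   | refl , refl = refl , add-det a a′

  rsk-injective : ∀ {w₁ w₂ P Q} → RSK w₁ P Q → RSK w₂ P Q → w₁ ≡ w₂
  rsk-injective [] [] = refl
  rsk-injective (step r p a) (step r′ p′ a′) with rsk-tab r | rsk-tab r′
  ... | tP , tQ , _ | tP′ , tQ′ , _ with add-inj a a′ tQ tQ′
  ...   | refl , refl , refl with tins-inj p p′ tP tP′
  ...     | refl , refl = cong (_ ∷_) (rsk-injective r r′)

  infix 4 _≼_
  _≼_ : ℕ × ℕ → ℕ × ℕ → Set
  (b , x) ≼ (c , y) = b < c ⊎ (b ≡ c × x ≤ y)

  -- biwords with the last letter first
  data Biword : List (ℕ × ℕ) → Set where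
    []  : Biword []
    [-] : ∀ {p} → Biword (p ∷ [])
    _∷_ : ∀ {p q w} → q ≼ p → Biword (q ∷ w) → Biword (p ∷ q ∷ w)

  -- A larger label may go into any row. For equal labels the letters increase weakly, so `tins-≤`
  -- places the new box not below the previous one.
  rsk-total : ∀ {w} → Biword w → ∃₂ λ P Q → RSK w P Q
  rsk-total [] = _ , _ , []
  rsk-total ([-] {b , x}) = _ , _ , step [] new new
  rsk-total (_∷_ {b , x} {c , y} le bw) with rsk-total bw
  ... | P , Q , r@(step r′ p a) with tins x P
  ...   | P′ , i , p′ = P′ , proj₁ (added le) , step r p′ (proj₂ (added le))
    where
    i≤ : i ≤ length Q
    i≤ with rsk-tab r
    ... | tP , tQ , e = ≤-trans (box-≤ (box-tins p′ tP)) (≤-reflexive (trans (cong length e) (length-map length Q)))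
    added : (c , y) ≼ (b , x) → ∃ λ Q′ → Add b i Q Q′
    added (inj₁ c<b) = add-exists i Q (top-raise Q c<b (add-≤ a)) i≤ i≤
    added (inj₂ (refl , y≤x)) = add-exists i Q (add-top a) (tins-≤ y≤x p p′ (proj₁ (rsk-tab r′))) i≤

  add-row-≤ : ∀ {b i j Q₀ Q Q′} → Add b j Q₀ Q → Add b i Q Q′ → i ≤ j
  add-row-≤ new (here _ _) = z≤n
  add-row-≤ new (there (p ∷ []) _) = ⊥-elim (<-irrefl refl p)
  add-row-≤ (here _ _) (here _ _) = z≤n
  add-row-≤ (here {R} _ _) (there p _) = ⊥-elim (<-irrefl refl (All.head (All.++⁻ʳ R p)))
  add-row-≤ (there _ _) (here _ _) = z≤n
  add-row-≤ (there _ a) (there _ a′) = s≤s (add-row-≤ a a′)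

  add-label-≤ : ∀ {b c i j Q₀ Q Q′} → Add c j Q₀ Q → Add b i Q Q′ → c ≤ b
  add-label-≤ {b} a a′ = add-bound a (sub a′)
    where
    sub : ∀ {i Q Q′} → Add b i Q Q′ → All (All (_≤ b)) Q
    sub new = []
    sub (here p ps) = p ∷ ps
    sub (there p a) = All.map <⇒≤ p ∷ sub a

  -- If the labels agreed and the letters decreased, `tins->` would put the new box strictly below
  -- the previous one, which `Add` excludes for equal labels.
  add-≼ : ∀ {b c x y i j P₀ P P′ Q₀ Q Q′} → TIns y P₀ P j → Add c j Q₀ Q → TIns x P P′ i → Add b i Q Q′ → (c , y) ≼ (b , x)
  add-≼ {b} {c} {x} {y} p a p′ a′ with c ≟ b
  ... | no c≢b = inj₁ (≤∧≢⇒< (add-label-≤ a a′) c≢b)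
  ... | yes refl with y ≤? x
  ...   | yes y≤x = inj₂ (refl , y≤x)
  ...   | no y≰x = ⊥-elim (<⇒≱ (tins-> (≰⇒> y≰x) p p′) (add-row-≤ a a′))

  rsk-biword : ∀ {w P Q} → RSK w P Q → Biword w
  rsk-biword [] = []
  rsk-biword (step [] _ _) = [-]
  rsk-biword (step r@(step _ p a) p′ a′) = add-≼ p a p′ a′ ∷ rsk-biword r

  unrsk : ∀ n P Q → sum (shape Q) ≤ n → Tab P → Tab Q → shape P ≡ shape Q → ∃ λ w → RSK w P Q
  unrsk n [] [] _ _ _ _ = [] , []
  unrsk zero P (R ∷ Q) le _ (row _ cons _ _) _ with le
  ... | ()
  unrsk (suc n) P (R ∷ Q) le tP tQ e with unadd R Q tQ
  ... | b , i , Q₀ , a , tQ₀ with uninsert i (shape Q₀) tP (subst (Box i (shape Q₀)) (sym e) (box-add a tQ₀)) (tab-decreasing tQ₀)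
  ...   | x , P₀ , p , tP₀ with unrsk n P₀ Q₀ (smaller (box-add a tQ₀)) tP₀ tQ₀ (box-inj (box-tins p tP₀) (subst (Box i (shape Q₀)) (sym e) (box-add a tQ₀)))
    where
    box-sum : ∀ {i s s′} → Box i s s′ → sum s′ ≡ suc (sum s)
    box-sum new = refl
    box-sum here = refl
    box-sum (there {n = n} {s = s} b) = trans (cong (n +_) (box-sum b)) (+-suc n (sum s))
    smaller : Box i (shape Q₀) (shape (R ∷ Q)) → sum (shape Q₀) ≤ n
    smaller b = ≤-pred (≤-trans (≤-reflexive (sym (box-sum b))) le)
  ...     | w , r = (b , x) ∷ w , step r p a
  unrsk n (_ ∷ _) [] _ _ _ ()

  count-concat-add : ∀ {b i Q Q′} c → Add b i Q Q′ → count c (concat Q′) ≡ δ b c + count c (concat Q)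
  count-concat-add {b} c new = trans (count-∷ c b []) refl
  count-concat-add {b} c (here {R} {Q} _ _) = begin
    count c ((R ∷ʳ b) ++ concat Q)  ≡⟨ cong (count c) (++-assoc R (b ∷ []) (concat Q)) ⟩
    count c (R ++ b ∷ concat Q)     ≡⟨ count-insert c R b (concat Q) ⟩
    δ b c + count c (R ++ concat Q) ∎
    where
    open ≡-Reasoning
    open ChargeRotation using (count-insert)
  count-concat-add {b} c (there {R = R} {Q} {Q′} _ a) = begin
    count c (R ++ concat Q′)                ≡⟨ count-++ c R (concat Q′) ⟩
    count c R + count c (concat Q′)         ≡⟨ cong (count c R +_) (count-concat-add c a) ⟩
    count c R + (δ b c + count c (concat Q)) ≡⟨ +-assoc (count c R) (δ b c) _ ⟨
    count c R + δ b c + count c (concat Q)  ≡⟨ cong (_+ count c (concat Q)) (+-comm (count c R) (δ b c)) ⟩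
    δ b c + count c R + count c (concat Q)  ≡⟨ +-assoc (δ b c) (count c R) _ ⟩
    δ b c + (count c R + count c (concat Q)) ≡⟨ cong (δ b c +_) (count-++ c R (concat Q)) ⟨
    δ b c + count c (R ++ concat Q)         ∎
    where open ≡-Reasoning

  rsk-labels : ∀ {w P Q} c → RSK w P Q → count c (concat Q) ≡ count c (map proj₁ w)
  rsk-labels c [] = refl
  rsk-labels c (step {b} {w = w} r _ a) = trans (count-concat-add c a) (trans (cong (δ b c +_) (rsk-labels c r)) (sym (count-∷ c b (map proj₁ w))))

  All-tins : ∀ {Z : ℕ → Set} {x T T′ i} → TIns x T T′ i → Z x → All (All Z) T → All (All Z) T′
  All-tins new z [] = (z ∷ []) ∷ []
  All-tins (app p) z (q ∷ qs) = All-ins p z q ∷ qs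
  All-tins {Z} (bmp p t) z (q ∷ qs) = All-ins p z q ∷ All-tins t (bumped p q) qs
    where
    bumped : ∀ {x R R′ y} → Ins x R R′ (just y) → All Z R → Z y
    bumped (bump _) (q ∷ _) = q
    bumped (pass _ p) (_ ∷ qs) = bumped p qs

  All-untins : ∀ {Z : ℕ → Set} {x T T′ i} → TIns x T T′ i → All (All Z) T′ → Z x × All (All Z) T
  All-untins new ((z ∷ []) ∷ []) = z , []
  All-untins {Z} (app p) (q ∷ qs) with un p q
    where
    un : ∀ {x R R′} → Ins x R R′ nothing → All Z R′ → Z x × All Z R
    un end (z ∷ []) = z , []
    un (pass _ p) (q ∷ qs) with un p qs
    ... | z , zs = z , q ∷ zs
  ... | z , zs = z , zs ∷ qs
  All-untins {Z} (bmp p t) (q ∷ qs) with All-untins t qs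
  ... | zy , zs with un p zy q
    where
    un : ∀ {x R R′ y} → Ins x R R′ (just y) → Z y → All Z R′ → Z x × All Z R
    un (bump _) zy (z ∷ zs) = z , zy ∷ zs
    un (pass _ p) zy (q ∷ qs) with un p zy qs
    ... | z , zs = z , q ∷ zs
  ...   | z , zR = z , zR ∷ zs

  rsk-letters : ∀ {Z : ℕ → Set} {w P Q} → RSK w P Q → All Z (map proj₂ w) → All (All Z) P
  rsk-letters [] [] = []
  rsk-letters (step r p _) (z ∷ zs) = All-tins p z (rsk-letters r zs)

  rsk-unletters : ∀ {Z : ℕ → Set} {w P Q} → RSK w P Q → All (All Z) P → All Z (map proj₂ w)
  rsk-unletters [] _ = []
  rsk-unletters (step r p _) zs with All-untins p zs
  ... | z , zs′ = z ∷ rsk-unletters r zs′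

  rw : Tableau → Word
  rw [] = []
  rw (R ∷ T) = rw T ++ R

  module PlacticInsertion (𝓚 : CommutativeRing 0ℓ 0ℓ) where
    open PlacticRing 𝓚
    private module K = CommutativeRing 𝓚

    module _ {f : Word → K.Carrier} (inv : Invariant f) where
      private
        eq : ∀ {u v} → u ≡ v → f u K.≈ f v
        eq e = K.reflexive (cong f e)

        slide : ∀ {x r} u S v → x < r → Weakly (r ∷ S) → f (u ++ r ∷ S ++ x ∷ v) K.≈ f (u ++ r ∷ x ∷ S ++ v)
        slide u [] v _ _ = K.refl
        slide {x} {r} u (s ∷ S) v x<r ((r≤s ∷ _) ∷ w) = K.trans (eq (sym (++-assoc u (r ∷ []) (s ∷ S ++ x ∷ v))))
          (K.trans (slide (u ++ r ∷ []) S v (<-≤-trans x<r r≤s) w)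
          (K.trans (eq (++-assoc u (r ∷ []) (s ∷ x ∷ S ++ v))) (K.sym (knuth₂ inv u (S ++ v) x<r r≤s))))

      -- Knuth's second relation carries x left through the entries after the bumped one, the first
      -- relation then carries the bumped letter left to the front of the row.
      ins-plactic : ∀ {x R R′ y} u v → Ins x R R′ (just y) → Weakly R → f (u ++ R ++ x ∷ v) K.≈ f (u ++ y ∷ R′ ++ v)
      ins-plactic u v (bump {R = R} x<r) w = slide u R v x<r w
      ins-plactic {x} u v (pass {p} {R} {R′} p≤x i) (p≤ ∷ w) = K.trans (eq (sym (++-assoc u (p ∷ []) (R ++ x ∷ v))))
        (K.trans (ins-plactic (u ++ p ∷ []) v i w) (K.trans (eq (++-assoc u (p ∷ []) _)) (swap i p≤)))
        where
        swap : ∀ {R R′ y} → Ins x R R′ (just y) → All (p ≤_) R → f (u ++ p ∷ y ∷ R′ ++ v) K.≈ f (u ++ y ∷ p ∷ R′ ++ v)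
        swap (bump {R = S} x<r) _ = knuth₁ inv u (S ++ v) p≤x x<r
        swap (pass {R′ = S} r≤x j) (p≤r ∷ _) = knuth₁ inv u (S ++ v) p≤r (≤-<-trans r≤x (ins-bumped j))

      tins-plactic : ∀ {x T T′ i} v → TIns x T T′ i → Tab T → f (rw T ++ x ∷ v) K.≈ f (rw T′ ++ v)
      tins-plactic v new _ = K.refl
      tins-plactic {x} v (app {R = R} {T = T} p) _ = eq (trans (++-assoc (rw T) R (x ∷ v)) (trans (cong (rw T ++_) (appended p)) (sym (++-assoc (rw T) _ v))))
        where
        appended : ∀ {R R′} → Ins x R R′ nothing → R ++ x ∷ v ≡ R′ ++ v
        appended end = refl
        appended (pass _ p) = cong (_ ∷_) (appended p)
      tins-plactic {x} v (bmp {y = y} {R} {R′} {T} {T′} p t) (row w _ _ tT) = K.trans (eq (++-assoc (rw T) R (x ∷ v)))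
        (K.trans (ins-plactic (rw T) v p w) (K.trans (tins-plactic (R′ ++ v) t tT) (eq (sym (++-assoc (rw T′) R′ v)))))

      rsk-plactic : ∀ {w P Q} v → RSK w P Q → f (reverse (map proj₂ w) ++ v) K.≈ f (rw P ++ v)
      rsk-plactic v [] = K.refl
      rsk-plactic v (step {x = x} {w = w} r p _) = K.trans (eq (trans (cong (_++ v) (unfold-reverse x (map proj₂ w))) (++-assoc (reverse (map proj₂ w)) (x ∷ []) v)))
        (K.trans (rsk-plactic (x ∷ v) r) (tins-plactic v p (proj₁ (rsk-tab r))))

-- Sums over lists without repetition.

module SumsOverLists where
  open import Data.Bool using (Bool; true; false; if_then_else_)
  open import Data.List using (List; []; _∷_; _++_; map; concatMap; filterᵇ)
  open import Data.List.Membership.Propositional.Properties using (∈-++⁺ˡ; ∈-++⁺ʳ; ∈-++⁻; ∈-∃++)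
  open import Data.List.Relation.Unary.All as All using (All; []; _∷_)
  open import Data.List.Relation.Unary.AllPairs using ([]; _∷_)
  open import Relation.Binary.PropositionalEquality as ≡ using (_≡_; _≢_)

  unique-∉ : ∀ {X : Set} {x : X} {xs} → Unique (x ∷ xs) → x ∉ xs
  unique-∉ (p ∷ _) x∈ = All.lookup p x∈ ≡.refl

  unique-remove : ∀ {X : Set} (as : List X) {y bs} → Unique (as ++ y ∷ bs) → Unique (as ++ bs) × y ∉ (as ++ bs)
  unique-remove [] u@(_ ∷ us) = us , unique-∉ u
  unique-remove (a ∷ as) {y} {bs} (p ∷ us) with unique-remove as us
  ... | u′ , y∉ = (All.++⁺ (All.++⁻ˡ as p) (All.tail (All.++⁻ʳ as p)) ∷ u′) , λ
    { (here ≡.refl) → All.head (All.++⁻ʳ as p) ≡.refl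
    ; (there y∈) → y∉ y∈ }

  ∈-remove : ∀ {X : Set} (as : List X) {y z bs} → z ∈ as ++ y ∷ bs → z ≢ y → z ∈ as ++ bs
  ∈-remove as z∈ z≢y with ∈-++⁻ as z∈
  ... | inj₁ z∈as = ∈-++⁺ˡ z∈as
  ... | inj₂ (here e) = ⊥-elim (z≢y e)
  ... | inj₂ (there z∈bs) = ∈-++⁺ʳ as z∈bs

  ∈-insert : ∀ {X : Set} (as : List X) {y z bs} → z ∈ as ++ bs → z ∈ as ++ y ∷ bs
  ∈-insert as z∈ with ∈-++⁻ as z∈
  ... | inj₁ z∈as = ∈-++⁺ˡ z∈as
  ... | inj₂ z∈bs = ∈-++⁺ʳ as (there z∈bs)

  module SumOver (𝓚 : CommutativeRing 0ℓ 0ℓ) where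
    open CommutativeRing 𝓚 renaming (Carrier to K; sym to ≈-sym)

    Σ : ∀ {X : Set} → (X → K) → List X → K
    Σ f [] = 0#
    Σ f (x ∷ xs) = f x + Σ f xs

    Σ-cong : ∀ {X : Set} {f g : X → K} xs → (∀ x → x ∈ xs → f x ≈ g x) → Σ f xs ≈ Σ g xs
    Σ-cong [] p = refl
    Σ-cong (x ∷ xs) p = +-cong (p x (here ≡.refl)) (Σ-cong xs (λ y y∈ → p y (there y∈)))

    Σ-0 : ∀ {X : Set} {f : X → K} xs → (∀ x → x ∈ xs → f x ≈ 0#) → Σ f xs ≈ 0#
    Σ-0 [] p = refl
    Σ-0 (x ∷ xs) p = trans (+-cong (p x (here ≡.refl)) (Σ-0 xs (λ y y∈ → p y (there y∈)))) (+-identityʳ _)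

    Σ-++ : ∀ {X : Set} (f : X → K) xs ys → Σ f (xs ++ ys) ≈ Σ f xs + Σ f ys
    Σ-++ f [] ys = ≈-sym (+-identityˡ _)
    Σ-++ f (x ∷ xs) ys = trans (+-congˡ (Σ-++ f xs ys)) (≈-sym (+-assoc _ _ _))

    Σ-map : ∀ {X Y : Set} (f : Y → K) (g : X → Y) xs → Σ f (map g xs) ≈ Σ (λ x → f (g x)) xs
    Σ-map f g [] = refl
    Σ-map f g (x ∷ xs) = +-congˡ (Σ-map f g xs)

    Σ-concatMap : ∀ {X Y : Set} (f : Y → K) (g : X → List Y) xs → Σ f (concatMap g xs) ≈ Σ (λ x → Σ f (g x)) xs
    Σ-concatMap f g [] = refl
    Σ-concatMap f g (x ∷ xs) = trans (Σ-++ f (g x) (concatMap g xs)) (+-congˡ (Σ-concatMap f g xs))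

    Σ-filter : ∀ {X : Set} (f : X → K) (p : X → Bool) xs → Σ f (filterᵇ p xs) ≈ Σ (λ x → if p x then f x else 0#) xs
    Σ-filter f p [] = refl
    Σ-filter f p (x ∷ xs) with p x
    ... | true = +-congˡ (Σ-filter f p xs)
    ... | false = trans (Σ-filter f p xs) (≈-sym (+-identityˡ _))

    private
      Σ-insert : ∀ {X : Set} (f : X → K) as y bs → Σ f (as ++ y ∷ bs) ≈ f y + Σ f (as ++ bs)
      Σ-insert f [] y bs = refl
      Σ-insert f (a ∷ as) y bs = trans (+-congˡ (Σ-insert f as y bs)) (trans (≈-sym (+-assoc _ _ _)) (trans (+-congʳ (+-comm _ _)) (+-assoc _ _ _)))

    -- The matching is a relation, the form in which insertion and the padding of partitions are
    -- available; no inverse function has to be named.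
    Σ-bijection : ∀ {X Y : Set} (R : X → Y → Set) (f : X → K) (g : Y → K) xs ys → Unique xs → Unique ys →
      (∀ x → x ∈ xs → ∃ λ y → y ∈ ys × R x y) → (∀ y → y ∈ ys → ∃ λ x → x ∈ xs × R x y) →
      (∀ {x y y′} → R x y → R x y′ → y ≡ y′) → (∀ {x x′ y} → R x y → R x′ y → x ≡ x′) →
      (∀ {x y} → x ∈ xs → R x y → f x ≈ g y) → Σ f xs ≈ Σ g ys
    Σ-bijection R f g [] [] _ _ _ _ _ _ _ = refl
    Σ-bijection R f g [] (y ∷ ys) _ _ _ back _ _ _ with back y (here ≡.refl)
    ... | _ , () , _
    Σ-bijection {X} {Y} R f g (x ∷ xs) ys ux@(_ ∷ ux′) uy to back fun inj val with to x (here ≡.refl)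
    ... | y , y∈ , xy with ∈-∃++ y∈
    ...   | as , bs , ≡.refl = trans (+-cong (val (here ≡.refl) xy)
              (Σ-bijection R f g xs (as ++ bs) ux′ (proj₁ (unique-remove as uy)) to′ back′ fun inj (λ x∈ r → val (there x∈) r)))
              (≈-sym (Σ-insert g as y bs))
      where
      to′ : ∀ x′ → x′ ∈ xs → ∃ λ y′ → y′ ∈ as ++ bs × R x′ y′
      to′ x′ x′∈ with to x′ (there x′∈)
      ... | y′ , y′∈ , r = y′ , ∈-remove as y′∈ (λ e → unique-∉ ux (≡.subst (_∈ xs) (inj r (≡.subst (R x) (≡.sym e) xy)) x′∈)) , r
      back′ : ∀ y′ → y′ ∈ as ++ bs → ∃ λ x′ → x′ ∈ xs × R x′ y′
      back′ y′ y′∈ with back y′ (∈-insert as y′∈)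
      ... | x′ , there x′∈ , r = x′ , x′∈ , r
      ... | x′ , here ≡.refl , r = ⊥-elim (proj₂ (unique-remove as uy) (≡.subst (_∈ as ++ bs) (fun r xy) y′∈))

-- Membership and uniqueness in the enumerations of words, tableaux and partitions.

module Enumerations where
  open import Data.Bool using (Bool; true; _∧_; T)
  open import Data.Bool.ListAction using (and; all)
  open import Data.Nat
  open import Data.Nat.Properties
  open import Data.Nat.ListAction using (sum)
  open import Data.List using (List; []; _∷_; map; length; concat; concatMap; filterᵇ; upTo; zipWith)
  open import Data.List.Properties using (∷-injective; ≡-dec)
  open import Data.List.Membership.Propositional.Properties
  open import Data.List.Relation.Unary.All as All using (All; []; _∷_)
  open import Data.List.Relation.Unary.AllPairs using ([]; _∷_)
  open import Data.Unit using (tt)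
  open import Relation.Nullary using (Dec; yes; no)
  open import Relation.Nullary.Decidable using (⌊_⌋)
  open import Relation.Binary.PropositionalEquality
  open import Defs
  open RowInsertion
  open SumsOverLists using (unique-∉)

  ∧-elim : ∀ {a b} → T (a ∧ b) → T a × T b
  ∧-elim {true} {true} _ = tt , tt

  ∧-intro : ∀ {a b} → T a → T b → T (a ∧ b)
  ∧-intro {true} {true} _ _ = tt

  ∈-filterᵇ⁺ : ∀ {X : Set} (p : X → Bool) {x xs} → x ∈ xs → T (p x) → x ∈ filterᵇ p xs
  ∈-filterᵇ⁺ p = ∈-filter⁺ _

  ∈-filterᵇ⁻ : ∀ {X : Set} (p : X → Bool) {x xs} → x ∈ filterᵇ p xs → x ∈ xs × T (p x)
  ∈-filterᵇ⁻ p = ∈-filter⁻ _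

  unique-filterᵇ : ∀ {X : Set} (p : X → Bool) {xs} → Unique xs → Unique (filterᵇ p xs)
  unique-filterᵇ p = Unique.filter⁺ _

  ∈-concatMap⁺′ : ∀ {X Y : Set} (f : X → List Y) {x y xs} → x ∈ xs → y ∈ f x → y ∈ concatMap f xs
  ∈-concatMap⁺′ f {xs = x ∷ xs} (here refl) y∈ = ∈-++⁺ˡ y∈
  ∈-concatMap⁺′ f {xs = x ∷ xs} (there x∈) y∈ = ∈-++⁺ʳ (f x) (∈-concatMap⁺′ f x∈ y∈)

  ∈-concatMap⁻′ : ∀ {X Y : Set} (f : X → List Y) {y} xs → y ∈ concatMap f xs → ∃ λ x → x ∈ xs × y ∈ f x
  ∈-concatMap⁻′ f (x ∷ xs) y∈ with ∈-++⁻ (f x) y∈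
  ... | inj₁ p = x , here refl , p
  ... | inj₂ p with ∈-concatMap⁻′ f xs p
  ...   | x′ , x′∈ , q = x′ , there x′∈ , q

  unique-concatMap : ∀ {X Y : Set} (f : X → List Y) xs → Unique xs → (∀ x → x ∈ xs → Unique (f x)) →
    (∀ {x x′ y} → x ∈ xs → x′ ∈ xs → y ∈ f x → y ∈ f x′ → x ≡ x′) → Unique (concatMap f xs)
  unique-concatMap f [] _ _ _ = []
  unique-concatMap f (x ∷ xs) u@(_ ∷ us) uf dis = Unique.++⁺ (uf x (here refl))
    (unique-concatMap f xs us (λ x′ x′∈ → uf x′ (there x′∈)) (λ a b → dis (there a) (there b)))
    (λ (p , q) → let (x′ , x′∈ , q′) = ∈-concatMap⁻′ f xs q in
       unique-∉ u (subst (_∈ xs) (sym (dis (here refl) (there x′∈) p q′)) x′∈))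

  ∈-range1⁺ : ∀ {n i} → 1 ≤ i → i ≤ n → i ∈ range1 n
  ∈-range1⁺ {n} {suc i} _ le = ∈-map⁺ suc (∈-upTo⁺ le)

  ∈-range1⁻ : ∀ {n i} → i ∈ range1 n → 1 ≤ i × i ≤ n
  ∈-range1⁻ i∈ with ∈-map⁻ suc i∈
  ... | j , j∈ , refl = s≤s z≤n , ∈-upTo⁻ j∈

  unique-range1 : ∀ n → Unique (range1 n)
  unique-range1 n = Unique.map⁺ suc-injective (Unique.upTo⁺ n)

  ∈-words⁺ : ∀ cs w → All (_∈ cs) w → w ∈ words (length w) cs
  ∈-words⁺ cs [] [] = here refl
  ∈-words⁺ cs (x ∷ w) (p ∷ ps) = ∈-concatMap⁺′ (λ a → map (a ∷_) (words (length w) cs)) p (∈-map⁺ (x ∷_) (∈-words⁺ cs w ps))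

  ∈-words⁻ : ∀ L cs {w} → w ∈ words L cs → length w ≡ L × All (_∈ cs) w
  ∈-words⁻ zero cs (here refl) = refl , []
  ∈-words⁻ (suc L) cs w∈ with ∈-concatMap⁻′ (λ a → map (a ∷_) (words L cs)) cs w∈
  ... | a , a∈ , w∈′ with ∈-map⁻ (a ∷_) w∈′
  ...   | v , v∈ , refl with ∈-words⁻ L cs v∈
  ...     | l , ps = cong suc l , a∈ ∷ ps

  unique-map-∷ : ∀ {X : Set} (a : X) {xs : List (List X)} → Unique xs → Unique (map (a ∷_) xs)
  unique-map-∷ a = Unique.map⁺ (λ e → proj₂ (∷-injective e))

  same-head : ∀ {X : Set} {a b : X} {y : List X} {xs ys} → y ∈ map (a ∷_) xs → y ∈ map (b ∷_) ys → a ≡ b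
  same-head p q with ∈-map⁻ _ p | ∈-map⁻ _ q
  ... | _ , _ , refl | _ , _ , refl = refl

  unique-words : ∀ L {cs} → Unique cs → Unique (words L cs)
  unique-words zero u = [] ∷ []
  unique-words (suc L) {cs} u = unique-concatMap (λ a → map (a ∷_) (words L cs)) cs u (λ a _ → unique-map-∷ a (unique-words L u)) (λ _ _ → same-head)

  ∈-fillings⁺ : ∀ m T → All (All (_∈ range1 m)) T → T ∈ fillings (shape T) m
  ∈-fillings⁺ m [] [] = here refl
  ∈-fillings⁺ m (R ∷ T) (p ∷ ps) = ∈-concatMap⁺′ (λ row → map (row ∷_) (fillings (shape T) m)) (∈-words⁺ (range1 m) R p) (∈-map⁺ (R ∷_) (∈-fillings⁺ m T ps))

  ∈-fillings⁻ : ∀ ν m {T} → T ∈ fillings ν m → shape T ≡ ν × All (All (_∈ range1 m)) T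
  ∈-fillings⁻ [] m (here refl) = refl , []
  ∈-fillings⁻ (r ∷ ν) m T∈ with ∈-concatMap⁻′ (λ row → map (row ∷_) (fillings ν m)) (words r (range1 m)) T∈
  ... | R , R∈ , T∈′ with ∈-map⁻ (R ∷_) T∈′
  ...   | T , T∈″ , refl with ∈-words⁻ r (range1 m) R∈ | ∈-fillings⁻ ν m T∈″
  ...     | l , ps | s , qs = cong₂ _∷_ l s , ps ∷ qs

  unique-fillings : ∀ ν m → Unique (fillings ν m)
  unique-fillings [] m = [] ∷ []
  unique-fillings (r ∷ ν) m = unique-concatMap (λ row → map (row ∷_) (fillings ν m)) (words r (range1 m)) (unique-words r (unique-range1 m))
    (λ R _ → unique-map-∷ R (unique-fillings ν m)) (λ _ _ → same-head)

  weakly⁺ : ∀ R → T (weaklyIncᵇ R) → Weakly R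
  weakly⁺ [] _ = []
  weakly⁺ (a ∷ []) _ = [] ∷ []
  weakly⁺ (a ∷ b ∷ R) p = extend (weakly⁺ (b ∷ R) (proj₂ (∧-elim {a ≤ᵇ b} p)))
    where
    a≤b = ≤ᵇ⇒≤ a b (proj₁ (∧-elim {a ≤ᵇ b} p))
    extend : Weakly (b ∷ R) → Weakly (a ∷ b ∷ R)
    extend w@(b≤ ∷ _) = (a≤b ∷ All.map (≤-trans a≤b) b≤) ∷ w

  weakly⁻ : ∀ {R} → Weakly R → T (weaklyIncᵇ R)
  weakly⁻ [] = tt
  weakly⁻ {_ ∷ []} (_ ∷ _) = tt
  weakly⁻ {_ ∷ _ ∷ _} ((p ∷ _) ∷ w) = ∧-intro (≤⇒≤ᵇ p) (weakly⁻ w)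

  ▷⁺ : ∀ R S → length S ≤ length R → T (and (zipWith _<ᵇ_ R S)) → R ▷ S
  ▷⁺ R [] _ _ = []
  ▷⁺ (r ∷ R) (s ∷ S) (s≤s le) p with ∧-elim {r <ᵇ s} p
  ... | q , ps = <ᵇ⇒< r s q ∷ ▷⁺ R S le ps
  ▷⁺ [] (s ∷ S) () p

  ▷⁻ : ∀ {R S} → R ▷ S → T (and (zipWith _<ᵇ_ R S))
  ▷⁻ {[]} [] = tt
  ▷⁻ {_ ∷ _} [] = tt
  ▷⁻ (p ∷ ps) = ∧-intro (<⇒<ᵇ p) (▷⁻ ps)

  Positive : List ℕ → Set
  Positive = All (0 <_)

  nonEmpty⁺ : ∀ {R : Row} → 0 < length R → NonEmpty R
  nonEmpty⁺ {_ ∷ _} _ = cons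

  -- `zipWith` compares two rows only as far as both reach. That the lower row is not longer is
  -- taken from the shape, and that no row is empty from its positivity.
  tab⁺ : ∀ Q → Decreasing (shape Q) → Positive (shape Q) → T (isSSYTᵇ Q) → Tab Q
  tab⁺ [] _ _ _ = []
  tab⁺ (R ∷ []) _ (p ∷ _) s = row (weakly⁺ R s) (nonEmpty⁺ p) tt []
  tab⁺ (R ∷ S ∷ Q) (le ∷ d) (p ∷ ps) s with ∧-elim {weaklyIncᵇ R} s
  ... | w , s′ with ∧-elim {and (zipWith _<ᵇ_ R S)} s′
  ...   | c , s″ = row (weakly⁺ R w) (nonEmpty⁺ p) (▷⁺ R S le c) (tab⁺ (S ∷ Q) d ps s″)

  tab⁻ : ∀ {Q} → Tab Q → T (isSSYTᵇ Q)
  tab⁻ [] = tt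
  tab⁻ {_ ∷ []} (row w _ _ _) = weakly⁻ w
  tab⁻ {_ ∷ _ ∷ _} (row w _ p t) = ∧-intro (weakly⁻ w) (∧-intro (▷⁻ p) (tab⁻ t))

  tab-positive : ∀ {Q} → Tab Q → Positive (shape Q)
  tab-positive [] = []
  tab-positive (row _ cons _ t) = s≤s z≤n ∷ tab-positive t

  decreasing⁺ : ∀ s → T (decreasingᵇ s) → Decreasing s
  decreasing⁺ [] _ = []
  decreasing⁺ (a ∷ []) _ = [-]
  decreasing⁺ (a ∷ b ∷ s) p = ≤ᵇ⇒≤ b a (proj₁ (∧-elim {b ≤ᵇ a} p)) ∷ decreasing⁺ (b ∷ s) (proj₂ (∧-elim {b ≤ᵇ a} p))

  decreasing⁻ : ∀ {s} → Decreasing s → T (decreasingᵇ s)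
  decreasing⁻ [] = tt
  decreasing⁻ [-] = tt
  decreasing⁻ (p ∷ d) = ∧-intro (≤⇒≤ᵇ p) (decreasing⁻ d)

  positive⁺ : ∀ s → T (all (λ a → 0 <ᵇ a) s) → Positive s
  positive⁺ [] _ = []
  positive⁺ (a ∷ s) p with ∧-elim {0 <ᵇ a} p
  ... | q , r = <ᵇ⇒< 0 a q ∷ positive⁺ s r

  positive⁻ : ∀ {s} → Positive s → T (all (λ a → 0 <ᵇ a) s)
  positive⁻ [] = tt
  positive⁻ (p ∷ ps) = ∧-intro (<⇒<ᵇ p) (positive⁻ ps)

  ∈-partitionsOf⁺ : ∀ {s} → Decreasing s → Positive s → s ∈ partitionsOf (sum s)
  ∈-partitionsOf⁺ {s} d p = ∈-filterᵇ⁺ (λ xs → isPartitionᵇ xs ∧ (sum xs ≡ᵇ sum s))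
    (∈-concatMap⁺′ (λ L → words L (upTo (suc (sum s)))) (∈-upTo⁺ (s≤s (length≤ p))) (∈-words⁺ (upTo (suc (sum s))) s (All.tabulate (λ x∈ → ∈-upTo⁺ (s≤s (part≤ x∈))))))
    (∧-intro (∧-intro (decreasing⁻ d) (positive⁻ p)) (≡⇒≡ᵇ (sum s) (sum s) refl))
    where
    length≤ : ∀ {s} → Positive s → length s ≤ sum s
    length≤ [] = z≤n
    length≤ (p ∷ ps) = +-mono-≤ p (length≤ ps)
    part≤ : ∀ {s x} → x ∈ s → x ≤ sum s
    part≤ {y ∷ s} (here refl) = m≤m+n y (sum s)
    part≤ {y ∷ s} (there x∈) = ≤-trans (part≤ x∈) (m≤n+m (sum s) y)

  ∈-partitionsOf⁻ : ∀ n {s} → s ∈ partitionsOf n → Decreasing s × Positive s × sum s ≡ n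
  ∈-partitionsOf⁻ n {s} s∈ with ∈-filterᵇ⁻ (λ xs → isPartitionᵇ xs ∧ (sum xs ≡ᵇ n)) {xs = concatMap (λ L → words L (upTo (suc n))) (upTo (suc n))} s∈
  ... | _ , p with ∧-elim {isPartitionᵇ s} p
  ...   | q , r with ∧-elim {decreasingᵇ s} q
  ...     | d , ps = decreasing⁺ s d , positive⁺ s ps , ≡ᵇ⇒≡ (sum s) n r

  unique-partitionsOf : ∀ n → Unique (partitionsOf n)
  unique-partitionsOf n = unique-filterᵇ (λ xs → isPartitionᵇ xs ∧ (sum xs ≡ᵇ n)) (unique-concatMap (λ L → words L (upTo (suc n))) (upTo (suc n)) (Unique.upTo⁺ (suc n))
    (λ L _ → unique-words L (Unique.upTo⁺ (suc n)))
    (λ {L} {L′} _ _ p q → trans (sym (proj₁ (∈-words⁻ L _ p))) (proj₁ (∈-words⁻ L′ _ q))))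

  ⌊⌋-true : ∀ {P : Set} (d : Dec P) → T ⌊ d ⌋ → P
  ⌊⌋-true (yes p) _ = p

  ⌊⌋-intro : ∀ {P : Set} (d : Dec P) → P → T ⌊ d ⌋
  ⌊⌋-intro (yes _) _ = tt
  ⌊⌋-intro (no ¬p) p = ¬p p

  Content : List ℕ → List ℕ → Set
  Content α w = map (λ i → count i w) (range1 (length α)) ≡ α

  ∈-SSYT⁺ : ∀ {Q} α → Tab Q → All (All (_∈ range1 (length α))) Q → Content α (concat Q) → Q ∈ SSYT (shape Q) α
  ∈-SSYT⁺ {Q} α t ps c = ∈-filterᵇ⁺ (λ T → isSSYTᵇ T ∧ hasContentᵇ α T) (∈-fillings⁺ (length α) Q ps) (∧-intro (tab⁻ t) (⌊⌋-intro (≡-dec _≟_ _ α) c))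

  ∈-SSYT⁻ : ∀ ν α {Q} → Decreasing ν → Positive ν → Q ∈ SSYT ν α → Tab Q × shape Q ≡ ν × All (All (_∈ range1 (length α))) Q × Content α (concat Q)
  ∈-SSYT⁻ ν α {Q} d p Q∈ with ∈-filterᵇ⁻ (λ T → isSSYTᵇ T ∧ hasContentᵇ α T) {xs = fillings ν (length α)} Q∈
  ... | Q∈′ , b with ∧-elim {isSSYTᵇ Q} b | ∈-fillings⁻ ν (length α) Q∈′
  ...   | s , c | refl , ps = tab⁺ Q d p s , refl , ps , ⌊⌋-true (≡-dec _≟_ _ α) c

  unique-SSYT : ∀ ν α → Unique (SSYT ν α)
  unique-SSYT ν α = unique-filterᵇ (λ T → isSSYTᵇ T ∧ hasContentᵇ α T) (unique-fillings ν (length α))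

  -- Tableaux of arbitrary content: the condition on the content is left to the functional, which
  -- vanishes on all others.
  tableaux : List ℕ → ℕ → List Tableau
  tableaux ν n = filterᵇ isSSYTᵇ (fillings ν n)

  ∈-tableaux⁺ : ∀ {Q} n → Tab Q → All (All (_∈ range1 n)) Q → Q ∈ tableaux (shape Q) n
  ∈-tableaux⁺ {Q} n t ps = ∈-filterᵇ⁺ isSSYTᵇ (∈-fillings⁺ n Q ps) (tab⁻ t)

  ∈-tableaux⁻ : ∀ ν n {Q} → Decreasing ν → Positive ν → Q ∈ tableaux ν n → Tab Q × shape Q ≡ ν × All (All (_∈ range1 n)) Q
  ∈-tableaux⁻ ν n {Q} d p Q∈ with ∈-filterᵇ⁻ isSSYTᵇ {xs = fillings ν n} Q∈
  ... | Q∈′ , s with ∈-fillings⁻ ν n Q∈′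
  ...   | refl , ps = tab⁺ Q d p s , refl , ps

-- Biwords as the terms of products of complete functions.

module Biwords where
  open import Data.Nat
  open import Data.Nat.Properties
  open import Data.List using (List; []; _∷_; _++_; map; length; concatMap; reverse)
  open import Data.List.Properties using (∷-injective; unfold-reverse; map-++; ++-cancelˡ)
  open import Data.List.Membership.Propositional.Properties
  open import Data.List.Relation.Unary.All as All using (All; []; _∷_)
  open import Data.List.Relation.Unary.AllPairs using (AllPairs; []; _∷_)
  open import Relation.Binary.PropositionalEquality
  open import Defs using (count)
  open WordCharge using (Word)
  open ChargeRotation using (count-++; count-∷; δ-refl; δ-≢)
  open RowInsertion
  open RobinsonSchenstedKnuth
  open SumsOverLists
  open Enumerations
  open PlacticWords
  open HallLittlewoodFunctionals

  hrows : List ℕ → ℕ → List Word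
  hrows [] zero = [] ∷ []
  hrows [] (suc j) = []
  hrows (b ∷ B) zero = [] ∷ []
  hrows (b ∷ B) (suc j) = hrows B (suc j) ++ map (b ∷_) (hrows (b ∷ B) j)

  ∈-hrows⁻ : ∀ B j {v} → AllPairs _<_ B → v ∈ hrows B j → Weakly v × length v ≡ j × All (_∈ B) v
  ∈-hrows⁻ [] zero _ (here refl) = [] , refl , []
  ∈-hrows⁻ (b ∷ B) zero _ (here refl) = [] , refl , []
  ∈-hrows⁻ (b ∷ B) (suc j) inc@(b< ∷ inc′) v∈ with ∈-++⁻ (hrows B (suc j)) v∈
  ... | inj₁ p with ∈-hrows⁻ B (suc j) inc′ p
  ...   | w , l , a = w , l , All.map there a
  ∈-hrows⁻ (b ∷ B) (suc j) inc@(b< ∷ inc′) v∈ | inj₂ p with ∈-map⁻ (b ∷_) p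
  ... | v , v∈′ , refl with ∈-hrows⁻ (b ∷ B) j inc v∈′
  ...   | w , l , a = All.map least a ∷ w , cong suc l , here refl ∷ a
    where
    least : ∀ {x} → x ∈ b ∷ B → b ≤ x
    least (here refl) = ≤-refl
    least (there x∈) = <⇒≤ (All.lookup b< x∈)

  ∈-hrows⁺ : ∀ B {v} → AllPairs _<_ B → Weakly v → All (_∈ B) v → v ∈ hrows B (length v)
  ∈-hrows⁺ [] {[]} _ _ _ = here refl
  ∈-hrows⁺ [] {x ∷ v} _ _ (() ∷ _)
  ∈-hrows⁺ (b ∷ B) {[]} _ _ _ = here refl
  ∈-hrows⁺ (b ∷ B) {x ∷ v} inc (_ ∷ w) (here refl ∷ a) = ∈-++⁺ʳ (hrows B (suc (length v))) (∈-map⁺ (b ∷_) (∈-hrows⁺ (b ∷ B) inc w a))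
  ∈-hrows⁺ (b ∷ B) {x ∷ v} (b< ∷ inc) (x≤ ∷ w) (there x∈ ∷ a) = ∈-++⁺ˡ (∈-hrows⁺ B inc (x≤ ∷ w) (x∈ ∷ strengthen x≤ a))
    where
    strengthen : ∀ {v} → All (x ≤_) v → All (_∈ b ∷ B) v → All (_∈ B) v
    strengthen [] [] = []
    strengthen (p ∷ ps) (here refl ∷ qs) = ⊥-elim (<⇒≱ (All.lookup b< x∈) p)
    strengthen (p ∷ ps) (there q ∷ qs) = q ∷ strengthen ps qs

  unique-hrows : ∀ B j → AllPairs _<_ B → Unique (hrows B j)
  unique-hrows [] zero _ = [] ∷ []
  unique-hrows [] (suc j) _ = []
  unique-hrows (b ∷ B) zero _ = [] ∷ []
  unique-hrows (b ∷ B) (suc j) inc@(b< ∷ inc′) = Unique.++⁺ (unique-hrows B (suc j) inc′) (unique-map-∷ b (unique-hrows (b ∷ B) j inc)) disjoint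
    where
    disjoint : ∀ {v} → v ∈ hrows B (suc j) × v ∈ map (b ∷_) (hrows (b ∷ B) j) → ⊥
    disjoint (p , q) with ∈-map⁻ (b ∷_) q
    ... | _ , _ , refl with ∈-hrows⁻ B (suc j) inc′ p
    ...   | _ , _ , b∈ ∷ _ = <-irrefl refl (All.lookup b< b∈)

  -- The label of a letter records the factor of h_α from which it comes, counted from k; it becomes
  -- the entry of the recording tableau.
  biwords : List ℕ → ℕ → List ℕ → List (List (ℕ × ℕ))
  biwords B k [] = [] ∷ []
  biwords B k (j ∷ α) = concatMap (λ v → map (map (k ,_) v ++_) (biwords B (suc k) α)) (hrows B j)

  nth : List ℕ → ℕ → ℕ
  nth [] i = 0
  nth (a ∷ α) zero = a
  nth (a ∷ α) (suc i) = nth α i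

  Sorted : List (ℕ × ℕ) → Set
  Sorted = AllPairs _≼_

  Labelled : ℕ → List ℕ → List ℕ → Set
  Labelled k α ls = All (k ≤_) ls × (∀ i → count (k + i) ls ≡ nth α i)

  count-replicated : ∀ (k : ℕ) (v : Word) → count k (map proj₁ (map (k ,_) v)) ≡ length v
  count-replicated k [] = refl
  count-replicated k (x ∷ v) = trans (count-∷ k k _) (cong₂ _+_ (δ-refl k) (count-replicated k v))

  count-absent : ∀ c ls → All (c ≢_) ls → count c ls ≡ 0
  count-absent c [] [] = refl
  count-absent c (l ∷ ls) (p ∷ ps) = trans (count-∷ c l ls) (cong₂ _+_ (δ-≢ (λ e → p (sym e))) (count-absent c ls ps))

  labels-≡ : ∀ (k : ℕ) (v : Word) → All (k ≡_) (map proj₁ (map (k ,_) v))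
  labels-≡ k [] = []
  labels-≡ k (x ∷ v) = refl ∷ labels-≡ k v

  letters-≡ : ∀ (k : ℕ) (v : Word) → map proj₂ (map (k ,_) v) ≡ v
  letters-≡ k [] = refl
  letters-≡ k (x ∷ v) = cong (x ∷_) (letters-≡ k v)

  ∈-biwords⁻ : ∀ B k α {w} → AllPairs _<_ B → w ∈ biwords B k α → Sorted w × All (_∈ B) (map proj₂ w) × Labelled k α (map proj₁ w)
  ∈-biwords⁻ B k [] inc (here refl) = [] , [] , [] , λ _ → refl
  ∈-biwords⁻ B k (j ∷ α) inc w∈ with ∈-concatMap⁻′ (λ v → map (map (k ,_) v ++_) (biwords B (suc k) α)) (hrows B j) w∈
  ... | v , v∈ , w∈′ with ∈-map⁻ (map (k ,_) v ++_) w∈′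
  ...   | w , w∈″ , refl with ∈-hrows⁻ B j inc v∈ | ∈-biwords⁻ B (suc k) α inc w∈″
  ...     | wk , refl , a | s , b , ge , cnt = AllPairs.++⁺ (row-sorted wk) s (cross v ge) ,
            subst (All (_∈ B)) (sym (map-++ proj₂ (map (k ,_) v) w)) (All.++⁺ (subst (All (_∈ B)) (sym (letters-≡ k v)) a) b) ,
            subst (All (k ≤_)) (sym (map-++ proj₁ (map (k ,_) v) w)) (All.++⁺ (All.map ≤-reflexive (labels-≡ k v)) (All.map <⇒≤ ge)) ,
            λ i → trans (cong (count (k + i)) (map-++ proj₁ (map (k ,_) v) w)) (trans (count-++ (k + i) (map proj₁ (map (k ,_) v)) (map proj₁ w)) (cnt′ i))
    where
    row-sorted : ∀ {v} → Weakly v → Sorted (map (k ,_) v)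
    row-sorted [] = []
    row-sorted (p ∷ ps) = All.map⁺ (All.map (λ le → inj₂ (refl , le)) p) ∷ row-sorted ps
    below : ∀ x {w} → All (suc k ≤_) (map proj₁ w) → All ((k , x) ≼_) w
    below x {[]} [] = []
    below x {_ ∷ _} (p ∷ ps) = inj₁ p ∷ below x ps
    cross : ∀ v {w} → All (suc k ≤_) (map proj₁ w) → All (λ p → All (p ≼_) w) (map (k ,_) v)
    cross [] _ = []
    cross (x ∷ v) ge = below x ge ∷ cross v ge
    cnt′ : ∀ i → count (k + i) (map proj₁ (map (k ,_) v)) + count (k + i) (map proj₁ w) ≡ nth (length v ∷ α) i
    cnt′ zero rewrite +-identityʳ k = trans (cong₂ _+_ (count-replicated k v) (count-absent k _ (All.map <⇒≢ ge))) (+-identityʳ _)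
    cnt′ (suc i) rewrite +-suc k i = cong₂ _+_ (count-absent (suc k + i) (map proj₁ (map (k ,_) v)) (All.map (λ { refl e → <-irrefl (sym e) (s≤s (m≤m+n k i)) }) (labels-≡ k v))) (cnt i)

  split-label : ∀ k w → Sorted w → All (k ≤_) (map proj₁ w) → ∃₂ λ v w′ → w ≡ map (k ,_) v ++ w′ × All (suc k ≤_) (map proj₁ w′)
  split-label k [] _ _ = [] , [] , refl , []
  split-label k ((l , x) ∷ w) (p ∷ s) (k≤l ∷ ks) with m≤n⇒m<n∨m≡n k≤l
  ... | inj₁ k<l = [] , (l , x) ∷ w , refl , k<l ∷ All.map⁺ (All.map (above k<l) p)
    where
    above : k < l → ∀ {q} → (l , x) ≼ q → k < proj₁ q
    above k<l (inj₁ l<c) = <-trans k<l l<c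
    above k<l (inj₂ (refl , _)) = k<l
  ... | inj₂ refl with split-label k w s ks
  ...   | v , w′ , refl , g = x ∷ v , w′ , refl , g

  ∈-biwords⁺ : ∀ B k α w → AllPairs _<_ B → Sorted w → All (_∈ B) (map proj₂ w) → Labelled k α (map proj₁ w) → w ∈ biwords B k α
  ∈-biwords⁺ B k [] [] _ _ _ _ = here refl
  ∈-biwords⁺ B k [] ((l , x) ∷ w) _ _ _ ((p ∷ _) , cnt) = ⊥-elim (1+n≢0 (trans (sym present) (cnt (l ∸ k))))
    where
    present : count (k + (l ∸ k)) (l ∷ map proj₁ w) ≡ suc (count l (map proj₁ w))
    present rewrite m+[n∸m]≡n p = trans (count-∷ l l _) (cong (_+ count l (map proj₁ w)) (δ-refl l))
  ∈-biwords⁺ B k (j ∷ α) w inc s a (ge , cnt) with split-label k w s ge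
  ... | v , w′ , refl , ge′ = subst (λ n → map (k ,_) v ++ w′ ∈ biwords B k (n ∷ α)) len
          (∈-concatMap⁺′ (λ v → map (map (k ,_) v ++_) (biwords B (suc k) α))
            (∈-hrows⁺ B inc (row-weakly v s) (subst (All (_∈ B)) (letters-≡ k v) (All.++⁻ˡ (map proj₂ (map (k ,_) v)) a′)))
            (∈-map⁺ (map (k ,_) v ++_) (∈-biwords⁺ B (suc k) α w′ inc (rest v s) (All.++⁻ʳ (map proj₂ (map (k ,_) v)) a′) (ge′ , cnt′))))
    where
    a′ = subst (All (_∈ B)) (map-++ proj₂ (map (k ,_) v) w′) a
    row-weakly : ∀ v → Sorted (map (k ,_) v ++ w′) → Weakly v
    row-weakly [] _ = []
    row-weakly (x ∷ v) (p ∷ s) = All.map le (All.map⁻ (All.++⁻ˡ (map (k ,_) v) p)) ∷ row-weakly v s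
      where
      le : ∀ {y} → (k , x) ≼ (k , y) → x ≤ y
      le (inj₁ k<k) = ⊥-elim (<-irrefl refl k<k)
      le (inj₂ (_ , p)) = p
    rest : ∀ v → Sorted (map (k ,_) v ++ w′) → Sorted w′
    rest [] s = s
    rest (x ∷ v) (_ ∷ s) = rest v s
    cnt″ : ∀ i → count (k + i) (map proj₁ (map (k ,_) v)) + count (k + i) (map proj₁ w′) ≡ nth (j ∷ α) i
    cnt″ i = trans (sym (trans (cong (count (k + i)) (map-++ proj₁ (map (k ,_) v) w′)) (count-++ (k + i) (map proj₁ (map (k ,_) v)) (map proj₁ w′)))) (cnt i)
    len : length v ≡ j
    len with cnt″ 0
    ... | e rewrite +-identityʳ k = trans (sym (trans (cong₂ _+_ (count-replicated k v) (count-absent k _ (All.map <⇒≢ ge′))) (+-identityʳ _))) e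
    cnt′ : ∀ i → count (suc k + i) (map proj₁ w′) ≡ nth α i
    cnt′ i with cnt″ (suc i)
    ... | e rewrite +-suc k i = trans (cong (_+ count (suc k + i) (map proj₁ w′)) (sym (count-absent (suc k + i) (map proj₁ (map (k ,_) v)) (All.map (λ { refl e → <-irrefl (sym e) (s≤s (m≤m+n k i)) }) (labels-≡ k v))))) e

  unique-biwords : ∀ B k α → AllPairs _<_ B → Unique (biwords B k α)
  unique-biwords B k [] inc = [] ∷ []
  unique-biwords B k (j ∷ α) inc = unique-concatMap (λ v → map (map (k ,_) v ++_) (biwords B (suc k) α)) (hrows B j) (unique-hrows B j inc)
    (λ v _ → Unique.map⁺ (++-cancelˡ (map (k ,_) v) _ _) (unique-biwords B (suc k) α inc)) same
    where
    prefix : ∀ v v′ {w w′ : List (ℕ × ℕ)} → length v ≡ length v′ → map (k ,_) v ++ w ≡ map (k ,_) v′ ++ w′ → v ≡ v′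
    prefix [] [] _ _ = refl
    prefix (x ∷ v) (y ∷ v′) l e with ∷-injective e
    ... | refl , e′ = cong (x ∷_) (prefix v v′ (suc-injective l) e′)
    same : ∀ {v v′ w} → v ∈ hrows B j → v′ ∈ hrows B j → w ∈ map (map (k ,_) v ++_) (biwords B (suc k) α) → w ∈ map (map (k ,_) v′ ++_) (biwords B (suc k) α) → v ≡ v′
    same {v} {v′} v∈ v′∈ p q with ∈-map⁻ _ p | ∈-map⁻ _ q
    ... | _ , _ , refl | _ , _ , e = prefix v v′ (trans (proj₁ (proj₂ (∈-hrows⁻ B j inc v∈))) (sym (proj₁ (proj₂ (∈-hrows⁻ B j inc v′∈))))) e

  AllPairs-reverse : ∀ {X : Set} {R : X → X → Set} {xs} → AllPairs R xs → AllPairs (λ x y → R y x) (reverse xs)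
  AllPairs-reverse [] = []
  AllPairs-reverse {R = R} {x ∷ xs} (p ∷ ps) = subst (AllPairs (λ x y → R y x)) (sym (unfold-reverse x xs))
    (AllPairs.++⁺ (AllPairs-reverse ps) ([] ∷ []) (All.tabulate (λ y∈ → All.lookup p (Any.reverse⁻ y∈) ∷ [])))

  ≼-trans : ∀ {p q r} → p ≼ q → q ≼ r → p ≼ r
  ≼-trans (inj₁ a) (inj₁ b) = inj₁ (<-trans a b)
  ≼-trans (inj₁ a) (inj₂ (refl , _)) = inj₁ a
  ≼-trans (inj₂ (refl , _)) (inj₁ b) = inj₁ b
  ≼-trans (inj₂ (refl , a)) (inj₂ (refl , b)) = inj₂ (refl , ≤-trans a b)

  biword-sorted : ∀ {w} → Biword w → AllPairs (λ p q → q ≼ p) w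
  biword-sorted [] = []
  biword-sorted [-] = [] ∷ []
  biword-sorted (le ∷ b) with biword-sorted b
  ... | ps ∷ s = (le ∷ All.map (λ q → ≼-trans q le) ps) ∷ ps ∷ s

  sorted-biword : ∀ {w} → AllPairs (λ p q → q ≼ p) w → Biword w
  sorted-biword [] = []
  sorted-biword ([] ∷ []) = [-]
  sorted-biword ((p ∷ _) ∷ s@(_ ∷ _)) = p ∷ sorted-biword s

  module HSums (𝓚 : CommutativeRing 0ℓ 0ℓ) (t : CommutativeRing.Carrier 𝓚) where
    open CommutativeRing 𝓚 using (_≈_; reflexive; 0#; 1#) renaming (Carrier to K; refl to ≈-refl; trans to ≈-trans; sym to ≈-sym; +-cong to ⊹-cong; +-congʳ to ⊹-congʳ; +-identityʳ to ⊹-identityʳ; +-identityˡ to ⊹-identityˡ)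
    open SumOver 𝓚
    open PlacticRing 𝓚
    module HL = HallLittlewood 𝓚 t
    open HL.C using (h; h*)

    ap-h : ∀ B j f → ap (h B j) f ≈ Σ f (hrows B j)
    ap-h [] zero f = ≈-sym (⊹-identityʳ _)
    ap-h [] (suc j) f = ≈-refl
    ap-h (b ∷ B) zero f = ≈-sym (⊹-identityʳ _)
    ap-h (b ∷ B) (suc j) f = ≈-trans (⊹-cong (ap-h B (suc j) f) (≈-trans (ap-h (b ∷ B) j (λ v → f (b ∷ v))) (≈-sym (Σ-map f (b ∷_) (hrows (b ∷ B) j)))))
      (≈-sym (Σ-++ f (hrows B (suc j)) (map (b ∷_) (hrows (b ∷ B) j))))

    ap-h* : ∀ B k α f → ap (h* B α) f ≈ Σ (λ w → f (map proj₂ w)) (biwords B k α)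
    ap-h* B k [] f = ≈-sym (⊹-identityʳ _)
    ap-h* B k (j ∷ α) f = ≈-trans (ap-h B j _) (≈-trans
      (Σ-cong (hrows B j) (λ v _ → ≈-trans (ap-h* B (suc k) α (λ w → f (v ++ w)))
        (≈-trans (Σ-cong (biwords B (suc k) α) (λ w _ → reflexive (cong f (sym (trans (map-++ proj₂ (map (k ,_) v) w) (cong (_++ map proj₂ w) (letters-≡ k v)))))))
          (≈-sym (Σ-map (λ w → f (map proj₂ w)) (map (k ,_) v ++_) (biwords B (suc k) α))))))
      (≈-sym (Σ-concatMap (λ w → f (map proj₂ w)) (λ v → map (map (k ,_) v ++_) (biwords B (suc k) α)) (hrows B j))))

-- Contents of words, and Cauchy's identity in the plactic ring.

module PlacticCauchy where
  open import Data.Nat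
  open import Data.Nat.Properties
  open import Data.Nat.ListAction using (sum)
  open import Data.List using (List; []; _∷_; _++_; map; length; concat; concatMap; reverse)
  open import Data.List.Properties using (∷-injective; unfold-reverse; reverse-involutive; reverse-injective; map-∘; map-applyUpTo; length-++; reverse-map; ++-identityʳ)
  open import Data.List.Membership.Propositional.Properties
  open import Data.List.Membership.DecPropositional _≟_ using (_∈?_)
  open import Data.List.Relation.Unary.All as All using (All; []; _∷_)
  open import Data.List.Relation.Unary.AllPairs using ([]; _∷_)
  open import Relation.Nullary using (yes; no)
  open import Relation.Binary.PropositionalEquality
  open import Defs
  open WordCharge using (Word)
  open ChargeRotation using (count-∷; count-insert; δ; δ-refl; δ-≢)
  open RowInsertion
  open RobinsonSchenstedKnuth
  open SumsOverLists
  open Enumerations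
  open Biwords
  open PlacticWords
  open HallLittlewoodFunctionals

  range1-suc : ∀ n → range1 (suc n) ≡ 1 ∷ map suc (range1 n)
  range1-suc n = cong (λ xs → 1 ∷ map suc xs) (sym (map-applyUpTo (λ x → x) suc n))

  alphabet≡range1 : ∀ n → alphabet n ≡ range1 n
  alphabet≡range1 zero = refl
  alphabet≡range1 (suc n) = trans (cong (λ xs → 1 ∷ map suc xs) (alphabet≡range1 n)) (sym (range1-suc n))

  sum-δ-∉ : ∀ x cs → x ∉ cs → sum (map (δ x) cs) ≡ 0
  sum-δ-∉ x [] _ = refl
  sum-δ-∉ x (c ∷ cs) x∉ = cong₂ _+_ (δ-≢ (λ e → x∉ (here e))) (sum-δ-∉ x cs (λ p → x∉ (there p)))

  sum-δ-∈ : ∀ {x cs} → Unique cs → x ∈ cs → sum (map (δ x) cs) ≡ 1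
  sum-δ-∈ {x} {c ∷ cs} u@(_ ∷ _) (here refl) = cong₂ _+_ (δ-refl x) (sum-δ-∉ x cs (unique-∉ u))
  sum-δ-∈ {x} {c ∷ cs} u@(_ ∷ us) (there x∈) = cong₂ _+_ (δ-≢ {x} {c} (λ { refl → unique-∉ u x∈ })) (sum-δ-∈ us x∈)

  countIn : List ℕ → Word → ℕ
  countIn cs w = sum (map (λ c → count c w) cs)

  countIn-∷ : ∀ cs x w → countIn cs (x ∷ w) ≡ sum (map (δ x) cs) + countIn cs w
  countIn-∷ [] x w = refl
  countIn-∷ (c ∷ cs) x w = begin
    count c (x ∷ w) + countIn cs (x ∷ w)                            ≡⟨ cong₂ _+_ (count-∷ c x w) (countIn-∷ cs x w) ⟩
    (δ x c + count c w) + (sum (map (δ x) cs) + countIn cs w)       ≡⟨ interchange (δ x c) (count c w) (sum (map (δ x) cs)) (countIn cs w) ⟩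
    (δ x c + sum (map (δ x) cs)) + (count c w + countIn cs w)       ∎
    where
    open ≡-Reasoning
    open import Algebra.Properties.CommutativeSemigroup +-commutativeSemigroup using (interchange)

  countIn-all : ∀ {cs} w → Unique cs → All (_∈ cs) w → countIn cs w ≡ length w
  countIn-all {[]} [] u [] = refl
  countIn-all {c ∷ cs} [] (_ ∷ u) [] = countIn-all {cs} [] u []
  countIn-all {cs} (x ∷ w) u (p ∷ ps) = trans (countIn-∷ cs x w) (cong₂ _+_ (sum-δ-∈ u p) (countIn-all w u ps))

  countIn-≤ : ∀ {cs} w → Unique cs → countIn cs w ≤ length w
  countIn-≤ {cs} [] u = ≤-reflexive (countIn-all [] u [])
  countIn-≤ {cs} (x ∷ w) u with x ∈? cs
  ... | yes x∈ = ≤-trans (≤-reflexive (trans (countIn-∷ cs x w) (cong (_+ countIn cs w) (sum-δ-∈ u x∈)))) (s≤s (countIn-≤ w u))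
  ... | no x∉ = ≤-trans (≤-reflexive (trans (countIn-∷ cs x w) (cong (_+ countIn cs w) (sum-δ-∉ x cs x∉)))) (m≤n⇒m≤1+n (countIn-≤ w u))

  all-countIn : ∀ {cs} w → Unique cs → countIn cs w ≡ length w → All (_∈ cs) w
  all-countIn [] u _ = []
  all-countIn {cs} (x ∷ w) u e with x ∈? cs
  ... | yes x∈ = x∈ ∷ all-countIn w u (suc-injective (trans (sym (trans (countIn-∷ cs x w) (cong (_+ countIn cs w) (sum-δ-∈ u x∈)))) e))
  ... | no x∉ = ⊥-elim (<-irrefl refl (≤-trans (≤-reflexive (sym (trans (sym (trans (countIn-∷ cs x w) (cong (_+ countIn cs w) (sum-δ-∉ x cs x∉)))) e))) (countIn-≤ w u)))

  -- In contrast to `Content` this excludes 0 and the letters beyond the length of α, as the shift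
  -- rule and a choice of alphabet of that length require.
  record HasContent (α : List ℕ) (w : Word) : Set where
    constructor counts
    field
      zeros : count 0 w ≡ 0
      letters : ∀ i → count (suc i) w ≡ nth α i

  content⁺ : ∀ α (g : ℕ → ℕ) → (∀ i → g (suc i) ≡ nth α i) → map g (range1 (length α)) ≡ α
  content⁺ [] g p = refl
  content⁺ (a ∷ α) g p = trans (cong (map g) (range1-suc (length α))) (cong₂ _∷_ (p 0)
    (trans (sym (map-∘ (range1 (length α)))) (content⁺ α (λ i → g (suc i)) (λ i → p (suc i)))))

  content⁻ : ∀ α (g : ℕ → ℕ) → map g (range1 (length α)) ≡ α → ∀ i → i < length α → g (suc i) ≡ nth α i
  content⁻ (a ∷ α) g e i lt with ∷-injective (trans (sym (cong (map g) (range1-suc (length α)))) e)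
  content⁻ (a ∷ α) g e zero lt | e₁ , e₂ = e₁
  content⁻ (a ∷ α) g e (suc i) (s≤s lt) | e₁ , e₂ = content⁻ α (λ i → g (suc i)) (trans (map-∘ (range1 (length α))) e₂) i lt

  nth-≥ : ∀ α i → length α ≤ i → nth α i ≡ 0
  nth-≥ [] i _ = refl
  nth-≥ (a ∷ α) (suc i) (s≤s le) = nth-≥ α i le

  count-∈ : ∀ {x w} → x ∈ w → 1 ≤ count x w
  count-∈ {x} {y ∷ w} (here refl) = subst (1 ≤_) (sym (trans (count-∷ x x w) (cong (_+ count x w) (δ-refl x)))) (s≤s z≤n)
  count-∈ {x} {y ∷ w} (there x∈) = ≤-trans (count-∈ x∈) (≤-trans (m≤n+m _ (δ y x)) (≤-reflexive (sym (count-∷ x y w))))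

  hasContent-content : ∀ {α w} → HasContent α w → Content α w
  hasContent-content {α} {w} (counts _ p) = content⁺ α (λ i → count i w) p

  hasContent-range : ∀ {α w} → HasContent α w → All (_∈ range1 (length α)) w
  hasContent-range {α} {w} (counts z p) = All.tabulate inRange
    where
    inRange : ∀ {x} → x ∈ w → x ∈ range1 (length α)
    inRange {zero} x∈ = ⊥-elim (<⇒≱ (count-∈ x∈) (≤-reflexive z))
    inRange {suc x} x∈ with x <? length α
    ... | yes lt = ∈-range1⁺ (s≤s z≤n) lt
    ... | no ≮ = ⊥-elim (<⇒≱ (count-∈ x∈) (≤-reflexive (trans (p x) (nth-≥ α x (≮⇒≥ ≮)))))

  content-hasContent : ∀ {α w} → Content α w → All (_∈ range1 (length α)) w → HasContent α w
  content-hasContent {α} {w} c a = counts (count-absent 0 w (All.map (λ { p refl → <-irrefl refl (proj₁ (∈-range1⁻ p)) }) a)) cs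
    where
    cs : ∀ i → count (suc i) w ≡ nth α i
    cs i with i <? length α
    ... | yes lt = content⁻ α (λ i → count i w) c i lt
    ... | no ≮ = trans (count-absent (suc i) w (All.map (λ { p refl → ≮ (proj₂ (∈-range1⁻ p)) }) a)) (sym (nth-≥ α i (≮⇒≥ ≮)))

  hasContent-length : ∀ {α w} → HasContent α w → length w ≡ sum α
  hasContent-length {α} {w} c = trans (sym (countIn-all w (unique-range1 (length α)) (hasContent-range c))) (cong sum (hasContent-content {α} {w} c))

  -- The prescribed letters already account for the whole length, so no other letter can occur.
  length-hasContent : ∀ {α w} → Content α w → length w ≡ sum α → HasContent α w
  length-hasContent {α} {w} c l = content-hasContent c (all-countIn w (unique-range1 (length α)) (trans (cong sum c) (sym l)))

  labelled-hasContent : ∀ {α ls} → Labelled 1 α ls → HasContent α ls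
  labelled-hasContent {α} {ls} (p , q) = counts (count-absent 0 ls (All.map <⇒≢ p)) q

  hasContent-labelled : ∀ {α ls} → HasContent α ls → Labelled 1 α ls
  hasContent-labelled {α} {ls} c@(counts _ q) = All.map (λ p → proj₁ (∈-range1⁻ p)) (hasContent-range c) , q

  count-reverse : ∀ c w → count c (reverse w) ≡ count c w
  count-reverse c [] = refl
  count-reverse c (x ∷ w) = begin
    count c (reverse (x ∷ w))       ≡⟨ cong (count c) (unfold-reverse x w) ⟩
    count c (reverse w ++ x ∷ [])   ≡⟨ count-insert c (reverse w) x [] ⟩
    δ x c + count c (reverse w ++ []) ≡⟨ cong (δ x c +_) (trans (cong (count c) (++-identityʳ (reverse w))) (count-reverse c w)) ⟩
    δ x c + count c w               ≡⟨ count-∷ c x w ⟨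
    count c (x ∷ w)                 ∎
    where open ≡-Reasoning

  hasContent-cong : ∀ {α v w} → (∀ c → count c v ≡ count c w) → HasContent α v → HasContent α w
  hasContent-cong e (counts z p) = counts (trans (sym (e 0)) z) (λ i → trans (sym (e (suc i))) (p i))

  length-concat : ∀ (Q : Tableau) → length (concat Q) ≡ sum (shape Q)
  length-concat [] = refl
  length-concat (R ∷ Q) = trans (length-++ R) (cong (length R +_) (length-concat Q))

  tableauPairs : ℕ → List ℕ → List ℕ → List (Tableau × Tableau)
  tableauPairs n α ν = concatMap (λ P → map (P ,_) (SSYT ν α)) (tableaux ν n)

  ∈-tableauPairs⁻ : ∀ n α ν {P Q} → Decreasing ν → Positive ν → (P , Q) ∈ tableauPairs n α ν →
    (Tab P × shape P ≡ ν × All (All (_∈ range1 n)) P) × (Tab Q × shape Q ≡ ν × HasContent α (concat Q))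
  ∈-tableauPairs⁻ n α ν d p PQ∈ with ∈-concatMap⁻′ (λ P → map (P ,_) (SSYT ν α)) (tableaux ν n) PQ∈
  ... | P , P∈ , PQ∈′ with ∈-map⁻ (P ,_) PQ∈′
  ...   | Q , Q∈ , refl with ∈-SSYT⁻ ν α d p Q∈
  ...     | tQ , sQ , a , c = ∈-tableaux⁻ ν n d p P∈ , tQ , sQ , content-hasContent c (All.concat⁺ a)

  unique-tableauPairs : ∀ n α ν → Unique (tableauPairs n α ν)
  unique-tableauPairs n α ν = unique-concatMap (λ P → map (P ,_) (SSYT ν α)) (tableaux ν n)
    (unique-filterᵇ isSSYTᵇ (unique-fillings ν n)) (λ P _ → Unique.map⁺ (λ { refl → refl }) (unique-SSYT ν α))
    (λ _ _ → same)
    where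
    same : ∀ {P P′ : Tableau} {PQ : Tableau × Tableau} {xs ys} → PQ ∈ map (P ,_) xs → PQ ∈ map (P′ ,_) ys → P ≡ P′
    same p q with ∈-map⁻ _ p | ∈-map⁻ _ q
    ... | _ , _ , refl | _ , _ , refl = refl

  module RSKSum (𝓚 : CommutativeRing 0ℓ 0ℓ) (t : CommutativeRing.Carrier 𝓚) where
    open CommutativeRing 𝓚 using (_≈_; reflexive) renaming (Carrier to K; refl to ≈-refl; trans to ≈-trans; sym to ≈-sym)
    open SumOver 𝓚
    open PlacticRing 𝓚
    open PlacticInsertion 𝓚
    open HSums 𝓚 t
    open HL.C using (h*)

    -- Cauchy's identity in plactic form, via the Robinson–Schensted–Knuth correspondence.
    h*-tableaux : ∀ n α {f} → Invariant f →
      ap (h* (alphabet n) α) f ≈ Σ (λ ν → Σ (λ P → Σ (λ _ → f (rw P)) (SSYT ν α)) (tableaux ν n)) (partitionsOf (sum α))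
    h*-tableaux n α {f} inv = ≈-trans (ap-h* (alphabet n) 1 α f)
      -- Biwords are listed in reading order, while `RSK` expects the most recent pair first; hence
      -- the reversal.
      (≈-trans (Σ-bijection (λ w (P , Q) → RSK (reverse w) P Q) (λ w → f (map proj₂ w)) (λ (P , Q) → f (rw P))
          (biwords (alphabet n) 1 α) (concatMap (tableauPairs n α) (partitionsOf (sum α)))
          (unique-biwords (alphabet n) 1 α inc)
          (unique-concatMap (tableauPairs n α) (partitionsOf (sum α)) (unique-partitionsOf (sum α)) (λ ν _ → unique-tableauPairs n α ν) sameShape)
          to back (λ {w} → functional {w}) injective (λ {w} → value {w}))
        (≈-trans (Σ-concatMap _ (tableauPairs n α) (partitionsOf (sum α)))
          (Σ-cong (partitionsOf (sum α)) (λ ν _ → ≈-trans (Σ-concatMap _ (λ P → map (P ,_) (SSYT ν α)) (tableaux ν n))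
            (Σ-cong (tableaux ν n) (λ P _ → Σ-map _ (P ,_) (SSYT ν α)))))))
      where
      inc = HL.alphabet-inc n
      pairs∈ : ∀ ν {PQ} → ν ∈ partitionsOf (sum α) → PQ ∈ tableauPairs n α ν → _
      pairs∈ ν ν∈ PQ∈ = ∈-tableauPairs⁻ n α ν (proj₁ (∈-partitionsOf⁻ (sum α) ν∈)) (proj₁ (proj₂ (∈-partitionsOf⁻ (sum α) ν∈))) PQ∈
      sameShape : ∀ {ν ν′ PQ} → ν ∈ partitionsOf (sum α) → ν′ ∈ partitionsOf (sum α) → PQ ∈ tableauPairs n α ν → PQ ∈ tableauPairs n α ν′ → ν ≡ ν′
      sameShape {ν} {ν′} ν∈ ν′∈ p q with pairs∈ ν ν∈ p | pairs∈ ν′ ν′∈ q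
      ... | (_ , s , _) , _ | (_ , s′ , _) , _ = trans (sym s) s′
      map-reverse : ∀ (g : ℕ × ℕ → ℕ) w c → count c (map g (reverse w)) ≡ count c (map g w)
      map-reverse g w c = trans (cong (count c) (reverse-map g w)) (count-reverse c (map g w))
      unreverse : ∀ w {x} → x ∈ map proj₂ (reverse w) → x ∈ map proj₂ w
      unreverse w x∈ with ∈-map⁻ proj₂ x∈
      ... | p , p∈ , refl = ∈-map⁺ proj₂ (Any.reverse⁻ p∈)
      to : ∀ w → w ∈ biwords (alphabet n) 1 α → ∃ λ PQ → PQ ∈ concatMap (tableauPairs n α) (partitionsOf (sum α)) × RSK (reverse w) (proj₁ PQ) (proj₂ PQ)
      to w w∈ with ∈-biwords⁻ (alphabet n) 1 α inc w∈
      ... | s , a , l with rsk-total (sorted-biword (AllPairs-reverse s))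
      ...   | P , Q , r with rsk-tab r
      ...     | tP , tQ , e = (P , Q) , ∈-concatMap⁺′ (tableauPairs n α) ν∈
                (∈-concatMap⁺′ (λ P → map (P ,_) (SSYT (shape Q) α)) (subst (λ ν → P ∈ tableaux ν n) e (∈-tableaux⁺ n tP (rsk-letters r a′)))
                  (∈-map⁺ (P ,_) (∈-SSYT⁺ α tQ (All.concat⁻ (hasContent-range cQ)) (hasContent-content {α} {concat Q} cQ)))) , r
        where
        a′ : All (_∈ range1 n) (map proj₂ (reverse w))
        a′ = All.tabulate (λ x∈ → subst (_ ∈_) (alphabet≡range1 n) (All.lookup a (unreverse w x∈)))
        cQ : HasContent α (concat Q)
        cQ = hasContent-cong {v = map proj₁ w} (λ c → sym (trans (rsk-labels c r) (map-reverse proj₁ w c))) (labelled-hasContent l)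
        ν∈ : shape Q ∈ partitionsOf (sum α)
        ν∈ = subst (λ N → shape Q ∈ partitionsOf N) (trans (sym (length-concat Q)) (hasContent-length cQ)) (∈-partitionsOf⁺ (tab-decreasing tQ) (tab-positive tQ))
      back : ∀ PQ → PQ ∈ concatMap (tableauPairs n α) (partitionsOf (sum α)) → ∃ λ w → w ∈ biwords (alphabet n) 1 α × RSK (reverse w) (proj₁ PQ) (proj₂ PQ)
      back (P , Q) PQ∈ with ∈-concatMap⁻′ (tableauPairs n α) (partitionsOf (sum α)) PQ∈
      ... | ν , ν∈ , PQ∈′ with pairs∈ ν ν∈ PQ∈′
      ...   | (tP , sP , aP) , (tQ , sQ , cQ) with unrsk (sum (shape Q)) P Q ≤-refl tP tQ (trans sP (sym sQ))
      ...     | w , r = reverse w , ∈-biwords⁺ (alphabet n) 1 α (reverse w) inc (AllPairs-reverse (biword-sorted (rsk-biword r))) letters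
                  (hasContent-labelled (hasContent-cong {v = concat Q} (λ c → trans (rsk-labels c r) (sym (map-reverse proj₁ w c))) cQ)) ,
                subst (λ w → RSK w P Q) (sym (reverse-involutive w)) r
        where
        letters : All (_∈ alphabet n) (map proj₂ (reverse w))
        letters = All.tabulate (λ x∈ → subst (_ ∈_) (sym (alphabet≡range1 n)) (All.lookup (rsk-unletters r aP) (unreverse w x∈)))
      functional : ∀ {w} {PQ PQ′ : Tableau × Tableau} → RSK (reverse w) (proj₁ PQ) (proj₂ PQ) → RSK (reverse w) (proj₁ PQ′) (proj₂ PQ′) → PQ ≡ PQ′
      functional r r′ with rsk-functional r r′
      ... | refl , refl = refl
      injective : ∀ {w w′} {PQ : Tableau × Tableau} → RSK (reverse w) (proj₁ PQ) (proj₂ PQ) → RSK (reverse w′) (proj₁ PQ) (proj₂ PQ) → w ≡ w′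
      injective r r′ = reverse-injective (rsk-injective r r′)
      value : ∀ {w} {PQ : Tableau × Tableau} → w ∈ biwords (alphabet n) 1 α → RSK (reverse w) (proj₁ PQ) (proj₂ PQ) → f (map proj₂ w) ≈ f (rw (proj₁ PQ))
      value {w} {P , Q} _ r = ≈-trans (reflexive (cong f (sym word≡))) (≈-trans (rsk-plactic inv [] r) (reflexive (cong f (++-identityʳ (rw P)))))
        where
        word≡ : reverse (map proj₂ (reverse w)) ++ [] ≡ map proj₂ w
        word≡ = trans (++-identityʳ _) (trans (sym (reverse-map proj₂ (reverse w))) (cong (map proj₂) (reverse-involutive w)))

-- Power series in t as a commutative ring.

module PowerSeries where
  open import Data.Bool using (true; false; if_then_else_)
  open import Data.Nat as ℕ using (ℕ; zero; suc; _∸_; _≡ᵇ_)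
  open import Data.Nat.DivMod using (_%_; m<n⇒m%n≡m; [m+n]%n≡m%n)
  open import Data.Integer as ℤ using (ℤ; +_; _+_; _*_; -_)
  open import Data.List using (List; []; _∷_; map; upTo; applyUpTo; length)
  open import Data.List.Properties using (map-∘; map-applyUpTo)
  open import Relation.Binary.PropositionalEquality as ≡ using (_≡_; refl; sym; trans; cong; cong₂)
  open import Defs using (Series; Σℤ; sumS; _⊛_; oneS; tpow; oneMinusTpow; invOneMinusTpow)
  open Convolutions
  open SumsOverLists

  private module ℤS = FiniteSums ℤ.+-*-ring
  open ℤS using (conv; conv-cong; conv-0; conv-+; conv-flip; conv-assoc; conv-*ˡ; conv-*ʳ)

  infix 4 _≈ˢ_
  record _≈ˢ_ (f g : Series) : Set where
    constructor pointwise
    field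
      coeff : ∀ k → f k ≡ g k
  open _≈ˢ_ public

  Σℤ-upTo : ∀ (F : ℕ → ℕ → ℤ) s → Σℤ (map (λ i → F i (s ∸ i)) (upTo (suc s))) ≡ conv F s
  Σℤ-upTo F zero = ℤ.+-identityʳ (F 0 0)
  Σℤ-upTo F (suc s) = cong (λ z → F 0 (suc s) + z) (trans (cong Σℤ shift) (Σℤ-upTo (λ i → F (suc i)) s))
    where
    shift : map (λ i → F i (suc s ∸ i)) (applyUpTo suc (suc s)) ≡ map (λ i → F (suc i) (s ∸ i)) (upTo (suc s))
    shift = trans (cong (map (λ i → F i (suc s ∸ i))) (sym (map-applyUpTo (λ x → x) suc (suc s)))) (sym (map-∘ (upTo (suc s))))

  ⊛-conv : ∀ f g k → (f ⊛ g) k ≡ conv (λ i j → f i * g j) k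
  ⊛-conv f g = Σℤ-upTo (λ i j → f i * g j)

  private
    zeroS : Series
    zeroS _ = + 0

    _⊕_ : Series → Series → Series
    (f ⊕ g) k = f k + g k

    ⊛-cong : ∀ {f f′ g g′} → f ≈ˢ f′ → g ≈ˢ g′ → f ⊛ g ≈ˢ f′ ⊛ g′
    ⊛-cong {f} {f′} {g} {g′} p q = pointwise (λ k → trans (⊛-conv f g k)
      (trans (conv-cong k (λ i j _ → cong₂ _*_ (coeff p i) (coeff q j))) (sym (⊛-conv f′ g′ k))))

    ⊛-comm : ∀ f g → f ⊛ g ≈ˢ g ⊛ f
    ⊛-comm f g = pointwise (λ k → trans (⊛-conv f g k) (trans (conv-flip _ k)
      (trans (conv-cong k (λ i j _ → ℤ.*-comm (f j) (g i))) (sym (⊛-conv g f k)))))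

    ⊛-assoc : ∀ f g h → (f ⊛ g) ⊛ h ≈ˢ f ⊛ (g ⊛ h)
    ⊛-assoc f g h = pointwise (λ k → begin
      ((f ⊛ g) ⊛ h) k ≡⟨ ⊛-conv (f ⊛ g) h k ⟩
      conv (λ i j → (f ⊛ g) i * h j) k
        ≡⟨ conv-cong k (λ i j _ → trans (cong (_* h j) (⊛-conv f g i)) (conv-*ʳ (λ a b → f a * g b) i (h j))) ⟩
      conv (λ i j → conv (λ a b → f a * g b * h j) i) k ≡⟨ conv-assoc (λ a b j → f a * g b * h j) k ⟨
      conv (λ a i → conv (λ b j → f a * g b * h j) i) k
        ≡⟨ conv-cong k (λ a i _ → trans (conv-cong i (λ b j _ → ℤ.*-assoc (f a) (g b) (h j)))
             (trans (conv-*ˡ (f a) (λ b j → g b * h j) i) (cong (f a *_) (sym (⊛-conv g h i))))) ⟩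
      conv (λ a i → f a * (g ⊛ h) i) k ≡⟨ ⊛-conv f (g ⊛ h) k ⟨
      (f ⊛ (g ⊛ h)) k ∎)
      where open ≡.≡-Reasoning

    ⊛-identityˡ : ∀ f → oneS ⊛ f ≈ˢ f
    ⊛-identityˡ f = pointwise λ k → trans (⊛-conv oneS f k) (go k)
      where
      go : ∀ k → conv (λ i j → oneS i * f j) k ≡ f k
      go zero = ℤ.*-identityˡ (f 0)
      go (suc k) = trans (cong₂ _+_ (ℤ.*-identityˡ (f (suc k))) (conv-0 k (λ i j _ → refl))) (ℤ.+-identityʳ (f (suc k)))

    ⊛-distribˡ : ∀ f g h → f ⊛ (g ⊕ h) ≈ˢ (f ⊛ g) ⊕ (f ⊛ h)
    ⊛-distribˡ f g h = pointwise (λ k → trans (⊛-conv f (g ⊕ h) k)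
      (trans (conv-cong k (λ i j _ → ℤ.*-distribˡ-+ (f i) (g j) (h j)))
        (trans (conv-+ (λ i j → f i * g j) (λ i j → f i * h j) k) (cong₂ _+_ (sym (⊛-conv f g k)) (sym (⊛-conv f h k))))))

    ≈ˢ-trans : ∀ {f g h} → f ≈ˢ g → g ≈ˢ h → f ≈ˢ h
    ≈ˢ-trans p q = pointwise (λ k → trans (coeff p k) (coeff q k))

  seriesRing : CommutativeRing 0ℓ 0ℓ
  seriesRing = record
    { Carrier = Series ; _≈_ = _≈ˢ_ ; _+_ = _⊕_ ; _*_ = _⊛_ ; -_ = λ f k → - f k ; 0# = zeroS ; 1# = oneS
    ; isCommutativeRing = record
      { isRing = record
        { +-isAbelianGroup = record
          { isGroup = record
            { isMonoid = record
              { isSemigroup = record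
                { isMagma = record
                  { isEquivalence = record
                    { refl = pointwise (λ _ → refl) ; sym = λ p → pointwise (λ k → sym (coeff p k)) ; trans = ≈ˢ-trans }
                  ; ∙-cong = λ p q → pointwise (λ k → cong₂ _+_ (coeff p k) (coeff q k)) }
                ; assoc = λ f g h → pointwise (λ k → ℤ.+-assoc (f k) (g k) (h k)) }
              ; identity = (λ f → pointwise (λ k → ℤ.+-identityˡ (f k))) , (λ f → pointwise (λ k → ℤ.+-identityʳ (f k))) }
            ; inverse = (λ f → pointwise (λ k → ℤ.+-inverseˡ (f k))) , (λ f → pointwise (λ k → ℤ.+-inverseʳ (f k)))
            ; ⁻¹-cong = λ p → pointwise (λ k → cong -_ (coeff p k)) }
          ; comm = λ f g → pointwise (λ k → ℤ.+-comm (f k) (g k)) }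
        ; *-cong = ⊛-cong
        ; *-assoc = ⊛-assoc
        ; *-identity = ⊛-identityˡ , (λ f → ≈ˢ-trans (⊛-comm f oneS) (⊛-identityˡ f))
        ; distrib = ⊛-distribˡ , (λ f g h → ≈ˢ-trans (⊛-comm (g ⊕ h) f) (≈ˢ-trans (⊛-distribˡ f g h)
            (pointwise (λ k → cong₂ _+_ (coeff (⊛-comm f g) k) (coeff (⊛-comm f h) k))))) }
      ; *-comm = ⊛-comm } }

  open CommutativeRing seriesRing using (setoid) renaming (trans to ≈-trans; sym to ≈-sym; *-congʳ to ⊛-congʳ; *-assoc to ⊛-assoc′)

  tpow-0 : tpow 0 ≈ˢ oneS
  tpow-0 = pointwise λ { zero → refl ; (suc k) → refl }

  t-shift : ∀ f k → (tpow 1 ⊛ f) (suc k) ≡ f k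
  t-shift f k = trans (⊛-conv (tpow 1) f (suc k)) (trans (ℤ.+-identityˡ _) (go k))
    where
    go : ∀ k → conv (λ i j → tpow 1 (suc i) * f j) k ≡ f k
    go zero = ℤ.*-identityˡ (f 0)
    go (suc k) = trans (cong₂ _+_ (ℤ.*-identityˡ (f (suc k))) (conv-0 k (λ i j _ → refl))) (ℤ.+-identityʳ (f (suc k)))

  tpow-suc : ∀ n → tpow (suc n) ≈ˢ tpow 1 ⊛ tpow n
  tpow-suc n = pointwise λ { zero → refl ; (suc k) → sym (t-shift (tpow n) k) }

  tpow-⊛-≥ : ∀ d f k → (tpow d ⊛ f) (d ℕ.+ k) ≡ f k
  tpow-⊛-≥ zero f k = coeff (≈-trans (⊛-congʳ {f} tpow-0) (⊛-identityˡ f)) k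
  tpow-⊛-≥ (suc d) f k = trans (coeff (≈-trans (⊛-congʳ {f} (tpow-suc d)) (⊛-assoc′ (tpow 1) (tpow d) f)) (suc (d ℕ.+ k)))
    (trans (t-shift (tpow d ⊛ f) (d ℕ.+ k)) (tpow-⊛-≥ d f k))

  tpow-⊛-< : ∀ d f k → k ℕ.< d → (tpow d ⊛ f) k ≡ + 0
  tpow-⊛-< (suc d) f zero _ = trans (ℤ.+-identityʳ _) (ℤ.*-zeroˡ (f 0))
  tpow-⊛-< (suc d) f (suc k) (ℕ.s≤s lt) = trans (coeff (≈-trans (⊛-congʳ {f} (tpow-suc d)) (⊛-assoc′ (tpow 1) (tpow d) f)) (suc k))
    (trans (t-shift (tpow d ⊛ f) k) (tpow-⊛-< d f k lt))

  -- The coefficients of the geometric series have period `suc j`, so subtracting its shift leaves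
  -- those of lower degree, of which only the constant term is nonzero.
  invOneMinusTpow-inverse : ∀ j → oneMinusTpow (suc j) ⊛ invOneMinusTpow (suc j) ≈ˢ oneS
  invOneMinusTpow-inverse j = ≈-trans expand (pointwise coefficient)
    where
    d = suc j
    u = invOneMinusTpow d
    open CommutativeRing seriesRing using (distribʳ; +-cong; ring; *-identityˡ)
    open import Algebra.Properties.Ring ring using (-‿distribˡ-*)
    minus : Series
    minus k = - (tpow d ⊛ u) k
    expand : oneMinusTpow d ⊛ u ≈ˢ (u ⊕ minus)
    expand = ≈-trans (distribʳ u oneS (λ k → - tpow d k)) (+-cong (*-identityˡ u) (≈-sym (-‿distribˡ-* (tpow d) u)))
    coefficient : ∀ k → u k + - (tpow d ⊛ u) k ≡ oneS k
    coefficient k with ℕ.<-≤-connex k d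
    ... | inj₂ d≤k = trans (cong₂ (λ a b → a + - b) periodic drop) (trans (ℤ.+-inverseʳ (u (k ∸ d))) (sym (positive d≤k)))
      where
      k≡ : d ℕ.+ (k ∸ d) ≡ k
      k≡ = ℕ.m+[n∸m]≡n d≤k
      drop : (tpow d ⊛ u) k ≡ u (k ∸ d)
      drop = trans (cong (tpow d ⊛ u) (sym k≡)) (tpow-⊛-≥ d u (k ∸ d))
      periodic : u k ≡ u (k ∸ d)
      periodic = trans (cong u (sym k≡)) (cong (λ r → if r ≡ᵇ 0 then + 1 else + 0) (trans (cong (_% d) (ℕ.+-comm d (k ∸ d))) ([m+n]%n≡m%n (k ∸ d) d)))
      positive : ∀ {k} → d ℕ.≤ k → oneS k ≡ + 0
      positive (ℕ.s≤s _) = refl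
    ... | inj₁ k<d = trans (cong₂ (λ a b → a + - b) small (tpow-⊛-< d u k k<d)) (ℤ.+-identityʳ (oneS k))
      where
      small : u k ≡ oneS k
      small = trans (cong (λ r → if r ≡ᵇ 0 then + 1 else + 0) (m<n⇒m%n≡m k<d)) (is-one k)
        where
        is-one : ∀ k → (if k ≡ᵇ 0 then + 1 else + 0) ≡ oneS k
        is-one zero = refl
        is-one (suc k) = refl

  open SumOver seriesRing

  sumS-Σ : ∀ fs → sumS fs ≈ˢ Σ (λ f → f) fs
  sumS-Σ [] = pointwise (λ k → refl)
  sumS-Σ (f ∷ fs) = pointwise (λ k → cong (λ z → f k + z) (coeff (sumS-Σ fs) k))

  -- Resolves a Kostka number, which is the length of a list of tableaux, into a sum over that list.
  Σ-tpow : ∀ {X : Set} c (xs : List X) → Σ (λ _ → tpow c) xs ≈ˢ (λ k → if c ≡ᵇ k then + length xs else + 0)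
  Σ-tpow c [] = pointwise (λ k → lemma k)
    where
    lemma : ∀ k → + 0 ≡ (if c ≡ᵇ k then + 0 else + 0)
    lemma k with c ≡ᵇ k
    ... | true = refl
    ... | false = refl
  Σ-tpow c (x ∷ xs) = pointwise (λ k → trans (cong (λ z → tpow c k + z) (coeff (Σ-tpow c xs) k)) (lemma k))
    where
    lemma : ∀ k → tpow c k + (if c ≡ᵇ k then + length xs else + 0) ≡ (if c ≡ᵇ k then + suc (length xs) else + 0)
    lemma k with c ≡ᵇ k
    ... | true = refl
    ... | false = refl

-- The functional defined by charge, and the coefficients of Q′.

module ChargeFunctional where
  open import Data.Bool using (true; false; _∧_; if_then_else_)
  open import Data.Nat
  open import Data.Nat.Properties
  open import Data.Nat.ListAction using (sum)
  open import Data.List using (List; []; _∷_; _++_; map; length; concat; concatMap; reverse; replicate)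
  open import Data.List.Properties using (≡-dec; unfold-reverse; concat-++; ++-identityʳ)
  open import Data.List.Relation.Unary.All as All using (All; []; _∷_)
  open import Data.List.Relation.Unary.Linked using (Linked; []; [-]; _∷_)
  open import Relation.Nullary using (¬_; Dec; yes; no)
  open import Relation.Nullary.Decidable using (⌊_⌋; map′; _×-dec_)
  open import Relation.Binary.PropositionalEquality
  open import Defs
  open WordCharge using (Word)
  open ChargeRotation using (δ; count-insert; count-∷; count-++; PartitionContent; charge-knuth₁; charge-knuth₂; charge-rotate; charge-shift)
  open RobinsonSchenstedKnuth
  open SumsOverLists
  open Enumerations
  open Biwords
  open PlacticCauchy
  open PlacticWords
  open HallLittlewoodFunctionals
  open PowerSeries

  -- `HasContent` constrains infinitely many letters; the counts up to the length of α together with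
  -- the length of the word decide it.
  hasContent? : ∀ α w → Dec (HasContent α w)
  hasContent? α w = map′ (λ (c , l) → length-hasContent c l) (λ c → hasContent-content {α} {w} c , hasContent-length c)
    (≡-dec _≟_ (map (λ i → count i w) (range1 (length α))) α ×-dec (length w ≟ sum α))

  private
    𝕊 = seriesRing
    module 𝕊 = CommutativeRing seriesRing

  zeroS : Series
  zeroS = 𝕊.0#

  φ : List ℕ → Word → Series
  φ lam w = if ⌊ hasContent? lam w ⌋ then tpow (charge w) else zeroS

  φ-yes : ∀ {lam w} → HasContent lam w → φ lam w ≡ tpow (charge w)
  φ-yes {lam} {w} c with hasContent? lam w
  ... | yes _ = refl
  ... | no ¬c = ⊥-elim (¬c c)

  φ-no : ∀ {lam w} → ¬ HasContent lam w → φ lam w ≡ zeroS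
  φ-no {lam} {w} ¬c with hasContent? lam w
  ... | yes c = ⊥-elim (¬c c)
  ... | no _ = refl

  φ-≡ : ∀ {lam v w} → (∀ c → count c v ≡ count c w) → charge v ≡ charge w → φ lam v ≡ φ lam w
  φ-≡ {lam} {v} {w} e ch with hasContent? lam w
  ... | yes c = trans (φ-yes (hasContent-cong (λ c → sym (e c)) c)) (cong tpow ch)
  ... | no ¬c = φ-no (λ c → ¬c (hasContent-cong e c))

  count-swap : ∀ c u x y v → count c (u ++ x ∷ y ∷ v) ≡ count c (u ++ y ∷ x ∷ v)
  count-swap c u x y v = begin
    count c (u ++ x ∷ y ∷ v)            ≡⟨ count-insert c u x (y ∷ v) ⟩
    δ x c + count c (u ++ y ∷ v)        ≡⟨ cong (δ x c +_) (count-insert c u y v) ⟩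
    δ x c + (δ y c + count c (u ++ v))  ≡⟨ x∙yz≈y∙xz (δ x c) (δ y c) _ ⟩
    δ y c + (δ x c + count c (u ++ v))  ≡⟨ cong (δ y c +_) (count-insert c u x v) ⟨
    δ y c + count c (u ++ x ∷ v)        ≡⟨ count-insert c u y (x ∷ v) ⟨
    count c (u ++ y ∷ x ∷ v)            ∎
    where
    open ≡-Reasoning
    open import Algebra.Properties.CommutativeSemigroup +-commutativeSemigroup using (x∙yz≈y∙xz)

  open PlacticRing seriesRing

  φ-invariant : ∀ lam → Invariant (φ lam)
  φ-invariant lam = record
    { knuth₁ = λ u v {x} {y} {z} p q → 𝕊.reflexive (φ-≡ {lam} {u ++ x ∷ z ∷ y ∷ v} {u ++ z ∷ x ∷ y ∷ v} (λ c → count-swap c u x z (y ∷ v)) (charge-knuth₁ u v p q))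
    ; knuth₂ = λ u v {x} {y} {z} p q → 𝕊.reflexive (φ-≡ {lam} {u ++ y ∷ x ∷ z ∷ v} {u ++ y ∷ z ∷ x ∷ v} (λ c → trans (cong (count c) (sym (Data.List.Properties.++-assoc u (y ∷ []) (x ∷ z ∷ v))))
        (trans (count-swap c (u ++ y ∷ []) x z v) (cong (count c) (Data.List.Properties.++-assoc u (y ∷ []) (z ∷ x ∷ v))))) (charge-knuth₂ u v p q)) }
    where import Data.List.Properties

  φ-empty : φ [] [] ≈ˢ oneS
  φ-empty = tpow-0

  φ-count : ∀ m lam w → count 1 w ≢ m → φ (m ∷ lam) w ≈ˢ zeroS
  φ-count m lam w ne = 𝕊.reflexive (φ-no {m ∷ lam} {w} (λ c → ne (HasContent.letters c 0)))

  nth-decreasing : ∀ {lam} → Linked _≥_ lam → ∀ i → nth lam (suc i) ≤ nth lam i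
  nth-decreasing [] i = z≤n
  nth-decreasing [-] zero = z≤n
  nth-decreasing [-] (suc i) = z≤n
  nth-decreasing (p ∷ l) zero = p
  nth-decreasing (p ∷ l) (suc i) = nth-decreasing l i

  hasContent-partition : ∀ {lam w} → Linked _≥_ lam → HasContent lam w → PartitionContent w
  hasContent-partition {lam} {w} l (counts z p) = record
    { no-zero = z
    ; decreasing = λ { (suc j) _ → subst₂ _≤_ (sym (p (suc j))) (sym (p j)) (nth-decreasing l j) } }

  φ-rotate : ∀ {m lam} → IsPartition (m ∷ lam) → ∀ w x → 2 ≤ x → φ (m ∷ lam) (w ++ x ∷ []) ≈ˢ tpow 1 ⊛ φ (m ∷ lam) (x ∷ w)
  φ-rotate {m} {lam} (l , _) w x 2≤x = go (hasContent? (m ∷ lam) (x ∷ w))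
    where
    rotated : ∀ c → count c (w ++ x ∷ []) ≡ count c (x ∷ w)
    rotated c = trans (count-insert c w x []) (trans (cong (λ v → δ x c + count c v) (++-identityʳ w)) (sym (count-∷ c x w)))
    go : Dec (HasContent (m ∷ lam) (x ∷ w)) → φ (m ∷ lam) (w ++ x ∷ []) ≈ˢ tpow 1 ⊛ φ (m ∷ lam) (x ∷ w)
    go (yes c) rewrite φ-yes c | φ-yes (hasContent-cong {v = x ∷ w} {w ++ x ∷ []} (λ c → sym (rotated c)) c) | charge-rotate x w 2≤x (hasContent-partition l c) = tpow-suc (charge (x ∷ w))
    go (no ¬c) rewrite φ-no ¬c | φ-no {m ∷ lam} {w ++ x ∷ []} (λ c → ¬c (hasContent-cong rotated c)) = 𝕊.sym (𝕊.zeroʳ (tpow 1))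

  linked-tail : ∀ {m lam} → Linked _≥_ (m ∷ lam) → Linked _≥_ lam
  linked-tail [-] = []
  linked-tail (_ ∷ l) = l

  count-map-suc : ∀ c w → count (suc c) (map suc w) ≡ count c w
  count-map-suc c [] = refl
  count-map-suc c (x ∷ w) = trans (count-∷ (suc c) (suc x) (map suc w)) (trans (cong (δ x c +_) (count-map-suc c w)) (sym (count-∷ c x w)))

  φ-shift : ∀ {m lam} → IsPartition (m ∷ lam) → ∀ w → All (1 ≤_) w → φ (m ∷ lam) (map suc w ++ replicate m 1) ≈ˢ φ lam w
  φ-shift {m} {lam} (l , _) w pos = go (hasContent? lam w)
    where
    v = map suc w ++ replicate m 1
    ones : ∀ c k → c ≢ 1 → count c (replicate k 1) ≡ 0
    ones c k ne = count-absent c (replicate k 1) (All.replicate⁺ k ne)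
    ones′ : ∀ k → count 1 (replicate k 1) ≡ k
    ones′ zero = refl
    ones′ (suc k) = cong suc (ones′ k)
    zero-w : count 0 w ≡ 0
    zero-w = count-absent 0 w (All.map <⇒≢ pos)
    cnt0 : count 0 v ≡ 0
    cnt0 = trans (count-++ 0 (map suc w) (replicate m 1)) (cong₂ _+_ (count-absent 0 (map suc w) (All.map⁺ (All.map (λ _ ()) pos))) (ones 0 m (λ ())))
    cnt1 : count 1 v ≡ m
    cnt1 = trans (count-++ 1 (map suc w) (replicate m 1)) (cong₂ _+_ (trans (count-map-suc 0 w) zero-w) (ones′ m))
    cnt2 : ∀ i → count (suc (suc i)) v ≡ count (suc i) w
    cnt2 i = trans (count-++ (suc (suc i)) (map suc w) (replicate m 1)) (trans (cong₂ _+_ (count-map-suc (suc i) w) (ones (suc (suc i)) m (λ ()))) (+-identityʳ _))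
    up : HasContent lam w → HasContent (m ∷ lam) v
    up (counts z p) = counts cnt0 λ { zero → cnt1 ; (suc i) → trans (cnt2 i) (p i) }
    down : HasContent (m ∷ lam) v → HasContent lam w
    down (counts z p) = counts zero-w (λ i → trans (sym (cnt2 i)) (p (suc i)))
    go : Dec (HasContent lam w) → φ (m ∷ lam) v ≈ˢ φ lam w
    -- The condition of `charge-shift` on the number of 1s in `w` is that the second part of the
    -- partition is at most the first.
    go (yes c) = 𝕊.reflexive (trans (φ-yes (up c)) (trans (cong tpow (charge-shift w m (hasContent-partition (linked-tail l) c)
      (subst (_≤ m) (sym (HasContent.letters c 0)) (nth-decreasing l 0)))) (sym (φ-yes c))))
    go (no ¬c) = 𝕊.reflexive (trans (φ-no (λ c → ¬c (down c))) (sym (φ-no ¬c)))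

  readingWord≡rw : ∀ P → readingWord P ≡ rw P
  readingWord≡rw [] = refl
  readingWord≡rw (R ∷ P) = trans (cong concat (unfold-reverse R P)) (trans (sym (concat-++ (reverse P) (R ∷ []))) (cong₂ _++_ (readingWord≡rw P) (++-identityʳ R)))

  count-rw : ∀ c P → count c (rw P) ≡ count c (concat P)
  count-rw c [] = refl
  count-rw c (R ∷ P) = trans (count-++ c (rw P) R) (trans (+-comm _ (count c R)) (trans (cong (count c R +_) (count-rw c P)) (sym (count-++ c R (concat P)))))

  open SumOver seriesRing
  open RSKSum seriesRing (tpow 1)
  open HSums seriesRing (tpow 1)
  open HL.C using (h*)

  -- When λ and α have the same size, both sides sum over pairs of tableaux of one shape. Otherwise
  -- both vanish: on the left no recording tableau exists, on the right no tableau has content λ.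
  Q′coeff-h* : ∀ lam α → Q′coeff lam α ≈ˢ ap (h* (alphabet (length lam)) α) (φ lam)
  Q′coeff-h* lam α = 𝕊.trans expand (𝕊.trans (same (sum lam ≟ sum α)) (𝕊.sym (h*-tableaux n α (φ-invariant lam))))
    where
    n = length lam
    inner : List ℕ → Tableau → Series
    inner ν P = Σ (λ _ → φ lam (rw P)) (SSYT ν α)
    sumOver : ℕ → Series
    sumOver N = Σ (λ ν → Σ (inner ν) (tableaux ν n)) (partitionsOf N)
    term : List ℕ → Tableau → Series
    term ν P k = if charge (readingWord P) ≡ᵇ k then ℤ.+ kostka ν α else ℤ.+ 0
    -- The test of the content in `SSYT` is transferred to `φ`, which is 0 on reading words of any
    -- other content.
    perFilling : ∀ ν P → P ∈ fillings ν n → (if isSSYTᵇ P ∧ hasContentᵇ lam P then term ν P else zeroS) ≈ˢ (if isSSYTᵇ P then inner ν P else zeroS)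
    perFilling ν P P∈ with isSSYTᵇ P
    ... | false = 𝕊.refl
    ... | true with ≡-dec _≟_ (map (λ i → count i (concat P)) (range1 n)) lam
    ...   | yes c = 𝕊.sym (𝕊.trans (Σ-cong (SSYT ν α) (λ _ _ → 𝕊.reflexive (φ-yes {lam} {rw P} content))) (subst (λ w → Σ (λ _ → tpow (charge w)) (SSYT ν α) ≈ˢ term ν P) (readingWord≡rw P) (Σ-tpow (charge (readingWord P)) (SSYT ν α))))
      where
      content : HasContent lam (rw P)
      content = hasContent-cong {v = concat P} (λ c → sym (count-rw c P)) (content-hasContent c (All.concat⁺ (proj₂ (∈-fillings⁻ ν n P∈))))
    ...   | no ¬c = 𝕊.sym (Σ-0 (SSYT ν α) (λ _ _ → 𝕊.reflexive (φ-no {lam} {rw P} (λ c → ¬c (hasContent-content {lam} {concat P} (hasContent-cong (λ c → count-rw c P) c))))))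
    expand : Q′coeff lam α ≈ˢ sumOver (sum lam)
    expand = 𝕊.trans (sumS-Σ (concatMap (λ ν → map (term ν) (SSYT ν lam)) (partitionsOf (sum lam))))
      (𝕊.trans (Σ-concatMap (λ f → f) (λ ν → map (term ν) (SSYT ν lam)) (partitionsOf (sum lam)))
      (Σ-cong (partitionsOf (sum lam)) (λ ν _ → 𝕊.trans (Σ-map (λ f → f) (term ν) (SSYT ν lam))
        (𝕊.trans (Σ-filter (term ν) (λ P → isSSYTᵇ P ∧ hasContentᵇ lam P) (fillings ν n))
        (𝕊.trans (Σ-cong (fillings ν n) (perFilling ν)) (𝕊.sym (Σ-filter (inner ν) isSSYTᵇ (fillings ν n))))))))
    same : Dec (sum lam ≡ sum α) → sumOver (sum lam) ≈ˢ sumOver (sum α)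
    same (yes e) = 𝕊.reflexive (cong sumOver e)
    same (no ne) = 𝕊.trans
      (Σ-0 (partitionsOf (sum lam)) (λ ν ν∈ → Σ-0 (tableaux ν n) (λ P _ → Σ-0 (SSYT ν α) (λ Q Q∈ → ⊥-elim (ne (size ν ν∈ Q∈))))))
      (𝕊.sym (Σ-0 (partitionsOf (sum α)) (λ ν ν∈ → Σ-0 (tableaux ν n) (λ P P∈ → Σ-0 (SSYT ν α) (λ Q Q∈ → 𝕊.reflexive (φ-no {lam} {rw P} (λ c → ne (size′ ν ν∈ P∈ c))))))))
      where
      size : ∀ ν {Q} → ν ∈ partitionsOf (sum lam) → Q ∈ SSYT ν α → sum lam ≡ sum α
      size ν {Q} ν∈ Q∈ with ∈-partitionsOf⁻ (sum lam) ν∈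
      ... | d , p , s with ∈-SSYT⁻ ν α d p Q∈
      ...   | _ , refl , a , c = trans (sym s) (trans (sym (length-concat Q)) (hasContent-length (content-hasContent {α} {concat Q} c (All.concat⁺ a))))
      size′ : ∀ ν {P} → ν ∈ partitionsOf (sum α) → P ∈ tableaux ν n → HasContent lam (rw P) → sum lam ≡ sum α
      size′ ν {P} ν∈ P∈ c with ∈-partitionsOf⁻ (sum α) ν∈
      ... | d , p , s with ∈-tableaux⁻ ν n d p P∈
      ...   | _ , refl , _ = trans (sym (hasContent-length (hasContent-cong {w = concat P} (λ c → count-rw c P) c))) (trans (length-concat P) s)

-- Partitions inside a given diagram, described by multiplicities.

module ContainedPartitions where
  open import Data.Nat
  open import Data.Nat.Properties
  open import Data.List using (List; []; _∷_; _++_; map; length; concatMap; replicate; reverse; upTo)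
  open import Data.List.Properties using (++-cancelˡ; ++-assoc; ++-identityʳ; length-++; length-replicate; reverse-++; reverse-involutive; unfold-reverse)
  open import Data.List.Membership.Propositional.Properties
  open import Data.List.Relation.Unary.All as All using (All; []; _∷_)
  open import Data.List.Relation.Unary.AllPairs using ([]; _∷_)
  open import Data.List.Relation.Unary.Linked using (Linked; []; [-]; _∷_)
  open import Data.List.Relation.Binary.Pointwise using (Pointwise; []; _∷_)
  open import Relation.Binary.PropositionalEquality
  open import Defs
  open ChargeRotation using (count-++; count-∷; δ-refl)
  open RowInsertion using (Decreasing; []; [-]; _∷_; decreasing-tail)
  open Enumerations
  open Biwords using (count-absent)
  open HallLittlewoodFunctionals

  -- ns lists the multiplicities of a partition whose diagram is contained in that of the
  -- partition with multiplicities ms; x counts the longer rows of the latter not yet used.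
  data Fits : List ℕ → ℕ → List ℕ → Set where
    []  : ∀ {x} → Fits [] x []
    fit : ∀ {m ms x n ns} y → n + y ≡ x + m → Fits ms y ns → Fits (m ∷ ms) x (n ∷ ns)

  tuples : List ℕ → ℕ → List (List ℕ)
  tuples [] x = [] ∷ []
  tuples (m ∷ ms) x = concatMap (λ n → map (n ∷_) (tuples ms (x + m ∸ n))) (upTo (suc (x + m)))

  ∈-tuples⁺ : ∀ {ms x ns} → Fits ms x ns → ns ∈ tuples ms x
  ∈-tuples⁺ [] = here refl
  ∈-tuples⁺ {m ∷ ms} {x} (fit {n = n} y e f) = ∈-concatMap⁺′ (λ n → map (n ∷_) (tuples ms (x + m ∸ n)))
    (∈-upTo⁺ (s≤s (subst (n ≤_) e (m≤m+n n y))))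
    (∈-map⁺ (n ∷_) (subst (λ y → _ ∈ tuples ms y) (trans (sym (m+n∸m≡n n y)) (cong (_∸ n) e)) (∈-tuples⁺ f)))

  ∈-tuples⁻ : ∀ ms x {ns} → ns ∈ tuples ms x → Fits ms x ns
  ∈-tuples⁻ [] x (here refl) = []
  ∈-tuples⁻ (m ∷ ms) x ns∈ with ∈-concatMap⁻′ (λ n → map (n ∷_) (tuples ms (x + m ∸ n))) (upTo (suc (x + m))) ns∈
  ... | n , n∈ , ns∈′ with ∈-map⁻ (n ∷_) ns∈′
  ...   | ns , ns∈″ , refl = fit (x + m ∸ n) (m+[n∸m]≡n (≤-pred (∈-upTo⁻ n∈))) (∈-tuples⁻ ms _ ns∈″)

  unique-tuples : ∀ ms x → Unique (tuples ms x)
  unique-tuples [] x = [] ∷ []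
  unique-tuples (m ∷ ms) x = unique-concatMap (λ n → map (n ∷_) (tuples ms (x + m ∸ n))) (upTo (suc (x + m))) (Unique.upTo⁺ (suc (x + m)))
    (λ n _ → unique-map-∷ n (unique-tuples ms _)) (λ _ _ → same-head)

  ∈-boxed⁺ : ∀ {b s} → Pointwise _≤_ b s → b ∈ boxed s
  ∈-boxed⁺ [] = here refl
  ∈-boxed⁺ {s = a ∷ s} (p ∷ ps) = ∈-concatMap⁺′ (λ b → map (b ∷_) (boxed s)) (∈-upTo⁺ (s≤s p)) (∈-map⁺ _ (∈-boxed⁺ ps))

  ∈-boxed⁻ : ∀ s {b} → b ∈ boxed s → Pointwise _≤_ b s
  ∈-boxed⁻ [] (here refl) = []
  ∈-boxed⁻ (a ∷ s) b∈ with ∈-concatMap⁻′ (λ b → map (b ∷_) (boxed s)) (upTo (suc a)) b∈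
  ... | n , n∈ , b∈′ with ∈-map⁻ (n ∷_) b∈′
  ...   | b , b∈″ , refl = ≤-pred (∈-upTo⁻ n∈) ∷ ∈-boxed⁻ s b∈″

  unique-boxed : ∀ s → Unique (boxed s)
  unique-boxed [] = [] ∷ []
  unique-boxed (a ∷ s) = unique-concatMap (λ b → map (b ∷_) (boxed s)) (upTo (suc a)) (Unique.upTo⁺ (suc a))
    (λ n _ → unique-map-∷ n (unique-boxed s)) (λ _ _ → same-head)

  -- `boxed` yields lists of the same length as λ, so a partition with fewer parts appears there
  -- with zeros at the end.
  pad : List ℕ → ℕ → List ℕ
  pad p k = p ++ replicate k 0

  pointwise-refl : ∀ s → Pointwise _≤_ s s
  pointwise-refl s = Pw.refl ≤-refl

  replicate-++ : ∀ {a b} (z : ℕ) {s} → replicate (a + b) z ++ s ≡ replicate a z ++ replicate b z ++ s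
  replicate-++ {zero} z = refl
  replicate-++ {suc a} z = cong (z ∷_) (replicate-++ {a} z)

  replicate-mono : ∀ k {a b s} → a ≤ b → Pointwise _≤_ (replicate k a ++ s) (replicate k b ++ s)
  replicate-mono zero le = pointwise-refl _
  replicate-mono (suc k) le = le ∷ replicate-mono k le

  fits-length : ∀ {ms x ns} → Fits ms x ns → length ns ≡ length ms
  fits-length [] = refl
  fits-length (fit _ _ f) = cong suc (fits-length f)

  -- Of the x + m rows available for the current size, the first n receive parts of that size, and
  -- the y others are passed on to smaller parts.
  fits-⊆ : ∀ {ms x ns} → Fits ms x ns → ∃ λ k → Pointwise _≤_ (pad (rowsOf ns) k) (replicate x (length ms) ++ rowsOf ms)
  fits-⊆ {x = x} [] = x , subst (Pointwise _≤_ (replicate x 0)) (sym (++-identityʳ (replicate x 0))) (pointwise-refl _)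
  fits-⊆ {m ∷ ms} {x} {n ∷ ns} (fit y e f) with fits-⊆ f
  ... | k , p = k , subst₂ (Pointwise _≤_) (sym (++-assoc (replicate n (suc (length ns))) (rowsOf ns) (replicate k 0))) regroup
          (Pw.++⁺ (pointwise-refl (replicate n (suc (length ns)))) (Pw.transitive ≤-trans p (replicate-mono y (n≤1+n _))))
    where
    regroup : replicate n (suc (length ns)) ++ replicate y (suc (length ms)) ++ rowsOf ms ≡ replicate x (suc (length ms)) ++ rowsOf (m ∷ ms)
    regroup = trans (cong (λ l → replicate n (suc l) ++ replicate y (suc (length ms)) ++ rowsOf ms) (fits-length f))
      (trans (sym (replicate-++ {n} {y} _)) (trans (cong (λ k → replicate k (suc (length ms)) ++ rowsOf ms) e) (replicate-++ {x} {m} _)))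

  decreasing-∷ : ∀ {a s} → All (_≤ a) s → Decreasing s → Decreasing (a ∷ s)
  decreasing-∷ [] [] = [-]
  decreasing-∷ (p ∷ _) d@([-]) = p ∷ d
  decreasing-∷ (p ∷ _) d@(_ ∷ _) = p ∷ d

  pad-decreasing : ∀ ns k → Decreasing (pad (rowsOf ns) k)
  pad-decreasing [] zero = []
  pad-decreasing [] (suc k) = decreasing-∷ (All.replicate⁺ k z≤n) (pad-decreasing [] k)
  pad-decreasing (n ∷ ns) k = subst Decreasing (sym (++-assoc (replicate n r) (rowsOf ns) (replicate k 0))) (go n)
    where
    r = suc (length ns)
    small : All (_≤ r) (pad (rowsOf ns) k)
    small = All.++⁺ (All.map m≤n⇒m≤1+n (rowsOf-≤ ns)) (All.replicate⁺ k z≤n)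
    go : ∀ n → Decreasing (replicate n r ++ pad (rowsOf ns) k)
    go zero = pad-decreasing ns k
    go (suc n) = decreasing-∷ (All.++⁺ (All.replicate⁺ n ≤-refl) small) (go n)

  decreasing-≤ : ∀ {a s} → Decreasing (a ∷ s) → All (_≤ a) s
  decreasing-≤ [-] = []
  decreasing-≤ (p ∷ d) = p ∷ All.map (λ q → ≤-trans q p) (decreasing-≤ d)

  split-top : ∀ M r {s b} → Decreasing b → Pointwise _≤_ b (replicate M (suc r) ++ s) →
    ∃₂ λ n y → ∃ λ b′ → n + y ≡ M × b ≡ replicate n (suc r) ++ b′ × Decreasing b′ × Pointwise _≤_ b′ (replicate y r ++ s)
  split-top zero r {b = b} d p = 0 , 0 , b , refl , refl , d , p
  split-top (suc M) r {s} {a ∷ b} d (p ∷ ps) with m≤n⇒m<n∨m≡n p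
  ... | inj₁ (s≤s a≤r) = 0 , suc M , a ∷ b , refl , refl , d , a≤r ∷ lower M ps (All.map (λ q → ≤-trans q a≤r) (decreasing-≤ d))
    where
    lower : ∀ M {b} → Pointwise _≤_ b (replicate M (suc r) ++ s) → All (_≤ r) b → Pointwise _≤_ b (replicate M r ++ s)
    lower zero p _ = p
    lower (suc M) (_ ∷ ps) (q ∷ qs) = q ∷ lower M ps qs
  ... | inj₂ refl with split-top M r (decreasing-tail d) ps
  ...   | n , y , b′ , e , refl , d′ , p′ = suc n , y , b′ , cong suc e , refl , d′ , p′

  ⊆-fits : ∀ ms x {b} → Decreasing b → Pointwise _≤_ b (replicate x (length ms) ++ rowsOf ms) → ∃₂ λ ns k → Fits ms x ns × b ≡ pad (rowsOf ns) k
  ⊆-fits [] x d p = [] , x , [] , zeros x p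
    where
    zeros : ∀ x {b} → Pointwise _≤_ b (replicate x 0 ++ []) → b ≡ replicate x 0
    zeros zero [] = refl
    zeros (suc x) (z≤n ∷ ps) = cong (0 ∷_) (zeros x ps)
  ⊆-fits (m ∷ ms) x {b} d p with split-top (x + m) (length ms) d (subst (Pointwise _≤_ b) (sym (replicate-++ {x} {m} _)) p)
  ... | n , y , b′ , e , refl , d′ , p′ with ⊆-fits ms y d′ p′
  ...   | ns , k , f , refl = n ∷ ns , k , fit y e f ,
          trans (cong (λ l → replicate n (suc l) ++ pad (rowsOf ns) k) (sym (fits-length f))) (sym (++-assoc (replicate n (suc (length ns))) (rowsOf ns) (replicate k 0)))

  count-rowsOf : ∀ n ns → count (suc (length ns)) (rowsOf (n ∷ ns)) ≡ n
  count-rowsOf n ns = trans (count-++ r (replicate n r) (rowsOf ns))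
    (trans (cong₂ _+_ (all n) (count-absent r (rowsOf ns) (All.map (λ le e → <-irrefl (sym e) (s≤s le)) (rowsOf-≤ ns)))) (+-identityʳ n))
    where
    r = suc (length ns)
    all : ∀ n → count r (replicate n r) ≡ n
    all zero = refl
    all (suc n) = trans (count-∷ r r (replicate n r)) (cong₂ _+_ (δ-refl r) (all n))

  pad-injective : ∀ ns ns′ {k k′} → length ns ≡ length ns′ → pad (rowsOf ns) k ≡ pad (rowsOf ns′) k′ → ns ≡ ns′
  pad-injective [] [] _ _ = refl
  pad-injective (n ∷ ns) (n′ ∷ ns′) {k} {k′} l e with head≡
    where
    total : ∀ n ns k → count (suc (length ns)) (pad (rowsOf (n ∷ ns)) k) ≡ n
    total n ns k = trans (count-++ (suc (length ns)) (rowsOf (n ∷ ns)) (replicate k 0)) (trans (cong₂ _+_ (count-rowsOf n ns)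
      (count-absent (suc (length ns)) (replicate k 0) (All.replicate⁺ k (λ ())))) (+-identityʳ n))
    head≡ : n ≡ n′
    head≡ = trans (sym (total n ns k)) (trans (cong (count (suc (length ns))) e) (trans (cong (λ r → count r (pad (rowsOf (n′ ∷ ns′)) k′)) l) (total n′ ns′ k′)))
  ... | refl = cong (n ∷_) (pad-injective ns ns′ (suc-injective l) (++-cancelˡ (replicate n (suc (length ns))) _ _
        (trans (sym (++-assoc (replicate n (suc (length ns))) (rowsOf ns) (replicate k 0))) (trans e (trans (++-assoc (replicate n (suc (length ns′))) (rowsOf ns′) (replicate k′ 0))
          (cong (λ r → replicate n r ++ pad (rowsOf ns′) k′) (sym l)))))))

  -- The local function of stripZeros, composed with reverse, as the solution of a metavariable.
  mutual
    dropZeros : List ℕ → List ℕ → List ℕ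
    dropZeros = _

    stripZeros-def : ∀ xs → stripZeros xs ≡ dropZeros xs (reverse xs)
    stripZeros-def xs with reverse xs
    ... | ys = refl

  reverse-replicate : ∀ k (x : ℕ) → reverse (replicate k x) ≡ replicate k x
  reverse-replicate zero x = refl
  reverse-replicate (suc k) x = trans (unfold-reverse x (replicate k x)) (trans (cong (_++ x ∷ []) (reverse-replicate k x)) (snoc k))
    where
    snoc : ∀ k → replicate k x ++ x ∷ [] ≡ x ∷ replicate k x
    snoc zero = refl
    snoc (suc k) = cong (x ∷_) (snoc k)

  stripZeros-pad : ∀ {p} k → All (0 <_) p → stripZeros (pad p k) ≡ p
  stripZeros-pad {p} k pos = begin
    stripZeros (pad p k)                              ≡⟨ stripZeros-def (pad p k) ⟩
    dropZeros (pad p k) (reverse (pad p k))           ≡⟨ cong (dropZeros (pad p k)) (trans (reverse-++ p (replicate k 0)) (cong (_++ reverse p) (reverse-replicate k 0))) ⟩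
    dropZeros (pad p k) (replicate k 0 ++ reverse p)  ≡⟨ zeros (pad p k) k (reverse p) ⟩
    dropZeros (pad p k) (reverse p)                   ≡⟨ stop (pad p k) (reverse p) (All.tabulate (λ x∈ → All.lookup pos (Any.reverse⁻ x∈))) ⟩
    reverse (reverse p)                               ≡⟨ reverse-involutive p ⟩
    p                                                 ∎
    where
    open ≡-Reasoning
    zeros : ∀ xs k ys → dropZeros xs (replicate k 0 ++ ys) ≡ dropZeros xs ys
    zeros xs zero ys = refl
    zeros xs (suc k) ys = zeros xs k ys
    stop : ∀ xs ys → All (0 <_) ys → dropZeros xs ys ≡ reverse ys
    stop xs [] [] = refl
    stop xs (suc _ ∷ ys) (s≤s _ ∷ _) = refl

  rowsOf-zeros : ∀ k ms → rowsOf (replicate k 0 ++ ms) ≡ rowsOf ms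
  rowsOf-zeros zero ms = refl
  rowsOf-zeros (suc k) ms = rowsOf-zeros k ms

  -- The list of multiplicities is required to end at the largest part, so that its indices are
  -- exactly the columns of the diagram.
  multiplicities : ∀ {lam} → IsPartition lam → ∃ λ ms → lam ≡ rowsOf ms × at lam 1 ≡ length ms
  multiplicities {[]} _ = [] , refl , refl
  multiplicities {a ∷ lam} (l , pos ∷ ps) with multiplicities {lam} (tail l , ps)
    where
    tail : ∀ {a s} → Linked _≥_ (a ∷ s) → Linked _≥_ s
    tail [-] = []
    tail (_ ∷ l) = l
  ... | ms , refl , e with m≤n⇒m<n∨m≡n (subst (_≤ a) e (first l))
    where
    first : ∀ {a s} → Linked _≥_ (a ∷ s) → at s 1 ≤ a
    first [-] = z≤n
    first (p ∷ _) = p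
  -- The new part exceeds the previous largest one; the sizes between them have multiplicity 0.
  ...   | inj₁ (s≤s {n = a′} lt) = 1 ∷ replicate (a′ ∸ length ms) 0 ++ ms , cong₂ _∷_ (sym len) (sym (rowsOf-zeros (a′ ∸ length ms) ms)) , sym len
    where
    len : suc (length (replicate (a′ ∸ length ms) 0 ++ ms)) ≡ suc a′
    len = cong suc (trans (length-++ (replicate (a′ ∸ length ms) 0)) (trans (cong (_+ length ms) (length-replicate (a′ ∸ length ms))) (m∸n+n≡m lt)))
  multiplicities {a ∷ lam} (l , pos ∷ ps) | m ∷ ms , refl , e | inj₂ refl = suc m ∷ ms , refl , refl
  multiplicities {a ∷ lam} (l , () ∷ ps) | [] , refl , e | inj₂ refl

-- The weights of the inverse sum are the ℵ(λ/μ).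

module AlephWeights where
  open import Data.Bool using (T?)
  open import Data.Nat as ℕ using (ℕ; zero; suc; _≤_; _<_; _≥_; s≤s; _∸_; _≤ᵇ_)
  open import Data.Nat.Properties as ℕ using ()
  open import Data.Nat.DivMod using (_/_; m*n/n≡m)
  open import Data.Nat.ListAction using (sum)
  open import Data.Nat.ListAction.Properties using (sum-++)
  open import Data.List using (List; []; _∷_; _++_; map; length; concatMap; foldr; replicate; upTo; filterᵇ)
  open import Data.List.Properties using (map-++; map-∘; map-cong; map-cong-local; map-applyUpTo; upTo-∷ʳ; concatMap-++; filter-none; filter-all; filter-++; length-++; length-replicate; ++-identityʳ)
  open import Data.List.Relation.Unary.All as All using (All; []; _∷_)
  open import Data.List.Relation.Unary.Linked using (Linked; []; [-]; _∷_)
  open import Data.Vec using ([]; _∷_)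
  open import Relation.Binary.PropositionalEquality as ≡ using (_≡_; cong; cong₂)
  open import Defs
  open RingNormalisation
  open Convolutions
  open VertexOperators
  open GaussianStrips
  open HallLittlewoodFunctionals
  open SumsOverLists
  open Enumerations
  open Biwords using (count-absent)
  open PlacticCauchy using (range1-suc)
  open ChargeRotation using (count-++)
  open ContainedPartitions

  height : List ℕ → ℕ → ℕ
  height lam j = length (filterᵇ (j ≤ᵇ_) lam)

  height-none : ∀ {lam j} → All (_< j) lam → height lam j ≡ 0
  height-none {lam} {j} p = cong length (filter-none (λ x → T? (j ≤ᵇ x)) (All.map (λ lt le → ℕ.<⇒≱ lt (ℕ.≤ᵇ⇒≤ j _ le)) p))

  height-all : ∀ {lam j} → All (j ≤_) lam → height lam j ≡ length lam
  height-all {lam} {j} p = cong length (filter-all (λ x → T? (j ≤ᵇ x)) (All.map ℕ.≤⇒≤ᵇ p))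

  height-++ : ∀ a b j → height (a ++ b) j ≡ height a j ℕ.+ height b j
  height-++ a b j = ≡.trans (cong length (filter-++ (λ x → T? (j ≤ᵇ x)) a b)) (length-++ (filterᵇ (j ≤ᵇ_) a))

  linked-≤-at : ∀ {lam} → Linked _≥_ lam → All (_≤ at lam 1) lam
  linked-≤-at [] = []
  linked-≤-at [-] = ℕ.≤-refl ∷ []
  linked-≤-at (p ∷ l) = ℕ.≤-refl ∷ All.map (λ q → ℕ.≤-trans q p) (linked-≤-at l)

  at-map-range1 : ∀ (f : ℕ → ℕ) N j → j < N → at (map f (range1 N)) (suc j) ≡ f (suc j)
  at-map-range1 f (suc N) zero _ = ≡.refl
  at-map-range1 f (suc N) (suc j) (s≤s lt) = ≡.trans (cong (λ xs → at (map f xs) (suc (suc j))) (range1-suc N))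
    (≡.trans (cong (λ xs → at xs (suc j)) (≡.sym (map-∘ (range1 N)))) (at-map-range1 (λ i → f (suc i)) N j lt))

  at-map-range1-≥ : ∀ (f : ℕ → ℕ) N j → N ≤ j → at (map f (range1 N)) (suc j) ≡ 0
  at-map-range1-≥ f zero j _ = ≡.refl
  at-map-range1-≥ f (suc N) (suc j) (s≤s le) = ≡.trans (cong (λ xs → at (map f xs) (suc (suc j))) (range1-suc N))
    (≡.trans (cong (λ xs → at xs (suc j)) (≡.sym (map-∘ (range1 N)))) (at-map-range1-≥ (λ i → f (suc i)) N j le))

  at-conj : ∀ {lam} → Linked _≥_ lam → ∀ j → at (conj lam) (suc j) ≡ height lam (suc j)
  at-conj {lam} l j with ℕ.<-≤-connex j (at lam 1)
  ... | inj₁ lt = at-map-range1 (height lam) (at lam 1) j lt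
  ... | inj₂ le = ≡.trans (at-map-range1-≥ (height lam) (at lam 1) j le) (≡.sym (height-none (All.map (λ q → s≤s (ℕ.≤-trans q le)) (linked-≤-at l))))

  height-top : ∀ m ms → height (rowsOf (m ∷ ms)) (suc (length ms)) ≡ m
  height-top m ms = ≡.trans (height-++ (replicate m r) (rowsOf ms) r)
    (≡.trans (cong₂ ℕ._+_ (≡.trans (height-all (All.replicate⁺ m ℕ.≤-refl)) (length-replicate m)) (height-none (All.map s≤s (rowsOf-≤ ms)))) (ℕ.+-identityʳ m))
    where r = suc (length ms)

  height-low : ∀ m ms {j} → j ≤ length ms → height (rowsOf (m ∷ ms)) j ≡ m ℕ.+ height (rowsOf ms) j
  height-low m ms {j} le = ≡.trans (height-++ (replicate m (suc (length ms))) (rowsOf ms) j)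
    (cong (ℕ._+ height (rowsOf ms) j) (≡.trans (height-all (All.replicate⁺ m (ℕ.m≤n⇒m≤1+n le))) (length-replicate m)))

  range1-snoc : ∀ n → range1 (suc n) ≡ range1 n ++ suc n ∷ []
  range1-snoc n = ≡.trans (cong (map suc) (≡.sym (upTo-∷ʳ n))) (map-++ suc (upTo n) (n ∷ []))

  range1-≤ : ∀ n → All (λ i → 1 ≤ i × i ≤ n) (range1 n)
  range1-≤ n = All.tabulate ∈-range1⁻

  tri# : ℕ → ℕ
  tri# d = (d ℕ.* (d ∸ 1)) / 2

  tri#-suc : ∀ d → tri# (suc d) ≡ d ℕ.+ tri# d
  tri#-suc d = ≡.trans (closed (suc d)) (cong (d ℕ.+_) (≡.sym (closed d)))
    where
    triangle : ℕ → ℕ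
    triangle zero = 0
    triangle (suc d) = d ℕ.+ triangle d
    double : ∀ d → triangle d ℕ.* 2 ≡ d ℕ.* (d ∸ 1)
    double zero = ≡.refl
    double (suc zero) = ≡.refl
    double (suc (suc d)) = ≡.trans (ℕ.*-distribʳ-+ 2 (suc d) (triangle (suc d))) (≡.trans (cong (suc d ℕ.* 2 ℕ.+_) (double (suc d))) (lemma d))
      where
      open import Data.Nat.Tactic.RingSolver using (solve-∀)
      lemma : ∀ d → suc d ℕ.* 2 ℕ.+ suc d ℕ.* d ≡ suc (suc d) ℕ.* suc d
      lemma = solve-∀
    closed : ∀ d → tri# d ≡ triangle d
    closed d = ≡.trans (cong (_/ 2) (≡.sym (double d))) (m*n/n≡m (triangle d) 2)

  -- `c` and `c′` count the parts of λ and μ that are larger than all sizes listed; they add to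
  -- every column considered.
  skew : ℕ → ℕ → List ℕ → List ℕ → ℕ
  skew c c′ ms ns = sum (map (λ i → tri# ((c ℕ.+ height (rowsOf ms) i) ∸ (c′ ℕ.+ height (rowsOf ns) i))) (range1 (length ms)))

  fits-skew : ∀ {ms x ns} → Fits ms x ns → ℕ
  fits-skew [] = 0
  fits-skew (fit y _ f) = tri# y ℕ.+ fits-skew f

  -- The column of the largest listed size has difference y. For the columns before it, the m and n
  -- parts of that size move into the offsets, whose difference thereby becomes y.
  skew-fits : ∀ {ms x ns} (f : Fits ms x ns) c′ → skew (c′ ℕ.+ x) c′ ms ns ≡ fits-skew f
  skew-fits [] c′ = ≡.refl
  skew-fits {m ∷ ms} {x} {n ∷ ns} (fit y e f) c′ = begin
    sum (map F (range1 (suc (length ms))))               ≡⟨ cong (λ xs → sum (map F xs)) (range1-snoc (length ms)) ⟩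
    sum (map F (range1 (length ms) ++ r ∷ []))           ≡⟨ cong sum (map-++ F (range1 (length ms)) (r ∷ [])) ⟩
    sum (map F (range1 (length ms)) ++ F r ∷ [])         ≡⟨ sum-++ (map F (range1 (length ms))) (F r ∷ []) ⟩
    sum (map F (range1 (length ms))) ℕ.+ (F r ℕ.+ 0)     ≡⟨ cong₂ ℕ._+_ low (≡.trans (ℕ.+-identityʳ (F r)) top) ⟩
    fits-skew f ℕ.+ tri# y                               ≡⟨ ℕ.+-comm (fits-skew f) (tri# y) ⟩
    tri# y ℕ.+ fits-skew f                               ∎
    where
    open ≡.≡-Reasoning
    r = suc (length ms)
    F : ℕ → ℕ
    F i = tri# ((c′ ℕ.+ x ℕ.+ height (rowsOf (m ∷ ms)) i) ∸ (c′ ℕ.+ height (rowsOf (n ∷ ns)) i))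
    len = fits-length f
    offset : c′ ℕ.+ x ℕ.+ m ≡ c′ ℕ.+ n ℕ.+ y
    offset = ≡.trans (ℕ.+-assoc c′ x m) (≡.trans (cong (c′ ℕ.+_) (≡.sym e)) (≡.sym (ℕ.+-assoc c′ n y)))
    top : F r ≡ tri# y
    top = cong tri# (≡.trans (cong₂ _∸_ (≡.trans (cong (c′ ℕ.+ x ℕ.+_) (height-top m ms)) offset)
        (cong (c′ ℕ.+_) (≡.trans (cong (λ l → height (rowsOf (n ∷ ns)) (suc l)) (≡.sym len)) (height-top n ns)))) (ℕ.m+n∸m≡n (c′ ℕ.+ n) y))
    low : sum (map F (range1 (length ms))) ≡ fits-skew f
    low = ≡.trans (cong sum (map-cong-local (All.map (λ {i} (_ , i≤) → cong tri# (cong₂ _∸_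
        (≡.trans (cong (c′ ℕ.+ x ℕ.+_) (height-low m ms i≤)) (≡.trans (≡.sym (ℕ.+-assoc (c′ ℕ.+ x) m _)) (cong (ℕ._+ height (rowsOf ms) i) offset)))
        (≡.trans (cong (c′ ℕ.+_) (height-low n ns (≡.subst (i ≤_) (≡.sym len) i≤))) (≡.sym (ℕ.+-assoc c′ n _))))) (range1-≤ (length ms)))))
      (skew-fits f (c′ ℕ.+ n))

  nSkew-fits : ∀ {ms ns} (f : Fits ms 0 ns) → at (rowsOf ms) 1 ≡ length ms → nSkew (rowsOf ms) (rowsOf ns) ≡ fits-skew f
  nSkew-fits {ms} {ns} f e = ≡.trans (cong sum (≡.trans
      (map-cong-local (All.map (λ { {suc i} (_ , _) → cong₂ (λ a b → tri# (a ∸ b)) (at-conj (proj₁ (rowsOf-part ms)) i) (at-conj (proj₁ (rowsOf-part ns)) i) }) (range1-≤ (at (rowsOf ms) 1))))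
      (cong (λ N → map (λ i → tri# (height (rowsOf ms) i ∸ height (rowsOf ns) i)) (range1 N)) e))) (skew-fits f 0)

  indexed : ∀ {X : Set} → (ℕ → ℕ → X) → ℕ → List ℕ → List X
  indexed g k [] = []
  indexed g k (p ∷ μ) = g p k ∷ indexed g (suc k) μ

  indexed-++ : ∀ {X : Set} (g : ℕ → ℕ → X) k μ ν → indexed g k (μ ++ ν) ≡ indexed g k μ ++ indexed g (k ℕ.+ length μ) ν
  indexed-++ g k [] ν = cong (λ k → indexed g k ν) (≡.sym (ℕ.+-identityʳ k))
  indexed-++ g k (p ∷ μ) ν = cong (g p k ∷_) (≡.trans (indexed-++ g (suc k) μ ν) (cong (λ j → indexed g (suc k) μ ++ indexed g j ν) (≡.sym (ℕ.+-suc k (length μ)))))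

  map-at : ∀ {X : Set} (g : ℕ → ℕ → X) k μ → map (λ j → g (at μ (suc j)) (k ℕ.+ j)) (upTo (length μ)) ≡ indexed g k μ
  map-at g k [] = ≡.refl
  map-at g k (p ∷ μ) = cong₂ _∷_ (cong (g p) (ℕ.+-identityʳ k)) (≡.trans (cong (map (λ j → g (at (p ∷ μ) (suc j)) (k ℕ.+ j))) (≡.sym (map-applyUpTo (λ x → x) suc (length μ))))
    (≡.trans (≡.sym (map-∘ (upTo (length μ)))) (≡.trans (map-cong (λ j → cong (g (at μ (suc j))) (ℕ.+-suc k j)) (upTo (length μ))) (map-at g (suc k) μ))))

  map-at-range1 : ∀ {X : Set} (g : ℕ → ℕ → X) μ → map (λ i → g (at μ i) (i ∸ 1)) (range1 (length μ)) ≡ indexed g 0 μ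
  map-at-range1 g μ = ≡.trans (≡.sym (map-∘ (upTo (length μ)))) (map-at g 0 μ)

  module Weights (𝓚 : CommutativeRing 0ℓ 0ℓ) (t : CommutativeRing.Carrier 𝓚) where
    open CommutativeRing 𝓚 renaming (Carrier to A; sym to ≈-sym) hiding (zero)
    open FiniteSums ring
    open CommutativeRingSolver 𝓚
    open Operators 𝓚 t using (pow)
    open VerticalStrips 𝓚 t using (gb; tri; asum)
    open SumOver 𝓚
    open SetoidReasoning setoid

    prod : List A → A
    prod = foldr _*_ 1#

    prod-++ : ∀ xs ys → prod (xs ++ ys) ≈ prod xs * prod ys
    prod-++ [] ys = ≈-sym (*-identityˡ _)
    prod-++ (x ∷ xs) ys = trans (*-congˡ (prod-++ xs ys)) (≈-sym (*-assoc _ _ _))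

    pow-+ : ∀ i j → pow (i ℕ.+ j) ≈ pow i * pow j
    pow-+ zero j = ≈-sym (*-identityˡ _)
    pow-+ (suc i) j = trans (*-congˡ (pow-+ i j)) (≈-sym (*-assoc _ _ _))

    conv-Σ : ∀ (F : ℕ → ℕ → A) s → conv F s ≈ Σ (λ i → F i (s ∸ i)) (upTo (suc s))
    conv-Σ F zero = ≈-sym (+-identityʳ _)
    conv-Σ F (suc s) = +-congˡ (trans (conv-Σ (λ i → F (suc i)) s)
      (trans (≈-sym (Σ-map (λ i → F i (suc s ∸ i)) suc (upTo (suc s)))) (reflexive (cong (Σ (λ i → F i (suc s ∸ i))) (map-applyUpTo (λ x → x) suc (suc s))))))

    weight : List ℕ → ℕ → List ℕ → A
    weight (m ∷ ms) x (n ∷ ns) = tri (x ℕ.+ m ∸ n) * gb n (x ℕ.+ m ∸ n) * weight ms (x ℕ.+ m ∸ n) ns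
    weight _ x _ = 1#

    asum-Σ : ∀ ms x g → asum ms x g ≈ Σ (λ ns → weight ms x ns * g ns) (tuples ms x)
    asum-Σ [] x g = trans (≈-sym (*-identityˡ _)) (≈-sym (+-identityʳ _))
    asum-Σ (m ∷ ms) x g = trans (conv-Σ _ (x ℕ.+ m)) (≈-sym (trans
      (Σ-concatMap (λ ns → weight (m ∷ ms) x ns * g ns) (λ n → map (n ∷_) (tuples ms (x ℕ.+ m ∸ n))) (upTo (suc (x ℕ.+ m))))
      (Σ-cong (upTo (suc (x ℕ.+ m))) (λ n _ → trans (Σ-map (λ ns → weight (m ∷ ms) x ns * g ns) (n ∷_) (tuples ms (x ℕ.+ m ∸ n)))
        (trans (Σ-cong (tuples ms (x ℕ.+ m ∸ n)) (λ ns _ → *-assoc _ _ _))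
        (trans (Σ-*ˡ (tri (x ℕ.+ m ∸ n) * gb n (x ℕ.+ m ∸ n)) (λ ns → weight ms (x ℕ.+ m ∸ n) ns * g (n ∷ ns)) (tuples ms (x ℕ.+ m ∸ n)))
          (*-congˡ (≈-sym (asum-Σ ms (x ℕ.+ m ∸ n) (λ ns → g (n ∷ ns)))))))))))
      where
      Σ-*ˡ : ∀ {X : Set} c (f : X → A) xs → Σ (λ x → c * f x) xs ≈ c * Σ f xs
      Σ-*ˡ c f [] = ≈-sym (zeroʳ c)
      Σ-*ˡ c f (x ∷ xs) = trans (+-congˡ (Σ-*ˡ c f xs)) (≈-sym (distribˡ _ _ _))

    fits-weight : ∀ {ms x ns} → Fits ms x ns → A
    fits-weight [] = 1#
    fits-weight (fit {n = n} y _ f) = tri y * gb n y * fits-weight f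

    weight-fits : ∀ {ms x ns} (f : Fits ms x ns) → weight ms x ns ≈ fits-weight f
    weight-fits [] = refl
    weight-fits {m ∷ ms} {x} (fit {n = n} {ns} y e f) with ≡.trans (≡.sym (ℕ.m+n∸m≡n n y)) (cong (_∸ n) e)
    ... | ≡.refl = *-congˡ (weight-fits f)

    -- `tp e`, `om e` and `inv j` stand for t^e, 1 - t^e and 1/(1 - t^(j+1)), in the form in which
    -- the definition of ℵ contains them.
    module Matching (tp om inv : ℕ → A) (tp-pow : ∀ e → tp e ≈ pow e) (om-pow : ∀ e → om e ≈ 1# - pow e) (inv-om : ∀ j → om (suc j) * inv j ≈ 1#) where

      -- The product of 1 - t^(y+j) over 1 ≤ j ≤ n: the numerator of the Gaussian binomial
      -- coefficient [n+y choose n], whose denominator is `D n 0`.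
      D : ℕ → ℕ → A
      D zero y = 1#
      D (suc n) y = om (suc n ℕ.+ y) * D n y

      D-first : ∀ n y → D (suc n) y ≈ om (suc y) * D n (suc y)
      D-first zero y = refl
      D-first (suc n) y = begin
        om (suc (suc n) ℕ.+ y) * D (suc n) y                  ≈⟨ *-congˡ (D-first n y) ⟩
        om (suc (suc n) ℕ.+ y) * (om (suc y) * D n (suc y))   ≈⟨ solve (om (suc (suc n) ℕ.+ y) ∷ om (suc y) ∷ D n (suc y) ∷ []) (v0 :* (v1 :* v2)) (v1 :* (v0 :* v2)) ≡.refl ⟩
        om (suc y) * (om (suc (suc n) ℕ.+ y) * D n (suc y))   ≈⟨ *-congˡ (*-congʳ (reflexive (cong (λ z → om (suc z)) (≡.sym (ℕ.+-suc n y))))) ⟩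
        om (suc y) * D (suc n) (suc y)                        ∎

      -- The product formula for Gaussian binomial coefficients with the denominator cleared.
      -- Pascal's rule becomes (1 - p) + p (1 - q) = 1 - p q.
      gb-D : ∀ n y → gb n y * D n 0 ≈ D n y
      gb-D zero y = *-identityˡ _
      gb-D (suc a) zero = *-identityˡ _
      gb-D (suc a) (suc b) = begin
        (gb a (suc b) + p * gb (suc a) b) * (om (suc a ℕ.+ 0) * D a 0)
          ≈⟨ solve (gb a (suc b) ∷ p ∷ gb (suc a) b ∷ om (suc a ℕ.+ 0) ∷ D a 0 ∷ [])
               ((v0 :+ v1 :* v2) :* (v3 :* v4)) (v3 :* (v0 :* v4) :+ v1 :* (v2 :* (v3 :* v4))) ≡.refl ⟩
        om (suc a ℕ.+ 0) * (gb a (suc b) * D a 0) + p * (gb (suc a) b * D (suc a) 0)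
          ≈⟨ +-cong (*-cong (trans (reflexive (cong om (ℕ.+-identityʳ (suc a)))) (om-pow (suc a))) (gb-D a (suc b)))
               (*-congˡ (trans (gb-D (suc a) b) (trans (D-first a b) (*-congʳ (om-pow (suc b)))))) ⟩
        (1# - p) * D a (suc b) + p * ((1# - q) * D a (suc b))
          ≈⟨ solve (p ∷ q ∷ D a (suc b) ∷ []) ((:1 :- v0) :* v2 :+ v0 :* ((:1 :- v1) :* v2)) ((:1 :- v0 :* v1) :* v2) ≡.refl ⟩
        (1# - p * q) * D a (suc b)
          ≈⟨ *-congʳ (trans (+-congˡ (-‿cong (≈-sym (pow-+ (suc a) (suc b))))) (≈-sym (om-pow (suc a ℕ.+ suc b)))) ⟩
        om (suc a ℕ.+ suc b) * D a (suc b) ∎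
        where
        p = pow (suc a)
        q = pow (suc b)

      E : ℕ → A
      E n = prod (map inv (upTo n))

      E-suc : ∀ n → E (suc n) ≈ E n * inv n
      E-suc n = trans (reflexive (cong (λ xs → prod (map inv xs)) (≡.sym (upTo-∷ʳ n))))
        (trans (reflexive (cong prod (map-++ inv (upTo n) (n ∷ [])))) (trans (prod-++ (map inv (upTo n)) (inv n ∷ [])) (*-congˡ (*-identityʳ _))))

      E-D : ∀ n → E n * D n 0 ≈ 1#
      E-D zero = *-identityˡ _
      E-D (suc n) = begin
        E (suc n) * (om (suc n ℕ.+ 0) * D n 0) ≈⟨ *-cong (E-suc n) (*-congʳ (reflexive (cong om (ℕ.+-identityʳ (suc n))))) ⟩
        E n * inv n * (om (suc n) * D n 0) ≈⟨ solve (E n ∷ inv n ∷ om (suc n) ∷ D n 0 ∷ []) (v0 :* v1 :* (v2 :* v3)) ((v2 :* v1) :* (v0 :* v3)) ≡.refl ⟩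
        (om (suc n) * inv n) * (E n * D n 0) ≈⟨ *-cong (inv-om n) (E-D n) ⟩
        1# * 1# ≈⟨ *-identityˡ _ ⟩
        1# ∎

      E-gb : ∀ n y → E n * D n y ≈ gb n y
      E-gb n y = begin
        E n * D n y               ≈⟨ *-congˡ (≈-sym (gb-D n y)) ⟩
        E n * (gb n y * D n 0)    ≈⟨ solve (E n ∷ gb n y ∷ D n 0 ∷ []) (v0 :* (v1 :* v2)) (v1 :* (v0 :* v2)) ≡.refl ⟩
        gb n y * (E n * D n 0)    ≈⟨ trans (*-congˡ (E-D n)) (*-identityʳ _) ⟩
        gb n y                    ∎

      invB : List ℕ → ℕ → A
      invB μ N = prod (concatMap (λ i → map inv (upTo (count i μ))) (range1 N))

      invB-suc : ∀ μ N → invB μ (suc N) ≈ invB μ N * E (count (suc N) μ)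
      invB-suc μ N = trans (reflexive (cong prod (≡.trans (cong (concatMap F) (range1-snoc N)) (concatMap-++ F (range1 N) (suc N ∷ [])))))
        (trans (prod-++ (concatMap F (range1 N)) (F (suc N) ++ [])) (*-congˡ (reflexive (cong prod (++-identityʳ (F (suc N)))))))
        where
        F : ℕ → List A
        F i = map inv (upTo (count i μ))

      invB-cong : ∀ {μ ν} N → (∀ i → i ≤ N → count i μ ≡ count i ν) → invB μ N ≈ invB ν N
      invB-cong zero e = refl
      invB-cong {μ} {ν} (suc N) e = trans (invB-suc μ N) (trans (*-cong (invB-cong {μ} {ν} N (λ i le → e i (ℕ.m≤n⇒m≤1+n le))) (reflexive (cong E (e (suc N) ℕ.≤-refl)))) (≈-sym (invB-suc ν N)))

      prodE : List ℕ → A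
      prodE [] = 1#
      prodE (n ∷ ns) = E n * prodE ns

      invB-full : ∀ ns → invB (rowsOf ns) (length ns) ≈ prodE ns
      invB-full [] = refl
      invB-full (n ∷ ns) = trans (invB-suc (rowsOf (n ∷ ns)) (length ns)) (trans (*-cong
        (trans (invB-cong {rowsOf (n ∷ ns)} {rowsOf ns} (length ns) (λ i le → ≡.trans (count-++ i (replicate n (suc (length ns))) (rowsOf ns))
            (cong (ℕ._+ count i (rowsOf ns)) (count-absent i (replicate n (suc (length ns))) (All.replicate⁺ n (λ { ≡.refl → ℕ.<-irrefl ≡.refl le })))))) (invB-full ns))
        (reflexive (cong E (count-rowsOf n ns)))) (*-comm _ _))

      invB-at : ∀ ns → invB (rowsOf ns) (at (rowsOf ns) 1) ≈ invB (rowsOf ns) (length ns)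
      invB-at [] = refl
      invB-at (zero ∷ ns) = trans (invB-at ns) (≈-sym (trans (invB-suc (rowsOf ns) (length ns)) (trans (*-congˡ (reflexive (cong E (count-rowsOf 0 ns)))) (*-identityʳ _))))
      invB-at (suc n ∷ ns) = refl

      fits-D : ∀ {ms x ns} → Fits ms x ns → A
      fits-D [] = 1#
      fits-D (fit {n = n} y _ f) = D n y * fits-D f

      module _ (hh : ℕ → ℕ) where
        G : ℕ → ℕ → A
        G p k = om (hh p ∸ k)

        replicate-D : ∀ r n y k → hh r ≡ k ℕ.+ (n ℕ.+ y) → prod (indexed G k (replicate n r)) ≈ D n y
        replicate-D r zero y k e = refl
        replicate-D r (suc n) y k e = *-cong (reflexive (cong om (≡.trans (cong (_∸ k) e) (ℕ.m+n∸m≡n k (suc (n ℕ.+ y))))))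
          (replicate-D r n y (suc k) (≡.trans e (ℕ.+-suc k (n ℕ.+ y))))

        -- All parts of μ equal to r share ν_i = λ~_r, while i - 1 runs through n consecutive values
        -- starting at the number k of larger parts. As λ~_r = k + n + y, the exponents descend from
        -- y + n to y + 1, which gives `D n y`.
        indexed-D : ∀ {ms x ns} (f : Fits ms x ns) k → (∀ j → j < length ms → hh (suc j) ≡ k ℕ.+ x ℕ.+ height (rowsOf ms) (suc j)) →
          prod (indexed G k (rowsOf ns)) ≈ fits-D f
        indexed-D [] k H = refl
        indexed-D {m ∷ ms} {x} (fit {n = n} {ns} y e f) k H = begin
          prod (indexed G k (replicate n r ++ rowsOf ns))
            ≈⟨ reflexive (cong prod (indexed-++ G k (replicate n r) (rowsOf ns))) ⟩
          prod (indexed G k (replicate n r) ++ indexed G (k ℕ.+ length (replicate n r)) (rowsOf ns))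
            ≈⟨ prod-++ (indexed G k (replicate n r)) _ ⟩
          prod (indexed G k (replicate n r)) * prod (indexed G (k ℕ.+ length (replicate n r)) (rowsOf ns))
            ≈⟨ *-cong (replicate-D r n y k top) (trans (reflexive (cong (λ l → prod (indexed G (k ℕ.+ l) (rowsOf ns))) (length-replicate n))) (indexed-D f (k ℕ.+ n) low)) ⟩
          D n y * fits-D f ∎
          where
          r = suc (length ns)
          offset : k ℕ.+ x ℕ.+ m ≡ k ℕ.+ (n ℕ.+ y)
          offset = ≡.trans (ℕ.+-assoc k x m) (cong (k ℕ.+_) (≡.sym e))
          top : hh r ≡ k ℕ.+ (n ℕ.+ y)
          top = ≡.trans (cong (λ l → hh (suc l)) (fits-length f)) (≡.trans (H (length ms) ℕ.≤-refl) (≡.trans (cong (k ℕ.+ x ℕ.+_) (height-top m ms)) offset))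
          low : ∀ j → j < length ms → hh (suc j) ≡ k ℕ.+ n ℕ.+ y ℕ.+ height (rowsOf ms) (suc j)
          low j lt = ≡.trans (H j (ℕ.m≤n⇒m≤1+n lt)) (≡.trans (cong (k ℕ.+ x ℕ.+_) (height-low m ms lt)) (≡.trans (≡.sym (ℕ.+-assoc (k ℕ.+ x) m _))
            (cong (ℕ._+ height (rowsOf ms) (suc j)) (≡.trans offset (≡.sym (ℕ.+-assoc k n y))))))

      pow-tri : ∀ y → pow (tri# y) ≈ tri y
      pow-tri zero = refl
      pow-tri (suc y) = trans (reflexive (cong pow (tri#-suc y))) (trans (pow-+ y (tri# y)) (*-congˡ (pow-tri y)))

      -- The three factors of ℵ are regrouped by part size: 1/b_μ supplies the denominator and the
      -- product over ν the numerator of one Gaussian binomial coefficient per size.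
      combine : ∀ {ms x ns} (f : Fits ms x ns) → prodE ns * (pow (fits-skew f) * fits-D f) ≈ fits-weight f
      combine [] = trans (*-identityˡ _) (*-identityˡ _)
      combine (fit {n = n} {ns} y e f) = begin
        E n * prodE ns * (pow (tri# y ℕ.+ fits-skew f) * (D n y * fits-D f))
          ≈⟨ *-congˡ (*-congʳ (trans (pow-+ (tri# y) (fits-skew f)) (*-congʳ (pow-tri y)))) ⟩
        E n * prodE ns * (tri y * pow (fits-skew f) * (D n y * fits-D f))
          ≈⟨ solve (E n ∷ prodE ns ∷ tri y ∷ pow (fits-skew f) ∷ D n y ∷ fits-D f ∷ [])
               (v0 :* v1 :* (v2 :* v3 :* (v4 :* v5))) (v2 :* (v0 :* v4) :* (v1 :* (v3 :* v5))) ≡.refl ⟩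
        tri y * (E n * D n y) * (prodE ns * (pow (fits-skew f) * fits-D f))
          ≈⟨ *-cong (*-congˡ (E-gb n y)) (combine f) ⟩
        tri y * gb n y * fits-weight f ∎

      aleph-weight : ∀ {ms ns} → Fits ms 0 ns → at (rowsOf ms) 1 ≡ length ms →
        let lam = rowsOf ms ; μ = rowsOf ns in
        invB μ (at μ 1) * (tp (nSkew lam μ) * prod (map (λ i → om (at (conj lam) (at μ i) ∸ (i ∸ 1))) (range1 (length μ)))) ≈ weight ms 0 ns
      aleph-weight {ms} {ns} f e = trans
        (*-cong (trans (invB-at ns) (invB-full ns))
          (*-cong (trans (tp-pow _) (reflexive (cong pow (nSkew-fits f e))))
            (trans (reflexive (cong prod (map-at-range1 (λ p k → om (at (conj (rowsOf ms)) p ∸ k)) (rowsOf ns))))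
              (indexed-D (at (conj (rowsOf ms))) f 0 (λ j _ → at-conj (proj₁ (rowsOf-part ms)) j)))))
        (trans (combine f) (≈-sym (weight-fits f)))

-- Specialisation to power series and comparison with the defined sums.

open import Data.Nat
open import Data.Nat.Properties
open import Data.Nat.ListAction using (sum)
open import Data.Nat.ListAction.Properties using (sum-++)
open import Data.List using (List; []; _∷_; map; length; replicate; upTo; filterᵇ)
open import Data.List.Properties using (length-++; length-replicate)
open import Data.List.Relation.Binary.Pointwise using (Pointwise-length)
open import Relation.Binary.PropositionalEquality
open import Defs
open PlacticWords
open HallLittlewoodFunctionals
open SumsOverLists
open Enumerations
open PowerSeries
open ChargeFunctional
open ContainedPartitions
open AlephWeights
open VertexOperators
open GaussianStrips

open CommutativeRing seriesRing using () renaming (trans to ≈-trans; sym to ≈-sym; refl to ≈-refl; reflexive to ≈-reflexive; *-cong to ⊛-cong; *-comm to ⊛-comm; +-congˡ to ⊕-congˡ; *-identityˡ to ⊛-identityˡ)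
open SumOver seriesRing
open PlacticRing seriesRing using (𝒫) renaming (at to evaluate)
open VerticalStrips seriesRing (tpow 1) using (wt; asum)
open Weights seriesRing (tpow 1)

module HL′ = HallLittlewood seriesRing (tpow 1)
open HL′.C using (h*)
open HL′.Evaluate φ φ-invariant φ-empty φ-count φ-rotate φ-shift using (FX; V; V-asum)

pow-tpow : ∀ e → tpow e ≈ˢ Operators.pow seriesRing (tpow 1) e
pow-tpow zero = tpow-0
pow-tpow (suc e) = ≈-trans (tpow-suc e) (⊛-cong {tpow 1} ≈-refl (pow-tpow e))

oneMinusTpow-pow : ∀ e → oneMinusTpow e ≈ˢ CommutativeRing._-_ seriesRing oneS (Operators.pow seriesRing (tpow 1) e)
oneMinusTpow-pow e = ⊕-congˡ {oneS} (CommutativeRing.-‿cong seriesRing (pow-tpow e))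

open Matching tpow oneMinusTpow (λ j → invOneMinusTpow (suc j)) pow-tpow oneMinusTpow-pow invOneMinusTpow-inverse

FX-Q′coeff : ∀ ms α → FX ms [] α ≈ˢ Q′coeff (rowsOf ms) α
FX-Q′coeff ms α = ≈-trans (evaluate (Ring.*-identityˡ 𝒫 (h* B α)) (φ (rowsOf ms)) (φ-invariant (rowsOf ms))) (≈-sym (Q′coeff-h* (rowsOf ms) α))
  where B = alphabet (length (rowsOf ms))

wt-rowsOf : ∀ ms → sum (rowsOf ms) ≡ wt ms
wt-rowsOf [] = refl
wt-rowsOf (m ∷ ms) = trans (sum-++ (replicate m r) (rowsOf ms)) (cong₂ _+_ (trans (rep m) (*-comm m r)) (wt-rowsOf ms))
  where
  r = suc (length ms)
  rep : ∀ m → sum (replicate m r) ≡ m * r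
  rep zero = refl
  rep (suc m) = cong (r +_) (rep m)

plusOne-V : ∀ ms α → Q′coeffPlusOne (rowsOf ms) α ≈ˢ V α ms
plusOne-V ms α = ≈-trans (sumS-Σ (map (λ j → Q′coeff (rowsOf ms) (j ∷ α)) (upTo (suc (sum (rowsOf ms))))))
  (≈-trans (Σ-map (λ f → f) (λ j → Q′coeff (rowsOf ms) (j ∷ α)) (upTo (suc (sum (rowsOf ms)))))
  (≈-trans (Σ-cong (upTo (suc (sum (rowsOf ms)))) (λ j _ → ≈-sym (FX-Q′coeff ms (j ∷ α))))
  (≈-trans (≈-reflexive (cong (λ N → Σ (λ j → FX ms [] (j ∷ α)) (upTo (suc N))) (wt-rowsOf ms)))
    (≈-sym (conv-Σ (λ j _ → FX ms [] (j ∷ α)) (wt ms))))))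

pad-functional : ∀ p k k′ → length (pad p k) ≡ length (pad p k′) → k ≡ k′
pad-functional p k k′ e = +-cancelˡ-≡ (length p) k k′ (trans (sym (len k)) (trans e (len k′)))
  where
  len : ∀ k → length (pad p k) ≡ length p + k
  len k = trans (length-++ p) (cong (length p +_) (length-replicate k))

-- Fitting tuples of multiplicities correspond to the decreasing lists inside the box of λ: such a
-- list is a partition μ ⊆ λ followed by zeros, which `stripZeros` removes again.
subPartitions-asum : ∀ ms α → at (rowsOf ms) 1 ≡ length ms →
  sumS (map (λ μ → Q′coeff μ α ⊛ aleph (rowsOf ms) μ) (subPartitions (rowsOf ms))) ≈ˢ asum ms 0 (λ ns → FX ns [] α)
subPartitions-asum ms α first = ≈-trans (sumS-Σ (map term (map stripZeros boxes))) (≈-trans (Σ-map (λ f → f) term (map stripZeros boxes))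
  (≈-trans (Σ-map term stripZeros boxes) (≈-trans (≈-sym bijection) (≈-sym (asum-Σ ms 0 (λ ns → FX ns [] α))))))
  where
  lam = rowsOf ms
  boxes = filterᵇ decreasingᵇ (boxed lam)
  term : List ℕ → Series
  term μ = Q′coeff μ α ⊛ aleph lam μ
  -- The prescribed length fixes the number of zeros, so that the relation is single-valued.
  Padded : List ℕ → List ℕ → Set
  Padded ns b = Fits ms 0 ns × length b ≡ length lam × ∃ λ k → b ≡ pad (rowsOf ns) k
  to : ∀ ns → ns ∈ tuples ms 0 → ∃ λ b → b ∈ boxes × Padded ns b
  to ns ns∈ with ∈-tuples⁻ ms 0 ns∈
  ... | f with fits-⊆ f
  ...   | k , p = pad (rowsOf ns) k , ∈-filterᵇ⁺ decreasingᵇ (∈-boxed⁺ p) (decreasing⁻ (pad-decreasing ns k)) , f , Pointwise-length p , k , refl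
  back : ∀ b → b ∈ boxes → ∃ λ ns → ns ∈ tuples ms 0 × Padded ns b
  back b b∈ with ∈-filterᵇ⁻ decreasingᵇ {xs = boxed lam} b∈
  ... | b∈′ , d with ⊆-fits ms 0 (decreasing⁺ b d) (∈-boxed⁻ lam b∈′)
  ...   | ns , k , f , e = ns , ∈-tuples⁺ f , f , Pointwise-length (∈-boxed⁻ lam b∈′) , k , e
  functional : ∀ {ns b b′} → Padded ns b → Padded ns b′ → b ≡ b′
  functional {ns} (_ , l , k , refl) (_ , l′ , k′ , refl) = cong (pad (rowsOf ns)) (pad-functional (rowsOf ns) k k′ (trans l (sym l′)))
  injective : ∀ {ns ns′ b} → Padded ns b → Padded ns′ b → ns ≡ ns′
  injective {ns} {ns′} (f , _ , k , refl) (f′ , _ , k′ , e) = pad-injective ns ns′ (trans (fits-length f) (sym (fits-length f′))) e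
  value : ∀ {ns b} → ns ∈ tuples ms 0 → Padded ns b → weight ms 0 ns ⊛ FX ns [] α ≈ˢ term (stripZeros b)
  value {ns} _ (f , _ , k , refl) rewrite stripZeros-pad {rowsOf ns} k (proj₂ (rowsOf-part ns)) =
    ≈-trans (⊛-comm (weight ms 0 ns) (FX ns [] α)) (⊛-cong {FX ns [] α} {Q′coeff (rowsOf ns) α} (FX-Q′coeff ns α) (≈-sym (aleph-weight f first)))
  bijection : Σ (λ ns → weight ms 0 ns ⊛ FX ns [] α) (tuples ms 0) ≈ˢ Σ (λ b → term (stripZeros b)) boxes
  bijection = Σ-bijection Padded (λ ns → weight ms 0 ns ⊛ FX ns [] α) (λ b → term (stripZeros b)) (tuples ms 0) boxes
    (unique-tuples ms 0) (unique-filterᵇ decreasingᵇ (unique-boxed lam)) to back functional injective value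

theorem1 : (λ′ : List ℕ) → IsPartition λ′ → (α : List ℕ) → (k : ℕ) →
    Q′coeffPlusOne λ′ α k ≡ sumS (map (λ μ → Q′coeff μ α ⊛ aleph λ′ μ) (subPartitions λ′)) k
theorem1 λ′ part α k with multiplicities part
... | ms , refl , first = coeff (≈-trans (plusOne-V ms α) (≈-trans (V-asum α ms) (≈-sym (subPartitions-asum ms α first)))) k
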